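{- For all integers $n\ge 272$, $B(q(n-1),q(n),q(n+1),q(n+2),q(n+3))>0$, where $B(a_0,a_1,a_2,a_3,a_4)=-a_0a_2a_4+a_2^3+a_0a_3^2+a_1^2a_4-2a_1a_2a_3$; that is, $$-q(n-1)q(n+1)q(n+3)+q(n+1)^3+q(n-1)q(n+2)^2+q(n)^2q(n+3)-2q(n)q(n+1)q(n+2)>0.$$
   Context: $q(n)$ denotes the number of partitions of $n$ into distinct parts. -}

module Defs where

open import Data.Nat using (ℕ; zero; suc; _∸_; _<ᵇ_)
open import Data.Bool using (if_then_else_)
import Data.Nat as ℕ
open import Data.Integer using (ℤ; +_; _+_; _-_; _*_; -_)

-- dq n k = number of partitions of n into distinct parts, all parts in {1,…,k}.
-- Recursion on the largest allowed part k: either k is not used, or it is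
-- used exactly once (possible only when k ≤ n) and the rest is a partition of
-- n ∸ k into distinct parts from {1,…,k-1}.
dq : ℕ → ℕ → ℕ
dq zero    _       = 1
dq (suc n) zero    = 0
dq (suc n) (suc k) =
  dq (suc n) k ℕ.+ (if suc n <ᵇ suc k then 0 else dq (suc n ∸ suc k) k)

q : ℕ → ℕ
q n = dq n n

B : ℤ → ℤ → ℤ → ℤ → ℤ → ℤ
B a0 a1 a2 a3 a4 =
  - (a0 * a2 * a4) + a2 * a2 * a2 + a0 * (a3 * a3) + a1 * a1 * a4
  - (+ 2) * a1 * a2 * a3

qℤ : ℕ → ℤ
qℤ n = + (q n)

-- Let r = 1 - 1/m, with m chosen so that independent parts k = 1, 2, …, present with odds r^k : 1, have
-- mean sum close to n + 1. The probability p i of the sum i is proportional to r^i q(i), and B is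
-- homogeneous under q(i) ↦ c r^i q(i). If A₀, A₂, A₄ are the even central differences of p at n + 1 and
-- D₁, D₃ the odd ones, then 4B = (4A₂ - A₄)(A₀A₄ - A₂²) + (A₀D₃² + 2A₂D₁D₃ + A₄D₁²), so that B > 0 follows
-- from A₀ > 0, A₀A₄ > A₂² and A₄ < 4A₂. Now A_{2j} is the mean over the unit circle of w^j Re ψ, where
-- w = |1 - x|² and ψ is the generating function of the centred sum. Pointwise Re ψ ≥ (1 - w/4)^L minus a
-- small error, with L about the variance times 2, and the means of w^j (1 - w/4)^L are Beta integrals.
--
-- Everything stays in ℚ: means over the circle are averages over the powers of (3 + 4i)/5, and the phase of
-- ψ is bounded by distributing x^(-n-1) over the factors so that each becomes the generating function
-- of an integer law of mean zero, up to positive factors.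
--
-- For n + 1 < 62500 the inequality is evaluated, the values of q being computed from
-- ∑_i x^(i(i+1)/2) / ((1 - x)⋯(1 - x^i)) by Horner's scheme.
module Submission where

-- A pointwise lower bound of Re ψ suffices, because every mean that has to be positive is taken
-- against a nonnegative weight. This leaves room for crude constants: for (1 - w/4)^L the ratio
-- A₀A₄ / A₂² is nearly 3, the Gaussian value, for every large L. So L may exceed twice the
-- variance, and a good part of the second and fourth moments may be lost. The error that decides is
-- the phase. Its square is of order m^8 w³, which is 1/m where w is of order m^(-3); hence m has to
-- be large, here m ≥ 250. The mean of the sum is at most m², and 250² = 62500 is the threshold
-- between evaluation and analysis. Since m runs through a grid, the mean falls short of n + 1 by
-- some g ≤ m/20. This is put into one extra factor whose law need not be centred. Away from x = 1
-- the lower bound may be negative, and there only the decay of |ψ| counts; it is measured in terms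
-- of Y = m² w.

module FiniteRange where
  open import Defs using (dq; q)
  open import Data.Nat as ℕ using (ℕ; zero; suc; _+_; _*_; _∸_; _≤_; _<_; z≤n; s≤s; _<ᵇ_)
  open import Data.Nat.Properties
  open import Data.Nat.Induction using (<-rec)
  open import Data.Bool using (Bool; if_then_else_; true; false; _∧_; T)
  open import Data.List using (List; []; _∷_; _++_; length; drop; take; replicate)
  open import Data.List.Properties using (length-replicate)
  open import Data.Product using (_×_; _,_; proj₁; proj₂)
  open import Data.Sum using (_⊎_; inj₁; inj₂)
  open import Data.Unit using (tt)
  open import Function using (_∘_)
  open import Relation.Binary.PropositionalEquality

  -- B > 0, with the negative terms moved to the left so that it can be evaluated in ℕ.
  HankelNeg : (a₀ a₁ a₂ a₃ a₄ : ℕ) → Set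
  HankelNeg a₀ a₁ a₂ a₃ a₄ = a₀ ℕ.* a₂ ℕ.* a₄ ℕ.+ 2 ℕ.* (a₁ ℕ.* a₂ ℕ.* a₃) ℕ.< a₂ ℕ.* a₂ ℕ.* a₂ ℕ.+ a₀ ℕ.* (a₃ ℕ.* a₃) ℕ.+ a₁ ℕ.* a₁ ℕ.* a₄

  -- Formal power series and geometric factors

  Series : Set
  Series = ℕ → ℕ

  infixl 6 _⊕_
  _⊕_ : Series → Series → Series
  (f ⊕ g) n = f n + g n

  -- Multiplication of the generating function by x^a.
  sh : ℕ → Series → Series
  sh zero    f n       = f n
  sh (suc a) f zero    = 0
  sh (suc a) f (suc n) = sh a f n

  δ : Series
  δ zero    = 1
  δ (suc n) = 0

  sh-cong : ∀ a {f g : Series} → (∀ n → f n ≡ g n) → ∀ n → sh a f n ≡ sh a g n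
  sh-cong zero    h n       = h n
  sh-cong (suc a) h zero    = refl
  sh-cong (suc a) h (suc n) = sh-cong a h n

  sh-local : ∀ a {f g : Series} n → (∀ m → m ≤ n → f m ≡ g m) → sh a f n ≡ sh a g n
  sh-local zero    n       h = h n ≤-refl
  sh-local (suc a) zero    h = refl
  sh-local (suc a) (suc n) h = sh-local a n (λ m p → h m (m≤n⇒m≤1+n p))

  sh-suc-local : ∀ a {f g : Series} n → (∀ {m} → m < n → f m ≡ g m) → sh (suc a) f n ≡ sh (suc a) g n
  sh-suc-local a zero    h = refl
  sh-suc-local a (suc n) h = sh-local a n (λ m p → h (s≤s p))

  sh-⊕ : ∀ a f g n → sh a (f ⊕ g) n ≡ sh a f n + sh a g n
  sh-⊕ zero    f g n       = refl
  sh-⊕ (suc a) f g zero    = refl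
  sh-⊕ (suc a) f g (suc n) = sh-⊕ a f g n

  sh-+ : ∀ a b f n → sh (a + b) f n ≡ sh a (sh b f) n
  sh-+ zero    b f n       = refl
  sh-+ (suc a) b f zero    = refl
  sh-+ (suc a) b f (suc n) = sh-+ a b f n

  sh-comm : ∀ a b f n → sh a (sh b f) n ≡ sh b (sh a f) n
  sh-comm a b f n = trans (sym (sh-+ a b f n)) (trans (cong (λ c → sh c f n) (+-comm a b)) (sh-+ b a f n))

  sh-small : ∀ a f n → n < a → sh a f n ≡ 0
  sh-small (suc a) f zero    p       = refl
  sh-small (suc a) f (suc n) (s≤s p) = sh-small a f n p

  sh-+ˡ : ∀ a f n → sh a f (a + n) ≡ f n
  sh-+ˡ zero    f n = refl
  sh-+ˡ (suc a) f n = sh-+ˡ a f n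

  -- g = x^(1+a) (f + g), that is, g = x^(1+a) / (1 - x^(1+a)) f.
  Geometric : ℕ → Series → Series → Set
  Geometric a f g = ∀ n → g n ≡ sh (suc a) (f ⊕ g) n

  -- The shift by `suc a` makes coefficient `n` depend on earlier coefficients only. The identities
  -- for `geo` below are proved by checking this recurrence.
  geometric-unique : ∀ a {f f′ g g′} → (∀ n → f n ≡ f′ n) → Geometric a f g → Geometric a f′ g′ → ∀ n → g n ≡ g′ n
  geometric-unique a {g = g} {g′} e p p′ = <-rec (λ n → g n ≡ g′ n) λ n ih →
    trans (p n) (trans (sh-suc-local a n (λ {m} m<n → cong₂ _+_ (e m) (ih m<n))) (sym (p′ n)))

  -- Fuel makes the recurrence structural; by `fuelled-stable` any fuel above `n` gives the same
  -- coefficient `n`.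
  fuelled : ℕ → ℕ → Series → Series
  fuelled a zero    f n = 0
  fuelled a (suc t) f n = sh (suc a) (f ⊕ fuelled a t f) n

  fuelled-stable : ∀ a f t t′ n → n < t → n < t′ → fuelled a t f n ≡ fuelled a t′ f n
  fuelled-stable a f (suc t) (suc t′) n (s≤s p) (s≤s p′) =
    sh-suc-local a n (λ {m} m<n → cong (f m +_) (fuelled-stable a f t t′ m (<-≤-trans m<n p) (<-≤-trans m<n p′)))

  geo : ℕ → Series → Series
  geo a f n = fuelled a (suc n) f n

  geo-geometric : ∀ a f → Geometric a f (geo a f)
  geo-geometric a f n = sh-suc-local a n (λ {m} m<n → cong (f m +_) (fuelled-stable a f n (suc m) m m<n ≤-refl))

  geo-cong : ∀ a {f g} → (∀ n → f n ≡ g n) → ∀ n → geo a f n ≡ geo a g n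
  geo-cong a {f} {g} e = geometric-unique a e (geo-geometric a f) (geo-geometric a g)

  swap-middle : ∀ a b c d → a + b + (c + d) ≡ a + c + (b + d)
  swap-middle a b c d = trans (+-assoc a b (c + d)) (trans (cong (a +_) (trans (sym (+-assoc b c d)) (trans (cong (_+ d) (+-comm b c)) (+-assoc c b d)))) (sym (+-assoc a c (b + d))))

  geo-⊕ : ∀ a f g n → geo a (f ⊕ g) n ≡ geo a f n + geo a g n
  geo-⊕ a f g = geometric-unique a (λ _ → refl) (geo-geometric a (f ⊕ g)) λ n →
    trans (cong₂ _+_ (geo-geometric a f n) (geo-geometric a g n))
    (trans (sym (sh-⊕ (suc a) (f ⊕ geo a f) (g ⊕ geo a g) n))
           (sh-cong (suc a) (λ m → swap-middle (f m) (geo a f m) (g m) (geo a g m)) n))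

  geo-comm : ∀ a b f n → geo a (geo b f) n ≡ geo b (geo a f) n
  geo-comm a b f n = trans (sym (geometric-unique a (λ _ → refl) w-geometric (geo-geometric a g) n))
                           (geometric-unique b (λ _ → refl) u-geometric (geo-geometric b (geo a f)) n)
    where
    g u w : Series
    g = geo b f
    u = geo a g
    -- The candidate `w` is what the recurrence for `b` makes of `u`. It satisfies the recurrence
    -- for `a`, hence equals `u`, and then it satisfies the one for `b` as well.
    w = sh (suc b) (geo a f ⊕ u)
    w-geometric : Geometric a g w
    w-geometric n = trans (sh-cong (suc b) (λ m → trans (cong₂ _+_ (geo-geometric a f m) (geo-geometric a g m)) (sym (sh-⊕ (suc a) (f ⊕ geo a f) (g ⊕ u) m))) n)
      (trans (sh-comm (suc b) (suc a) (f ⊕ geo a f ⊕ (g ⊕ u)) n)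
      (sh-cong (suc a) (λ m → trans (sh-cong (suc b) (λ k → swap-middle (f k) (geo a f k) (g k) (u k)) m)
        (trans (sh-⊕ (suc b) (f ⊕ g) (geo a f ⊕ u) m) (cong (_+ w m) (sym (geo-geometric b f m))))) n))
    u-geometric : Geometric b (geo a f) w
    u-geometric n = sh-cong (suc b) (λ m → cong (geo a f m +_) (sym (geometric-unique a (λ _ → refl) w-geometric (geo-geometric a g) m))) n

  -- Partitions sorted by the number of parts

  -- parts i k n is the number of partitions of n into exactly i distinct parts, all at most k.
  parts : ℕ → ℕ → Series
  parts zero    k       = δ
  parts (suc i) zero    n = 0
  parts (suc i) (suc k) = parts (suc i) k ⊕ sh (suc k) (parts i k)

  ∑≤ : (ℕ → Series) → ℕ → Series
  ∑≤ F zero    = F zero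
  ∑≤ F (suc i) = ∑≤ F i ⊕ F (suc i)

  ∑≤-cong : ∀ {F G : ℕ → Series} i n → (∀ j → F j n ≡ G j n) → ∑≤ F i n ≡ ∑≤ G i n
  ∑≤-cong zero    n h = h zero
  ∑≤-cong (suc i) n h = cong₂ _+_ (∑≤-cong i n h) (h (suc i))

  ∑≤-first : ∀ F i n → ∑≤ F (suc i) n ≡ F zero n + ∑≤ (F ∘ suc) i n
  ∑≤-first F zero    n = refl
  ∑≤-first F (suc i) n = trans (cong (_+ F (suc (suc i)) n) (∑≤-first F i n)) (+-assoc (F zero n) (∑≤ (F ∘ suc) i n) (F (suc (suc i)) n))

  ∑≤-⊕ : ∀ F G i n → ∑≤ (λ j → F j ⊕ G j) i n ≡ ∑≤ F i n + ∑≤ G i n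
  ∑≤-⊕ F G zero    n = refl
  ∑≤-⊕ F G (suc i) n = trans (cong (_+ (F (suc i) n + G (suc i) n)) (∑≤-⊕ F G i n)) (swap-middle (∑≤ F i n) (∑≤ G i n) (F (suc i) n) (G (suc i) n))

  sh-∑≤ : ∀ a F i n → sh a (∑≤ F i) n ≡ ∑≤ (λ j → sh a (F j)) i n
  sh-∑≤ a F zero    n = refl
  sh-∑≤ a F (suc i) n = trans (sh-⊕ a (∑≤ F i) (F (suc i)) n) (cong (_+ sh a (F (suc i)) n) (sh-∑≤ a F i n))

  dq-suc : ∀ n k → dq n (suc k) ≡ dq n k + sh (suc k) (λ m → dq m k) n
  dq-suc zero    k = refl
  dq-suc (suc n) k = cong (dq (suc n) k +_) (guard n k (λ m → dq m k))
    where
    guard : ∀ n k (f : Series) → (if n <ᵇ k then 0 else f (n ∸ k)) ≡ sh k f n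
    guard n       zero    f = refl
    guard zero    (suc k) f = refl
    guard (suc n) (suc k) f = guard n k f

  -- At most `k` distinct parts fit below `k`, so for `k ≤ i` no number of parts is missed.
  ∑-parts : ∀ i k n → k ≤ i → ∑≤ (λ j → parts j k) i n ≡ dq n k
  ∑-parts i zero n z≤n = empty i n
    where
    empty : ∀ i n → ∑≤ (λ j → parts j zero) i n ≡ dq n zero
    empty zero    zero    = refl
    empty zero    (suc n) = refl
    empty (suc i) n       = trans (+-identityʳ _) (empty i n)
  ∑-parts (suc i) (suc k) n (s≤s p) = trans (∑≤-first (λ j → parts j (suc k)) i n)
    (trans (cong (δ n +_) (∑≤-⊕ (λ j → parts (suc j) k) (λ j → sh (suc k) (parts j k)) i n))
    (trans (sym (+-assoc (δ n) (∑≤ (λ j → parts (suc j) k) i n) _))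
    (trans (cong₂ _+_ (trans (sym (∑≤-first (λ j → parts j k) i n)) (∑-parts (suc i) k n (m≤n⇒m≤1+n p)))
                      (trans (sym (sh-∑≤ (suc k) (λ j → parts j k) i n)) (sh-cong (suc k) (λ m → ∑-parts i k m p) n)))
           (sym (dq-suc n k)))))

  -- Decreasing every part by one removes a part 1.
  parts-shift : ∀ i k n → parts (suc i) (suc k) n ≡ sh (suc i) (parts (suc i) k ⊕ parts i k) n
  parts-shift zero zero n = refl
  parts-shift (suc i) zero n = trans (sh-cong 1 (λ _ → refl) n) (trans (zero-sh 1 n) (sym (trans (sh-cong (suc (suc i)) (λ _ → refl) n) (zero-sh (suc (suc i)) n))))
    where
    zero-sh : ∀ a n → sh a (λ _ → 0) n ≡ 0
    zero-sh zero    n       = refl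
    zero-sh (suc a) zero    = refl
    zero-sh (suc a) (suc n) = zero-sh a n
  parts-shift zero (suc k) n = trans (cong (_+ sh (2 + k) δ n) (parts-shift zero k n)) (trans (cong (sh 1 (parts 1 k ⊕ δ) n +_) (sh-+ 1 (suc k) δ n)) (trans (sym (sh-⊕ 1 (parts 1 k ⊕ δ) (sh (suc k) δ) n)) (sh-cong 1 (λ m → right-swap (parts 1 k m) (δ m) (sh (suc k) δ m)) n)))
    where
    right-swap : ∀ a b c → a + b + c ≡ a + c + b
    right-swap a b c = trans (+-assoc a b c) (trans (cong (a +_) (+-comm b c)) (sym (+-assoc a c b)))
  parts-shift (suc i) (suc k) n =
    trans (cong₂ _+_ (parts-shift (suc i) k n)
      (trans (sh-cong (2 + k) (parts-shift i k) n)
      (trans (sym (sh-+ (2 + k) (suc i) h n)) (trans (cong (λ a → sh a h n) (trans (cong (2 +_) (+-comm k (suc i))) (cong suc (sym (+-suc (suc i) k))))) (sh-+ (2 + i) (suc k) h n)))))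
    (trans (sym (sh-⊕ (2 + i) (parts (2 + i) k ⊕ parts (suc i) k) (sh (suc k) h) n))
           (sh-cong (2 + i) (λ m → trans (cong (parts (2 + i) k m + parts (suc i) k m +_) (sh-⊕ (suc k) (parts (suc i) k) (parts i k) m)) (swap-middle (parts (2 + i) k m) (parts (suc i) k m) _ _)) n))
    where h = parts (suc i) k ⊕ parts i k

  parts-stable : ∀ i k n → n ≤ k → parts i k n ≡ parts i n n
  parts-stable i k n p = subst (λ k → parts i k n ≡ parts i n n) (m∸n+n≡m p) (go (k ∸ n) i)
    where
    go : ∀ d i → parts i (d + n) n ≡ parts i n n
    go zero    i       = refl
    go (suc d) zero    = refl
    go (suc d) (suc i) = trans (cong (parts (suc i) (d + n) n +_) (sh-small (suc (d + n)) (parts i (d + n)) n (s≤s (m≤n+m n d))))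
                               (trans (+-identityʳ _) (go d (suc i)))

  -- The product of x^s / (1 - x^s) over j < s ≤ j + t.
  chain : ℕ → ℕ → Series
  chain j zero    = δ
  chain j (suc t) = geo (j + t) (chain j t)

  -- `chain` puts the factor of largest exponent outermost, whereas Horner's scheme needs the
  -- smallest there; `geo-comm` exchanges them.
  chain-first : ∀ j t n → chain j (suc t) n ≡ geo j (chain (suc j) t) n
  chain-first j zero    n = cong (λ a → geo a δ n) (+-identityʳ j)
  chain-first j (suc t) n = trans (geo-cong (j + suc t) (chain-first j t) n)
    (trans (geo-comm (j + suc t) j (chain (suc j) t) n) (geo-cong j (λ m → cong (λ a → geo a (chain (suc j) t) m) (+-suc j t)) n))

  -- When the bound on the parts is no longer active, `parts-shift` is the recurrence that
  -- characterises `geo i`: decreasing all parts by one leaves `i + 1` or `i` parts.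
  parts≡chain : ∀ i n → parts i n n ≡ chain 0 i n
  parts≡chain zero    n = refl
  parts≡chain (suc i) n = geometric-unique i (parts≡chain i) exact (geo-geometric i (chain 0 i)) n
    where
    exact : Geometric i (λ n → parts i n n) (λ n → parts (suc i) n n)
    exact n = trans (sym (parts-stable (suc i) (suc n) n (n≤1+n n))) (trans (parts-shift i n n)
      (sh-suc-local i n (λ {m} m<n → trans (+-comm (parts (suc i) n m) (parts i n m)) (cong₂ _+_ (parts-stable i n m (<⇒≤ m<n)) (parts-stable (suc i) n m (<⇒≤ m<n))))))

  tail : ℕ → ℕ → Series
  tail j t = ∑≤ (chain j) t

  tail-horner : ∀ j t n → tail j (suc t) n ≡ δ n + geo j (tail (suc j) t) n
  tail-horner j t n = trans (∑≤-first (chain j) t n) (cong (δ n +_) (trans (∑≤-cong t n (λ i → chain-first j i n)) (sym (geo-∑≤ t n))))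
    where
    geo-∑≤ : ∀ t n → geo j (tail (suc j) t) n ≡ ∑≤ (λ i → geo j (chain (suc j) i)) t n
    geo-∑≤ zero    n = refl
    geo-∑≤ (suc t) n = trans (geo-⊕ j (tail (suc j) t) (chain (suc j) (suc t)) n) (cong (_+ geo j (chain (suc j) (suc t)) n) (geo-∑≤ t n))

  tail-small : ∀ j t n → n ≤ j → tail j t n ≡ δ n
  tail-small j zero    n p = refl
  tail-small j (suc t) n p = trans (tail-horner j t n) (trans (cong (δ n +_) (sh-small (suc j) (tail (suc j) t ⊕ _) n (s≤s p))) (+-identityʳ (δ n)))

  q≡tail : ∀ i n → n ≤ i → q n ≡ tail 0 i n
  q≡tail i n p = trans (sym (∑-parts i n n p)) (∑≤-cong i n (λ j → parts≡chain j n))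

  -- Horner's scheme on lists

  infix 4 _Lists_
  -- Only an initial segment of the series is asserted. The length of the list is the order of
  -- truncation, so no order has to be carried along.
  data _Lists_ : List ℕ → Series → Set where
    []  : ∀ {f : Series} → [] Lists f
    _∷_ : ∀ {f x xs} → x ≡ f 0 → xs Lists f ∘ suc → x ∷ xs Lists f

  lists-cong : ∀ {xs : List ℕ} {f g : Series} → (∀ n → f n ≡ g n) → xs Lists f → xs Lists g
  lists-cong e []       = []
  lists-cong e (p ∷ ps) = trans p (e 0) ∷ lists-cong (e ∘ suc) ps

  lists-++ : ∀ {xs ys : List ℕ} {f : Series} → xs Lists f → ys Lists (λ n → f (length xs + n)) → xs ++ ys Lists f
  lists-++ []       qs = qs
  lists-++ (p ∷ ps) qs = p ∷ lists-++ ps qs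

  lists-drop : ∀ k {xs : List ℕ} {f : Series} → xs Lists f → drop k xs Lists (λ n → f (k + n))
  lists-drop zero    ps       = ps
  lists-drop (suc k) []       = []
  lists-drop (suc k) (p ∷ ps) = lists-drop k ps

  -- zipWith _+_ would keep the intermediate series alive during the evaluation below.
  zip+ : List ℕ → List ℕ → List ℕ
  zip+ []       ys       = []
  zip+ (x ∷ xs) []       = []
  zip+ (x ∷ xs) (y ∷ ys) = x + y ∷ zip+ xs ys

  lists-zip : ∀ {xs ys : List ℕ} {f g : Series} → xs Lists f → ys Lists g → zip+ xs ys Lists f ⊕ g
  lists-zip []       qs       = []
  lists-zip (p ∷ ps) []       = []
  lists-zip (p ∷ ps) (q ∷ qs) = cong₂ _+_ p q ∷ lists-zip ps qs

  lists-replicate : ∀ {f : Series} k {x} → (∀ n → n < k → x ≡ f n) → replicate k x Lists f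
  lists-replicate zero    h = []
  lists-replicate (suc k) h = h 0 (s≤s z≤n) ∷ lists-replicate k (λ n p → h (suc n) (s≤s p))

  -- The product of xs and 1 / (1 - x^s), in blocks of length s: each block is the previous one plus the next s entries of xs.
  mutual
    blocks : ℕ → ℕ → List ℕ → List ℕ → List ℕ
    blocks zero    s xs b = []
    blocks (suc t) s xs b = b ++ more t s (drop s xs) b

    more : ℕ → ℕ → List ℕ → List ℕ → List ℕ
    more t s []       b = []
    more t s (x ∷ xs) b = blocks t s (x ∷ xs) (zip+ b (x ∷ xs))

  row : ℕ → List ℕ → List ℕ
  -- The fuel 70000 exceeds the number of blocks of any list evaluated here. A shortage would
  -- shorten the list, not falsify it.
  row j xs = 1 ∷ (replicate j 0 ++ blocks 70000 (suc j) xs (take (suc j) xs))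

  rows : ℕ → List ℕ → List ℕ
  rows zero    xs = xs
  rows (suc j) xs = rows j (row j xs)

  -- A block shorter than `s` may only be the last one; otherwise the next block would be appended
  -- at the wrong offset.
  Full : ℕ → List ℕ → List ℕ → Set
  Full s xs b = drop s xs ≡ [] ⊎ length b ≡ s

  full-take : ∀ s xs → Full s xs (take s xs)
  full-take zero    xs       = inj₂ refl
  full-take (suc s) []       = inj₁ refl
  full-take (suc s) (x ∷ xs) with full-take s xs
  ... | inj₁ p = inj₁ p
  ... | inj₂ p = inj₂ (cong suc p)

  full-zip : ∀ b xs → Full (length b) xs (zip+ b xs)
  full-zip []      xs       = inj₂ refl
  full-zip (y ∷ b) []       = inj₁ refl
  full-zip (y ∷ b) (x ∷ xs) with full-zip b xs
  ... | inj₁ p = inj₁ p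
  ... | inj₂ p = inj₂ (cong suc p)

  mutual
    -- Here `g` is f / (1 - x^s). Its recurrence survives shifting both series by `s`, which is the
    -- passage to the next block.
    lists-blocks : ∀ t s {xs b : List ℕ} {f g : Series} → (∀ n → g (s + n) ≡ g n + f (s + n)) → Full s xs b →
                   xs Lists f → b Lists g → blocks t s xs b Lists g
    lists-blocks zero    s h full ps qs = []
    lists-blocks (suc t) s {xs} {b} {f} {g} h full ps qs = lists-++ {xs = b} qs (lists-more t s {f = f} {g = g} h full (lists-drop s ps) qs)

    lists-more : ∀ t s {xs b : List ℕ} {f g : Series} → (∀ n → g (s + n) ≡ g n + f (s + n)) → xs ≡ [] ⊎ length b ≡ s →
                 xs Lists (λ n → f (s + n)) → b Lists g → more t s xs b Lists (λ n → g (length b + n))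
    lists-more t s h full [] qs = []
    lists-more t s h (inj₁ ()) (p ∷ ps) qs
    lists-more t s {x ∷ xs} {b} {f} {g} h (inj₂ refl) (p ∷ ps) qs =
      lists-blocks t s {f = λ n → f (s + n)} {g = λ n → g (s + n)} (λ n → h (s + n)) (full-zip b (x ∷ xs)) (p ∷ ps) (lists-cong (λ n → sym (h n)) (lists-zip qs (p ∷ ps)))

  -- The leading 1 and the `j` zeros account for the shift by x^(j+1), and the blocks for f / (1 -
  -- x^(j+1)).
  lists-row : ∀ j {xs : List ℕ} {f : Series} → xs Lists f → row j xs Lists δ ⊕ geo j f
  lists-row j {xs} {f} ps = refl ∷ lists-++ (lists-replicate j (λ n p → sym (sh-small j _ n p)))
    (subst (λ k → blocks 70000 (suc j) xs (take (suc j) xs) Lists (λ n → (δ ⊕ geo j f) (suc (k + n)))) (sym (length-replicate j))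
      (lists-cong (λ n → sym (step n)) (lists-blocks 70000 (suc j) {xs} {take (suc j) xs} {f} {g} advance (full-take (suc j) xs) ps
        (lists-first (suc j) {xs} {f} {g} start ps))))
    where
    g : Series
    g n = geo j f (suc j + n)
    step : ∀ n → geo j f (suc j + n) ≡ g n
    step n = refl
    next : ∀ n → g n ≡ f n + geo j f n
    next n = trans (geo-geometric j f (suc j + n)) (sh-+ˡ (suc j) (f ⊕ geo j f) n)
    advance : ∀ n → g (suc j + n) ≡ g n + f (suc j + n)
    advance n = trans (next (suc j + n)) (+-comm (f (suc j + n)) (g n))
    start : ∀ n → n < suc j → f n ≡ g n
    start n p = sym (trans (next n) (trans (cong (f n +_) (trans (geo-geometric j f n) (sh-small (suc j) _ n p))) (+-identityʳ (f n))))
    lists-first : ∀ k {xs : List ℕ} {f g : Series} → (∀ n → n < k → f n ≡ g n) → xs Lists f → take k xs Lists g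
    lists-first zero    h ps       = []
    lists-first (suc k) h []       = []
    lists-first (suc k) h (p ∷ ps) = trans p (h 0 (s≤s z≤n)) ∷ lists-first k (λ n l → h (suc n) (s≤s l)) ps

  lists-rows : ∀ j t {xs : List ℕ} → xs Lists tail j t → rows j xs Lists tail 0 (j + t)
  lists-rows zero    t ps = ps
  lists-rows (suc j) t {xs} ps = subst (λ i → rows j (row j xs) Lists tail 0 i) (+-suc j t)
    (lists-rows j (suc t) {row j xs} (lists-cong {xs = row j xs} (λ n → sym (tail-horner j t n)) (lists-row j ps)))

  -- Evaluation of the inequality

  -- Running out of entries gives `false`, so success certifies that all `n` windows were present.
  windows : ℕ → ℕ → ℕ → ℕ → ℕ → List ℕ → Bool
  windows zero    a b c d es       = true
  windows (suc n) a b c d []       = false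
  windows (suc n) a b c d (e ∷ es) =
    (a * c * e + 2 * (b * c * d) <ᵇ c * c * c + a * (d * d) + b * b * e) ∧ windows n b c d e es

  all-windows : ℕ → List ℕ → Bool
  all-windows n (a ∷ b ∷ c ∷ d ∷ es) = windows n a b c d es
  all-windows n _                     = false

  ∧-split : ∀ a {b} → a ∧ b ≡ true → a ≡ true × b ≡ true
  ∧-split true p = refl , p

  windows-sound : ∀ n {es : List ℕ} {f : Series} → windows n (f 0) (f 1) (f 2) (f 3) es ≡ true → es Lists (λ i → f (4 + i)) →
                  ∀ i → i < n → HankelNeg (f i) (f (1 + i)) (f (2 + i)) (f (3 + i)) (f (4 + i))
  windows-sound (suc n) {e ∷ es} {f} ok (refl ∷ ps) = λ where
      zero    i<n       → <ᵇ⇒< _ _ (subst T (sym (proj₁ both)) tt)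
      (suc i) (s≤s i<n) → windows-sound n {f = f ∘ suc} (proj₂ both) ps i i<n
    where
    both = ∧-split (f 0 * f 2 * f 4 + 2 * (f 1 * f 2 * f 3) <ᵇ f 2 * f 2 * f 2 + f 0 * (f 3 * f 3) + f 1 * f 1 * f 4) {windows n (f 1) (f 2) (f 3) (f 4) es} ok

  all-windows-sound : ∀ n {xs : List ℕ} {f : Series} → all-windows n xs ≡ true → xs Lists f →
                      ∀ i → i < n → HankelNeg (f i) (f (1 + i)) (f (2 + i)) (f (3 + i)) (f (4 + i))
  all-windows-sound n {f = f} ok (refl ∷ refl ∷ refl ∷ refl ∷ ps) = windows-sound n {f = f} ok ps

  start : ℕ → List ℕ
  start k = 1 ∷ replicate k 0

  lists-start : ∀ k {f : Series} → (∀ n → n ≤ k → f n ≡ δ n) → start k Lists f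
  lists-start k h = sym (h 0 z≤n) ∷ lists-replicate k (λ n p → sym (h (suc n) p))

  -- Sealed, so that later uses treat the list as opaque.
  abstract
    -- The values q 0, …, q 62501.
    values : List ℕ
    -- Row `j` lengthens the list by `j + 1`, so 353 rows add 353 · 354 / 2 = 62481 entries to the
    -- 21 initial ones.
    values = rows 353 (start 20)

    -- The innermost tail begins 1, 0, 0, ... up to index 353 whatever its depth `t`, so one list
    -- serves all depths.
    lists-values : ∀ t → values Lists tail 0 (353 + t)
    lists-values t = lists-rows 353 t {start 20} (lists-start 20 {tail 353 t} (λ n p → tail-small 353 t n (≤-trans p (m≤m+n 20 333))))

    -- The number of windows is 62227 = 62498 - 271, one for each `n` with 271 ≤ `n` < 62498.
    windows-ok : all-windows 62227 (drop 271 values) ≡ true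
    windows-ok = refl

  -- The series `f` is arbitrary because the depth of the tail that agrees with `q` varies with `n`.
  hankel-from : ∀ (f : Series) → values Lists f → ∀ n → 271 ≤ n → n < 62498 → (∀ k → k ≤ 4 + n → f k ≡ q k) →
                HankelNeg (q n) (q (1 + n)) (q (2 + n)) (q (3 + n)) (q (4 + n))
  hankel-from f ps n lo hi e = hankel-cong (value 0 z≤n) (value 1 (s≤s z≤n)) (value 2 (s≤s (s≤s z≤n))) (value 3 (s≤s (s≤s (s≤s z≤n)))) (value 4 ≤-refl)
    (all-windows-sound 62227 {f = λ j → f (271 + j)} windows-ok (lists-drop 271 ps) (n ∸ 271) (∸-monoˡ-< hi lo))
    where
    shift : ∀ j → 271 + (j + (n ∸ 271)) ≡ j + n
    shift j = trans (sym (+-assoc 271 j (n ∸ 271))) (trans (cong (_+ (n ∸ 271)) (+-comm 271 j)) (trans (+-assoc j 271 (n ∸ 271)) (cong (j +_) (m+[n∸m]≡n lo))))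
    value : ∀ j → j ≤ 4 → f (271 + (j + (n ∸ 271))) ≡ q (j + n)
    value j p = trans (cong f (shift j)) (e (j + n) (+-monoˡ-≤ n p))
    hankel-cong : ∀ {a b c d e a′ b′ c′ d′ e′} → a ≡ a′ → b ≡ b′ → c ≡ c′ → d ≡ d′ → e ≡ e′ → HankelNeg a b c d e → HankelNeg a′ b′ c′ d′ e′
    hankel-cong refl refl refl refl refl h = h

  small : ∀ n → 271 ≤ n → n < 62498 → HankelNeg (q n) (q (1 + n)) (q (2 + n)) (q (3 + n)) (q (4 + n))
  small n lo hi = hankel-from (tail 0 (353 + (4 + n))) (lists-values (4 + n)) n lo hi (λ k p → sym (q≡tail (353 + (4 + n)) k (≤-trans p (m≤n+m (4 + n) 353))))

module CircleMethod where
  open FiniteRange using (HankelNeg)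
  open import Data.Nat as ℕ using (ℕ; zero; suc)
  import Data.Nat.Properties as ℕ
  open import Data.Integer as ℤ using (ℤ)
  import Data.Integer.Properties as ℤ
  import Data.Rational.Unnormalised as ℚᵘ
  import Data.Rational.Unnormalised.Properties as ℚᵘ
  open import Data.Rational hiding (floor)
  open import Data.Rational.Properties
  open import Data.Bool using (true; false)
  open import Data.List using (_∷_; [])
  open import Data.Maybe using (Maybe; just; nothing)
  open import Data.Product using (∃; _×_; _,_; proj₁; proj₂)
  open import Data.Sum using (_⊎_; inj₁; inj₂)
  open import Data.Empty using (⊥; ⊥-elim)
  open import Relation.Binary.PropositionalEquality hiding (J)
  open import Relation.Nullary.Decidable using (True; toWitness; yes; no)
  import Tactic.RingSolver.Core.AlmostCommutativeRing as ACR
  import Tactic.RingSolver.NonReflective as NR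
  open import Level using (0ℓ)
  open import Algebra.Bundles using (CommutativeMonoid)
  import Algebra.Solver.CommutativeMonoid as CMSolver
  open import Defs using (dq)

  -- Rational arithmetic and certificates for inequalities

  isZero : (x : ℚ) → Maybe (0ℚ ≡ x)
  isZero x with 0ℚ ≟ x
  ... | yes p = just p
  ... | no _  = nothing

  ringℚ : ACR.AlmostCommutativeRing 0ℓ 0ℓ
  ringℚ = ACR.fromCommutativeRing +-*-commutativeRing isZero

  open NR ringℚ using (Expr) renaming (solve to ring; _⊕_ to _:+_; _⊗_ to _:*_; ⊝_ to :-_; Κ to con; _⊜_ to infix 4 _:=_)

  # : ℕ → ℚ
  # zero = 0ℚ
  # (suc n) = ℤ.+ suc n / 1

  infixl 8 _÷′_
  _÷′_ : (n d : ℕ) → .{{ℕ.NonZero d}} → ℚ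
  n ÷′ suc d = ℤ.+ n / suc d

  infixl 6 _:-_
  _:-_ : ∀ {n} → Expr ℚ n → Expr ℚ n → Expr ℚ n
  x :- y = x :+ (:- y)

  :# : ∀ {n} → ℕ → Expr ℚ n
  :# k = con (# k)

  infixl 8 _:/_
  _:/_ : ∀ {n} k d → .{{ℕ.NonZero d}} → Expr ℚ n
  k :/ d = con (k ÷′ d)

  lit≤ : (p q : ℚ) → {True (p ≤? q)} → p ≤ q
  lit≤ p q {t} = toWitness t

  lit< : (p q : ℚ) → {True (p <? q)} → p < q
  lit< p q {t} = toWitness t

  lit : (q : ℚ) → {True (0ℚ ≤? q)} → 0ℚ ≤ q
  lit q {t} = toWitness t

  infixl 6 _⊹_
  _⊹_ : ∀ {a b} → 0ℚ ≤ a → 0ℚ ≤ b → 0ℚ ≤ a + b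
  _⊹_ {a} {b} p q = subst (_≤ a + b) (+-identityˡ 0ℚ) (+-mono-≤ p q)

  infixl 7 _⊠_
  _⊠_ : ∀ {a b} → 0ℚ ≤ a → 0ℚ ≤ b → 0ℚ ≤ a * b
  _⊠_ {a} {b} p q = subst (_≤ a * b) (*-zeroˡ b) (*-monoʳ-≤-nonNeg b {{nonNegative q}} p)

  0<+ : ∀ {a b} → 0ℚ < a → 0ℚ ≤ b → 0ℚ < a + b
  0<+ {a} {b} p q = subst (_< a + b) (+-identityˡ 0ℚ) (+-mono-<-≤ p q)

  0<* : ∀ {a b} → 0ℚ < a → 0ℚ < b → 0ℚ < a * b
  0<* {a} {b} p q = subst (_< a * b) (*-zeroˡ b) (*-monoˡ-<-pos b {{positive q}} p)

  -- Most estimates are certificates of this form: the difference is displayed as a sum of products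
  -- that are nonnegative by construction, and the ring solver verifies the identity.
  ≤by : ∀ {a b d} → 0ℚ ≤ d → a + d ≡ b → a ≤ b
  ≤by {a} {b} {d} p e = subst₂ _≤_ (+-identityʳ a) e (+-monoʳ-≤ a p)

  <by : ∀ {a b d} → 0ℚ < d → a + d ≡ b → a < b
  <by {a} {b} {d} p e = subst₂ _<_ (+-identityʳ a) e (+-monoʳ-< a p)

  diff : ∀ {a b} → a ≤ b → 0ℚ ≤ b - a
  diff {a} {b} p = subst (_≤ b - a) (+-inverseʳ a) (+-monoˡ-≤ (- a) p)

  diff< : ∀ {a b} → a < b → 0ℚ < b - a
  diff< {a} {b} p = subst (_< b - a) (+-inverseʳ a) (+-monoˡ-< (- a) p)

  undiff : ∀ {a b} → 0ℚ ≤ b - a → a ≤ b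
  undiff {a} {b} p = ≤by p (e a b)
    where e = ring 2 (λ a b → a :+ (b :- a) := b) refl

  *-mono : ∀ {a b c d} → 0ℚ ≤ a → a ≤ b → 0ℚ ≤ c → c ≤ d → a * c ≤ b * d
  *-mono {a} {b} {c} {d} a0 ab c0 cd = ≤by (diff ab ⊠ (c0 ⊹ diff cd) ⊹ a0 ⊠ diff cd) (e a b c d)
    where e = ring 4 (λ a b c d → a :* c :+ ((b :- a) :* (c :+ (d :- c)) :+ a :* (d :- c)) := b :* d) refl

  *-monoˡ : ∀ {b c d} → 0ℚ ≤ b → c ≤ d → b * c ≤ b * d
  *-monoˡ {b} b0 cd = *-monoˡ-≤-nonNeg b {{nonNegative b0}} cd

  *-monoʳ : ∀ {b c d} → 0ℚ ≤ b → c ≤ d → c * b ≤ d * b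
  *-monoʳ {b} b0 cd = *-monoʳ-≤-nonNeg b {{nonNegative b0}} cd

  *-cancel : ∀ {a b c} → 0ℚ < c → c * a ≤ c * b → a ≤ b
  *-cancel {c = c} p = *-cancelˡ-≤-pos c {{positive p}}

  sq≥0 : ∀ a → 0ℚ ≤ a * a
  sq≥0 a with ≤-total 0ℚ a
  ... | inj₁ p = p ⊠ p
  ... | inj₂ p = subst (0ℚ ≤_) (e a) (diff p ⊠ diff p)
    where e = ring 1 (λ a → (con 0ℚ :- a) :* (con 0ℚ :- a) := a :* a) refl

  sqrt≤ : ∀ {a b} → 0ℚ ≤ b → a * a ≤ b * b → a ≤ b
  sqrt≤ {a} {b} b0 h with ≤-total a b
  ... | inj₁ p = p
  ... | inj₂ p with a ≤? b
  ...   | yes q = q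
  ...   | no  q = ⊥-elim (<-irrefl refl (<-≤-trans (<by (0<* (diff< b<a) (0<+ (≤-<-trans b0 b<a) b0)) (e a b)) h))
    where b<a = ≰⇒> q
          e = ring 2 (λ a b → b :* b :+ (a :- b) :* (a :+ b) := a :* a) refl

  cases≤ : ∀ {ℓ} {A : Set ℓ} p q → (p ≤ q → A) → (q ≤ p → A) → A
  cases≤ p q f g with ≤-total p q
  ... | inj₁ h = f h
  ... | inj₂ h = g h

  ∣∣≤ : ∀ {a b} → a ≤ b → - a ≤ b → ∣ a ∣ ≤ b
  ∣∣≤ {a} {b} p q with ∣p∣≡p∨∣p∣≡-p a
  ... | inj₁ e = subst (_≤ b) (sym e) p
  ... | inj₂ e = subst (_≤ b) (sym e) q

  ≤∣∣ : ∀ a → a ≤ ∣ a ∣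
  ≤∣∣ a with ≤-total 0ℚ a
  ... | inj₁ p = ≤-reflexive (sym (0≤p⇒∣p∣≡p p))
  ... | inj₂ p = ≤-trans p (0≤∣p∣ a)

  -≤∣∣ : ∀ a → - a ≤ ∣ a ∣
  -≤∣∣ a = subst (- a ≤_) (∣-p∣≡∣p∣ a) (≤∣∣ (- a))

  ∣∣² : ∀ a → ∣ a ∣ * ∣ a ∣ ≡ a * a
  ∣∣² a with ∣p∣≡p∨∣p∣≡-p a
  ... | inj₁ e rewrite e = refl
  ... | inj₂ e rewrite e = l a
    where l = ring 1 (λ a → (:- a) :* (:- a) := a :* a) refl

  -- Unfolds along the successor and so serves inductions, while `#` gives normalised literals for
  -- computation; `ι-lit` links the two.
  ι : ℕ → ℚ
  ι zero = 0ℚ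
  ι (suc n) = 1ℚ + ι n

  ι≥0 : ∀ n → 0ℚ ≤ ι n
  ι≥0 zero = ≤-refl
  ι≥0 (suc n) = lit 1ℚ ⊹ ι≥0 n

  ι-+ : ∀ m n → ι (m ℕ.+ n) ≡ ι m + ι n
  ι-+ zero n = sym (+-identityˡ (ι n))
  ι-+ (suc m) n = trans (cong (λ t → 1ℚ + t) (ι-+ m n)) (sym (+-assoc 1ℚ (ι m) (ι n)))

  ι-* : ∀ m n → ι (m ℕ.* n) ≡ ι m * ι n
  ι-* zero n = sym (*-zeroˡ (ι n))
  ι-* (suc m) n = trans (ι-+ n (m ℕ.* n)) (trans (cong (λ t → ι n + t) (ι-* m n)) (e (ι m) (ι n)))
    where e = ring 2 (λ a b → b :+ a :* b := (con 1ℚ :+ a) :* b) refl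

  ι-mono : ∀ {m n} → m ℕ.≤ n → ι m ≤ ι n
  ι-mono {n = n} ℕ.z≤n = ι≥0 n
  ι-mono (ℕ.s≤s p) = +-monoʳ-≤ 1ℚ (ι-mono p)

  infixr 8 _^_
  _^_ : ℚ → ℕ → ℚ
  x ^ zero = 1ℚ
  x ^ suc n = x * x ^ n

  ^≥0 : ∀ {x} n → 0ℚ ≤ x → 0ℚ ≤ x ^ n
  ^≥0 zero p = lit 1ℚ
  ^≥0 (suc n) p = p ⊠ ^≥0 n p

  ^>0 : ∀ {x} n → 0ℚ < x → 0ℚ < x ^ n
  ^>0 zero p = lit< 0ℚ 1ℚ
  ^>0 (suc n) p = 0<* p (^>0 n p)

  ^≤1 : ∀ {x} n → 0ℚ ≤ x → x ≤ 1ℚ → x ^ n ≤ 1ℚ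
  ^≤1 zero p q = ≤-refl
  ^≤1 {x} (suc n) p q = subst (x * x ^ n ≤_) (*-identityˡ 1ℚ) (*-mono p q (^≥0 n p) (^≤1 n p q))

  ^-+ : ∀ x m n → x ^ (m ℕ.+ n) ≡ x ^ m * x ^ n
  ^-+ x zero n = sym (*-identityˡ (x ^ n))
  ^-+ x (suc m) n = trans (cong (x *_) (^-+ x m n)) (sym (*-assoc x (x ^ m) (x ^ n)))

  ^-* : ∀ x y n → (x * y) ^ n ≡ x ^ n * y ^ n
  ^-* x y zero = sym (*-identityˡ 1ℚ)
  ^-* x y (suc n) = trans (cong (x * y *_) (^-* x y n)) (e x y (x ^ n) (y ^ n))
    where e = ring 4 (λ a b c d → a :* b :* (c :* d) := a :* c :* (b :* d)) refl

  ^-^ : ∀ x m n → x ^ (m ℕ.* n) ≡ (x ^ n) ^ m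
  ^-^ x zero n = refl
  ^-^ x (suc m) n = trans (^-+ x n (m ℕ.* n)) (cong (x ^ n *_) (^-^ x m n))

  ^-mono : ∀ {x y} n → 0ℚ ≤ x → x ≤ y → x ^ n ≤ y ^ n
  ^-mono zero p q = ≤-refl
  ^-mono (suc n) p q = *-mono p q (^≥0 n p) (^-mono n p q)

  ^-anti : ∀ {x m n} → 0ℚ ≤ x → x ≤ 1ℚ → m ℕ.≤ n → x ^ n ≤ x ^ m
  ^-anti {n = n} p q ℕ.z≤n = ^≤1 n p q
  ^-anti p q (ℕ.s≤s r) = *-monoˡ p (^-anti p q r)

  -- ∑ f n and ∏ f n range over the indices 1, …, n.
  ∑ : (ℕ → ℚ) → ℕ → ℚ
  ∑ f zero = 0ℚ
  ∑ f (suc n) = ∑ f n + f (suc n)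

  ∏ : (ℕ → ℚ) → ℕ → ℚ
  ∏ f zero = 1ℚ
  ∏ f (suc n) = ∏ f n * f (suc n)

  ∑-mono : ∀ {f g : ℕ → ℚ} n → (∀ k → f k ≤ g k) → ∑ f n ≤ ∑ g n
  ∑-mono zero h = ≤-refl
  ∑-mono (suc n) h = +-mono-≤ (∑-mono n h) (h (suc n))

  ∑≥0 : ∀ {f : ℕ → ℚ} n → (∀ k → 0ℚ ≤ f k) → 0ℚ ≤ ∑ f n
  ∑≥0 zero h = ≤-refl
  ∑≥0 (suc n) h = ∑≥0 n h ⊹ h (suc n)

  ∑-+ : ∀ f g n → ∑ (λ k → f k + g k) n ≡ ∑ f n + ∑ g n
  ∑-+ f g zero = refl
  ∑-+ f g (suc n) = trans (cong (_+ (f (suc n) + g (suc n))) (∑-+ f g n)) (e (∑ f n) (∑ g n) (f (suc n)) (g (suc n)))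
    where e = ring 4 (λ a b c d → a :+ b :+ (c :+ d) := a :+ c :+ (b :+ d)) refl

  ∑-* : ∀ c f n → ∑ (λ k → c * f k) n ≡ c * ∑ f n
  ∑-* c f zero = sym (*-zeroʳ c)
  ∑-* c f (suc n) = trans (cong (_+ c * f (suc n)) (∑-* c f n)) (sym (*-distribˡ-+ c (∑ f n) (f (suc n))))

  ∑-const : ∀ c n → ∑ (λ _ → c) n ≡ ι n * c
  ∑-const c zero = sym (*-zeroˡ c)
  ∑-const c (suc n) = trans (cong (_+ c) (∑-const c n)) (e (ι n) c)
    where e = ring 2 (λ a b → a :* b :+ b := (con 1ℚ :+ a) :* b) refl

  ∏≥0 : ∀ {f : ℕ → ℚ} n → (∀ k → 0ℚ ≤ f k) → 0ℚ ≤ ∏ f n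
  ∏≥0 zero h = lit 1ℚ
  ∏≥0 (suc n) h = ∏≥0 n h ⊠ h (suc n)

  abstract
    -- The reciprocal is only ever applied to positive arguments; elsewhere it is 0.
    inv : ℚ → ℚ
    inv x with 0ℚ <? x
    ... | yes p = 1/_ x {{>-nonZero p}}
    ... | no _  = 0ℚ

    inv-* : ∀ {x} → 0ℚ < x → x * inv x ≡ 1ℚ
    inv-* {x} p with 0ℚ <? x
    ... | yes q = *-inverseʳ x {{>-nonZero q}}
    ... | no ¬q = ⊥-elim (¬q p)

    inv>0 : ∀ {x} → 0ℚ < x → 0ℚ < inv x
    inv>0 {x} p with 0ℚ <? inv x
    ... | yes q = q
    ... | no ¬q = ⊥-elim (<-irrefl refl (<-≤-trans (lit< 0ℚ 1ℚ) (subst₂ _≤_ (inv-* p) (*-zeroʳ x) (*-monoˡ (<⇒≤ p) (≮⇒≥ ¬q)))))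

    inv≥0 : ∀ {x} → 0ℚ < x → 0ℚ ≤ inv x
    inv≥0 p = <⇒≤ (inv>0 p)

  ι-ℚᵘ : ∀ n → toℚᵘ (ι n) ℚᵘ.≃ ℚᵘ.mkℚᵘ (ℤ.+ n) 0
  ι-ℚᵘ zero = ℚᵘ.≃-refl
  ι-ℚᵘ (suc n) = ℚᵘ.≃-trans (toℚᵘ-homo-+ 1ℚ (ι n))
    (ℚᵘ.≃-trans (ℚᵘ.+-cong {toℚᵘ 1ℚ} ℚᵘ.≃-refl (ι-ℚᵘ n))
    (ℚᵘ.*≡* (cong (λ a → (ℤ.+ 1 ℤ.+ a) ℤ.* (ℤ.+ 1)) (ℤ.*-identityʳ (ℤ.+ n)))))

  ∃> : ∀ q → ∃ λ n → q < ι n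
  ∃> q@(mkℚ (ℤ.+ a) d c) = suc a , toℚᵘ-cancel-< (ℚᵘ.<-respʳ-≃ {toℚᵘ q} (ℚᵘ.≃-sym (ι-ℚᵘ (suc a)))
    (ℚᵘ.*<* (subst (ℤ._< (ℤ.+ suc a ℤ.* ℤ.+ suc d)) (sym (ℤ.*-identityʳ (ℤ.+ a))) (ℤ.+<+ (ℕ.≤-trans (ℕ.n<1+n a) (ℕ.m≤m*n (suc a) (suc d)))))))
  ∃> q@(mkℚ (ℤ.-[1+ a ]) d c) = 0 , negative⁻¹ q

  abstract
    floor : ∀ q → 0ℚ ≤ q → ∃ λ n → ι n ≤ q × q < 1ℚ + ι n
    floor q q0 = search (proj₁ (∃> q)) (proj₂ (∃> q))
      where
      search : ∀ b → q < ι b → ∃ λ n → ι n ≤ q × q < 1ℚ + ι n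
      search zero h = ⊥-elim (<-irrefl refl (<-≤-trans h q0))
      search (suc b) h with q <? ι b
      ... | yes p = search b p
      ... | no ¬p = b , ≮⇒≥ ¬p , h

  ι≤⇒≤ : ∀ {m n} → ι m < 1ℚ + ι n → m ℕ.≤ n
  ι≤⇒≤ {m} {n} h with m ℕ.≤? n
  ... | yes p = p
  ... | no ¬p = ⊥-elim (<-irrefl refl (<-≤-trans h (ι-mono (ℕ.≰⇒> ¬p))))

  ι-lit : ∀ n → ι n ≡ # n
  ι-lit n = toℚᵘ-injective (ℚᵘ.≃-trans (ι-ℚᵘ n) (ℚᵘ.≃-sym (toℚᵘ-homo-/ n)))
    where toℚᵘ-homo-/ : ∀ n → toℚᵘ (# n) ℚᵘ.≃ ℚᵘ.mkℚᵘ (ℤ.+ n) 0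
          toℚᵘ-homo-/ zero = ℚᵘ.≃-refl
          toℚᵘ-homo-/ (suc n) = toℚᵘ-fromℚᵘ (ℚᵘ.mkℚᵘ (ℤ.+ suc n) 0)

  -- Trigonometry at a rational point of the circle

  -- A rational point x of the unit circle, given by the real and imaginary parts of its powers.
  record Point : Set where
    field
      cos sin : ℤ → ℚ
      cos-0 : cos (ℤ.+ 0) ≡ 1ℚ
      sin-0 : sin (ℤ.+ 0) ≡ 0ℚ
      cos-+ : ∀ a b → cos (a ℤ.+ b) ≡ cos a * cos b - sin a * sin b
      sin-+ : ∀ a b → sin (a ℤ.+ b) ≡ sin a * cos b + cos a * sin b
      cos-neg : ∀ a → cos (ℤ.- a) ≡ cos a
      sin-neg : ∀ a → sin (ℤ.- a) ≡ - sin a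

    pyth : ∀ a → cos a * cos a + sin a * sin a ≡ 1ℚ
    pyth a = trans (sym (trans (cong₂ (λ p q → cos a * p - sin a * q) (cos-neg a) (sin-neg a)) (e (cos a) (sin a))))
      (trans (sym (cos-+ a (ℤ.- a))) (trans (cong cos (ℤ.+-inverseʳ a)) cos-0))
      where e = ring 2 (λ c s → c :* c :- s :* (:- s) := c :* c :+ s :* s) refl

    cos²≤1 : ∀ a → cos a * cos a ≤ 1ℚ
    cos²≤1 a = ≤by (sq≥0 (sin a)) (pyth a)

    cos≤1 : ∀ a → cos a ≤ 1ℚ
    cos≤1 a = sqrt≤ (lit 1ℚ) (subst (cos a * cos a ≤_) (sym (*-identityˡ 1ℚ)) (cos²≤1 a))

    ∣cos∣≤1 : ∀ a → ∣ cos a ∣ ≤ 1ℚ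
    ∣cos∣≤1 a = sqrt≤ (lit 1ℚ) (subst₂ _≤_ (sym (∣∣² (cos a))) (sym (*-identityˡ 1ℚ)) (cos²≤1 a))

    -- W a = |1 - x^a|².
    W : ℤ → ℚ
    W a = # 2 - # 2 * cos a

    w : ℚ
    w = W (ℤ.+ 1)

    W≥0 : ∀ a → 0ℚ ≤ W a
    W≥0 a = subst (0ℚ ≤_) (e (cos a)) (lit (# 2) ⊠ diff (cos≤1 a))
      where e = ring 1 (λ c → :# 2 :* (con 1ℚ :- c) := :# 2 :- :# 2 :* c) refl

    W≤4 : ∀ a → W a ≤ # 4
    W≤4 a = ≤by (lit (# 2) ⊠ diff (≤-trans (-≤∣∣ (cos a)) (∣cos∣≤1 a))) (e (cos a))
      where e = ring 1 (λ c → :# 2 :- :# 2 :* c :+ :# 2 :* (con 1ℚ :- (:- c)) := :# 4) refl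

    σ : ℚ
    σ = ∣ sin (ℤ.+ 1) ∣

    σ≥0 : 0ℚ ≤ σ
    σ≥0 = 0≤∣p∣ (sin (ℤ.+ 1))

    σ²≤w : σ * σ ≤ w
    σ²≤w = subst (_≤ w) (sym (trans (∣∣² s) (trans (e c s) (cong (_- c * c) (pyth (ℤ.+ 1))))))
       (≤by (sq≥0 (1ℚ - c)) (e′ c))
      where
      c = cos (ℤ.+ 1)
      s = sin (ℤ.+ 1)
      e = ring 2 (λ c s → s :* s := c :* c :+ s :* s :- c :* c) refl
      e′ = ring 1 (λ c → con 1ℚ :- c :* c :+ (con 1ℚ :- c) :* (con 1ℚ :- c) := :# 2 :- :# 2 :* c) refl

    cos₂ : ∀ a → cos (ℤ.+ 1 ℤ.+ (ℤ.+ 1 ℤ.+ a)) ≡ # 2 * cos (ℤ.+ 1) * cos (ℤ.+ 1 ℤ.+ a) - cos a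
    cos₂ a rewrite cos-+ (ℤ.+ 1) (ℤ.+ 1 ℤ.+ a) | cos-+ (ℤ.+ 1) a | sin-+ (ℤ.+ 1) a = 
      trans (e c s (cos a) (sin a)) (cong (λ t → # 2 * c * (c * cos a - s * sin a) - t * cos a) (pyth (ℤ.+ 1)) ■ e′ (# 2 * c * (c * cos a - s * sin a)) (cos a))
      where
      _■_ = trans
      c = cos (ℤ.+ 1)
      s = sin (ℤ.+ 1)
      e = ring 4 (λ c s C S → c :* (c :* C :- s :* S) :- s :* (s :* C :+ c :* S) := :# 2 :* c :* (c :* C :- s :* S) :- (c :* c :+ s :* s) :* C) refl
      e′ = ring 2 (λ t C → t :- con 1ℚ :* C := t :- C) refl

    sin₂ : ∀ a → sin (ℤ.+ 1 ℤ.+ (ℤ.+ 1 ℤ.+ a)) ≡ # 2 * cos (ℤ.+ 1) * sin (ℤ.+ 1 ℤ.+ a) - sin a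
    sin₂ a rewrite sin-+ (ℤ.+ 1) (ℤ.+ 1 ℤ.+ a) | cos-+ (ℤ.+ 1) a | sin-+ (ℤ.+ 1) a = 
      trans (e c s (cos a) (sin a)) (cong (λ t → # 2 * c * (s * cos a + c * sin a) - t * sin a) (pyth (ℤ.+ 1)) ■ e′ (# 2 * c * (s * cos a + c * sin a)) (sin a))
      where
      _■_ = trans
      c = cos (ℤ.+ 1)
      s = sin (ℤ.+ 1)
      e = ring 4 (λ c s C S → s :* (c :* C :- s :* S) :+ c :* (s :* C :+ c :* S) := :# 2 :* c :* (s :* C :+ c :* S) :- (c :* c :+ s :* s) :* S) refl
      e′ = ring 2 (λ t C → t :- con 1ℚ :* C := t :- C) refl

    -- The sequences W n, sin n - n sin 1 have second differences w (2 - W n), -w sin n.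
    W-step : ∀ n → W (ℤ.+ suc n) ≤ W (ℤ.+ n) + (1ℚ + # 2 * ι n) * w × W (ℤ.+ n) ≤ ι n * ι n * w
    W-step zero rewrite cos-0 = ≤-reflexive (e w) , ≤-reflexive (e′ w)
      where e = ring 1 (λ w → w := :# 2 :- :# 2 :* con 1ℚ :+ (con 1ℚ :+ :# 2 :* con 0ℚ) :* w) refl
            e′ = ring 1 (λ w → :# 2 :- :# 2 :* con 1ℚ := con 0ℚ :* con 0ℚ :* w) refl
    W-step (suc n) with W-step n
    ... | p , q =
      ≤by (diff p ⊹ W≥0 (ℤ.+ 1) ⊠ W≥0 (ℤ.+ suc n))
        (trans (cong (λ t → # 2 - # 2 * t + D) (cos₂ (ℤ.+ n))) (e (cos (ℤ.+ 1)) (cos (ℤ.+ suc n)) (cos (ℤ.+ n)) (ι n)))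
      , ≤by (diff p ⊹ diff q) (e′ (W (ℤ.+ suc n)) (W (ℤ.+ n)) (ι n) w)
      where
      D = W (ℤ.+ n) + (1ℚ + # 2 * ι n) * w - W (ℤ.+ suc n) + w * W (ℤ.+ suc n)
      e = ring 4 (λ c C D n → :# 2 :- :# 2 :* (:# 2 :* c :* C :- D) :+ ((:# 2 :- :# 2 :* D :+ (con 1ℚ :+ :# 2 :* n) :* (:# 2 :- :# 2 :* c)) :- (:# 2 :- :# 2 :* C) :+ (:# 2 :- :# 2 :* c) :* (:# 2 :- :# 2 :* C)) := :# 2 :- :# 2 :* C :+ (con 1ℚ :+ :# 2 :* (con 1ℚ :+ n)) :* (:# 2 :- :# 2 :* c)) refl
      e′ = ring 4 (λ A B n w → A :+ ((B :+ (con 1ℚ :+ :# 2 :* n) :* w) :- A :+ (n :* n :* w :- B)) := (con 1ℚ :+ n) :* (con 1ℚ :+ n) :* w) refl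

    ∣sin∣≤ : ∀ n → ∣ sin (ℤ.+ n) ∣ ≤ ι n * σ
    ∣sin∣≤ zero rewrite sin-0 = ≤-reflexive (sym (*-zeroˡ σ))
    ∣sin∣≤ (suc n) rewrite sin-+ (ℤ.+ 1) (ℤ.+ n) =
      ≤-trans (∣p+q∣≤∣p∣+∣q∣ (s * C) (c * S))
      (subst₂ (λ a b → a + b ≤ (1ℚ + ι n) * σ) (sym (∣p*q∣≡∣p∣*∣q∣ s C)) (sym (∣p*q∣≡∣p∣*∣q∣ c S))
       (≤by (σ≥0 ⊠ diff (∣cos∣≤1 (ℤ.+ n)) ⊹ diff (∣cos∣≤1 (ℤ.+ 1)) ⊠ 0≤∣p∣ S ⊹ diff (∣sin∣≤ n))
         (e (∣ s ∣) (∣ C ∣) (∣ c ∣) (∣ S ∣) (ι n))))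
      where
      s = sin (ℤ.+ 1)
      c = cos (ℤ.+ 1)
      S = sin (ℤ.+ n)
      C = cos (ℤ.+ n)
      e = ring 5 (λ s C c S n → s :* C :+ c :* S :+ (s :* (con 1ℚ :- C) :+ (con 1ℚ :- c) :* S :+ (n :* s :- S)) := (con 1ℚ :+ n) :* s) refl

    dev : ℕ → ℚ
    dev n = ι n * sin (ℤ.+ 1) - sin (ℤ.+ n)

    -- A third-order remainder for the sine without angles: the bound on first differences comes
    -- from summing second differences, and summing again gives n³/6. The factors 2 and 6 clear
    -- denominators.
    ∣dev∣≤ : ∀ n → # 2 * ∣ dev (suc n) - dev n ∣ ≤ (ι n * ι n + ι n) * (w * σ)
               × # 6 * ∣ dev n ∣ ≤ ι n * ι n * ι n * (w * σ)
    ∣dev∣≤ zero rewrite sin-0 = ≤-reflexive (trans (cong (λ t → # 2 * ∣ t ∣) (e s)) (sym (e₀ (w * σ))))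
       , ≤-reflexive (trans (cong (λ t → # 6 * ∣ t ∣) (e′ s)) (sym (e₁ (w * σ))))
      where
      s = sin (ℤ.+ 1)
      e = ring 1 (λ s → (con 1ℚ :+ con 0ℚ) :* s :- s :- (con 0ℚ :* s :- con 0ℚ) := con 0ℚ) refl
      e′ = ring 1 (λ s → con 0ℚ :* s :- con 0ℚ := con 0ℚ) refl
      e₀ = ring 1 (λ s → (con 0ℚ :* con 0ℚ :+ con 0ℚ) :* s := con 0ℚ) refl
      e₁ = ring 1 (λ s → con 0ℚ :* con 0ℚ :* con 0ℚ :* s := con 0ℚ) refl
    ∣dev∣≤ (suc n) with ∣dev∣≤ n
    ... | p , q = p′ , q′
      where
      s = sin (ℤ.+ 1)
      c = cos (ℤ.+ 1)
      A = dev (suc n) - dev n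
      S = sin (ℤ.+ suc n)
      second = ring 5 (λ n s c S T → (con 1ℚ :+ (con 1ℚ :+ n)) :* s :- (:# 2 :* c :* S :- T) :- ((con 1ℚ :+ n) :* s :- S) := ((con 1ℚ :+ n) :* s :- S :- (n :* s :- T)) :+ (:# 2 :- :# 2 :* c) :* S) refl
      eqA : dev (suc (suc n)) - dev (suc n) ≡ A + w * S
      eqA = trans (cong (λ t → ι (suc (suc n)) * s - t - dev (suc n)) (sin₂ (ℤ.+ n))) (second (ι n) s c S (sin (ℤ.+ n)))
      ring₁ = ring 5 (λ A S n w σ → :# 2 :* (A :+ w :* S) :+ ((n :* n :+ n) :* (w :* σ) :- :# 2 :* A :+ :# 2 :* w :* ((con 1ℚ :+ n) :* σ :- S)) := ((con 1ℚ :+ n) :* (con 1ℚ :+ n) :+ (con 1ℚ :+ n)) :* (w :* σ)) refl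
      p′ : # 2 * ∣ dev (suc (suc n)) - dev (suc n) ∣ ≤ (ι (suc n) * ι (suc n) + ι (suc n)) * (w * σ)
      p′ = ≤-trans (*-monoˡ (lit (# 2)) (≤-trans (≤-reflexive (cong ∣_∣ eqA)) (≤-trans (∣p+q∣≤∣p∣+∣q∣ A (w * S))
             (≤-reflexive (cong (λ t → ∣ A ∣ + t) (trans (∣p*q∣≡∣p∣*∣q∣ w S) (cong (_* ∣ S ∣) (0≤p⇒∣p∣≡p (W≥0 (ℤ.+ 1))))))))))
           (≤by (diff p ⊹ lit (# 2) ⊠ W≥0 (ℤ.+ 1) ⊠ diff (∣sin∣≤ (suc n))) (ring₁ (∣ A ∣) (∣ S ∣) (ι n) w σ))
      eqD = ring 2 (λ a b → a := b :+ (a :- b)) refl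
      ring₃ = ring 4 (λ A D n x → :# 6 :* (D :+ A) :+ (n :* n :* n :* x :- :# 6 :* D :+ :# 3 :* ((n :* n :+ n) :* x :- :# 2 :* A) :+ x) := (con 1ℚ :+ n) :* (con 1ℚ :+ n) :* (con 1ℚ :+ n) :* x) refl
      q′ : # 6 * ∣ dev (suc n) ∣ ≤ ι (suc n) * ι (suc n) * ι (suc n) * (w * σ)
      q′ = ≤-trans (*-monoˡ (lit (# 6)) (≤-trans (≤-reflexive (cong ∣_∣ (eqD (dev (suc n)) (dev n)))) (∣p+q∣≤∣p∣+∣q∣ (dev n) A)))
            (≤by (diff q ⊹ lit (# 3) ⊠ diff p ⊹ W≥0 (ℤ.+ 1) ⊠ σ≥0) (ring₃ (∣ A ∣) (∣ dev n ∣) (ι n) (w * σ)))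

  -- Integer laws and their generating functions

  ιℤ : ℤ → ℚ
  ιℤ (ℤ.+ n) = ι n
  ιℤ (ℤ.-[1+ n ]) = - ι (suc n)

  ιℤ-⊖ : ∀ m n → ιℤ (m ℤ.⊖ n) ≡ ι m - ι n
  ιℤ-⊖ m zero = e (ι m)
    where e = ring 1 (λ a → a := a :- con 0ℚ) refl
  ιℤ-⊖ zero (suc n) = sym (+-identityˡ (- ι (suc n)))
  ιℤ-⊖ (suc m) (suc n) = trans (cong ιℤ (ℤ.[1+m]⊖[1+n]≡m⊖n m n)) (trans (ιℤ-⊖ m n) (e (ι m) (ι n)))
    where e = ring 2 (λ a b → a :- b := con 1ℚ :+ a :- (con 1ℚ :+ b)) refl

  ιℤ-+ : ∀ a b → ιℤ (a ℤ.+ b) ≡ ιℤ a + ιℤ b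
  ιℤ-+ (ℤ.+ m) (ℤ.+ n) = ι-+ m n
  ιℤ-+ (ℤ.+ m) (ℤ.-[1+ n ]) = ιℤ-⊖ m (suc n)
  ιℤ-+ (ℤ.-[1+ m ]) (ℤ.+ n) = trans (ιℤ-⊖ n (suc m)) (+-comm (ι n) (- ι (suc m)))
  ιℤ-+ (ℤ.-[1+ m ]) (ℤ.-[1+ n ]) = trans (cong (λ t → - (1ℚ + (1ℚ + t))) (ι-+ m n)) (e (ι m) (ι n))
    where e = ring 2 (λ a b → :- (con 1ℚ :+ (con 1ℚ :+ (a :+ b))) := :- (con 1ℚ :+ a) :+ :- (con 1ℚ :+ b)) refl

  ιℤ-neg : ∀ a → ιℤ (ℤ.- a) ≡ - ιℤ a
  ιℤ-neg (ℤ.+ zero) = refl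
  ιℤ-neg (ℤ.+ suc n) = refl
  ιℤ-neg (ℤ.-[1+ n ]) = e (ι (suc n))
    where e = ring 1 (λ a → a := :- (:- a)) refl

  ∣ιℤ∣ : ∀ a → ∣ ιℤ a ∣ ≡ ι ℤ.∣ a ∣
  ∣ιℤ∣ (ℤ.+ n) = 0≤p⇒∣p∣≡p (ι≥0 n)
  ∣ιℤ∣ (ℤ.-[1+ n ]) = trans (∣-p∣≡∣p∣ (ι (suc n))) (0≤p⇒∣p∣≡p (ι≥0 (suc n)))

  -- Finitely supported probability laws on ℤ: node v s t is the mixture (1 - v) s + v t.
  data Law : Set where
    leaf : ℤ → Law
    node : ℚ → Law → Law → Law

  𝔼 : Law → (ℤ → ℚ) → ℚ
  𝔼 (leaf y) g = g y
  𝔼 (node v s t) g = (1ℚ - v) * 𝔼 s g + v * 𝔼 t g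

  data Valid : Law → Set where
    leaf : ∀ y → Valid (leaf y)
    node : ∀ {v s t} → 0ℚ ≤ v → v ≤ 1ℚ → Valid s → Valid t → Valid (node v s t)

  data All (P : ℤ → Set) : Law → Set where
    leaf : ∀ {y} → P y → All P (leaf y)
    node : ∀ {v s t} → All P s → All P t → All P (node v s t)

  shift : ℤ → Law → Law
  shift a (leaf y) = leaf (y ℤ.+ a)
  shift a (node v s t) = node v (shift a s) (shift a t)

  -- The law after adding an independent coin that is `a` with probability `v` and 0 otherwise.
  add : ℚ → ℤ → Law → Law
  add v a t = node v t (shift a t)

  valid-shift : ∀ a {t} → Valid t → Valid (shift a t)
  valid-shift a (leaf y) = leaf (y ℤ.+ a)
  valid-shift a (node p q s t) = node p q (valid-shift a s) (valid-shift a t)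

  valid-add : ∀ {v} a {t} → 0ℚ ≤ v → v ≤ 1ℚ → Valid t → Valid (add v a t)
  valid-add a p q t = node p q t (valid-shift a t)

  all-shift : ∀ {P Q} a {t} → (∀ y → P y → Q (y ℤ.+ a)) → All P t → All Q (shift a t)
  all-shift a h (leaf p) = leaf (h _ p)
  all-shift a h (node s t) = node (all-shift a h s) (all-shift a h t)

  all-map : ∀ {P Q} {t} → (∀ y → P y → Q y) → All P t → All Q t
  all-map h (leaf p) = leaf (h _ p)
  all-map h (node s t) = node (all-map h s) (all-map h t)

  𝔼-shift : ∀ a t g → 𝔼 (shift a t) g ≡ 𝔼 t (λ y → g (y ℤ.+ a))
  𝔼-shift a (leaf y) g = refl
  𝔼-shift a (node v s t) g = cong₂ (λ p q → (1ℚ - v) * p + v * q) (𝔼-shift a s g) (𝔼-shift a t g)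

  𝔼-cong : ∀ t {g h} → (∀ y → g y ≡ h y) → 𝔼 t g ≡ 𝔼 t h
  𝔼-cong (leaf y) e = e y
  𝔼-cong (node v s t) e = cong₂ (λ p q → (1ℚ - v) * p + v * q) (𝔼-cong s e) (𝔼-cong t e)

  𝔼-lin : ∀ t a b g h → 𝔼 t (λ y → a * g y + b * h y) ≡ a * 𝔼 t g + b * 𝔼 t h
  𝔼-lin (leaf y) a b g h = refl
  𝔼-lin (node v s t) a b g h = trans (cong₂ (λ p q → (1ℚ - v) * p + v * q) (𝔼-lin s a b g h) (𝔼-lin t a b g h))
    (e v a b (𝔼 s g) (𝔼 s h) (𝔼 t g) (𝔼 t h))
    where e = ring 7 (λ v a b p q p′ q′ → (con 1ℚ :- v) :* (a :* p :+ b :* q) :+ v :* (a :* p′ :+ b :* q′) := a :* ((con 1ℚ :- v) :* p :+ v :* p′) :+ b :* ((con 1ℚ :- v) :* q :+ v :* q′)) refl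

  𝔼-const : ∀ t c → 𝔼 t (λ _ → c) ≡ c
  𝔼-const (leaf y) c = refl
  𝔼-const (node v s t) c = trans (cong₂ (λ p q → (1ℚ - v) * p + v * q) (𝔼-const s c) (𝔼-const t c)) (e v c)
    where e = ring 2 (λ v c → (con 1ℚ :- v) :* c :+ v :* c := c) refl

  𝔼-mono : ∀ {t P g h} → Valid t → All P t → (∀ y → P y → g y ≤ h y) → 𝔼 t g ≤ 𝔼 t h
  𝔼-mono (leaf y) (leaf p) k = k y p
  𝔼-mono (node p q s t) (node as at) k = +-mono-≤ (*-monoˡ (diff q) (𝔼-mono s as k)) (*-monoˡ p (𝔼-mono t at k))

  𝔼-mono′ : ∀ {t g h} → Valid t → (∀ y → g y ≤ h y) → 𝔼 t g ≤ 𝔼 t h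
  𝔼-mono′ (leaf y) k = k y
  𝔼-mono′ (node p q s t) k = +-mono-≤ (*-monoˡ (diff q) (𝔼-mono′ s k)) (*-monoˡ p (𝔼-mono′ t k))

  𝔼-≤ : ∀ {t g c} → Valid t → All (λ y → g y ≤ c) t → 𝔼 t g ≤ c
  𝔼-≤ {t} {c = c} v a = ≤-trans (𝔼-mono v a (λ y p → p)) (≤-reflexive (𝔼-const t c))

  ∣𝔼∣ : ∀ {t g h} → Valid t → (∀ y → ∣ g y ∣ ≤ h y) → ∣ 𝔼 t g ∣ ≤ 𝔼 t h
  ∣𝔼∣ {t} {g} {h} v k = ∣∣≤ (𝔼-mono′ v (λ y → ≤-trans (≤∣∣ (g y)) (k y)))
    (subst (_≤ 𝔼 t h) (trans (𝔼-lin t (- 1ℚ) 0ℚ g g) (e (𝔼 t g))) (𝔼-mono′ v (λ y → subst (_≤ h y) (e′ (g y)) (≤-trans (-≤∣∣ (g y)) (k y)))))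
    where e = ring 1 (λ a → (:- con 1ℚ) :* a :+ con 0ℚ :* a := :- a) refl
          e′ = ring 1 (λ a → :- a := (:- con 1ℚ) :* a :+ con 0ℚ :* a) refl

  mean : Law → ℚ
  mean t = 𝔼 t ιℤ

  sq : ℤ → ℚ
  sq y = ιℤ y * ιℤ y

  mean-add : ∀ v a t → mean (add v a t) ≡ mean t + v * ιℤ a
  mean-add v a t = trans (cong (λ p → (1ℚ - v) * mean t + v * p)
     (trans (𝔼-shift a t ιℤ) (trans (𝔼-cong t (λ y → trans (ιℤ-+ y a) (e (ιℤ y) (ιℤ a))))
       (trans (𝔼-lin t 1ℚ (ιℤ a) ιℤ (λ _ → 1ℚ)) (cong (λ p → 1ℚ * mean t + ιℤ a * p) (𝔼-const t 1ℚ))))))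
     (e′ v (mean t) (ιℤ a))
    where e = ring 2 (λ y a → y :+ a := con 1ℚ :* y :+ a :* con 1ℚ) refl
          e′ = ring 3 (λ v m a → (con 1ℚ :- v) :* m :+ v :* (con 1ℚ :* m :+ a :* con 1ℚ) := m :+ v :* a) refl

  sq-add : ∀ v a t → 𝔼 (add v a t) sq ≡ 𝔼 t sq + v * (# 2 * ιℤ a * mean t + ιℤ a * ιℤ a)
  sq-add v a t = trans (cong (λ p → (1ℚ - v) * 𝔼 t sq + v * p)
     (trans (𝔼-shift a t sq) (trans (𝔼-cong t (λ y → trans (cong (λ z → z * z) (ιℤ-+ y a)) (e (ιℤ y) (ιℤ a))))
       (trans (𝔼-lin t 1ℚ 1ℚ sq (λ y → # 2 * ιℤ a * ιℤ y + ιℤ a * ιℤ a * 1ℚ))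
         (cong (λ p → 1ℚ * 𝔼 t sq + 1ℚ * p) (trans (𝔼-lin t (# 2 * ιℤ a) (ιℤ a * ιℤ a) ιℤ (λ _ → 1ℚ))
           (cong (λ p → # 2 * ιℤ a * mean t + ιℤ a * ιℤ a * p) (𝔼-const t 1ℚ))))))))
     (e′ v (𝔼 t sq) (mean t) (ιℤ a))
    where e = ring 2 (λ y a → (y :+ a) :* (y :+ a) := con 1ℚ :* (y :* y) :+ con 1ℚ :* (:# 2 :* a :* y :+ a :* a :* con 1ℚ)) refl
          e′ = ring 4 (λ v q m a → (con 1ℚ :- v) :* q :+ v :* (con 1ℚ :* q :+ con 1ℚ :* (:# 2 :* a :* m :+ a :* a :* con 1ℚ)) := q :+ v :* (:# 2 :* a :* m :+ a :* a)) refl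

  record ℂ : Set where
    constructor _⊕i_
    field re im : ℚ
  open ℂ public

  infixl 7 _⊗_
  _⊗_ : ℂ → ℂ → ℂ
  (a ⊕i b) ⊗ (c ⊕i d) = (a * c - b * d) ⊕i (a * d + b * c)

  conj : ℂ → ℂ
  conj (a ⊕i b) = a ⊕i (- b)

  norm² : ℂ → ℚ
  norm² (a ⊕i b) = a * a + b * b

  real : ℚ → ℂ
  real a = a ⊕i 0ℚ

  ⊗-comm : ∀ x y → x ⊗ y ≡ y ⊗ x
  ⊗-comm (a ⊕i b) (c ⊕i d) = cong₂ _⊕i_ (e a b c d) (e′ a b c d)
    where e = ring 4 (λ a b c d → a :* c :- b :* d := c :* a :- d :* b) refl
          e′ = ring 4 (λ a b c d → a :* d :+ b :* c := c :* b :+ d :* a) refl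

  ⊗-assoc : ∀ x y z → x ⊗ y ⊗ z ≡ x ⊗ (y ⊗ z)
  ⊗-assoc (a ⊕i b) (c ⊕i d) (e ⊕i f) = cong₂ _⊕i_ (p a b c d e f) (p′ a b c d e f)
    where p = ring 6 (λ a b c d e f → (a :* c :- b :* d) :* e :- (a :* d :+ b :* c) :* f := a :* (c :* e :- d :* f) :- b :* (c :* f :+ d :* e)) refl
          p′ = ring 6 (λ a b c d e f → (a :* c :- b :* d) :* f :+ (a :* d :+ b :* c) :* e := a :* (c :* f :+ d :* e) :+ b :* (c :* e :- d :* f)) refl

  norm²-⊗ : ∀ x y → norm² (x ⊗ y) ≡ norm² x * norm² y
  norm²-⊗ (a ⊕i b) (c ⊕i d) = e a b c d
    where e = ring 4 (λ a b c d → (a :* c :- b :* d) :* (a :* c :- b :* d) :+ (a :* d :+ b :* c) :* (a :* d :+ b :* c) := (a :* a :+ b :* b) :* (c :* c :+ d :* d)) refl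

  ⊗-conj : ∀ x → x ⊗ conj x ≡ real (norm² x)
  ⊗-conj (a ⊕i b) = cong₂ _⊕i_ (e a b) (e′ a b)
    where e = ring 2 (λ a b → a :* a :- b :* (:- b) := a :* a :+ b :* b) refl
          e′ = ring 2 (λ a b → a :* (:- b) :+ b :* a := con 0ℚ) refl

  norm²≥0 : ∀ x → 0ℚ ≤ norm² x
  norm²≥0 (a ⊕i b) = sq≥0 a ⊹ sq≥0 b

  re≤norm : ∀ x {c} → 0ℚ ≤ c → norm² x ≤ c * c → - c ≤ re x
  re≤norm (a ⊕i b) {c} c0 h = subst (- c ≤_) (e a) (neg-antimono-≤ (sqrt≤ c0 (≤-trans (≤by (sq≥0 b) (e′ a b)) h)))
    where e = ring 1 (λ a → :- (:- a) := a) refl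
          e′ = ring 2 (λ a b → (:- a) :* (:- a) :+ b :* b := a :* a :+ b :* b) refl

  module Characters (x : Point) where
    open Point x

    W≤ : ∀ y → W y ≤ sq y * w
    W≤ (ℤ.+ n) = proj₂ (W-step n)
    W≤ (ℤ.-[1+ n ]) = subst₂ _≤_ (cong (λ t → # 2 - # 2 * t) (sym (cos-neg (ℤ.+ suc n)))) (e (ι (suc n)) w) (proj₂ (W-step (suc n)))
      where e = ring 2 (λ n w → n :* n :* w := (:- n) :* (:- n) :* w) refl

    ∣sin∣≤ℤ : ∀ y → ∣ sin y ∣ ≤ ι ℤ.∣ y ∣ * σ
    ∣sin∣≤ℤ (ℤ.+ n) = ∣sin∣≤ n
    ∣sin∣≤ℤ (ℤ.-[1+ n ]) = subst (_≤ ι (suc n) * σ) (trans (sym (∣-p∣≡∣p∣ (sin (ℤ.+ suc n)))) (cong ∣_∣ (sym (sin-neg (ℤ.+ suc n))))) (∣sin∣≤ (suc n))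

    cube : ℤ → ℚ
    cube y = ι ℤ.∣ y ∣ * ι ℤ.∣ y ∣ * ι ℤ.∣ y ∣

    devℤ : ℤ → ℚ
    devℤ y = sin (ℤ.+ 1) * ιℤ y + (- 1ℚ) * sin y

    -- The terms with coefficient `0ℚ` bring both sides into the shape of `𝔼-lin`.
    ∣devℤ∣≤ : ∀ y → ∣ # 6 * devℤ y + 0ℚ * devℤ y ∣ ≤ (w * σ) * cube y + 0ℚ * cube y
    ∣devℤ∣≤ y = subst₂ _≤_ (sym (trans (cong ∣_∣ (e₀ (devℤ y))) (trans (∣p*q∣≡∣p∣*∣q∣ (# 6) (devℤ y)) refl))) (e₁ (cube y) (w * σ)) (go y)
      where
      e₀ = ring 1 (λ d → :# 6 :* d :+ con 0ℚ :* d := :# 6 :* d) refl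
      e₁ = ring 2 (λ d s → d :* s := s :* d :+ con 0ℚ :* d) refl
      e₂ = ring 3 (λ s n S → n :* s :- S := s :* n :+ (:- con 1ℚ) :* S) refl
      e₃ = ring 3 (λ s n S → :- (n :* s :- S) := s :* (:- n) :+ (:- con 1ℚ) :* (:- S)) refl
      go : ∀ y → # 6 * ∣ devℤ y ∣ ≤ cube y * (w * σ)
      go (ℤ.+ n) = subst (λ t → # 6 * ∣ t ∣ ≤ ι n * ι n * ι n * (w * σ)) (e₂ (sin (ℤ.+ 1)) (ι n) (sin (ℤ.+ n))) (proj₂ (∣dev∣≤ n))
      go (ℤ.-[1+ n ]) = subst (λ t → # 6 * t ≤ ι (suc n) * ι (suc n) * ι (suc n) * (w * σ))
        (trans (sym (∣-p∣≡∣p∣ (dev (suc n)))) (cong ∣_∣ (trans (e₃ (sin (ℤ.+ 1)) (ι (suc n)) (sin (ℤ.+ suc n)))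
          (cong (λ t → sin (ℤ.+ 1) * (- ι (suc n)) + (- 1ℚ) * t) (sym (sin-neg (ℤ.+ suc n))))))) (proj₂ (∣dev∣≤ (suc n)))

    pt : ℤ → ℂ
    pt y = cos y ⊕i sin y

    -- The value at x of the generating function of a law.
    char : Law → ℂ
    char t = 𝔼 t cos ⊕i 𝔼 t sin

    factor : ℚ → ℤ → ℂ
    factor v a = (1ℚ - v + v * cos a) ⊕i (v * sin a)

    char-add : ∀ v a t → char (add v a t) ≡ char t ⊗ factor v a
    char-add v a t = cong₂ _⊕i_
      (trans (cong (λ p → (1ℚ - v) * 𝔼 t cos + v * p) (trans (𝔼-shift a t cos) (trans (𝔼-cong t (λ y → trans (cos-+ y a) (e (cos y) (cos a) (sin y) (sin a))))
         (𝔼-lin t (cos a) (- sin a) cos sin)))) (r v (𝔼 t cos) (𝔼 t sin) (cos a) (sin a)))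
      (trans (cong (λ p → (1ℚ - v) * 𝔼 t sin + v * p) (trans (𝔼-shift a t sin) (trans (𝔼-cong t (λ y → trans (sin-+ y a) (e′ (cos y) (cos a) (sin y) (sin a))))
         (𝔼-lin t (cos a) (sin a) sin cos)))) (i v (𝔼 t cos) (𝔼 t sin) (cos a) (sin a)))
      where
      e = ring 4 (λ C c S s → C :* c :- S :* s := c :* C :+ (:- s) :* S) refl
      e′ = ring 4 (λ C c S s → S :* c :+ C :* s := c :* S :+ s :* C) refl
      r = ring 5 (λ v C S c s → (con 1ℚ :- v) :* C :+ v :* (c :* C :+ (:- s) :* S) := C :* (con 1ℚ :- v :+ v :* c) :- S :* (v :* s)) refl
      i = ring 5 (λ v C S c s → (con 1ℚ :- v) :* S :+ v :* (c :* S :+ s :* C) := C :* (v :* s) :+ S :* (con 1ℚ :- v :+ v :* c)) refl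

    re-char : ∀ {t} → Valid t → 1ℚ - ½ * w * 𝔼 t sq ≤ re (char t)
    re-char {t} v = subst₂ _≤_ (trans (𝔼-lin t 1ℚ (- (½ * w)) (λ _ → 1ℚ) sq) (trans (cong (λ p → 1ℚ * p + (- (½ * w)) * 𝔼 t sq) (𝔼-const t 1ℚ)) (e w (𝔼 t sq))))
       refl (𝔼-mono′ v (λ y → ≤by (lit ½ ⊠ diff (W≤ y)) (e′ w (sq y) (cos y))))
      where
      e = ring 2 (λ w q → con 1ℚ :* con 1ℚ :+ (:- (con ½ :* w)) :* q := con 1ℚ :- con ½ :* w :* q) refl
      e′ = ring 3 (λ w q c → con 1ℚ :* con 1ℚ :+ (:- (con ½ :* w)) :* q :+ con ½ :* (q :* w :- (:# 2 :- :# 2 :* c)) := c) refl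

    -- For mean zero the linear part of the sine averages to zero, and only the cubic remainder is
    -- left.
    im-char : ∀ {t} → Valid t → mean t ≡ 0ℚ → # 6 * ∣ im (char t) ∣ ≤ w * σ * 𝔼 t cube
    im-char {t} v m = subst₂ _≤_ (trans (cong ∣_∣ (trans (𝔼-lin t (# 6) 0ℚ devℤ devℤ) (trans (cong (λ p → # 6 * p + 0ℚ * p)
        (trans (𝔼-lin t (sin (ℤ.+ 1)) (- 1ℚ) ιℤ sin) (cong (λ p → sin (ℤ.+ 1) * p + (- 1ℚ) * 𝔼 t sin) m))) (e (sin (ℤ.+ 1)) (𝔼 t sin)))))
        (trans (∣p*q∣≡∣p∣*∣q∣ (# 6) (- 𝔼 t sin)) (cong (# 6 *_) (∣-p∣≡∣p∣ (𝔼 t sin)))))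
      (trans (𝔼-lin t (w * σ) 0ℚ cube cube) (e′ (w * σ) (𝔼 t cube)))
      (∣𝔼∣ v ∣devℤ∣≤)
      where
      e = ring 2 (λ s E → :# 6 :* (s :* con 0ℚ :+ (:- con 1ℚ) :* E) :+ con 0ℚ :* (s :* con 0ℚ :+ (:- con 1ℚ) :* E) := :# 6 :* (:- E)) refl
      e′ = ring 2 (λ s E → s :* E :+ con 0ℚ :* E := s :* E) refl

    -- Meant for the law `init`, whose mean is `- g`; there the linear bound has to do.
    im-char₁ : ∀ {t c} → Valid t → All (λ y → ι ℤ.∣ y ∣ ≤ c) t → ∣ im (char t) ∣ ≤ c * σ
    im-char₁ {t} {c} v a = ≤-trans (∣𝔼∣ v ∣sin∣≤ℤ) (𝔼-≤ v (all-map (λ y p → *-monoʳ σ≥0 p) a))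

  -- Products of complex numbers of small argument

  cprod : (ℕ → ℂ) → ℕ → ℂ
  cprod N zero = real 1ℚ
  cprod N (suc n) = cprod N n ⊗ N (suc n)

  1+τ² : (ℕ → ℚ) → ℕ → ℚ
  1+τ² τ k = 1ℚ + τ k * τ k

  ∏1+≤ : ∀ τ n → ∏ (1+τ² τ) n * (1ℚ - ∑ (λ k → τ k * τ k) n) ≤ 1ℚ
  ∏1+≤ τ zero = lit≤ _ _
  ∏1+≤ τ (suc n) = ≤-trans (≤by (∏≥0 n (λ k → lit 1ℚ ⊹ sq≥0 (τ k)) ⊠ sq≥0 (τ (suc n)) ⊠ (∑≥0 n (λ k → sq≥0 (τ k)) ⊹ sq≥0 (τ (suc n))))
      (e (∏ (1+τ² τ) n) (∑ (λ k → τ k * τ k) n) (τ (suc n) * τ (suc n)))) (∏1+≤ τ n)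
    where e = ring 3 (λ T S a → T :* (con 1ℚ :+ a) :* (con 1ℚ :- (S :+ a)) :+ T :* a :* (S :+ a) := T :* (con 1ℚ :- S)) refl

  ∣-∣≤ : ∀ {a b} → 0ℚ ≤ b → a * a ≤ b * b → ∣ a ∣ ≤ b
  ∣-∣≤ {a} {b} p q = sqrt≤ p (subst (_≤ b * b) (sym (∣∣² a)) q)

  ∣⊗∣ : ∀ a b c d → ∣ a * b + c * d ∣ ≤ ∣ a ∣ * ∣ b ∣ + ∣ c ∣ * ∣ d ∣
  ∣⊗∣ a b c d = subst₂ (λ p q → ∣ a * b + c * d ∣ ≤ p + q) (∣p*q∣≡∣p∣*∣q∣ a b) (∣p*q∣≡∣p∣*∣q∣ c d) (∣p+q∣≤∣p∣+∣q∣ (a * b) (c * d))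

  -- A product of complex numbers with small arguments: each factor lies in the sector |im| ≤ τ re.
  module Sector (N : ℕ → ℂ) (τ : ℕ → ℚ) (τ≥0 : ∀ k → 0ℚ ≤ τ k) (ρ≥0 : ∀ k → 0ℚ ≤ re (N k))
                (sec : ∀ k → ∣ im (N k) ∣ ≤ τ k * re (N k)) (Π : ℚ) (Π≥0 : 0ℚ ≤ Π) where

    P : ℕ → ℚ
    P = ∏ (λ k → re (N k))

    A : ℕ → ℚ
    A = ∑ τ

    P≥0 : ∀ n → 0ℚ ≤ P n
    P≥0 n = ∏≥0 n ρ≥0

    A≥0 : ∀ n → 0ℚ ≤ A n
    A≥0 n = ∑≥0 n τ≥0

    P²≤norm² : ∀ n → P n * P n ≤ norm² (cprod N n)
    P²≤norm² zero = lit≤ _ _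
    P²≤norm² (suc n) = subst (P n * ρ * (P n * ρ) ≤_) (sym (norm²-⊗ (cprod N n) (N (suc n))))
       (≤by (diff (P²≤norm² n) ⊠ sq≥0 ρ ⊹ norm²≥0 (cprod N n) ⊠ sq≥0 μ) (e (P n) ρ μ (norm² (cprod N n))))
      where ρ = re (N (suc n))
            μ = im (N (suc n))
            e = ring 4 (λ P ρ μ Q → P :* ρ :* (P :* ρ) :+ ((Q :- P :* P) :* (ρ :* ρ) :+ Q :* (μ :* μ)) := Q :* (ρ :* ρ :+ μ :* μ)) refl

    norm²≤ : ∀ n → norm² (cprod N n) ≤ P n * P n * ∏ (1+τ² τ) n
    norm²≤ zero = lit≤ _ _
    norm²≤ (suc n) = subst (_≤ P n * ρ * (P n * ρ) * (T * (1ℚ + t * t))) (sym (norm²-⊗ (cprod N n) (N (suc n))))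
       (≤by (diff (norm²≤ n) ⊠ (sq≥0 ρ ⊹ sq≥0 μ) ⊹ (P≥0 n ⊠ P≥0 n ⊠ ∏≥0 n (λ k → lit 1ℚ ⊹ sq≥0 (τ k))) ⊠ diff μ²≤)
         (e (P n) ρ μ (norm² (cprod N n)) T t))
      where ρ = re (N (suc n))
            μ = im (N (suc n))
            t = τ (suc n)
            T = ∏ (1+τ² τ) n
            μ²≤ : μ * μ ≤ (t * ρ) * (t * ρ)
            μ²≤ = subst (_≤ t * ρ * (t * ρ)) (∣∣² μ) (*-mono (0≤∣p∣ μ) (sec (suc n)) (0≤∣p∣ μ) (sec (suc n)))
            e = ring 6 (λ P ρ μ Q T t → Q :* (ρ :* ρ :+ μ :* μ) :+ ((P :* P :* T :- Q) :* (ρ :* ρ :+ μ :* μ) :+ P :* P :* T :* (t :* ρ :* (t :* ρ) :- μ :* μ)) := P :* ρ :* (P :* ρ) :* (T :* (con 1ℚ :+ t :* t))) refl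

    T-mono : ∀ n → ∏ (1+τ² τ) n ≤ ∏ (1+τ² τ) (suc n)
    T-mono n = ≤by (∏≥0 n (λ k → lit 1ℚ ⊹ sq≥0 (τ k)) ⊠ sq≥0 (τ (suc n))) (e (∏ (1+τ² τ) n) (τ (suc n)))
      where e = ring 2 (λ T t → T :+ T :* (t :* t) := T :* (con 1ℚ :+ t :* t)) refl

    ∣re∣≤ : ∀ n → ∏ (1+τ² τ) n ≤ Π * Π → ∣ re (cprod N n) ∣ ≤ Π * P n
    ∣re∣≤ n h = ∣-∣≤ (Π≥0 ⊠ P≥0 n) (≤-trans (≤by (sq≥0 (im (cprod N n))) refl) (≤-trans (norm²≤ n)
       (≤by (P≥0 n ⊠ P≥0 n ⊠ diff h) (e (P n) (∏ (1+τ² τ) n) Π))))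
      where e = ring 3 (λ P T Π → P :* P :* T :+ P :* P :* (Π :* Π :- T) := Π :* P :* (Π :* P)) refl

    ∣im∣≤ : ∀ n → ∏ (1+τ² τ) n ≤ Π * Π → ∣ im (cprod N n) ∣ ≤ Π * A n * P n
    ∣im∣≤ zero h = ≤-reflexive (e Π)
      where e = ring 1 (λ p → con 0ℚ := p :* con 0ℚ :* con 1ℚ) refl
    ∣im∣≤ (suc n) h = ≤-trans (∣⊗∣ (re c) (im (N (suc n))) (im c) ρ)
       (subst (λ t → ∣ re c ∣ * ∣ im (N (suc n)) ∣ + ∣ im c ∣ * t ≤ Π * A (suc n) * P (suc n)) (sym (0≤p⇒∣p∣≡p (ρ≥0 (suc n))))
       (≤by (diff (*-mono (0≤∣p∣ (re c)) (∣re∣≤ n h′) (0≤∣p∣ (im (N (suc n)))) (sec (suc n))) ⊹ diff (∣im∣≤ n h′) ⊠ ρ≥0 (suc n))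
         (e (∣ re c ∣ * ∣ im (N (suc n)) ∣) (∣ im c ∣) Π (A n) (P n) (τ (suc n)) ρ)))
      where c = cprod N n
            ρ = re (N (suc n))
            h′ = ≤-trans (T-mono n) h
            e = ring 7 (λ X Y Π A P t ρ → X :+ Y :* ρ :+ ((Π :* P :* (t :* ρ) :- X) :+ (Π :* A :* P :- Y) :* ρ) := Π :* (A :+ t) :* (P :* ρ)) refl

    -- A new factor costs at most `Π * A n * P n * (τ * ρ)` of real part, and ½ (A + τ)² exceeds ½
    -- A² by A τ and more. The loss is quadratic in the total argument, as for a cosine.
    re≥ : ∀ n → ∏ (1+τ² τ) n ≤ Π * Π → P n * (1ℚ - ½ * Π * (A n * A n)) ≤ re (cprod N n)
    re≥ zero h = ≤-reflexive (e Π)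
      where e = ring 1 (λ p → con 1ℚ :* (con 1ℚ :- con ½ :* p :* (con 0ℚ :* con 0ℚ)) := con 1ℚ) refl
    re≥ (suc n) h = ≤by (diff (re≥ n h′) ⊠ ρ≥0 (suc n) ⊹ diff prod ⊹ Π≥0 ⊠ lit ½ ⊠ sq≥0 (τ (suc n)) ⊠ P≥0 (suc n))
         (e (re c) (im c * μ) Π (A n) (P n) (τ (suc n)) ρ)
      where c = cprod N n
            ρ = re (N (suc n))
            μ = im (N (suc n))
            h′ = ≤-trans (T-mono n) h
            prod : im c * μ ≤ Π * A n * P n * (τ (suc n) * ρ)
            prod = ≤-trans (≤∣∣ (im c * μ)) (subst (_≤ Π * A n * P n * (τ (suc n) * ρ)) (sym (∣p*q∣≡∣p∣*∣q∣ (im c) μ)) (*-mono (0≤∣p∣ (im c)) (∣im∣≤ n h′) (0≤∣p∣ μ) (sec (suc n))))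
            e = ring 7 (λ R I Π A P t ρ → P :* ρ :* (con 1ℚ :- con ½ :* Π :* ((A :+ t) :* (A :+ t))) :+ ((R :- P :* (con 1ℚ :- con ½ :* Π :* (A :* A))) :* ρ :+ (Π :* A :* P :* (t :* ρ) :- I) :+ Π :* con ½ :* (t :* t) :* (P :* ρ)) := R :* ρ :- I) refl

  ⊗-identityˡ : ∀ x → real 1ℚ ⊗ x ≡ x
  ⊗-identityˡ (a ⊕i b) = cong₂ _⊕i_ (e a b) (e′ a b)
    where e = ring 2 (λ a b → con 1ℚ :* a :- con 0ℚ :* b := a) refl
          e′ = ring 2 (λ a b → con 1ℚ :* b :+ con 0ℚ :* a := b) refl

  ⊗-monoid : CommutativeMonoid 0ℓ 0ℓ
  ⊗-monoid = record
    { Carrier = ℂ ; _≈_ = _≡_ ; _∙_ = _⊗_ ; ε = real 1ℚ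
    ; isCommutativeMonoid = record
      { isMonoid = record
        { isSemigroup = record
          { isMagma = record { isEquivalence = isEquivalence ; ∙-cong = cong₂ _⊗_ }
          ; assoc = ⊗-assoc }
        ; identity = ⊗-identityˡ , λ x → trans (⊗-comm x (real 1ℚ)) (⊗-identityˡ x) }
      ; comm = ⊗-comm } }

  real-* : ∀ a b → real (a * b) ≡ real a ⊗ real b
  real-* a b = cong₂ _⊕i_ (e a b) (e′ a b)
    where e = ring 2 (λ a b → a :* b := a :* b :- con 0ℚ :* con 0ℚ) refl
          e′ = ring 2 (λ a b → con 0ℚ := a :* con 0ℚ :+ con 0ℚ :* b) refl

  regroup : ∀ Z h a G d H H′ ζ → ((Z ⊗ h) ⊗ (a ⊗ G)) ⊗ (((d ⊗ H) ⊗ H′) ⊗ ζ) ≡ ((Z ⊗ ζ) ⊗ (h ⊗ (H ⊗ G))) ⊗ ((a ⊗ d) ⊗ H′)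
  regroup = CMS.solve 8 (λ Z h a G d H H′ ζ → (((Z CMS.⊕ h) CMS.⊕ (a CMS.⊕ G)) CMS.⊕ (((d CMS.⊕ H) CMS.⊕ H′) CMS.⊕ ζ)) CMS.⊜ (((Z CMS.⊕ ζ) CMS.⊕ (h CMS.⊕ (H CMS.⊕ G))) CMS.⊕ ((a CMS.⊕ d) CMS.⊕ H′))) refl
    where module CMS = CMSolver ⊗-monoid

  -- The tilted model and its carries

  -- The parts k = 1, 2, … chosen independently with odds r^k : 1.
  module Tilt (r : ℚ) (r>0 : 0ℚ < r) (r≤1 : r ≤ 1ℚ) where

    z : ℕ → ℚ
    z k = r ^ k

    z>0 : ∀ k → 0ℚ < z k
    z>0 k = ^>0 k r>0

    z≥0 : ∀ k → 0ℚ ≤ z k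
    z≥0 k = <⇒≤ (z>0 k)

    z≤1 : ∀ k → z k ≤ 1ℚ
    z≤1 k = ^≤1 k (<⇒≤ r>0) r≤1

    i : ℕ → ℚ
    i k = inv (1ℚ + z k)

    1+z>0 : ∀ k → 0ℚ < 1ℚ + z k
    1+z>0 k = 0<+ (lit< 0ℚ 1ℚ) (z≥0 k)

    i-def : ∀ k → (1ℚ + z k) * i k ≡ 1ℚ
    i-def k = inv-* (1+z>0 k)

    i≥0 : ∀ k → 0ℚ ≤ i k
    i≥0 k = inv≥0 (1+z>0 k)

    v : ℕ → ℚ
    v k = z k * i k

    1-v : ∀ k → 1ℚ - v k ≡ i k
    1-v k = trans (cong (_- v k) (sym (i-def k))) (e (z k) (i k))
      where e = ring 2 (λ z i → (con 1ℚ :+ z) :* i :- z :* i := i) refl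

    v≥0 : ∀ k → 0ℚ ≤ v k
    v≥0 k = z≥0 k ⊠ i≥0 k

    v≤1 : ∀ k → v k ≤ 1ℚ
    v≤1 k = undiff (subst (0ℚ ≤_) (sym (1-v k)) (i≥0 k))

    i≤1 : ∀ k → i k ≤ 1ℚ
    i≤1 k = ≤by (v≥0 k) (trans (e (z k) (i k)) (i-def k))
      where e = ring 2 (λ z i → i :+ z :* i := (con 1ℚ :+ z) :* i) refl

    v≤z : ∀ k → v k ≤ z k
    v≤z k = ≤by (z≥0 k ⊠ diff (i≤1 k)) (e (z k) (i k))
      where e = ring 2 (λ z i → z :* i :+ z :* (con 1ℚ :- i) := z) refl

    z≤2v : ∀ k → z k ≤ # 2 * v k
    z≤2v k = ≤by (z≥0 k ⊠ (i≥0 k ⊠ diff (z≤1 k))) (trans (e (z k) (i k)) (trans (cong (λ t → z k + z k * (# 2 * i k - t)) (i-def k)) (e′ (z k) (i k))))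
      where e = ring 2 (λ z i → z :+ z :* (i :* (con 1ℚ :- z)) := z :+ z :* (:# 2 :* i :- (con 1ℚ :+ z) :* i)) refl
            e′ = ring 2 (λ z i → z :+ z :* (:# 2 :* i :- con 1ℚ) := :# 2 :* (z :* i)) refl

    -- The variance of the indicator of part k.
    ω : ℕ → ℚ
    ω k = v k * (1ℚ - v k)

    ω-def : ∀ k → ω k ≡ z k * (i k * i k)
    ω-def k = trans (cong (v k *_) (1-v k)) (*-assoc (z k) (i k) (i k))

    ω≥0 : ∀ k → 0ℚ ≤ ω k
    ω≥0 k = v≥0 k ⊠ diff (v≤1 k)

    -- The exact variance is z / (1 + z)². It is bounded by quadratics because z and z² are both
    -- geometric in `k`, so that their weighted sums have closed forms. Equality holds at z = 1.
    ω≤ : ∀ k → ω k ≤ z k - 3 ÷′ 4 * (z k * z k)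
    ω≤ k = subst (_≤ z k - 3 ÷′ 4 * (z k * z k)) (sym (ω-def k)) 
      (≤by (z≥0 k ⊠ (i≥0 k ⊠ i≥0 k) ⊠ (z≥0 k ⊠ (diff (z≤1 k) ⊠ (lit (5 ÷′ 4) ⊹ lit (3 ÷′ 4) ⊠ z≥0 k))))
      (trans (e (z k) (i k)) (trans (cong (λ t → (z k - 3 ÷′ 4 * (z k * z k)) * (t * t)) (i-def k)) (*-identityʳ (z k - 3 ÷′ 4 * (z k * z k))))))
      where e = ring 2 (λ z i → z :* (i :* i) :+ z :* (i :* i) :* (z :* ((con 1ℚ :- z) :* (5 :/ 4 :+ 3 :/ 4 :* z))) := (z :- 3 :/ 4 :* (z :* z)) :* ((con 1ℚ :+ z) :* i :* ((con 1ℚ :+ z) :* i))) refl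

    -- The maximum of (8/9 - z)(1 + z)² is just below 1, at z = 7/27; the certificate is expanded
    -- around 13/50.
    ≤ω : ∀ k → 8 ÷′ 9 * z k - z k * z k ≤ ω k
    ≤ω k = subst (8 ÷′ 9 * z k - z k * z k ≤_) (sym (ω-def k)) 
      (≤by (z≥0 k ⊠ (i≥0 k ⊠ i≥0 k) ⊠ (lit (1 ÷′ 9) ⊠ (sq≥0 (z k - 13 ÷′ 50) ⊠ (lit (# 9) ⊠ z≥0 k ⊹ lit (367 ÷′ 25)) ⊹ lit (63 ÷′ 2500) ⊠ z≥0 k ⊹ lit (477 ÷′ 62500))))
      (trans (cong (λ t → t + d) (sym (*-identityʳ (8 ÷′ 9 * z k - z k * z k))))
        (trans (cong (λ t → (8 ÷′ 9 * z k - z k * z k) * (t * t) + d) (sym (i-def k))) (e (z k) (i k)))))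
      where d = z k * (i k * i k) * (1 ÷′ 9 * ((z k - 13 ÷′ 50) * (z k - 13 ÷′ 50) * (# 9 * z k + 367 ÷′ 25) + 63 ÷′ 2500 * z k + 477 ÷′ 62500))
            e = ring 2 (λ z i → (8 :/ 9 :* z :- z :* z) :* ((con 1ℚ :+ z) :* i :* ((con 1ℚ :+ z) :* i)) :+ z :* (i :* i) :* (1 :/ 9 :* ((z :- 13 :/ 50) :* (z :- 13 :/ 50) :* (:# 9 :* z :+ 367 :/ 25) :+ 63 :/ 2500 :* z :+ 477 :/ 62500)) := z :* (i :* i)) refl

    ω≤z : ∀ k → ω k ≤ z k
    ω≤z k = ≤-trans (ω≤ k) (≤by (lit (3 ÷′ 4) ⊠ (z≥0 k ⊠ z≥0 k)) (e (z k)))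
      where e = ring 1 (λ z → z :- 3 :/ 4 :* (z :* z) :+ 3 :/ 4 :* (z :* z) := z) refl

  ∑-shift : ∀ f n → ∑ f (suc n) ≡ f 1 + ∑ (λ k → f (suc k)) n
  ∑-shift f zero = +-comm 0ℚ (f 1)
  ∑-shift f (suc n) = trans (cong (_+ f (suc (suc n))) (∑-shift f n)) (+-assoc (f 1) (∑ (λ k → f (suc k)) n) (f (suc (suc n))))

  v[1-v]≤¼ : ∀ v → v * (1ℚ - v) ≤ 1 ÷′ 4
  v[1-v]≤¼ v = ≤by (sq≥0 (v - ½)) (e v)
    where e = ring 1 (λ v → v :* (con 1ℚ :- v) :+ (v :- con ½) :* (v :- con ½) := 1 :/ 4) refl

  ∣ι∣≤ : ∀ {y B} → ιℤ y ≤ B → - ιℤ y ≤ B → ι ℤ.∣ y ∣ ≤ B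
  ∣ι∣≤ {y} {B} p q = subst (_≤ B) (∣ιℤ∣ y) (∣∣≤ p q)

  bernoulli : ∀ t n → 0ℚ ≤ t → t ≤ 1ℚ → (1ℚ - t) ^ n * (1ℚ + ι n * t) ≤ 1ℚ
  bernoulli t zero p q = ≤-reflexive (e t)
    where e = ring 1 (λ t → con 1ℚ :* (con 1ℚ :+ con 0ℚ :* t) := con 1ℚ) refl
  bernoulli t (suc n) p q = ≤-trans (≤by (^≥0 n (diff q) ⊠ (lit 1ℚ ⊹ ι≥0 n) ⊠ (p ⊠ p)) (e t (ι n) ((1ℚ - t) ^ n))) (bernoulli t n p q)
    where e = ring 3 (λ t n X → (con 1ℚ :- t) :* X :* (con 1ℚ :+ (con 1ℚ :+ n) :* t) :+ X :* (con 1ℚ :+ n) :* (t :* t) := X :* (con 1ℚ :+ n :* t)) refl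

  -- (1 - t)^l ≤ 1 - y once l t ≥ y / (1 - y).
  pow≤1- : ∀ t l y → 0ℚ ≤ t → t ≤ 1ℚ → y ≤ 1ℚ → (1ℚ - y) * (1ℚ + ι l * t) ≥ 1ℚ → (1ℚ - t) ^ l ≤ 1ℚ - y
  pow≤1- t l y t0 t1 y1 h = ≤by (^≥0 l (diff t1) ⊠ diff h ⊹ diff y1 ⊠ diff (bernoulli t l t0 t1)) (e ((1ℚ - t) ^ l) y (1ℚ + ι l * t))
    where e = ring 3 (λ X y Y → X :+ (X :* ((con 1ℚ :- y) :* Y :- con 1ℚ) :+ (con 1ℚ :- y) :* (con 1ℚ :- X :* Y)) := con 1ℚ :- y) refl

  ceil : ∀ q → 0ℚ ≤ q → ∃ λ n → q ≤ ι n × ι n ≤ q + 1ℚ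
  ceil q q0 = suc (proj₁ p) , <⇒≤ (proj₂ (proj₂ p)) , subst (1ℚ + ι (proj₁ p) ≤_) (+-comm 1ℚ q) (+-monoʳ-≤ 1ℚ (proj₁ (proj₂ p)))
    where p = floor q q0

  nsum : (ℕ → ℕ) → ℕ → ℕ
  nsum l zero = 0
  nsum l (suc n) = nsum l n ℕ.+ l (suc n)

  ι-nsum : ∀ l n → ι (nsum l n) ≡ ∑ (λ k → ι (l k)) n
  ι-nsum l zero = refl
  ι-nsum l (suc n) = trans (ι-+ (nsum l n) (l (suc n))) (cong (_+ ι (l (suc n))) (ι-nsum l n))

  ^-nsum : ∀ c l (f : ℕ → ℚ) n → 0ℚ ≤ c → (∀ k → c ^ l k ≤ f k) → c ^ nsum l n ≤ ∏ f n
  ^-nsum c l f zero c0 h = ≤-refl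
  ^-nsum c l f (suc n) c0 h = subst (_≤ ∏ f n * f (suc n)) (sym (^-+ c (nsum l n) (l (suc n))))
     (*-mono (^≥0 (nsum l n) c0) (^-nsum c l f n c0 h) (^≥0 (l (suc n)) c0) (h (suc n)))

  -- The carries: g + ∑_{i ≤ k} i v_i is split into an integer and a fractional part, so that
  -- each step below is the value at x of an integer law of mean zero.
  module Carry (r : ℚ) (r>0 : 0ℚ < r) (r≤1 : r ≤ 1ℚ) (g : ℚ) (g≥0 : 0ℚ ≤ g) where
    open Tilt r r>0 r≤1

    μ : ℕ → ℚ
    μ = ∑ (λ k → ι k * v k)

    M : ℕ → ℚ
    M k = g + μ k

    M≥0 : ∀ k → 0ℚ ≤ M k
    M≥0 k = g≥0 ⊹ ∑≥0 k (λ k → ι≥0 k ⊠ v≥0 k)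

    n : ℕ → ℕ
    n k = proj₁ (floor (M k) (M≥0 k))

    f : ℕ → ℚ
    f k = M k - ι (n k)

    f≥0 : ∀ k → 0ℚ ≤ f k
    f≥0 k = diff (proj₁ (proj₂ (floor (M k) (M≥0 k))))

    f≤1 : ∀ k → f k ≤ 1ℚ
    f≤1 k = ≤by (diff (<⇒≤ (proj₂ (proj₂ (floor (M k) (M≥0 k)))))) (e (M k) (ι (n k)))
      where e = ring 2 (λ M n → M :- n :+ (con 1ℚ :+ n :- M) := con 1ℚ) refl

    up down : ℤ
    up = ℤ.+ 1
    down = ℤ.-[1+ 0 ]

    jump : ℕ → ℤ
    jump k = (ℤ.- (ℤ.+ n (suc k))) ℤ.+ (ℤ.+ n k)

    -- Each carry `f k` occurs twice: as a coin stepping up in step `k`, and as a coin stepping down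
    -- one step earlier (in `init` for `k = 0`). The two factors are conjugate, so their product
    -- does not turn the phase.
    half : ℕ → Law
    half k = add (f (suc k)) down (add (f k) up (leaf (jump k)))

    step : ℕ → Law
    step k = add (v (suc k)) (ℤ.+ suc k) (half k)

    init : Law
    init = add (f 0) down (leaf (ℤ.- (ℤ.+ n 0)))

    half-valid : ∀ k → Valid (half k)
    half-valid k = valid-add down (f≥0 (suc k)) (f≤1 (suc k)) (valid-add up (f≥0 k) (f≤1 k) (leaf (jump k)))

    step-valid : ∀ k → Valid (step k)
    step-valid k = valid-add (ℤ.+ suc k) (v≥0 (suc k)) (v≤1 (suc k)) (half-valid k)

    init-valid : Valid init
    init-valid = valid-add down (f≥0 0) (f≤1 0) (leaf _)

    ιjump : ∀ k → ιℤ (jump k) ≡ f (suc k) - f k - ι (suc k) * v (suc k)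
    ιjump k = trans (ιℤ-+ (ℤ.- (ℤ.+ n (suc k))) (ℤ.+ n k)) (trans (cong (_+ ι (n k)) (ιℤ-neg (ℤ.+ n (suc k))))
       (e g (μ k) (ι (suc k) * v (suc k)) (ι (n k)) (ι (n (suc k)))))
      where e = ring 5 (λ g m d a b → :- b :+ a := (g :+ (m :+ d) :- b) :- (g :+ m :- a) :- d) refl

    half-mean : ∀ k → mean (half k) ≡ - (ι (suc k) * v (suc k))
    half-mean k = trans (mean-add (f (suc k)) down (add (f k) up (leaf (jump k)))) (trans (cong (_+ f (suc k) * (- (1ℚ + 0ℚ))) (mean-add (f k) up (leaf (jump k))))
       (trans (cong (λ t → t + f k * (1ℚ + 0ℚ) + f (suc k) * (- (1ℚ + 0ℚ))) (ιjump k)) (e (f k) (f (suc k)) (ι (suc k) * v (suc k)))))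
      where e = ring 3 (λ f f′ d → f′ :- f :- d :+ f :* (con 1ℚ :+ con 0ℚ) :+ f′ :* (:- (con 1ℚ :+ con 0ℚ)) := :- d) refl

    step-mean : ∀ k → mean (step k) ≡ 0ℚ
    step-mean k = trans (mean-add (v (suc k)) (ℤ.+ suc k) (half k)) (trans (cong (_+ v (suc k) * ι (suc k)) (half-mean k)) (e (v (suc k)) (ι (suc k))))
      where e = ring 2 (λ v k → :- (k :* v) :+ v :* k := con 0ℚ) refl

    -- Bounds for the second and third absolute moments; index `suc k` belongs to `step k`. The ½ is
    -- the variance of the two carry coins.
    E₂ E₃ : ℕ → ℚ
    E₂ k = ι k * ι k * ω k + ½
    E₃ k = ι k * ι k * ι k * ω k + # 6 * (ι k * ι k * ω k) + # 24 * (ι k * ω k) + # 8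

    E₂≥0 : ∀ k → 0ℚ ≤ E₂ k
    E₂≥0 k = ι≥0 k ⊠ ι≥0 k ⊠ ω≥0 k ⊹ lit ½

    E₃≥0 : ∀ k → 0ℚ ≤ E₃ k
    E₃≥0 k = ι≥0 k ⊠ ι≥0 k ⊠ ι≥0 k ⊠ ω≥0 k ⊹ lit (# 6) ⊠ (ι≥0 k ⊠ ι≥0 k ⊠ ω≥0 k) ⊹ lit (# 24) ⊠ (ι≥0 k ⊠ ω≥0 k) ⊹ lit (# 8)

    -- A step is a constant plus three independent coins and has mean zero, so its second moment is
    -- the sum of three variances.
    step-sq : ∀ k → 𝔼 (step k) sq ≤ E₂ (suc k)
    step-sq k = ≤-trans (≤-reflexive (trans (sq-add v′ (ℤ.+ suc k) (half k)) (trans (cong₂ (λ p q → p + v′ * (# 2 * κ * q + κ * κ))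
         (trans (sq-add f′ down (add f₀ up (leaf (jump k)))) (cong₂ (λ p q → p + f′ * (# 2 * (- (1ℚ + 0ℚ)) * q + (- (1ℚ + 0ℚ)) * (- (1ℚ + 0ℚ))))
            (trans (sq-add f₀ up (leaf (jump k))) (cong (λ t → t * t + f₀ * (# 2 * (1ℚ + 0ℚ) * t + (1ℚ + 0ℚ) * (1ℚ + 0ℚ))) (ιjump k)))
            (trans (mean-add f₀ up (leaf (jump k))) (cong (_+ f₀ * (1ℚ + 0ℚ)) (ιjump k)))))
         (half-mean k)) (e f₀ f′ v′ κ))))
       (+-monoʳ-≤ (κ * κ * ω (suc k)) (+-mono-≤ (v[1-v]≤¼ f₀) (v[1-v]≤¼ f′)))
      where
      f₀ = f k
      f′ = f (suc k)
      v′ = v (suc k)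
      κ = ι (suc k)
      e = ring 4 (λ f f′ v κ → (f′ :- f :- κ :* v) :* (f′ :- f :- κ :* v) :+ f :* (:# 2 :* (con 1ℚ :+ con 0ℚ) :* (f′ :- f :- κ :* v) :+ (con 1ℚ :+ con 0ℚ) :* (con 1ℚ :+ con 0ℚ)) :+ f′ :* (:# 2 :* (:- (con 1ℚ :+ con 0ℚ)) :* (f′ :- f :- κ :* v :+ f :* (con 1ℚ :+ con 0ℚ)) :+ (:- (con 1ℚ :+ con 0ℚ)) :* (:- (con 1ℚ :+ con 0ℚ))) :+ v :* (:# 2 :* κ :* (:- (κ :* v)) :+ κ :* κ) := κ :* κ :* (v :* (con 1ℚ :- v)) :+ (f :* (con 1ℚ :- f) :+ f′ :* (con 1ℚ :- f′))) refl

    -- The support of half k lies within distance 2 of its mean.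
    Near : ℕ → ℤ → Set
    Near k y = (- # 2 ≤ ιℤ y + ι (suc k) * v (suc k)) × (ιℤ y + ι (suc k) * v (suc k) ≤ # 2)

    half-near : ∀ k → All (Near k) (half k)
    half-near k = node (node (leaf (both j 0ℚ (sym (+-identityʳ (ιℤ j))))) (leaf (both (j ℤ.+ up) (1ℚ + 0ℚ) (ιℤ-+ j up))))
        (node (leaf (both (j ℤ.+ down) (- (1ℚ + 0ℚ)) (ιℤ-+ j down)))
          (leaf (both (j ℤ.+ up ℤ.+ down) (1ℚ + 0ℚ + (- (1ℚ + 0ℚ))) eq)))
      where
      j = jump k
      d = ι (suc k) * v (suc k)
      eq : ιℤ (jump k ℤ.+ up ℤ.+ down) ≡ ιℤ (jump k) + (1ℚ + 0ℚ + (- (1ℚ + 0ℚ)))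
      eq = trans (ιℤ-+ (jump k ℤ.+ up) down) (trans (cong (_+ (- (1ℚ + 0ℚ))) (ιℤ-+ (jump k) up)) (+-assoc (ιℤ (jump k)) (1ℚ + 0ℚ) (- (1ℚ + 0ℚ))))
      lo : ∀ y a → ιℤ y ≡ ιℤ (jump k) + a → {True (- 1ℚ ≤? a)} → - # 2 ≤ ιℤ y + d
      lo y a e {t} = ≤by (diff (toWitness t) ⊹ f≥0 (suc k) ⊹ diff (f≤1 k))
        (trans (ring₁ a (f k) (f (suc k)) d) (cong (_+ d) (sym (trans e (cong (_+ a) (ιjump k))))))
        where ring₁ = ring 4 (λ a f f′ d → :- :# 2 :+ (a :- (:- con 1ℚ) :+ f′ :+ (con 1ℚ :- f)) := f′ :- f :- d :+ a :+ d) refl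
      hi : ∀ y a → ιℤ y ≡ ιℤ (jump k) + a → {True (a ≤? 1ℚ)} → ιℤ y + d ≤ # 2
      hi y a e {t} = ≤by (diff (toWitness t) ⊹ f≥0 k ⊹ diff (f≤1 (suc k)))
        (trans (cong (λ s → s + d + (1ℚ - a + f k + (1ℚ - f (suc k)))) (trans e (cong (_+ a) (ιjump k)))) (ring₁ a (f k) (f (suc k)) d))
        where ring₁ = ring 4 (λ a f f′ d → f′ :- f :- d :+ a :+ d :+ (con 1ℚ :- a :+ f :+ (con 1ℚ :- f′)) := :# 2) refl

      both : ∀ y a → ιℤ y ≡ ιℤ (jump k) + a → {True (- 1ℚ ≤? a)} → {True (a ≤? 1ℚ)} → Near k y
      both y a e {t} {t′} = lo y a e {t} , hi y a e {t′}

    -- Exponents l for which (1 - w/4)^l bounds the real parts of the steps from below.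
    module Exponents (J : ℚ) (J≥0 : 0ℚ ≤ J) where

      goal : ℕ → ℚ
      goal zero = 0ℚ
      goal (suc zero) = # 2 * J * ((g + 1ℚ) * (g + 1ℚ))
      goal (suc (suc k)) = # 2 * J * E₂ (suc k)

      goal≥0 : ∀ k → 0ℚ ≤ goal k
      goal≥0 zero = ≤-refl
      goal≥0 (suc zero) = lit (# 2) ⊠ J≥0 ⊠ sq≥0 (g + 1ℚ)
      goal≥0 (suc (suc k)) = lit (# 2) ⊠ J≥0 ⊠ E₂≥0 (suc k)

      l : ℕ → ℕ
      l k = proj₁ (ceil (goal k) (goal≥0 k))

      ≤l : ∀ k → goal k ≤ ι (l k)
      ≤l k = proj₁ (proj₂ (ceil (goal k) (goal≥0 k)))

      l≤ : ∀ k → ι (l k) ≤ goal k + 1ℚ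
      l≤ k = proj₂ (proj₂ (ceil (goal k) (goal≥0 k)))

      total-l : ∀ K → ι (nsum l (suc K)) ≤ # 2 * J * ((g + 1ℚ) * (g + 1ℚ) + ∑ E₂ K) + ι (suc K)
      total-l K = ≤-trans (≤-reflexive (ι-nsum l (suc K))) (≤-trans (∑-mono (suc K) l≤) (≤-reflexive (trans (∑-+ goal (λ _ → 1ℚ) (suc K))
        (cong₂ _+_ (trans (∑-shift goal K) (trans (cong (λ t → goal 1 + t) (trans (same K) (∑-* (# 2 * J) E₂ K))) (sym (*-distribˡ-+ (# 2 * J) ((g + 1ℚ) * (g + 1ℚ)) (∑ E₂ K)))))
          (trans (∑-const 1ℚ (suc K)) (*-identityʳ (ι (suc K))))))))
        where same : ∀ K → ∑ (λ k → goal (suc k)) K ≡ ∑ (λ k → # 2 * J * E₂ k) K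
              same zero = refl
              same (suc K) = cong (_+ # 2 * J * E₂ (suc K)) (same K)

    module At (x : Point) where
      open Point x
      open Characters x

      cube-mono : ∀ y {B} → 0ℚ ≤ B → ι ℤ.∣ y ∣ ≤ B → cube y ≤ B * B * B
      cube-mono y B0 h = *-mono (p ⊠ p) (*-mono p h p h) p h
        where p = ι≥0 ℤ.∣ y ∣

      -- Without the part `suc k` the sum is within `κ * v′ + # 2` of zero, with it within
      -- `κ * (1ℚ - v′) + # 2`. Weighting the two cubes gives `E₃` minus 2 κ³ ω².
      step-cube : ∀ k → 𝔼 (step k) cube ≤ E₃ (suc k)
      step-cube k = ≤-trans (+-mono-≤ (*-monoˡ (diff (v≤1 (suc k))) (𝔼-≤ {g = cube} (half-valid k) (all-map small (half-near k))))
                                      (*-monoˡ (v≥0 (suc k)) (𝔼-≤ {g = cube} (valid-shift (ℤ.+ suc k) (half-valid k)) (all-shift (ℤ.+ suc k) large (half-near k)))))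
          (≤by (lit (# 2) ⊠ (ι≥0 (suc k) ⊠ ι≥0 (suc k) ⊠ ι≥0 (suc k)) ⊠ (ω≥0 (suc k) ⊠ ω≥0 (suc k))) (e v′ κ))
        where
        v′ = v (suc k)
        κ = ι (suc k)
        e = ring 2 (λ v κ → (con 1ℚ :- v) :* ((κ :* v :+ :# 2) :* (κ :* v :+ :# 2) :* (κ :* v :+ :# 2)) :+ v :* ((κ :* (con 1ℚ :- v) :+ :# 2) :* (κ :* (con 1ℚ :- v) :+ :# 2) :* (κ :* (con 1ℚ :- v) :+ :# 2)) :+ :# 2 :* (κ :* κ :* κ) :* ((v :* (con 1ℚ :- v)) :* (v :* (con 1ℚ :- v))) := κ :* κ :* κ :* (v :* (con 1ℚ :- v)) :+ :# 6 :* (κ :* κ :* (v :* (con 1ℚ :- v))) :+ :# 24 :* (κ :* (v :* (con 1ℚ :- v))) :+ :# 8) refl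
        κv≥0 = ι≥0 (suc k) ⊠ v≥0 (suc k)
        κu≥0 = ι≥0 (suc k) ⊠ diff (v≤1 (suc k))
        small : ∀ y → Near k y → cube y ≤ (κ * v′ + # 2) * (κ * v′ + # 2) * (κ * v′ + # 2)
        small y (p , q) = cube-mono y (κv≥0 ⊹ lit (# 2)) (∣ι∣≤ {y} (≤by (diff q ⊹ lit (# 2) ⊠ κv≥0) (e₁ (ιℤ y) (κ * v′))) (≤by (diff p) (e₂ (ιℤ y) (κ * v′))))
          where e₁ = ring 2 (λ y d → y :+ (:# 2 :- (y :+ d) :+ :# 2 :* d) := d :+ :# 2) refl
                e₂ = ring 2 (λ y d → :- y :+ (y :+ d :- (:- :# 2)) := d :+ :# 2) refl
        large : ∀ y → Near k y → cube (y ℤ.+ (ℤ.+ suc k)) ≤ (κ * (1ℚ - v′) + # 2) * (κ * (1ℚ - v′) + # 2) * (κ * (1ℚ - v′) + # 2)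
        large y (p , q) = cube-mono (y ℤ.+ (ℤ.+ suc k)) (κu≥0 ⊹ lit (# 2)) (∣ι∣≤ {y ℤ.+ (ℤ.+ suc k)}
           (≤by (diff q) (trans (cong (_+ (# 2 - (ιℤ y + κ * v′))) (ιℤ-+ y (ℤ.+ suc k))) (e₁ (ιℤ y) κ v′)))
           (≤by (diff p ⊹ lit (# 2) ⊠ κu≥0) (trans (cong (λ t → - t + (ιℤ y + κ * v′ - (- # 2) + # 2 * (κ * (1ℚ - v′)))) (ιℤ-+ y (ℤ.+ suc k))) (e₂ (ιℤ y) κ v′))))
          where e₁ = ring 3 (λ y κ v → y :+ κ :+ (:# 2 :- (y :+ κ :* v)) := κ :* (con 1ℚ :- v) :+ :# 2) refl
                e₂ = ring 3 (λ y κ v → :- (y :+ κ) :+ (y :+ κ :* v :- (:- :# 2) :+ :# 2 :* (κ :* (con 1ℚ :- v))) := κ :* (con 1ℚ :- v) :+ :# 2) refl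

      init-near : All (λ y → ι ℤ.∣ y ∣ ≤ g + 1ℚ) init
      init-near = node (leaf (∣ι∣≤ {ℤ.- (ℤ.+ n 0)} (≤-trans (≤-reflexive eq) (≤-trans (≤by (ι≥0 (n 0)) (e₀ (ι (n 0)))) (g≥0 ⊹ lit 1ℚ)))
                                  (≤-trans (≤-reflexive (cong -_ eq)) (≤by (f≥0 0 ⊹ lit 1ℚ) (e₁ (ι (n 0)) g)))))
                       (leaf (∣ι∣≤ {ℤ.- (ℤ.+ n 0) ℤ.+ down} (≤-trans (≤-reflexive eq′) (≤-trans (≤by (ι≥0 (n 0) ⊹ lit 1ℚ) (e₂ (ι (n 0)))) (g≥0 ⊹ lit 1ℚ)))
                                  (≤-trans (≤-reflexive (cong -_ eq′)) (≤by (f≥0 0) (e₃ (ι (n 0)) g)))))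
        where
        eq : ιℤ (ℤ.- (ℤ.+ n 0)) ≡ - ι (n 0)
        eq = ιℤ-neg (ℤ.+ n 0)
        eq′ : ιℤ (ℤ.- (ℤ.+ n 0) ℤ.+ down) ≡ - ι (n 0) - (1ℚ + 0ℚ)
        eq′ = trans (ιℤ-+ (ℤ.- (ℤ.+ n 0)) down) (cong (_+ (- (1ℚ + 0ℚ))) eq)
        e₀ = ring 1 (λ n → :- n :+ n := con 0ℚ) refl
        e₁ = ring 2 (λ n g → :- (:- n) :+ (g :+ con 0ℚ :- n :+ con 1ℚ) := g :+ con 1ℚ) refl
        e₂ = ring 1 (λ n → :- n :- (con 1ℚ :+ con 0ℚ) :+ (n :+ con 1ℚ) := con 0ℚ) refl
        e₃ = ring 2 (λ n g → :- (:- n :- (con 1ℚ :+ con 0ℚ)) :+ (g :+ con 0ℚ :- n) := g :+ con 1ℚ) refl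

      init-sq : 𝔼 init sq ≤ (g + 1ℚ) * (g + 1ℚ)
      init-sq = 𝔼-≤ {g = sq} init-valid (all-map (λ y p → subst (_≤ (g + 1ℚ) * (g + 1ℚ)) (trans (cong₂ _*_ (sym (∣ιℤ∣ y)) (sym (∣ιℤ∣ y))) (∣∣² (ιℤ y))) (*-mono (ι≥0 ℤ.∣ y ∣) p (ι≥0 ℤ.∣ y ∣) p)) init-near)

  -- Chosen because 26/25 lies below (51/50)², the square of the constant `Π` of `Sector`.
  T≤26/25 : ∀ T S → 0ℚ ≤ T → S ≤ 1 ÷′ 26 → T * (1ℚ - S) ≤ 1ℚ → T ≤ 26 ÷′ 25
  T≤26/25 T S T0 h k = ≤by (lit (26 ÷′ 25) ⊠ (diff k ⊹ T0 ⊠ diff h)) (e T S)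
    where e = ring 2 (λ T S → T :+ 26 :/ 25 :* (con 1ℚ :- T :* (con 1ℚ :- S) :+ T :* (1 :/ 26 :- S)) := 26 :/ 25) refl

  -- The real part of ψ near x = 1

  module Local (r : ℚ) (r>0 : 0ℚ < r) (r≤1 : r ≤ 1ℚ) (g : ℚ) (g≥0 : 0ℚ ≤ g) (x : Point) where
    open Tilt r r>0 r≤1
    open Carry r r>0 r≤1 g g≥0
    open At x
    open Point x
    open Characters x

    H : ℕ → ℂ
    H k = factor (f k) up

    factor-conj : ∀ v → factor v down ≡ conj (factor v up)
    factor-conj v = cong₂ _⊕i_ (cong (λ t → 1ℚ - v + v * t) (cos-neg up)) (trans (cong (v *_) (sin-neg up)) (e v (sin up)))
      where e = ring 2 (λ v s → v :* (:- s) := :- (v :* s)) refl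

    norm²-factor : ∀ v a → norm² (factor v a) ≡ 1ℚ - v * (1ℚ - v) * W a
    norm²-factor v a = trans (e v (cos a) (sin a)) (trans (cong (λ t → (1ℚ - v) * (1ℚ - v) + # 2 * v * (1ℚ - v) * cos a + v * v * t) (pyth a)) (e′ v (cos a)))
      where e = ring 3 (λ v c s → (con 1ℚ :- v :+ v :* c) :* (con 1ℚ :- v :+ v :* c) :+ v :* s :* (v :* s) := (con 1ℚ :- v) :* (con 1ℚ :- v) :+ :# 2 :* v :* (con 1ℚ :- v) :* c :+ v :* v :* (c :* c :+ s :* s)) refl
            e′ = ring 2 (λ v c → (con 1ℚ :- v) :* (con 1ℚ :- v) :+ :# 2 :* v :* (con 1ℚ :- v) :* c :+ v :* v :* con 1ℚ := con 1ℚ :- v :* (con 1ℚ :- v) :* (:# 2 :- :# 2 :* c)) refl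

    pt-+ : ∀ a b → pt (a ℤ.+ b) ≡ pt a ⊗ pt b
    pt-+ a b = cong₂ _⊕i_ (cos-+ a b) (trans (sin-+ a b) (+-comm (sin a * cos b) (cos a * sin b)))

    Z : ℕ → ℂ
    Z = cprod (λ k → factor (v k) (ℤ.+ k))

    h : ℕ → ℚ
    h zero = 1ℚ
    h (suc k) = h k * norm² (H k)

    N : ℕ → ℂ
    N zero = real 1ℚ
    N (suc zero) = char init
    N (suc (suc k)) = char (step k)

    char-init : char init ≡ pt (ℤ.- (ℤ.+ n 0)) ⊗ conj (H 0)
    char-init = trans (char-add (f 0) down (leaf (ℤ.- (ℤ.+ n 0)))) (cong (pt (ℤ.- (ℤ.+ n 0)) ⊗_) (factor-conj (f 0)))

    char-step : ∀ k → char (step k) ≡ ((pt (jump k) ⊗ H k) ⊗ conj (H (suc k))) ⊗ factor (v (suc k)) (ℤ.+ suc k)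
    char-step k = trans (char-add (v (suc k)) (ℤ.+ suc k) (half k)) (cong (_⊗ factor (v (suc k)) (ℤ.+ suc k))
      (trans (char-add (f (suc k)) down (add (f k) up (leaf (jump k)))) (cong₂ _⊗_ (char-add (f k) up (leaf (jump k))) (factor-conj (f (suc k))))))

    -- Carries of neighbouring steps meet as `H k ⊗ conj (H k)`, and the integer jumps add up to
    -- `- n k`. One factor `conj (H k)` stays unpaired; it is 1 once `M k` is an integer.
    telescope : ∀ k → cprod N (suc k) ≡ (Z k ⊗ real (h k)) ⊗ (pt (ℤ.- (ℤ.+ n k)) ⊗ conj (H k))
    telescope zero = trans (⊗-identityˡ (char init)) (trans char-init (sym (trans (cong (_⊗ (pt (ℤ.- (ℤ.+ n 0)) ⊗ conj (H 0))) (⊗-identityˡ (real 1ℚ))) (⊗-identityˡ _))))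
    telescope (suc k) = trans (cong₂ _⊗_ (telescope k) (char-step k)) (trans (regroup (Z k) (real (h k)) (pt (ℤ.- (ℤ.+ n k))) (conj (H k)) (pt (jump k)) (H k) (conj (H (suc k))) (factor (v (suc k)) (ℤ.+ suc k)))
      (cong₂ (λ p q → ((Z k ⊗ factor (v (suc k)) (ℤ.+ suc k)) ⊗ p) ⊗ (q ⊗ conj (H (suc k))))
        (trans (cong (real (h k) ⊗_) (⊗-conj (H k))) (sym (real-* (h k) (norm² (H k)))))
        (trans (sym (pt-+ (ℤ.- (ℤ.+ n k)) (jump k))) (cong pt (ie (n k) (n (suc k)))))))
      where
      ie : ∀ a b → (ℤ.- (ℤ.+ a)) ℤ.+ ((ℤ.- (ℤ.+ b)) ℤ.+ (ℤ.+ a)) ≡ ℤ.- (ℤ.+ b)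
      ie a b = trans (cong (λ t → (ℤ.- (ℤ.+ a)) ℤ.+ t) (ℤ.+-comm (ℤ.- (ℤ.+ b)) (ℤ.+ a))) (trans (sym (ℤ.+-assoc (ℤ.- (ℤ.+ a)) (ℤ.+ a) (ℤ.- (ℤ.+ b))))
         (trans (cong (ℤ._+ (ℤ.- (ℤ.+ b))) (ℤ.+-inverseˡ (ℤ.+ a))) (ℤ.+-identityˡ (ℤ.- (ℤ.+ b)))))

    c : ℚ
    c = 1ℚ - 1 ÷′ 4 * w

    c≥0 : 0ℚ ≤ c
    c≥0 = subst (0ℚ ≤_) (e w) (lit (1 ÷′ 4) ⊠ diff (W≤4 up))
      where e = ring 1 (λ w → 1 :/ 4 :* (:# 4 :- w) := con 1ℚ :- 1 :/ 4 :* w) refl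

    c≤1 : c ≤ 1ℚ
    c≤1 = ≤by (lit (1 ÷′ 4) ⊠ W≥0 up) (e w)
      where e = ring 1 (λ w → con 1ℚ :- 1 :/ 4 :* w :+ 1 :/ 4 :* w := con 1ℚ) refl

    -- `η` bounds the loss of real part in each single factor, so every real part is at least 1 - η
    -- = 1/J.
    module Small (η : ℚ) (η<1 : η < 1ℚ) (w<4 : w < # 4) (J : ℚ) (J-def : J * (1ℚ - η) ≡ 1ℚ) (J≥0 : 0ℚ ≤ J)
      (small-step : ∀ k → ½ * w * E₂ k ≤ η) (small-init : ½ * w * ((g + 1ℚ) * (g + 1ℚ)) ≤ η) where

      h-bounds : ∀ k → 0ℚ < h k × h k ≤ 1ℚ
      h-bounds zero = lit< _ _ , ≤-refl
      h-bounds (suc k) = 0<* (proj₁ (h-bounds k)) norm>0 ,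
          ≤-trans (*-mono (<⇒≤ (proj₁ (h-bounds k))) (proj₂ (h-bounds k)) (<⇒≤ norm>0) norm≤1) (≤-reflexive (*-identityˡ 1ℚ))
        where
        norm>0 : 0ℚ < norm² (H k)
        -- The squared modulus is 1 - w/4 plus (f - ½)² w, so `w < # 4` makes it positive.
        norm>0 = subst (0ℚ <_) (trans (e (f k) w) (sym (norm²-factor (f k) up))) (0<+ (0<* (lit< 0ℚ (1 ÷′ 4)) (diff< w<4)) (sq≥0 (f k - ½) ⊠ W≥0 up))
          where e = ring 2 (λ f w → 1 :/ 4 :* (:# 4 :- w) :+ (f :- con ½) :* (f :- con ½) :* w := con 1ℚ :- f :* (con 1ℚ :- f) :* w) refl
        norm≤1 : norm² (H k) ≤ 1ℚ
        norm≤1 = ≤by (f≥0 k ⊠ diff (f≤1 k) ⊠ W≥0 up) (trans (cong (_+ f k * (1ℚ - f k) * w) (norm²-factor (f k) up)) (e (f k * (1ℚ - f k) * w)))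
          where e = ring 1 (λ a → con 1ℚ :- a :+ a := con 1ℚ) refl

      ½w≥0 = lit ½ ⊠ W≥0 up

      re-step : ∀ k → 1ℚ - ½ * w * E₂ (suc k) ≤ re (char (step k))
      re-step k = ≤-trans (≤by (½w≥0 ⊠ diff (step-sq k)) (e (½ * w) (E₂ (suc k)) (𝔼 (step k) sq))) (re-char (step-valid k))
        where e = ring 3 (λ a E e → con 1ℚ :- a :* E :+ a :* (E :- e) := con 1ℚ :- a :* e) refl

      re-init : 1ℚ - ½ * w * ((g + 1ℚ) * (g + 1ℚ)) ≤ re (char init)
      re-init = ≤-trans (≤by (½w≥0 ⊠ diff init-sq) (e (½ * w) ((g + 1ℚ) * (g + 1ℚ)) (𝔼 init sq))) (re-char init-valid)
        where e = ring 3 (λ a E e → con 1ℚ :- a :* E :+ a :* (E :- e) := con 1ℚ :- a :* e) refl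

      1-η≤ : ∀ {a b} → a ≤ η → 1ℚ - a ≤ b → 1ℚ - η ≤ b
      1-η≤ p q = ≤-trans (+-monoʳ-≤ 1ℚ (neg-antimono-≤ p)) q

      ρ≥ : ∀ k → 1ℚ - η ≤ re (N k)
      ρ≥ zero = 1-η≤ (≤-trans (½w≥0 ⊠ (sq≥0 (g + 1ℚ))) small-init) (lit≤ _ _)
      ρ≥ (suc zero) = 1-η≤ small-init re-init
      ρ≥ (suc (suc k)) = 1-η≤ (small-step (suc k)) (re-step k)

      ρ≥0 : ∀ k → 0ℚ ≤ re (N k)
      ρ≥0 k = ≤-trans (<⇒≤ (diff< η<1)) (ρ≥ k)

      τ : ℕ → ℚ
      τ zero = 0ℚ
      τ (suc zero) = J * ((g + 1ℚ) * σ)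
      τ (suc (suc k)) = J * (1 ÷′ 6 * (w * σ * E₃ (suc k)))

      τ≥0 : ∀ k → 0ℚ ≤ τ k
      τ≥0 zero = ≤-refl
      τ≥0 (suc zero) = J≥0 ⊠ ((g≥0 ⊹ lit 1ℚ) ⊠ σ≥0)
      τ≥0 (suc (suc k)) = J≥0 ⊠ (lit (1 ÷′ 6) ⊠ (W≥0 up ⊠ σ≥0 ⊠ E₃≥0 (suc k)))

      sector : ∀ {a b ρ} → a ≤ b → 0ℚ ≤ b → 1ℚ - η ≤ ρ → a ≤ J * b * ρ
      sector {a} {b} {ρ} p q s = ≤-trans p (≤by (J≥0 ⊠ q ⊠ diff s) (trans (e J b η ρ) (trans (cong (λ t → J * b * ρ + b * (1ℚ - t)) J-def) (e′ (J * b * ρ) b))))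
        where e = ring 4 (λ J b η ρ → b :+ J :* b :* (ρ :- (con 1ℚ :- η)) := J :* b :* ρ :+ b :* (con 1ℚ :- J :* (con 1ℚ :- η))) refl
              e′ = ring 2 (λ a b → a :+ b :* (con 1ℚ :- con 1ℚ) := a) refl

      sec : ∀ k → ∣ im (N k) ∣ ≤ τ k * re (N k)
      sec zero = lit≤ _ _
      sec (suc zero) = sector (im-char₁ init-valid init-near) ((g≥0 ⊹ lit 1ℚ) ⊠ σ≥0) (ρ≥ 1)
      sec (suc (suc k)) = sector bound (lit (1 ÷′ 6) ⊠ (W≥0 up ⊠ σ≥0 ⊠ E₃≥0 (suc k))) (ρ≥ (suc (suc k)))
        where
        bound : ∣ im (char (step k)) ∣ ≤ 1 ÷′ 6 * (w * σ * E₃ (suc k))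
        bound = subst (_≤ 1 ÷′ 6 * (w * σ * E₃ (suc k))) (e ∣ im (char (step k)) ∣)
          (*-monoˡ (lit (1 ÷′ 6)) (≤-trans (im-char (step-valid k) (step-mean k)) (*-monoˡ (W≥0 up ⊠ σ≥0) (step-cube k))))
          where e = ring 1 (λ a → 1 :/ 6 :* (:# 6 :* a) := a) refl

      open Sector N τ τ≥0 ρ≥0 sec (51 ÷′ 50) (lit _) public

      A-sum : ∀ k → A (suc k) ≡ σ * (J * (1 ÷′ 6 * ∑ E₃ k) * w + J * (g + 1ℚ))
      A-sum k = trans (∑-shift τ k) (trans (cong (λ t → J * ((g + 1ℚ) * σ) + t) (trans (lem k) (∑-* (J * (1 ÷′ 6 * (w * σ))) E₃ k))) (e J g σ w (∑ E₃ k)))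
        where
        lem : ∀ k → ∑ (λ j → τ (suc j)) k ≡ ∑ (λ j → J * (1 ÷′ 6 * (w * σ)) * E₃ j) k
        lem zero = refl
        lem (suc k) = cong₂ _+_ (lem k) (e₀ J (w * σ) (E₃ (suc k)))
          where e₀ = ring 3 (λ J a E → J :* (1 :/ 6 :* (a :* E)) := J :* (1 :/ 6 :* a) :* E) refl
        e = ring 5 (λ J g σ w E → J :* ((g :+ con 1ℚ) :* σ) :+ J :* (1 :/ 6 :* (w :* σ)) :* E := σ :* (J :* (1 :/ 6 :* E) :* w :+ J :* (g :+ con 1ℚ))) refl

      open Exponents J J≥0 public

      c^l≤ : ∀ l E → ½ * w * E ≤ η → # 2 * J * E ≤ ι l → 0ℚ ≤ E → c ^ l ≤ 1ℚ - ½ * w * E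
      c^l≤ l E p q E0 = pow≤1- (1 ÷′ 4 * w) l (½ * w * E) (lit (1 ÷′ 4) ⊠ W≥0 up) 
          (undiff c≥0) (≤-trans p (<⇒≤ η<1))
          (≤by (diff (≤-trans p (<⇒≤ η<1)) ⊠ (lit (1 ÷′ 4) ⊠ W≥0 up) ⊠ diff q ⊹ lit (1 ÷′ 4) ⊠ W≥0 up ⊠ (lit (# 2) ⊠ J≥0 ⊠ E0) ⊠ diff p)
            (trans (e w E (ι l) J η) (trans (cong (λ t → (1ℚ - ½ * w * E) * (1ℚ + ι l * (1 ÷′ 4 * w)) + ½ * w * E * (1ℚ - t)) J-def) (e′ w E (ι l)))))
        where e = ring 5 (λ w E l J η → con 1ℚ :+ ((con 1ℚ :- con ½ :* w :* E) :* (1 :/ 4 :* w) :* (l :- :# 2 :* J :* E) :+ 1 :/ 4 :* w :* (:# 2 :* J :* E) :* (η :- con ½ :* w :* E)) := (con 1ℚ :- con ½ :* w :* E) :* (con 1ℚ :+ l :* (1 :/ 4 :* w)) :+ con ½ :* w :* E :* (con 1ℚ :- J :* (con 1ℚ :- η))) refl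
              e′ = ring 3 (λ w E l → (con 1ℚ :- con ½ :* w :* E) :* (con 1ℚ :+ l :* (1 :/ 4 :* w)) :+ con ½ :* w :* E :* (con 1ℚ :- con 1ℚ) := (con 1ℚ :- con ½ :* w :* E) :* (con 1ℚ :+ l :* (1 :/ 4 :* w))) refl

      c^l≤ρ : ∀ k → c ^ l k ≤ re (N k)
      c^l≤ρ zero = ^≤1 (l 0) c≥0 c≤1
      c^l≤ρ (suc zero) = ≤-trans (c^l≤ (l 1) ((g + 1ℚ) * (g + 1ℚ)) small-init (≤l 1) (sq≥0 (g + 1ℚ))) re-init
      c^l≤ρ (suc (suc k)) = ≤-trans (c^l≤ (l (suc (suc k))) (E₂ (suc k)) (small-step (suc k)) (≤l (suc (suc k))) (E₂≥0 (suc k))) (re-step k)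

      ∑τ²≤ : ∀ {m} n → (∀ k → τ k ≤ m) → ∑ (λ k → τ k * τ k) n ≤ m * A n
      ∑τ²≤ {m} n b = ≤-trans (∑-mono n (λ k → *-monoʳ (τ≥0 k) (b k))) (≤-reflexive (∑-* m τ n))

      ψ : ℕ → ℕ → ℂ
      ψ K n₀ = Z K ⊗ pt (ℤ.- (ℤ.+ n₀))

      module Centre (K n₀ : ℕ) (centre : M K ≡ ι n₀) where

        n-eq : n K ≡ n₀
        n-eq = ℕ.≤-antisym (ι≤⇒≤ (≤-<-trans (subst (ι (n K) ≤_) centre (≤by (f≥0 K) (e (ι (n K)) (M K)))) (<by (lit< 0ℚ 1ℚ) (+-comm (ι n₀) 1ℚ))))
                           (ι≤⇒≤ (subst (_< 1ℚ + ι (n K)) centre (proj₂ (proj₂ (floor (M K) (M≥0 K))))))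
          where e = ring 2 (λ n M → n :+ (M :- n) := M) refl

        f-eq : f K ≡ 0ℚ
        f-eq = trans (cong₂ _-_ centre (cong ι n-eq)) (+-inverseʳ (ι n₀))

        H-eq : conj (H K) ≡ real 1ℚ
        H-eq = trans (cong (λ t → conj (factor t up)) f-eq) (cong₂ _⊕i_ (e (cos up)) (e′ (sin up)))
          where e = ring 1 (λ c → con 1ℚ :- con 0ℚ :+ con 0ℚ :* c := con 1ℚ) refl
                e′ = ring 1 (λ c → :- (con 0ℚ :* c) := con 0ℚ) refl

        total : cprod N (suc K) ≡ ψ K n₀ ⊗ real (h K)
        total = trans (telescope K) (trans (cong₂ (λ m q → (Z K ⊗ real (h K)) ⊗ (pt (ℤ.- (ℤ.+ m)) ⊗ q)) n-eq H-eq)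
           (trans (cong ((Z K ⊗ real (h K)) ⊗_) (trans (⊗-comm P₀ (real 1ℚ)) (⊗-identityˡ P₀)))
             (trans (⊗-assoc (Z K) (real (h K)) P₀) (trans (cong (Z K ⊗_) (⊗-comm (real (h K)) P₀)) (sym (⊗-assoc (Z K) P₀ (real (h K))))))))
          where P₀ = pt (ℤ.- (ℤ.+ n₀))

        re-real : ∀ y a → re (y ⊗ real a) ≡ a * re y
        re-real (p ⊕i q) a = e p q a
          where e = ring 3 (λ p q a → p :* a :- q :* con 0ℚ := a :* p) refl

        norm²-real : ∀ y a → norm² (y ⊗ real a) ≡ norm² y * (a * a)
        norm²-real y a = trans (norm²-⊗ y (real a)) (cong (norm² y *_) (e a))
          where e = ring 1 (λ a → a :* a :+ con 0ℚ :* con 0ℚ := a :* a) refl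

        -- The product `p` of the real parts enters twice: bounded below by the power of `c` in the
        -- main term, and above by the modulus, hence by `X`, in the phase term. Dividing by
        -- `h K ≤ 1` only enlarges the main term.
        near : ∀ {m X} → (∀ k → τ k ≤ m) → m * A (suc K) ≤ 1 ÷′ 26 → 0ℚ ≤ X → norm² (ψ K n₀) ≤ X * X →
               c ^ nsum l (suc K) - 51 ÷′ 100 * (A (suc K) * A (suc K)) * X ≤ re (ψ K n₀)
        near {m} {X} τ≤ mA X0 hX = *-cancel h>0 (≤by (diff (^-nsum c l (λ k → re (N k)) (suc K) c≥0 c^l≤ρ)
               ⊹ ^≥0 (nsum l (suc K)) c≥0 ⊠ diff (proj₂ (h-bounds K))
               ⊹ lit (51 ÷′ 100) ⊠ (A≥0 (suc K) ⊠ A≥0 (suc K)) ⊠ diff P≤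
               ⊹ diff lower) (e hK (c ^ nsum l (suc K)) (A (suc K)) X p (re (ψ K n₀))))
          where
          hK = h K
          h>0 = proj₁ (h-bounds K)
          p = P (suc K)
          e = ring 6 (λ h C A X p R → h :* (C :- 51 :/ 100 :* (A :* A) :* X) :+ (p :- C :+ C :* (con 1ℚ :- h) :+ 51 :/ 100 :* (A :* A) :* (X :* h :- p) :+ (h :* R :- p :* (con 1ℚ :- con ½ :* (51 :/ 50) :* (A :* A)))) := h :* R) refl
          T = ∏ (1+τ² τ) (suc K)
          T≤ : T ≤ 51 ÷′ 50 * (51 ÷′ 50)
          T≤ = ≤-trans (T≤26/25 T (∑ (λ k → τ k * τ k) (suc K)) (∏≥0 (suc K) (λ k → lit 1ℚ ⊹ sq≥0 (τ k))) (≤-trans (∑τ²≤ (suc K) τ≤) mA) (∏1+≤ τ (suc K))) (lit≤ _ _)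
          P≤ : p ≤ X * hK
          P≤ = sqrt≤ (X0 ⊠ <⇒≤ h>0) (≤-trans (P²≤norm² (suc K)) (subst (_≤ X * hK * (X * hK)) (sym (trans (cong norm² total) (norm²-real (ψ K n₀) hK)))
             (≤-trans (*-monoʳ (sq≥0 hK) hX) (≤-reflexive (e₂ X hK)))))
            where e₂ = ring 2 (λ X h → X :* X :* (h :* h) := X :* h :* (X :* h)) refl
          lower : p * (1ℚ - ½ * (51 ÷′ 50) * (A (suc K) * A (suc K))) ≤ hK * re (ψ K n₀)
          lower = subst (p * (1ℚ - ½ * (51 ÷′ 50) * (A (suc K) * A (suc K))) ≤_) (trans (cong re total) (re-real (ψ K n₀) hK)) (re≥ (suc K) T≤)

  private
    bern : ∀ δ n → 0ℚ ≤ δ → δ ≤ 1ℚ → 1ℚ - ι n * δ ≤ (1ℚ - δ) ^ n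
    bern δ zero p q = ≤-reflexive (e δ)
      where e = ring 1 (λ δ → con 1ℚ :- con 0ℚ :* δ := con 1ℚ) refl
    bern δ (suc n) p q = ≤by (diff q ⊠ diff (bern δ n p q) ⊹ ι≥0 n ⊠ (p ⊠ p)) (e δ (ι n) ((1ℚ - δ) ^ n))
      where e = ring 3 (λ δ n X → con 1ℚ :- (con 1ℚ :+ n) :* δ :+ ((con 1ℚ :- δ) :* (X :- (con 1ℚ :- n :* δ)) :+ n :* (δ :* δ)) := (con 1ℚ :- δ) :* X) refl

  -- Splitting off a factor 1 - y ≤ (1 - δ)^⌊y/δ⌋ loses at most δ from the sum of the y's.
  ∏≤pow : ∀ (y : ℕ → ℚ) δ K n → (∀ k → 0ℚ ≤ y k) → (∀ k → y k ≤ 1ℚ) → 0ℚ ≤ δ → δ ≤ 1ℚ →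
          (ι n + ι K) * δ ≤ ∑ y K → ∏ (λ k → 1ℚ - y k) K ≤ (1ℚ - δ) ^ n
  ∏≤pow y δ zero n y0 y1 d0 d1 h = ≤-trans (≤by (diff h) (e (ι n) δ)) (bern δ n d0 d1)
    where e = ring 2 (λ n δ → con 1ℚ :+ (con 0ℚ :- (n :+ con 0ℚ) :* δ) := con 1ℚ :- n :* δ) refl
  ∏≤pow y δ (suc K) n y0 y1 d0 d1 h = go n 0 (ℕ.+-identityʳ n) (subst (_≤ y (suc K)) (sym (*-zeroˡ δ)) (y0 (suc K)))
    where
    Y = y (suc K)
    u≥0 = diff (y1 (suc K))
    -- invariant: n = rest + l and l δ ≤ Y
    go : ∀ rest l → rest ℕ.+ l ≡ n → ι l * δ ≤ Y → ∏ (λ k → 1ℚ - y k) K * (1ℚ - Y) ≤ (1ℚ - δ) ^ n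
    go zero l refl p = ≤-trans (≤-trans (*-monoʳ u≥0 (∏≤1 K)) (≤by (diff p) (e₀ Y (ι l * δ)))) (bern δ l d0 d1)
      where
      ∏≤1 : ∀ K → ∏ (λ k → 1ℚ - y k) K ≤ 1ℚ
      ∏≤1 zero = ≤-refl
      ∏≤1 (suc K) = ≤-trans (*-mono (∏≥0 K (λ k → diff (y1 k))) (∏≤1 K) (diff (y1 (suc K))) (≤by (y0 (suc K)) (e₁ (y (suc K))))) (≤-reflexive (*-identityˡ 1ℚ))
        where e₁ = ring 1 (λ y → con 1ℚ :- y :+ y := con 1ℚ) refl
      e₀ = ring 2 (λ Y a → con 1ℚ :* (con 1ℚ :- Y) :+ (Y :- a) := con 1ℚ :- a) refl
    go (suc rest) l eq p with (1ℚ + ι l) * δ ≤? Y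
    ... | yes q = go rest (suc l) (trans (ℕ.+-suc rest l) eq) q
    ... | no ¬q = subst (λ m → ∏ (λ k → 1ℚ - y k) K * (1ℚ - Y) ≤ (1ℚ - δ) ^ m) eq
          (subst (∏ (λ k → 1ℚ - y k) K * (1ℚ - Y) ≤_) (sym (^-+ (1ℚ - δ) (suc rest) l))
            (*-mono (∏≥0 K (λ k → diff (y1 k))) (∏≤pow y δ K (suc rest) y0 y1 d0 d1 rec) u≥0
               (≤-trans (≤by (diff p) (e₂ Y (ι l * δ))) (bern δ l d0 d1))))
      where
      Y< = <⇒≤ (≰⇒> ¬q)
      e₂ = ring 2 (λ Y a → con 1ℚ :- Y :+ (Y :- a) := con 1ℚ :- a) refl
      e₃ = ring 6 (λ r l K δ S Y → (con 1ℚ :+ r :+ K) :* δ :+ (S :+ Y :- (con 1ℚ :+ r :+ l :+ (con 1ℚ :+ K)) :* δ :+ ((con 1ℚ :+ l) :* δ :- Y)) := S) refl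
      rec : (ι (suc rest) + ι K) * δ ≤ ∑ y K
      rec = ≤by (diff (subst (λ m → (m + ι (suc K)) * δ ≤ ∑ y K + Y) (trans (cong ι (sym eq)) (ι-+ (suc rest) l)) h) ⊹ diff Y<) (e₃ (ι rest) (ι l) (ι K) δ (∑ y K) Y)

  -- Means over the powers of (3 + 4i)/5

  cpow : ℂ → ℕ → ℂ
  cpow p zero = real 1ℚ
  cpow p (suc n) = p ⊗ cpow p n

  ⊗-idˡ : ∀ x → real 1ℚ ⊗ x ≡ x
  ⊗-idˡ (a ⊕i b) = cong₂ _⊕i_ (e a b) (e′ a b)
    where e = ring 2 (λ a b → con 1ℚ :* a :- con 0ℚ :* b := a) refl
          e′ = ring 2 (λ a b → con 1ℚ :* b :+ con 0ℚ :* a := b) refl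

  ⊗-idʳ : ∀ x → x ⊗ real 1ℚ ≡ x
  ⊗-idʳ x = trans (⊗-comm x (real 1ℚ)) (⊗-idˡ x)

  swap₄ : ∀ a b c d → (a ⊗ b) ⊗ (c ⊗ d) ≡ (a ⊗ c) ⊗ (b ⊗ d)
  swap₄ a b c d = trans (⊗-assoc a b (c ⊗ d)) (trans (cong (a ⊗_) (trans (sym (⊗-assoc b c d)) (trans (cong (_⊗ d) (⊗-comm b c)) (⊗-assoc c b d)))) (sym (⊗-assoc a c (b ⊗ d))))

  cpow-+ : ∀ p m n → cpow p (m ℕ.+ n) ≡ cpow p m ⊗ cpow p n
  cpow-+ p zero n = sym (⊗-idˡ (cpow p n))
  cpow-+ p (suc m) n = trans (cong (p ⊗_) (cpow-+ p m n)) (sym (⊗-assoc p (cpow p m) (cpow p n)))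

  cpow-⊗ : ∀ p q n → cpow (p ⊗ q) n ≡ cpow p n ⊗ cpow q n
  cpow-⊗ p q zero = sym (⊗-idˡ (real 1ℚ))
  cpow-⊗ p q (suc n) = trans (cong ((p ⊗ q) ⊗_) (cpow-⊗ p q n)) (swap₄ p q (cpow p n) (cpow q n))

  cpow-1 : ∀ n → cpow (real 1ℚ) n ≡ real 1ℚ
  cpow-1 zero = refl
  cpow-1 (suc n) = trans (⊗-idˡ _) (cpow-1 n)

  cpow-swap : ∀ p j k → cpow (cpow p j) k ≡ cpow (cpow p k) j
  cpow-swap p j zero = sym (cpow-1 j)
  cpow-swap p j (suc k) = trans (cong (cpow p j ⊗_) (cpow-swap p j k)) (sym (cpow-⊗ p (cpow p k) j))

  norm²-cpow : ∀ p n → norm² p ≡ 1ℚ → norm² (cpow p n) ≡ 1ℚ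
  norm²-cpow p zero h = refl
  norm²-cpow p (suc n) h = trans (norm²-⊗ p (cpow p n)) (cong₂ _*_ h (norm²-cpow p n h))

  conj-⊗ : ∀ x y → conj (x ⊗ y) ≡ conj x ⊗ conj y
  conj-⊗ (a ⊕i b) (c ⊕i d) = cong₂ _⊕i_ (e a b c d) (e′ a b c d)
    where e = ring 4 (λ a b c d → a :* c :- b :* d := a :* c :- (:- b) :* (:- d)) refl
          e′ = ring 4 (λ a b c d → :- (a :* d :+ b :* c) := a :* (:- d) :+ (:- b) :* c) refl

  module Unit (p : ℂ) (unit : norm² p ≡ 1ℚ) where
    e : ℤ → ℂ
    e (ℤ.+ n) = cpow p n
    e (ℤ.-[1+ n ]) = conj (cpow p (suc n))

    p⊗p̄ : p ⊗ conj p ≡ real 1ℚ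
    p⊗p̄ = trans (⊗-conj p) (cong real unit)

    e-⊖ : ∀ m n → e (m ℤ.⊖ n) ≡ cpow p m ⊗ conj (cpow p n)
    e-⊖ m zero = sym (⊗-idʳ (cpow p m))
    e-⊖ zero (suc n) = sym (⊗-idˡ _)
    e-⊖ (suc m) (suc n) = trans (cong e (ℤ.[1+m]⊖[1+n]≡m⊖n m n)) (trans (e-⊖ m n) (sym (trans (cong ((p ⊗ cpow p m) ⊗_) (conj-⊗ p (cpow p n)))
      (trans (swap₄ p (cpow p m) (conj p) (conj (cpow p n))) (trans (cong (_⊗ (cpow p m ⊗ conj (cpow p n))) p⊗p̄) (⊗-idˡ _))))))

    e-+ : ∀ a b → e (a ℤ.+ b) ≡ e a ⊗ e b
    e-+ (ℤ.+ m) (ℤ.+ n) = cpow-+ p m n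
    e-+ (ℤ.+ m) (ℤ.-[1+ n ]) = e-⊖ m (suc n)
    e-+ (ℤ.-[1+ m ]) (ℤ.+ n) = trans (e-⊖ n (suc m)) (⊗-comm (cpow p n) (conj (cpow p (suc m))))
    e-+ (ℤ.-[1+ m ]) (ℤ.-[1+ n ]) = trans (cong (λ k → conj (cpow p k)) (cong suc (sym (ℕ.+-suc m n)))) (trans (cong conj (cpow-+ p (suc m) (suc n))) (conj-⊗ (cpow p (suc m)) (cpow p (suc n))))

    conj-conj : ∀ x → conj (conj x) ≡ x
    conj-conj (a ⊕i b) = cong (a ⊕i_) (l b)
      where l = ring 1 (λ b → :- (:- b) := b) refl

    e-neg : ∀ a → e (ℤ.- a) ≡ conj (e a)
    e-neg (ℤ.+ zero) = refl
    e-neg (ℤ.+ suc n) = refl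
    e-neg (ℤ.-[1+ n ]) = sym (conj-conj (cpow p (suc n)))

    point : Point
    point = record
      { cos = λ a → re (e a) ; sin = λ a → im (e a) ; cos-0 = refl ; sin-0 = refl
      ; cos-+ = λ a b → cong re (e-+ a b)
      ; sin-+ = λ a b → trans (cong im (e-+ a b)) (+-comm (re (e a) * im (e b)) (im (e a) * re (e b)))
      ; cos-neg = λ a → cong re (e-neg a) ; sin-neg = λ a → cong im (e-neg a) }

  u : ℂ
  u = (3 ÷′ 5) ⊕i (4 ÷′ 5)

  X : ℕ → Point
  X j = Unit.point (cpow u j) (norm²-cpow u j refl)

  -- Modulo 5, (3 + 4i)^n ≡ 3 + 4i for n ≥ 1; hence u = (3 + 4i)/5 is not a root of unity.
  residue : ∀ n → ∃ λ a → ∃ λ b → (# 5 ^ suc n * re (cpow u (suc n)) ≡ # 5 * ιℤ a + # 3) × (# 5 ^ suc n * im (cpow u (suc n)) ≡ # 5 * ιℤ b + # 4)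
  residue zero = ℤ.+ 0 , ℤ.+ 0 , refl , refl
  residue (suc n) with residue n
  ... | a , b , p , q = a ℤ.+ a ℤ.+ a ℤ.+ (ℤ.- (b ℤ.+ b ℤ.+ b ℤ.+ b)) ℤ.+ ℤ.-[1+ 1 ] , (a ℤ.+ a ℤ.+ a ℤ.+ a ℤ.+ (b ℤ.+ b ℤ.+ b) ℤ.+ ℤ.+ 4)
    , trans (e₁ (# 5 ^ suc n) R I) (trans (cong₂ (λ s t → # 3 * s - # 4 * t) p q) (trans (e₂ (ιℤ a) (ιℤ b)) (cong (λ t → # 5 * t + # 3) (sym c₁))))
    , trans (e₃ (# 5 ^ suc n) R I) (trans (cong₂ (λ s t → # 3 * t + # 4 * s) p q) (trans (e₄ (ιℤ a) (ιℤ b)) (cong (λ t → # 5 * t + # 4) (sym c₂))))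
    where
    R = re (cpow u (suc n))
    I = im (cpow u (suc n))
    e₁ = ring 3 (λ t R I → :# 5 :* t :* (3 :/ 5 :* R :- 4 :/ 5 :* I) := :# 3 :* (t :* R) :- :# 4 :* (t :* I)) refl
    e₂ = ring 2 (λ a b → :# 3 :* (:# 5 :* a :+ :# 3) :- :# 4 :* (:# 5 :* b :+ :# 4) := :# 5 :* (a :+ a :+ a :+ (:- (b :+ b :+ b :+ b)) :+ (:- :# 2)) :+ :# 3) refl
    e₃ = ring 3 (λ t R I → :# 5 :* t :* (3 :/ 5 :* I :+ 4 :/ 5 :* R) := :# 3 :* (t :* I) :+ :# 4 :* (t :* R)) refl
    e₄ = ring 2 (λ a b → :# 3 :* (:# 5 :* b :+ :# 4) :+ :# 4 :* (:# 5 :* a :+ :# 3) := :# 5 :* (a :+ a :+ a :+ a :+ (b :+ b :+ b) :+ :# 4) :+ :# 4) refl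
    ι3 : ∀ a → ιℤ (a ℤ.+ a ℤ.+ a) ≡ ιℤ a + ιℤ a + ιℤ a
    ι3 a = trans (ιℤ-+ (a ℤ.+ a) a) (cong (_+ ιℤ a) (ιℤ-+ a a))
    ι4 : ∀ a → ιℤ (a ℤ.+ a ℤ.+ a ℤ.+ a) ≡ ιℤ a + ιℤ a + ιℤ a + ιℤ a
    ι4 a = trans (ιℤ-+ (a ℤ.+ a ℤ.+ a) a) (cong (_+ ιℤ a) (ι3 a))
    c₁ : ιℤ (a ℤ.+ a ℤ.+ a ℤ.+ (ℤ.- (b ℤ.+ b ℤ.+ b ℤ.+ b)) ℤ.+ ℤ.-[1+ 1 ]) ≡ ιℤ a + ιℤ a + ιℤ a + (- (ιℤ b + ιℤ b + ιℤ b + ιℤ b)) + (- # 2)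
    c₁ = trans (ιℤ-+ (a ℤ.+ a ℤ.+ a ℤ.+ (ℤ.- (b ℤ.+ b ℤ.+ b ℤ.+ b))) ℤ.-[1+ 1 ]) (cong (_+ (- # 2)) (trans (ιℤ-+ (a ℤ.+ a ℤ.+ a) (ℤ.- (b ℤ.+ b ℤ.+ b ℤ.+ b)))
       (cong₂ _+_ (ι3 a) (trans (ιℤ-neg (b ℤ.+ b ℤ.+ b ℤ.+ b)) (cong -_ (ι4 b))))))
    c₂ : ιℤ (a ℤ.+ a ℤ.+ a ℤ.+ a ℤ.+ (b ℤ.+ b ℤ.+ b) ℤ.+ ℤ.+ 4) ≡ ιℤ a + ιℤ a + ιℤ a + ιℤ a + (ιℤ b + ιℤ b + ιℤ b) + # 4
    c₂ = trans (ιℤ-+ (a ℤ.+ a ℤ.+ a ℤ.+ a ℤ.+ (b ℤ.+ b ℤ.+ b)) (ℤ.+ 4)) (cong (_+ # 4) (trans (ιℤ-+ (a ℤ.+ a ℤ.+ a ℤ.+ a) (b ℤ.+ b ℤ.+ b)) (cong₂ _+_ (ι4 a) (ι3 b))))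

  im-u≢0 : ∀ n → im (cpow u (suc n)) ≡ 0ℚ → ⊥
  im-u≢0 n h with residue n
  ... | a , b , p , q = no-root b (trans (sym q) (trans (cong (# 5 ^ suc n *_) h) (*-zeroʳ (# 5 ^ suc n))))
    where
    no-root : ∀ b → # 5 * ιℤ b + # 4 ≡ 0ℚ → ⊥
    no-root (ℤ.+ n) h = <-irrefl (sym h) (subst (0ℚ <_) (+-comm (# 4) (# 5 * ι n)) (0<+ (lit< 0ℚ (# 4)) (lit (# 5) ⊠ ι≥0 n)))
    no-root (ℤ.-[1+ n ]) h = <-irrefl h (<by (0<+ (lit< 0ℚ 1ℚ) (lit (# 5) ⊠ ι≥0 n)) (e (ι n)))
      where e = ring 1 (λ n → :# 5 :* (:- (con 1ℚ :+ n)) :+ :# 4 :+ (con 1ℚ :+ :# 5 :* n) := con 0ℚ) refl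

  -- Bounded discrepancy replaces the integral over the circle: the average over `M` points differs
  -- from `t` by at most C/M. This holds for trigonometric polynomials and passes to linear
  -- combinations.
  record HasMean (f : Point → ℚ) (t : ℚ) : Set where
    constructor bounded
    field
      C     : ℚ
      bound : ∀ M → ∣ ∑ (λ j → f (X j)) M - ι M * t ∣ ≤ C

  mean-ext : ∀ {f g t} → (∀ x → f x ≡ g x) → HasMean f t → HasMean g t
  mean-ext {f} {g} {t} h (bounded C b) = bounded C λ M → subst (λ s → ∣ s - ι M * t ∣ ≤ C) (eq M) (b M)
    where eq : ∀ M → ∑ (λ j → f (X j)) M ≡ ∑ (λ j → g (X j)) M
          eq zero = refl
          eq (suc M) = cong₂ _+_ (eq M) (h (X (suc M)))

  mean-lin : ∀ {f g s t} a b → HasMean f s → HasMean g t → HasMean (λ x → a * f x + b * g x) (a * s + b * t)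
  mean-lin {f} {g} {s} {t} a b (bounded C p) (bounded D q) = bounded (∣ a ∣ * C + ∣ b ∣ * D) λ M →
    subst (λ y → ∣ y ∣ ≤ ∣ a ∣ * C + ∣ b ∣ * D) (eq M)
     (≤-trans (∣p+q∣≤∣p∣+∣q∣ (a * F M) (b * G M)) (subst₂ (λ y z → y + z ≤ ∣ a ∣ * C + ∣ b ∣ * D) (sym (∣p*q∣≡∣p∣*∣q∣ a (F M))) (sym (∣p*q∣≡∣p∣*∣q∣ b (G M)))
       (+-mono-≤ (*-monoˡ (0≤∣p∣ a) (p M)) (*-monoˡ (0≤∣p∣ b) (q M)))))
    where
    F G : ℕ → ℚ
    F M = ∑ (λ j → f (X j)) M - ι M * s
    G M = ∑ (λ j → g (X j)) M - ι M * t
    e = ring 7 (λ a b S T m s t → a :* (S :- m :* s) :+ b :* (T :- m :* t) := a :* S :+ b :* T :- m :* (a :* s :+ b :* t)) refl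
    eq : ∀ M → a * F M + b * G M ≡ ∑ (λ j → a * f (X j) + b * g (X j)) M - ι M * (a * s + b * t)
    eq M = trans (e a b (∑ (λ j → f (X j)) M) (∑ (λ j → g (X j)) M) (ι M) s t) (cong (_- ι M * (a * s + b * t))
      (sym (trans (∑-+ (λ j → a * f (X j)) (λ j → b * g (X j)) M) (cong₂ _+_ (∑-* a (λ j → f (X j)) M) (∑-* b (λ j → g (X j)) M)))))

  mean-const : ∀ c → HasMean (λ _ → c) c
  mean-const c = bounded 0ℚ λ M → ≤-reflexive (cong ∣_∣ (trans (cong (_- ι M * c) (∑-const c M)) (+-inverseʳ (ι M * c))))

  -- The average of f over the sample points tends to t, so inequalities pass to the means.
  mean-mono : ∀ {f g s t} → HasMean f s → HasMean g t → (∀ x → f x ≤ g x) → s ≤ t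
  mean-mono {f} {g} {s} {t} (bounded C p) (bounded D q) h with s ≤? t
  ... | yes s≤t = s≤t
  ... | no ¬q = ⊥-elim (<-irrefl refl (<-≤-trans (proj₂ big) bound))
    where
    d = s - t
    d>0 = diff< (≰⇒> ¬q)
    big = ∃> ((C + D) * inv d)
    M = proj₁ big
    S = ∑ (λ j → f (X j)) M
    T = ∑ (λ j → g (X j)) M
    e = ring 7 (λ S T m s t C D → m :* (s :- t) :+ (C :- (:- (S :- m :* s)) :+ (D :- (T :- m :* t)) :+ (T :- S)) := C :+ D) refl
    step : ι M * d ≤ C + D
    step = ≤by (diff (≤-trans (-≤∣∣ (S - ι M * s)) (p M)) ⊹ diff (≤-trans (≤∣∣ (T - ι M * t)) (q M)) ⊹ diff (∑-mono M (λ j → h (X j)))) (e S T (ι M) s t C D)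
    bound : ι M ≤ (C + D) * inv d
    bound = subst (_≤ (C + D) * inv d) (trans (*-assoc (ι M) d (inv d)) (trans (cong (ι M *_) (inv-* d>0)) (*-identityʳ (ι M)))) (*-monoʳ (inv≥0 d>0) step)

  csum : ℂ → ℕ → ℂ
  csum p zero = real 0ℚ
  csum p (suc M) = (re (csum p M) + re (cpow p (suc M))) ⊕i (im (csum p M) + im (cpow p (suc M)))

  geometric : ∀ a b M → csum (a ⊕i b) M ⊗ ((a - 1ℚ) ⊕i b) ≡ (re (cpow (a ⊕i b) (suc M)) - a) ⊕i (im (cpow (a ⊕i b) (suc M)) - b)
  geometric a b zero = cong₂ _⊕i_ (e a b) (e′ a b)
    where e = ring 2 (λ a b → con 0ℚ :* (a :- con 1ℚ) :- con 0ℚ :* b := a :* con 1ℚ :- b :* con 0ℚ :- a) refl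
          e′ = ring 2 (λ a b → con 0ℚ :* b :+ con 0ℚ :* (a :- con 1ℚ) := a :* con 0ℚ :+ b :* con 1ℚ :- b) refl
  geometric a b (suc M) = cong₂ _⊕i_
     (trans (e₁ a b (re S) (im S) (re P) (im P)) (trans (cong (λ t → re t + (re P * (a - 1ℚ) - im P * b)) (geometric a b M)) (e₂ a b (re P) (im P))))
     (trans (e₃ a b (re S) (im S) (re P) (im P)) (trans (cong (λ t → im t + (re P * b + im P * (a - 1ℚ))) (geometric a b M)) (e₄ a b (re P) (im P))))
    where
    S = csum (a ⊕i b) M
    P = cpow (a ⊕i b) (suc M)
    e₁ = ring 6 (λ a b S T P Q → (S :+ P) :* (a :- con 1ℚ) :- (T :+ Q) :* b := (S :* (a :- con 1ℚ) :- T :* b) :+ (P :* (a :- con 1ℚ) :- Q :* b)) refl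
    e₂ = ring 4 (λ a b P Q → P :- a :+ (P :* (a :- con 1ℚ) :- Q :* b) := a :* P :- b :* Q :- a) refl
    e₃ = ring 6 (λ a b S T P Q → (S :+ P) :* b :+ (T :+ Q) :* (a :- con 1ℚ) := (S :* b :+ T :* (a :- con 1ℚ)) :+ (P :* b :+ Q :* (a :- con 1ℚ))) refl
    e₄ = ring 4 (λ a b P Q → Q :- b :+ (P :* b :+ Q :* (a :- con 1ℚ)) := a :* Q :+ b :* P :- b) refl

  -- The geometric sum has modulus at most 2 / |q - 1|, and `q` is not 1 because u is no root of
  -- unity. Bounding by `1ℚ + # 4 * inv D` avoids the square root.
  mean-cos⁺ : ∀ k → HasMean (λ x → Point.cos x (ℤ.+ suc k)) 0ℚ
  mean-cos⁺ k = bounded (1ℚ + # 4 * inv D) λ M → subst (λ s → ∣ s ∣ ≤ 1ℚ + # 4 * inv D) (trans (sym (eq M)) (e₀ _ (ι M))) (bound M)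
    where
    q = cpow u (suc k)
    a = re q
    b = im q
    D = (a - 1ℚ) * (a - 1ℚ) + b * b
    b²>0 : 0ℚ < b * b
    b²>0 with 0ℚ <? b * b
    ... | yes p = p
    ... | no ¬p = ⊥-elim (im-u≢0 k (zero-sq b (≤-antisym (≮⇒≥ ¬p) (sq≥0 b))))
      where
      zero-sq : ∀ b → b * b ≡ 0ℚ → b ≡ 0ℚ
      zero-sq b h = ≤-antisym (sqrt≤ ≤-refl (≤-reflexive h)) (subst (0ℚ ≤_) (e b) (neg-antimono-≤ (sqrt≤ {a = - b} ≤-refl (≤-reflexive (trans (e′ b) h)))))
        where e = ring 1 (λ b → :- (:- b) := b) refl
              e′ = ring 1 (λ b → (:- b) :* (:- b) := b :* b) refl
    D>0 : 0ℚ < D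
    D>0 = subst (0ℚ <_) (+-comm (b * b) ((a - 1ℚ) * (a - 1ℚ))) (0<+ b²>0 (sq≥0 (a - 1ℚ)))
    eq : ∀ M → ∑ (λ j → Point.cos (X j) (ℤ.+ suc k)) M ≡ re (csum q M)
    eq zero = refl
    eq (suc M) = cong₂ _+_ (eq M) (cong re (cpow-swap u (suc M) (suc k)))
    e₀ = ring 2 (λ s m → s := s :- m :* con 0ℚ) refl
    unit : ∀ M → norm² (cpow q M) ≡ 1ℚ
    unit M = norm²-cpow q M (norm²-cpow u (suc k) refl)
    sq-bound : ∀ M → norm² (csum q M) ≤ # 4 * inv D
    sq-bound M = subst (_≤ # 4 * inv D) (trans (*-assoc (norm² S) D (inv D)) (trans (cong (norm² S *_) (inv-* D>0)) (*-identityʳ (norm² S)))) (*-monoʳ (inv≥0 D>0) four)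
      where
      S = csum q M
      P = cpow q (suc M)
      e₁ = ring 4 (λ P Q a b → (P :- a) :* (P :- a) :+ (Q :- b) :* (Q :- b) :+ ((P :+ a) :* (P :+ a) :+ (Q :+ b) :* (Q :+ b)) := :# 2 :* (P :* P :+ Q :* Q) :+ :# 2 :* (a :* a :+ b :* b)) refl
      four : norm² S * D ≤ # 4
      four = subst (_≤ # 4) (trans (sym (cong norm² (geometric a b M))) (norm²-⊗ S ((a - 1ℚ) ⊕i b)))
         (≤by (sq≥0 (re P + a) ⊹ sq≥0 (im P + b)) (trans (e₁ (re P) (im P) a b) (cong₂ (λ s t → # 2 * s + # 2 * t) (unit (suc M)) (norm²-cpow u (suc k) refl))))
    bound : ∀ M → ∣ re (csum q M) ∣ ≤ 1ℚ + # 4 * inv D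
    bound M = ∣-∣≤ (lit 1ℚ ⊹ E≥0) (≤-trans (≤by (sq≥0 (im S)) refl) (≤-trans (sq-bound M) (≤by (lit 1ℚ ⊹ E≥0 ⊹ E≥0 ⊠ E≥0) (e₂ E))))
      where
      S = csum q M
      E = # 4 * inv D
      E≥0 = lit (# 4) ⊠ inv≥0 D>0
      e₂ = ring 1 (λ E → E :+ (con 1ℚ :+ E :+ E :* E) := (con 1ℚ :+ E) :* (con 1ℚ :+ E)) refl

  mean-eq : ∀ {f t t′} → t ≡ t′ → HasMean f t → HasMean f t′
  mean-eq refl h = h

  mean-cos⁻ : ∀ k → HasMean (λ x → Point.cos x (ℤ.- (ℤ.+ suc k))) 0ℚ
  mean-cos⁻ k = mean-ext (λ x → sym (Point.cos-neg x (ℤ.+ suc k))) (mean-cos⁺ k)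

  mean-cos0 : HasMean (λ x → Point.cos x (ℤ.+ 0)) 1ℚ
  mean-cos0 = mean-ext (λ x → sym (Point.cos-0 x)) (mean-const 1ℚ)

  -- Coefficients of the tilted product as means

  module Coefficients (r : ℚ) (r>0 : 0ℚ < r) (r≤1 : r ≤ 1ℚ) where
    open Tilt r r>0 r≤1

    Z : Point → ℕ → ℂ
    Z x = cprod (λ k → Characters.factor x (v k) (ℤ.+ k))

    -- The real part of x^l ∏_{k ≤ K} (1 - v_k + v_k x^k).
    a : ℕ → ℤ → Point → ℚ
    a K l x = re (Z x K ⊗ Characters.pt x l)

    a-step : ∀ K l x → (1ℚ - v (suc K)) * a K l x + v (suc K) * a K (l ℤ.+ (ℤ.+ suc K)) x ≡ a (suc K) l x
    a-step K l x = trans (cong₂ (λ s t → (1ℚ - v′) * a K l x + v′ * (re z′ * s - im z′ * t)) (cos-+ l m) (sin-+ l m)) (e v′ (re z′) (im z′) (cos l) (sin l) (cos m) (sin m))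
      where
      open Point x
      m = ℤ.+ suc K
      v′ = v (suc K)
      z′ = Z x K
      e = ring 7 (λ v R I c s C S → (con 1ℚ :- v) :* (R :* c :- I :* s) :+ v :* (R :* (c :* C :- s :* S) :- I :* (s :* C :+ c :* S)) := (R :* (con 1ℚ :- v :+ v :* C) :- I :* (v :* S)) :* c :- (R :* (v :* S) :+ I :* (con 1ℚ :- v :+ v :* C)) :* s) refl

    a-zero : ∀ l x → Point.cos x l ≡ a 0 l x
    a-zero l x = e (Point.cos x l) (Point.sin x l)
      where e = ring 2 (λ c s → c := con 1ℚ :* c :- con 0ℚ :* s) refl

    mean-step : ∀ K l {s t} → HasMean (a K l) s → HasMean (a K (l ℤ.+ (ℤ.+ suc K))) t → HasMean (a (suc K) l) ((1ℚ - v (suc K)) * s + v (suc K) * t)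
    mean-step K l p q = mean-ext (a-step K l) (mean-lin (1ℚ - v (suc K)) (v (suc K)) p q)

    -- All exponents of the product are nonnegative, so after a positive shift no constant term is
    -- left.
    mean-pos : ∀ K m → HasMean (a K (ℤ.+ suc m)) 0ℚ
    mean-pos zero m = mean-ext (a-zero (ℤ.+ suc m)) (mean-cos⁺ m)
    mean-pos (suc K) m = mean-eq (e (v (suc K))) (mean-step K (ℤ.+ suc m) (mean-pos K m) (mean-pos K (m ℕ.+ suc K)))
      where e = ring 1 (λ v → (con 1ℚ :- v) :* con 0ℚ :+ v :* con 0ℚ := con 0ℚ) refl

    Π : ℕ → ℚ
    Π = ∏ (λ k → 1ℚ - v k)

    -- Extraction of the coefficient of x^n along the recursion of `dq` on the largest part; the
    -- odds v / (1 - v) of part k are r^k.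
    mean-neg : ∀ K n → HasMean (a K (ℤ.- (ℤ.+ n))) (Π K * (r ^ n * ι (dq n K)))
    mean-neg zero zero = mean-ext (a-zero (ℤ.+ 0)) mean-cos0
    mean-neg zero (suc n) = mean-eq (e (r ^ suc n)) (mean-ext (a-zero (ℤ.-[1+ n ])) (mean-cos⁻ n))
      where e = ring 1 (λ x → con 0ℚ := con 1ℚ :* (x :* con 0ℚ)) refl
    mean-neg (suc K) zero = mean-eq (e (v (suc K)) (Π K)) (mean-step K (ℤ.+ 0) (mean-neg K zero) (mean-pos K K))
      where e = ring 2 (λ v p → (con 1ℚ :- v) :* (p :* (con 1ℚ :* (con 1ℚ :+ con 0ℚ))) :+ v :* con 0ℚ := p :* (con 1ℚ :- v) :* (con 1ℚ :* (con 1ℚ :+ con 0ℚ))) refl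
    mean-neg (suc K) (suc n) with n ℕ.<ᵇ K in eq
    ... | true = mean-eq (trans (e (v (suc K)) (Π K) (r ^ suc n) (ι (dq (suc n) K))) (cong (λ m → Π (suc K) * (r ^ suc n * ι m)) (sym (ℕ.+-identityʳ (dq (suc n) K)))))
        (mean-step K (ℤ.-[1+ n ]) (mean-neg K (suc n)) (subst (λ l → HasMean (a K l) 0ℚ) (sym shift-eq) (mean-pos K m)))
      where
      n<K : n ℕ.< K
      n<K = ℕ.<ᵇ⇒< n K (subst Data.Bool.T (sym eq) _)
        where import Data.Bool
      m = K ℕ.∸ suc n
      e = ring 4 (λ v p x d → (con 1ℚ :- v) :* (p :* (x :* d)) :+ v :* con 0ℚ := p :* (con 1ℚ :- v) :* (x :* d)) refl
      shift-eq : ℤ.-[1+ n ] ℤ.+ (ℤ.+ suc K) ≡ ℤ.+ suc m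
      shift-eq = trans (ℤ.[1+m]⊖[1+n]≡m⊖n K n) (trans (ℤ.⊖-≥ (ℕ.<⇒≤ n<K)) (cong ℤ.+_ (sym (ℕ.suc-pred (K ℕ.∸ n) {{ℕ.>-nonZero (ℕ.m<n⇒0<n∸m n<K)}}) ■ cong suc (ℕ.pred[m∸n]≡m∸[1+n] K n))))
        where _■_ = trans
    ... | false = mean-eq (trans (cong (λ t → (1ℚ - v (suc K)) * (Π K * (r ^ suc n * ι (dq (suc n) K))) + v (suc K) * (Π K * (r ^ (n ℕ.∸ K) * ι (dq (n ℕ.∸ K) K)))) v-eq)
          (trans (cong (λ t → (1ℚ - v (suc K)) * (Π K * (r ^ suc n * ι (dq (suc n) K))) + t * (Π K * (r ^ (n ℕ.∸ K) * ι (dq (n ℕ.∸ K) K)))) v-eq)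
          (trans (e (v (suc K)) (Π K) (r ^ suc n) (r ^ suc K) (r ^ (n ℕ.∸ K)) (ι (dq (suc n) K)) (ι (dq (n ℕ.∸ K) K)))
           (trans (cong (λ t → Π (suc K) * (r ^ suc n * ι (dq (suc n) K) + t * ι (dq (n ℕ.∸ K) K))) pow-eq)
            (trans (e₂ (Π (suc K)) (r ^ suc n) (ι (dq (suc n) K)) (ι (dq (n ℕ.∸ K) K))) (cong (λ t → Π (suc K) * (r ^ suc n * t)) (sym (ι-+ (dq (suc n) K) (dq (n ℕ.∸ K) K)))))))))
        (mean-step K (ℤ.-[1+ n ]) (mean-neg K (suc n)) (subst (λ l → HasMean (a K l) (Π K * (r ^ (n ℕ.∸ K) * ι (dq (n ℕ.∸ K) K)))) (sym shift-eq) (mean-neg K (n ℕ.∸ K))))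
      where
      K≤n : K ℕ.≤ n
      K≤n = ℕ.≮⇒≥ (λ p → subst Data.Bool.T eq (ℕ.<⇒<ᵇ p))
        where import Data.Bool
      v-eq : v (suc K) ≡ (1ℚ - v (suc K)) * r ^ suc K
      v-eq = trans (*-comm (r ^ suc K) (i (suc K))) (cong (_* r ^ suc K) (sym (1-v (suc K))))
      e = ring 7 (λ v p x z y d d′ → (con 1ℚ :- v) :* (p :* (x :* d)) :+ (con 1ℚ :- v) :* z :* (p :* (y :* d′)) := p :* (con 1ℚ :- v) :* (x :* d :+ z :* y :* d′)) refl
      e₂ = ring 4 (λ p x d d′ → p :* (x :* d :+ x :* d′) := p :* (x :* (d :+ d′))) refl
      pow-eq : r ^ suc K * r ^ (n ℕ.∸ K) ≡ r ^ suc n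
      pow-eq = trans (sym (^-+ r (suc K) (n ℕ.∸ K))) (cong (λ m → r ^ suc m) (ℕ.m+[n∸m]≡n K≤n))
      shift-eq : ℤ.-[1+ n ] ℤ.+ (ℤ.+ suc K) ≡ ℤ.- (ℤ.+ (n ℕ.∸ K))
      shift-eq = trans (ℤ.[1+m]⊖[1+n]≡m⊖n K n) (ℤ.⊖-≤ K≤n)

  -- Beta integrals

  module Beta where
    -- In closed form (2L choose L + k) / 4^L: since 1 - w/4 = (1 + cos)/2, these are the means of
    -- its powers against cosines.
    b : ℕ → ℕ → ℚ
    b zero zero = 1ℚ
    b zero (suc k) = 0ℚ
    b (suc L) zero = ½ * b L 0 + ½ * b L 1
    b (suc L) (suc k) = ½ * b L (suc k) + 1 ÷′ 4 * (1ℚ * b L (suc (suc k)) + 1ℚ * b L k)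

    c : Point → ℚ
    c x = 1ℚ - 1 ÷′ 4 * Point.w x

    mean-b : ∀ L k → HasMean (λ x → c x ^ L * Point.cos x (ℤ.+ k)) (b L k)
    mean-b zero zero = mean-ext (λ x → sym (*-identityˡ _)) mean-cos0
    mean-b zero (suc k) = mean-ext (λ x → sym (*-identityˡ _)) (mean-cos⁺ k)
    mean-b (suc L) zero = mean-ext (λ x → trans (e (c x ^ L) (Point.cos x (ℤ.+ 1)) (Point.cos x (ℤ.+ 0)) ) (cong (λ t → c x ^ suc L * Point.cos x (ℤ.+ 0) + c x ^ L * (½ * Point.cos x (ℤ.+ 1)) * (1ℚ - t)) (Point.cos-0 x) ■ e′ (c x ^ suc L * Point.cos x (ℤ.+ 0)) (c x ^ L * (½ * Point.cos x (ℤ.+ 1)))))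
         (mean-lin ½ ½ (mean-b L 0) (mean-b L 1))
      where _■_ = trans
            e = ring 3 (λ X C O → con ½ :* (X :* O) :+ con ½ :* (X :* C) := (con 1ℚ :- 1 :/ 4 :* (:# 2 :- :# 2 :* C)) :* X :* O :+ X :* (con ½ :* C) :* (con 1ℚ :- O)) refl
            e′ = ring 2 (λ A B → A :+ B :* (con 1ℚ :- con 1ℚ) := A) refl
    mean-b (suc L) (suc k) = mean-ext (λ x → trans (cong (λ t → ½ * (c x ^ L * Point.cos x (ℤ.+ suc k)) + 1 ÷′ 4 * (1ℚ * (c x ^ L * t) + 1ℚ * (c x ^ L * Point.cos x (ℤ.+ k)))) (Point.cos₂ x (ℤ.+ k)))
          (e (c x ^ L) (Point.cos x (ℤ.+ 1)) (Point.cos x (ℤ.+ suc k)) (Point.cos x (ℤ.+ k))))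
        (mean-lin ½ (1 ÷′ 4) (mean-b L (suc k)) (mean-lin 1ℚ 1ℚ (mean-b L (suc (suc k))) (mean-b L k)))
      where e = ring 4 (λ X C D O → con ½ :* (X :* D) :+ 1 :/ 4 :* (con 1ℚ :* (X :* (:# 2 :* C :* D :- O)) :+ con 1ℚ :* (X :* O)) := (con 1ℚ :- 1 :/ 4 :* (:# 2 :- :# 2 :* C)) :* X :* D) refl

    -- `β-suc` draws on `k = 0`, but the induction on `L` couples neighbouring `k`.
    ratio : ∀ L k → (1ℚ + (ι L + ι k)) * b L (suc k) ≡ (ι L - ι k) * b L k
    ratio zero zero = refl
    ratio zero (suc k) = e (ι k)
      where e = ring 1 (λ k → (con 1ℚ :+ (con 0ℚ :+ (con 1ℚ :+ k))) :* con 0ℚ := (con 0ℚ :- (con 1ℚ :+ k)) :* con 0ℚ) refl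
    ratio (suc L) zero = trans (e (ι L) (b L 0) (b L 1) (b L 2)) (trans (cong₂ (λ p q → (1ℚ + ι L - 0ℚ) * (½ * b L 0 + ½ * b L 1) + 1 ÷′ 4 * (p - (ι L - (1ℚ + 0ℚ)) * b L 1) + 1 ÷′ 4 * (q - (ι L - 0ℚ) * b L 0)) (ratio L 1) (ratio L 0))
          (e₂ ((1ℚ + ι L - 0ℚ) * (½ * b L 0 + ½ * b L 1)) ((ι L - (1ℚ + 0ℚ)) * b L 1) ((ι L - 0ℚ) * b L 0)))
      where e = ring 4 (λ L x y w → (con 1ℚ :+ (con 1ℚ :+ L :+ con 0ℚ)) :* (con ½ :* y :+ 1 :/ 4 :* (con 1ℚ :* w :+ con 1ℚ :* x)) := (con 1ℚ :+ L :- con 0ℚ) :* (con ½ :* x :+ con ½ :* y) :+ 1 :/ 4 :* ((con 1ℚ :+ (L :+ (con 1ℚ :+ con 0ℚ))) :* w :- (L :- (con 1ℚ :+ con 0ℚ)) :* y) :+ 1 :/ 4 :* ((con 1ℚ :+ (L :+ con 0ℚ)) :* y :- (L :- con 0ℚ) :* x)) refl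
            e₂ = ring 3 (λ A B C → A :+ 1 :/ 4 :* (B :- B) :+ 1 :/ 4 :* (C :- C) := A) refl
    ratio (suc L) (suc k) = trans (e (ι L) (ι k) (b L k) (b L (suc k)) (b L (suc (suc k))) (b L (suc (suc (suc k)))))
        (trans (cong₂ (λ p q → R + 1 ÷′ 4 * (p - r₂) + ½ * (q - r₁) + 1 ÷′ 4 * ((1ℚ + (ι L + ι k)) * b L (suc k) - r₀)) (ratio L (suc (suc k))) (ratio L (suc k)))
        (trans (cong (λ p → R + 1 ÷′ 4 * (r₂ - r₂) + ½ * (r₁ - r₁) + 1 ÷′ 4 * (p - r₀)) (ratio L k)) (e₂ R r₂ r₁ r₀)))
      where
      R = (1ℚ + ι L - (1ℚ + ι k)) * (½ * b L (suc k) + 1 ÷′ 4 * (1ℚ * b L (suc (suc k)) + 1ℚ * b L k))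
      r₀ = (ι L - ι k) * b L k
      r₁ = (ι L - (1ℚ + ι k)) * b L (suc k)
      r₂ = (ι L - (1ℚ + (1ℚ + ι k))) * b L (suc (suc k))
      e = ring 6 (λ L k b₀ b₁ b₂ b₃ → (con 1ℚ :+ (con 1ℚ :+ L :+ (con 1ℚ :+ k))) :* (con ½ :* b₂ :+ 1 :/ 4 :* (con 1ℚ :* b₃ :+ con 1ℚ :* b₁)) := (con 1ℚ :+ L :- (con 1ℚ :+ k)) :* (con ½ :* b₁ :+ 1 :/ 4 :* (con 1ℚ :* b₂ :+ con 1ℚ :* b₀)) :+ 1 :/ 4 :* ((con 1ℚ :+ (L :+ (con 1ℚ :+ (con 1ℚ :+ k)))) :* b₃ :- (L :- (con 1ℚ :+ (con 1ℚ :+ k))) :* b₂) :+ con ½ :* ((con 1ℚ :+ (L :+ (con 1ℚ :+ k))) :* b₂ :- (L :- (con 1ℚ :+ k)) :* b₁) :+ 1 :/ 4 :* ((con 1ℚ :+ (L :+ k)) :* b₁ :- (L :- k) :* b₀)) refl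
      e₂ = ring 4 (λ A B C D → A :+ 1 :/ 4 :* (B :- B) :+ con ½ :* (C :- C) :+ 1 :/ 4 :* (D :- D) := A) refl

    -- β L is the central binomial coefficient (2L choose L) / 4^L.
    β : ℕ → ℚ
    β L = b L 0

    β-suc : ∀ L → # 2 * (1ℚ + ι L) * β (suc L) ≡ (# 2 * ι L + 1ℚ) * β L
    β-suc L = trans (e (ι L) (b L 0) (b L 1)) (trans (cong (λ t → (1ℚ + ι L) * b L 0 + t) (ratio L 0)) (e₂ (ι L) (b L 0)))
      where e = ring 3 (λ L x y → :# 2 :* (con 1ℚ :+ L) :* (con ½ :* x :+ con ½ :* y) := (con 1ℚ :+ L) :* x :+ (con 1ℚ :+ (L :+ con 0ℚ)) :* y) refl
            e₂ = ring 2 (λ L x → (con 1ℚ :+ L) :* x :+ (L :- con 0ℚ) :* x := (:# 2 :* L :+ con 1ℚ) :* x) refl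

    -- The recursion is w = 4 - 4c. The values are the Beta integrals 4^j B(L + ½, j + ½) / π.
    mom : ℕ → ℕ → ℚ
    mom L zero = β L
    mom L (suc j) = # 4 * mom L j + (- # 4) * mom (suc L) j

    mean-mom : ∀ j L → HasMean (λ x → c x ^ L * Point.w x ^ j) (mom L j)
    mean-mom zero L = mean-ext (λ x → cong (c x ^ L *_) (Point.cos-0 x)) (mean-b L 0)
    mean-mom (suc j) L = mean-ext (λ x → e (c x ^ L) (Point.w x) (Point.w x ^ j)) (mean-lin (# 4) (- # 4) (mean-mom j L) (mean-mom j (suc L)))
      where e = ring 3 (λ X w W → :# 4 :* (X :* W) :+ (:- :# 4) :* ((con 1ℚ :- 1 :/ 4 :* w) :* X :* W) := X :* (w :* W)) refl

    -- The two relations are proved together: at `suc j` the first uses the second at `j` for both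
    -- `L` and `suc L`, and the second uses the first at `suc j`.
    mom-ratio : ∀ j L → (# 2 * (1ℚ + ι L + ι j) * mom (suc L) j ≡ (# 2 * ι L + 1ℚ) * mom L j)
              × ((1ℚ + ι L + ι j) * mom L (suc j) ≡ (# 4 * ι j + # 2) * mom L j)
    mom-ratio zero L = p , next 0 L p
      where
      p = trans (cong (_* β (suc L)) (e (ι L))) (β-suc L)
        where e = ring 1 (λ L → :# 2 :* (con 1ℚ :+ L :+ con 0ℚ) := :# 2 :* (con 1ℚ :+ L)) refl
      next : ∀ j L → # 2 * (1ℚ + ι L + ι j) * mom (suc L) j ≡ (# 2 * ι L + 1ℚ) * mom L j → (1ℚ + ι L + ι j) * mom L (suc j) ≡ (# 4 * ι j + # 2) * mom L j
      next j L h = trans (e (ι L) (ι j) (mom L j) (mom (suc L) j)) (trans (cong (λ t → # 4 * (1ℚ + ι L + ι j) * mom L j - # 2 * t) h) (e₂ (ι L) (ι j) (mom L j)))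
        where e = ring 4 (λ L j m n → (con 1ℚ :+ L :+ j) :* (:# 4 :* m :+ (:- :# 4) :* n) := :# 4 :* (con 1ℚ :+ L :+ j) :* m :- :# 2 :* (:# 2 :* (con 1ℚ :+ L :+ j) :* n)) refl
              e₂ = ring 3 (λ L j m → :# 4 :* (con 1ℚ :+ L :+ j) :* m :- :# 2 :* ((:# 2 :* L :+ con 1ℚ) :* m) := (:# 4 :* j :+ :# 2) :* m) refl
    mom-ratio (suc j) L = p , next
      where
      D = 1ℚ + ι L + ι j
      D>0 : 0ℚ < D
      D>0 = 0<+ (0<+ (lit< 0ℚ 1ℚ) (ι≥0 L)) (ι≥0 j)
      cancel : ∀ {a b} → D * a ≡ D * b → a ≡ b
      cancel h = ≤-antisym (*-cancel D>0 (≤-reflexive h)) (*-cancel D>0 (≤-reflexive (sym h)))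
      ih₁ = proj₁ (mom-ratio j L)
      ih₂ = proj₂ (mom-ratio j L)
      ih₃ = proj₂ (mom-ratio j (suc L))
      p : # 2 * (1ℚ + ι L + ι (suc j)) * mom (suc L) (suc j) ≡ (# 2 * ι L + 1ℚ) * mom L (suc j)
      p = cancel (trans (e₁ (ι L) (ι j) (mom (suc L) (suc j))) (trans (cong (λ t → # 2 * (1ℚ + ι L + ι j) * t) ih₃) (trans (e₂ (ι L) (ι j) (mom (suc L) j))
            (trans (cong ((# 4 * ι j + # 2) *_) ih₁) (trans (e₃ (ι L) (ι j) (mom L j)) (trans (cong ((# 2 * ι L + 1ℚ) *_) (sym ih₂)) (e₄ (ι L) (ι j) (mom L (suc j)))))))))
        where e₁ = ring 3 (λ L j m → (con 1ℚ :+ L :+ j) :* (:# 2 :* (con 1ℚ :+ L :+ (con 1ℚ :+ j)) :* m) := :# 2 :* (con 1ℚ :+ L :+ j) :* ((con 1ℚ :+ (con 1ℚ :+ L) :+ j) :* m)) refl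
              e₂ = ring 3 (λ L j m → :# 2 :* (con 1ℚ :+ L :+ j) :* ((:# 4 :* j :+ :# 2) :* m) := (:# 4 :* j :+ :# 2) :* (:# 2 :* (con 1ℚ :+ L :+ j) :* m)) refl
              e₃ = ring 3 (λ L j m → (:# 4 :* j :+ :# 2) :* ((:# 2 :* L :+ con 1ℚ) :* m) := (:# 2 :* L :+ con 1ℚ) :* ((:# 4 :* j :+ :# 2) :* m)) refl
              e₄ = ring 3 (λ L j m → (:# 2 :* L :+ con 1ℚ) :* ((con 1ℚ :+ L :+ j) :* m) := (con 1ℚ :+ L :+ j) :* ((:# 2 :* L :+ con 1ℚ) :* m)) refl
      next : (1ℚ + ι L + ι (suc j)) * mom L (suc (suc j)) ≡ (# 4 * ι (suc j) + # 2) * mom L (suc j)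
      next = trans (e (ι L) (ι (suc j)) (mom L (suc j)) (mom (suc L) (suc j))) (trans (cong (λ t → # 4 * (1ℚ + ι L + ι (suc j)) * mom L (suc j) - # 2 * t) p) (e₂ (ι L) (ι (suc j)) (mom L (suc j))))
        where e = ring 4 (λ L j m n → (con 1ℚ :+ L :+ j) :* (:# 4 :* m :+ (:- :# 4) :* n) := :# 4 :* (con 1ℚ :+ L :+ j) :* m :- :# 2 :* (:# 2 :* (con 1ℚ :+ L :+ j) :* n)) refl
              e₂ = ring 3 (λ L j m → :# 4 :* (con 1ℚ :+ L :+ j) :* m :- :# 2 :* ((:# 2 :* L :+ con 1ℚ) :* m) := (:# 4 :* j :+ :# 2) :* m) refl

  -- Power sums and their trigonometric analogues

  -- Partial sums of k^j ρ^k for ρ = 1 - 1/e, with their exact remainders.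
  module Power (ρ e : ℚ) (ρ≥0 : 0ℚ ≤ ρ) (ρe : ρ * e ≡ e - 1ℚ) where

    -- The complete sums of k^j ρ^k over k ≥ 1 for j = 0, 1, 2, 3, written in e = 1 / (1 - ρ).
    A B C D : ℚ
    A = e - 1ℚ
    B = e * (e - 1ℚ)
    C = e * (e - 1ℚ) * (# 2 * e - 1ℚ)
    D = e * (e - 1ℚ) * (# 6 * (e * e) - # 6 * e + 1ℚ)

    sum₀ : ∀ K → ∑ (λ k → ρ ^ k) K + ρ ^ K * A ≡ A
    sum₀ zero = e₀ e
      where e₀ = ring 1 (λ e → con 0ℚ :+ con 1ℚ :* (e :- con 1ℚ) := e :- con 1ℚ) refl
    sum₀ (suc K) = trans (e₁ ρ e (ρ ^ K) (∑ (λ k → ρ ^ k) K)) (trans (cong (λ t → ∑ (λ k → ρ ^ k) K + ρ ^ K * t) ρe) (sum₀ K))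
      where e₁ = ring 4 (λ ρ e R S → S :+ ρ :* R :+ ρ :* R :* (e :- con 1ℚ) := S :+ R :* (ρ :* e)) refl

    sum₁ : ∀ K → ∑ (λ k → ι k * ρ ^ k) K + ρ ^ K * (ι K * A + B) ≡ B
    sum₁ zero = e₀ e
      where e₀ = ring 1 (λ e → con 0ℚ :+ con 1ℚ :* (con 0ℚ :* (e :- con 1ℚ) :+ e :* (e :- con 1ℚ)) := e :* (e :- con 1ℚ)) refl
    sum₁ (suc K) = trans (e₁ ρ e (ρ ^ K) (∑ (λ k → ι k * ρ ^ k) K) (ι K)) (trans (cong (λ t → ∑ (λ k → ι k * ρ ^ k) K + ρ ^ K * (t * (ι K + e))) ρe)
       (trans (e₂ e (ρ ^ K) (∑ (λ k → ι k * ρ ^ k) K) (ι K)) (sum₁ K)))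
      where e₁ = ring 5 (λ ρ e R S k → S :+ (con 1ℚ :+ k) :* (ρ :* R) :+ ρ :* R :* ((con 1ℚ :+ k) :* (e :- con 1ℚ) :+ e :* (e :- con 1ℚ)) := S :+ R :* (ρ :* e :* (k :+ e))) refl
            e₂ = ring 4 (λ e R S k → S :+ R :* ((e :- con 1ℚ) :* (k :+ e)) := S :+ R :* (k :* (e :- con 1ℚ) :+ e :* (e :- con 1ℚ))) refl

    sum₂ : ∀ K → ∑ (λ k → ι k * ι k * ρ ^ k) K + ρ ^ K * (ι K * ι K * A + # 2 * ι K * B + C) ≡ C
    sum₂ zero = e₀ e
      where e₀ = ring 1 (λ e → con 0ℚ :+ con 1ℚ :* (con 0ℚ :* con 0ℚ :* (e :- con 1ℚ) :+ :# 2 :* con 0ℚ :* (e :* (e :- con 1ℚ)) :+ e :* (e :- con 1ℚ) :* (:# 2 :* e :- con 1ℚ)) := e :* (e :- con 1ℚ) :* (:# 2 :* e :- con 1ℚ)) refl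
    sum₂ (suc K) = trans (e₁ ρ e (ρ ^ K) S (ι K)) (trans (cong (λ t → S + ρ ^ K * (t * (ι K * ι K + # 2 * ι K * e + (# 2 * e - 1ℚ) * e))) ρe)
       (trans (e₂ e (ρ ^ K) S (ι K)) (sum₂ K)))
      where S = ∑ (λ k → ι k * ι k * ρ ^ k) K
            e₁ = ring 5 (λ ρ e R S k → S :+ (con 1ℚ :+ k) :* (con 1ℚ :+ k) :* (ρ :* R) :+ ρ :* R :* ((con 1ℚ :+ k) :* (con 1ℚ :+ k) :* (e :- con 1ℚ) :+ :# 2 :* (con 1ℚ :+ k) :* (e :* (e :- con 1ℚ)) :+ e :* (e :- con 1ℚ) :* (:# 2 :* e :- con 1ℚ)) := S :+ R :* (ρ :* e :* (k :* k :+ :# 2 :* k :* e :+ (:# 2 :* e :- con 1ℚ) :* e))) refl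
            e₂ = ring 4 (λ e R S k → S :+ R :* ((e :- con 1ℚ) :* (k :* k :+ :# 2 :* k :* e :+ (:# 2 :* e :- con 1ℚ) :* e)) := S :+ R :* (k :* k :* (e :- con 1ℚ) :+ :# 2 :* k :* (e :* (e :- con 1ℚ)) :+ e :* (e :- con 1ℚ) :* (:# 2 :* e :- con 1ℚ))) refl

    sum₃ : ∀ K → ∑ (λ k → ι k * ι k * ι k * ρ ^ k) K + ρ ^ K * (ι K * ι K * ι K * A + # 3 * (ι K * ι K) * B + # 3 * ι K * C + D) ≡ D
    sum₃ zero = e₀ e
      where e₀ = ring 1 (λ e → con 0ℚ :+ con 1ℚ :* (con 0ℚ :* con 0ℚ :* con 0ℚ :* (e :- con 1ℚ) :+ :# 3 :* (con 0ℚ :* con 0ℚ) :* (e :* (e :- con 1ℚ)) :+ :# 3 :* con 0ℚ :* (e :* (e :- con 1ℚ) :* (:# 2 :* e :- con 1ℚ)) :+ e :* (e :- con 1ℚ) :* (:# 6 :* (e :* e) :- :# 6 :* e :+ con 1ℚ)) := e :* (e :- con 1ℚ) :* (:# 6 :* (e :* e) :- :# 6 :* e :+ con 1ℚ)) refl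
    sum₃ (suc K) = trans (e₁ ρ e (ρ ^ K) S (ι K)) (trans (cong (λ t → S + ρ ^ K * (t * (ι K * ι K * ι K + # 3 * (ι K * ι K) * e + # 3 * ι K * ((# 2 * e - 1ℚ) * e) + (# 6 * (e * e) - # 6 * e + 1ℚ) * e))) ρe)
       (trans (e₂ e (ρ ^ K) S (ι K)) (sum₃ K)))
      where S = ∑ (λ k → ι k * ι k * ι k * ρ ^ k) K
            e₁ = ring 5 (λ ρ e R S k → S :+ (con 1ℚ :+ k) :* (con 1ℚ :+ k) :* (con 1ℚ :+ k) :* (ρ :* R) :+ ρ :* R :* ((con 1ℚ :+ k) :* (con 1ℚ :+ k) :* (con 1ℚ :+ k) :* (e :- con 1ℚ) :+ :# 3 :* ((con 1ℚ :+ k) :* (con 1ℚ :+ k)) :* (e :* (e :- con 1ℚ)) :+ :# 3 :* (con 1ℚ :+ k) :* (e :* (e :- con 1ℚ) :* (:# 2 :* e :- con 1ℚ)) :+ e :* (e :- con 1ℚ) :* (:# 6 :* (e :* e) :- :# 6 :* e :+ con 1ℚ)) := S :+ R :* (ρ :* e :* (k :* k :* k :+ :# 3 :* (k :* k) :* e :+ :# 3 :* k :* ((:# 2 :* e :- con 1ℚ) :* e) :+ (:# 6 :* (e :* e) :- :# 6 :* e :+ con 1ℚ) :* e))) refl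
            e₂ = ring 4 (λ e R S k → S :+ R :* ((e :- con 1ℚ) :* (k :* k :* k :+ :# 3 :* (k :* k) :* e :+ :# 3 :* k :* ((:# 2 :* e :- con 1ℚ) :* e) :+ (:# 6 :* (e :* e) :- :# 6 :* e :+ con 1ℚ) :* e)) := S :+ R :* (k :* k :* k :* (e :- con 1ℚ) :+ :# 3 :* (k :* k) :* (e :* (e :- con 1ℚ)) :+ :# 3 :* k :* (e :* (e :- con 1ℚ) :* (:# 2 :* e :- con 1ℚ)) :+ e :* (e :- con 1ℚ) :* (:# 6 :* (e :* e) :- :# 6 :* e :+ con 1ℚ))) refl

    ρ^≥0 : ∀ K → 0ℚ ≤ ρ ^ K
    ρ^≥0 K = ^≥0 K ρ≥0

    module Wave (x : Point) where
      open Point x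

      c₁ : ℚ
      c₁ = cos (ℤ.+ 1)

      -- Equal to |1 - ρ x|².
      Δ : ℚ
      Δ = (1ℚ - ρ) * (1ℚ - ρ) + ρ * w

      cos-sum : ∀ K → Δ * ∑ (λ k → ρ ^ k * cos (ℤ.+ k)) K + ρ ^ suc K * (cos (ℤ.+ suc K) - ρ * cos (ℤ.+ K)) ≡ ρ * (c₁ - ρ)
      cos-sum zero = trans (cong (λ t → Δ * 0ℚ + ρ * 1ℚ * (c₁ - ρ * t)) cos-0) (e₀ Δ ρ c₁)
        where e₀ = ring 3 (λ Δ ρ c → Δ :* con 0ℚ :+ ρ :* con 1ℚ :* (c :- ρ :* con 1ℚ) := ρ :* (c :- ρ)) refl
      cos-sum (suc K) = trans (cong (λ t → Δ * (∑ (λ k → ρ ^ k * cos (ℤ.+ k)) K + ρ ^ suc K * cos (ℤ.+ suc K)) + ρ ^ suc (suc K) * (t - ρ * cos (ℤ.+ suc K))) (cos₂ (ℤ.+ K)))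
         (trans (e₁ ρ c₁ (ρ ^ K) (∑ (λ k → ρ ^ k * cos (ℤ.+ k)) K) (cos (ℤ.+ suc K)) (cos (ℤ.+ K))) (cos-sum K))
        where e₁ = ring 6 (λ ρ c R S p q → ((con 1ℚ :- ρ) :* (con 1ℚ :- ρ) :+ ρ :* (:# 2 :- :# 2 :* c)) :* (S :+ ρ :* R :* p) :+ ρ :* (ρ :* R) :* ((:# 2 :* c :* p :- q) :- ρ :* p) := ((con 1ℚ :- ρ) :* (con 1ℚ :- ρ) :+ ρ :* (:# 2 :- :# 2 :* c)) :* S :+ ρ :* R :* (p :- ρ :* q)) refl

      WS : ℕ → ℚ
      WS = ∑ (λ k → ρ ^ k * W (ℤ.+ k))

      WS-eq : ∀ K → WS K ≡ # 2 * ∑ (λ k → ρ ^ k) K - # 2 * ∑ (λ k → ρ ^ k * cos (ℤ.+ k)) K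
      WS-eq zero = refl
      WS-eq (suc K) = trans (cong (_+ ρ ^ suc K * W (ℤ.+ suc K)) (WS-eq K)) (e₀ (∑ (λ k → ρ ^ k) K) (∑ (λ k → ρ ^ k * cos (ℤ.+ k)) K) (ρ ^ suc K) (cos (ℤ.+ suc K)))
        where e₀ = ring 4 (λ S T R c → :# 2 :* S :- :# 2 :* T :+ R :* (:# 2 :- :# 2 :* c) := :# 2 :* (S :+ R) :- :# 2 :* (T :+ R :* c)) refl

      -- Δ times the remainder ∑_{k > K} ρ^k W k.
      rest : ℕ → ℚ
      rest K = ρ ^ K * (# 2 * A * Δ - # 2 * ρ * (cos (ℤ.+ suc K) - ρ * cos (ℤ.+ K)))

      WS-rest : ∀ K → Δ * WS K + rest K ≡ # 2 * A * Δ - # 2 * ρ * (c₁ - ρ)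
      WS-rest K = trans (cong (λ t → Δ * t + rest K) (WS-eq K)) (trans (e₀ ρ Δ A (ρ ^ K) (∑ (λ k → ρ ^ k) K) (∑ (λ k → ρ ^ k * cos (ℤ.+ k)) K) (cos (ℤ.+ suc K) - ρ * cos (ℤ.+ K)))
        (cong₂ (λ s t → # 2 * Δ * s - # 2 * t) (sum₀ K) (cos-sum K)) ■ e₁ Δ A (ρ * (c₁ - ρ)) ρ (c₁ - ρ))
        where
        infixl 5 _■_
        _■_ = trans
        e₀ = ring 7 (λ ρ Δ A R S T p → Δ :* (:# 2 :* S :- :# 2 :* T) :+ R :* (:# 2 :* A :* Δ :- :# 2 :* ρ :* p) := :# 2 :* Δ :* (S :+ R :* A) :- :# 2 :* (Δ :* T :+ ρ :* R :* p)) refl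
        e₁ = ring 5 (λ Δ A x ρ p → :# 2 :* Δ :* A :- :# 2 :* (ρ :* p) := :# 2 :* A :* Δ :- :# 2 :* ρ :* p) refl

      Δ≥ : (1ℚ - ρ) * (1ℚ - ρ) ≤ Δ
      Δ≥ = ≤by (ρ≥0 ⊠ W≥0 (ℤ.+ 1)) refl

      Δ≥0 : 0ℚ ≤ Δ
      Δ≥0 = ≤-trans (sq≥0 (1ℚ - ρ)) Δ≥

      -- The squared real part of x^(K+1) - ρ x^K, whose squared modulus |x - ρ|² is `Δ`.
      wave² : ∀ K → (cos (ℤ.+ suc K) - ρ * cos (ℤ.+ K)) * (cos (ℤ.+ suc K) - ρ * cos (ℤ.+ K)) ≤ Δ
      wave² K = ≤by (sq≥0 (s * Co + c₁ * Si - ρ * Si)) (trans (cong (λ t → (t - ρ * Co) * (t - ρ * Co) + (s * Co + c₁ * Si - ρ * Si) * (s * Co + c₁ * Si - ρ * Si)) (cos-+ (ℤ.+ 1) (ℤ.+ K)))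
          (trans (e₀ ρ c₁ s Co Si) (trans (cong₂ (λ p q → (p + ρ * ρ - # 2 * ρ * c₁) * q) (pyth (ℤ.+ 1)) (pyth (ℤ.+ K))) (e₁ ρ c₁))))
        where
        s = sin (ℤ.+ 1)
        Co = cos (ℤ.+ K)
        Si = sin (ℤ.+ K)
        e₀ = ring 5 (λ ρ c s C S → (c :* C :- s :* S :- ρ :* C) :* (c :* C :- s :* S :- ρ :* C) :+ (s :* C :+ c :* S :- ρ :* S) :* (s :* C :+ c :* S :- ρ :* S) := (c :* c :+ s :* s :+ ρ :* ρ :- :# 2 :* ρ :* c) :* (C :* C :+ S :* S)) refl
        e₁ = ring 2 (λ ρ c → (con 1ℚ :+ ρ :* ρ :- :# 2 :* ρ :* c) :* con 1ℚ := (con 1ℚ :- ρ) :* (con 1ℚ :- ρ) :+ ρ :* (:# 2 :- :# 2 :* c)) refl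

      ∣wave∣ : ∀ K → ρ ≤ 1ℚ → ∣ cos (ℤ.+ suc K) - ρ * cos (ℤ.+ K) ∣ * (1ℚ - ρ) ≤ Δ
      ∣wave∣ K ρ1 = sqrt≤ Δ≥0 (≤-trans (≤-reflexive (trans (e₀ ∣ p ∣ (1ℚ - ρ)) (cong (_* ((1ℚ - ρ) * (1ℚ - ρ))) (∣∣² p))))
          (*-mono (sq≥0 p) (wave² K) (sq≥0 (1ℚ - ρ)) Δ≥))
        where
        p = cos (ℤ.+ suc K) - ρ * cos (ℤ.+ K)
        e₀ = ring 2 (λ a b → a :* b :* (a :* b) := a :* a :* (b :* b)) refl

      -- The remainder lies between 0 and 4 ∑_{k > K} ρ^k, and is at most w ∑_{k > K} k² ρ^k up to lower order.
      module _ (ρ≤1 : ρ ≤ 1ℚ) (e≥1 : 1ℚ ≤ e) where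

        e≥0 : 0ℚ ≤ e
        e≥0 = ≤-trans (lit 1ℚ) e≥1

        unit : (1ℚ - ρ) * e ≡ 1ℚ
        unit = trans (e₀ ρ e) (trans (cong (λ t → e - t) ρe) (e₁ e))
          where e₀ = ring 2 (λ ρ e → (con 1ℚ :- ρ) :* e := e :- ρ :* e) refl
                e₁ = ring 1 (λ e → e :- (e :- con 1ℚ) := con 1ℚ) refl

        ρwave : ∀ {p} → p * (1ℚ - ρ) ≤ Δ → ρ * p ≤ A * Δ
        ρwave {p} h = ≤by (ρ≥0 ⊠ e≥0 ⊠ diff h) (trans (e₀ ρ e p Δ) (trans (cong₂ (λ s t → ρ * p + s * Δ - ρ * p * t) ρe unit) (e₁ (ρ * p) (A * Δ))))
          where e₀ = ring 4 (λ ρ e p Δ → ρ :* p :+ ρ :* e :* (Δ :- p :* (con 1ℚ :- ρ)) := ρ :* p :+ ρ :* e :* Δ :- ρ :* p :* ((con 1ℚ :- ρ) :* e)) refl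
                e₁ = ring 2 (λ a b → a :+ b :- a :* con 1ℚ := b) refl

        rest≥0 : ∀ K → 0ℚ ≤ rest K
        rest≥0 K = ρ^≥0 K ⊠ subst (0ℚ ≤_) (e₀ A Δ ρ p) (lit (# 2) ⊠ diff (ρwave (≤-trans (*-monoʳ (diff ρ≤1) (≤∣∣ p)) (∣wave∣ K ρ≤1))))
          where p = cos (ℤ.+ suc K) - ρ * cos (ℤ.+ K)
                e₀ = ring 4 (λ A Δ ρ p → :# 2 :* (A :* Δ :- ρ :* p) := :# 2 :* A :* Δ :- :# 2 :* ρ :* p) refl

        rest≤ : ∀ K → rest K ≤ ρ ^ K * (# 4 * A * Δ)
        rest≤ K = *-monoˡ (ρ^≥0 K) (≤by (lit (# 2) ⊠ diff (ρwave {p = - p} (≤-trans (*-monoʳ (diff ρ≤1) (-≤∣∣ p)) (∣wave∣ K ρ≤1)))) (e₀ A Δ ρ p))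
          where p = cos (ℤ.+ suc K) - ρ * cos (ℤ.+ K)
                e₀ = ring 4 (λ A Δ ρ p → :# 2 :* A :* Δ :- :# 2 :* ρ :* p :+ :# 2 :* (A :* Δ :- ρ :* (:- p)) := :# 4 :* A :* Δ) refl

        rest≤w : ∀ K → rest K ≤ ρ ^ K * (w * (# 2 * e + # 2 * ι K + 1ℚ + ι K * ι K * (1ℚ - ρ)))
        rest≤w K = *-monoˡ (ρ^≥0 K) (≤-trans (≤-reflexive (trans (e₀ ρ A w (cos (ℤ.+ suc K)) (cos (ℤ.+ K))) (cong (λ t → # 2 * ρ * A * w + ρ * (W (ℤ.+ suc K) - W (ℤ.+ K) + (1ℚ - ρ) * W (ℤ.+ K)) + # 2 * (1ℚ - ρ) * t) lemma ■ e₁ (# 2 * ρ * A * w + ρ * (W (ℤ.+ suc K) - W (ℤ.+ K) + (1ℚ - ρ) * W (ℤ.+ K))) ρ)))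
            (≤by (lit (# 2) ⊠ diff ρA≤e ⊠ W≥0 (ℤ.+ 1) ⊹ ρ≥0 ⊠ (diff (proj₁ (W-step K)) ⊹ diff ρ≤1 ⊠ diff (proj₂ (W-step K)))
                  ⊹ diff ρ≤1 ⊠ ((lit 1ℚ ⊹ lit (# 2) ⊠ ι≥0 K) ⊠ W≥0 (ℤ.+ 1) ⊹ diff ρ≤1 ⊠ (ι≥0 K ⊠ ι≥0 K ⊠ W≥0 (ℤ.+ 1))))
               (e₂ ρ A e w (W (ℤ.+ suc K)) (W (ℤ.+ K)) (ι K))))
          where
          infixl 5 _■_
          _■_ = trans
          lemma : A * (1ℚ - ρ) - ρ ≡ 0ℚ
          lemma = trans (e₃ e ρ) (trans (cong (λ t → t - 1ℚ) unit) (+-inverseʳ 1ℚ))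
            where e₃ = ring 2 (λ e ρ → (e :- con 1ℚ) :* (con 1ℚ :- ρ) :- ρ := (con 1ℚ :- ρ) :* e :- con 1ℚ) refl
          ρA≤e : ρ * A ≤ e
          ρA≤e = ≤-trans (*-mono ρ≥0 ρ≤1 (diff e≥1) (≤by (lit 1ℚ) (e₄ e))) (≤-reflexive (*-identityˡ e))
            where e₄ = ring 1 (λ e → e :- con 1ℚ :+ con 1ℚ := e) refl
          e₀ = ring 5 (λ ρ A w C c → :# 2 :* A :* ((con 1ℚ :- ρ) :* (con 1ℚ :- ρ) :+ ρ :* w) :- :# 2 :* ρ :* (C :- ρ :* c) := :# 2 :* ρ :* A :* w :+ ρ :* ((:# 2 :- :# 2 :* C) :- (:# 2 :- :# 2 :* c) :+ (con 1ℚ :- ρ) :* (:# 2 :- :# 2 :* c)) :+ :# 2 :* (con 1ℚ :- ρ) :* (A :* (con 1ℚ :- ρ) :- ρ)) refl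
          e₁ = ring 2 (λ a ρ → a :+ :# 2 :* (con 1ℚ :- ρ) :* con 0ℚ := a) refl
          e₂ = ring 7 (λ ρ A e w W′ W k → :# 2 :* ρ :* A :* w :+ ρ :* (W′ :- W :+ (con 1ℚ :- ρ) :* W) :+ (:# 2 :* (e :- ρ :* A) :* w :+ ρ :* ((W :+ (con 1ℚ :+ :# 2 :* k) :* w) :- W′ :+ (con 1ℚ :- ρ) :* (k :* k :* w :- W)) :+ (con 1ℚ :- ρ) :* ((con 1ℚ :+ :# 2 :* k) :* w :+ (con 1ℚ :- ρ) :* (k :* k :* w))) := w :* (:# 2 :* e :+ :# 2 :* k :+ con 1ℚ :+ k :* k :* (con 1ℚ :- ρ))) refl

  -- Elementary estimates for the tilt r = 1 - 1/m

  module Scale (m : ℚ) (m≥250 : # 250 ≤ m) where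

    m>0 : 0ℚ < m
    m>0 = <-≤-trans (lit< 0ℚ (# 250)) m≥250

    m≥0 : 0ℚ ≤ m
    m≥0 = <⇒≤ m>0

    s r : ℚ
    s = inv m
    r = 1ℚ - s

    ms : m * s ≡ 1ℚ
    ms = inv-* m>0

    s≥0 : 0ℚ ≤ s
    s≥0 = inv≥0 m>0

    s≤ : s ≤ 1 ÷′ 250
    s≤ = *-cancel m>0 (subst (_≤ m * (1 ÷′ 250)) (sym ms) (≤by (lit (1 ÷′ 250) ⊠ diff m≥250) (e m)))
      where e = ring 1 (λ m → con 1ℚ :+ 1 :/ 250 :* (m :- :# 250) := m :* (1 :/ 250)) refl

    r>0 : 0ℚ < r
    r>0 = diff< (≤-<-trans s≤ (lit< (1 ÷′ 250) 1ℚ))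

    r≥0 : 0ℚ ≤ r
    r≥0 = <⇒≤ r>0

    r≤1 : r ≤ 1ℚ
    r≤1 = ≤by s≥0 (e s)
      where e = ring 1 (λ s → con 1ℚ :- s :+ s := con 1ℚ) refl

    rm : r * m ≡ m - 1ℚ
    rm = trans (e m s) (cong (λ t → m - t) ms)
      where e = ring 2 (λ m s → (con 1ℚ :- s) :* m := m :- m :* s) refl

    open Tilt r r>0 r≤1 public

    -- E = 1 / (1 - r²)
    2m-1>0 : 0ℚ < # 2 * m - 1ℚ
    2m-1>0 = <by (0<+ m>0 (diff (≤-trans (lit≤ 1ℚ (# 250)) m≥250))) (e m)
      where e = ring 1 (λ m → con 0ℚ :+ (m :+ (m :- con 1ℚ)) := :# 2 :* m :- con 1ℚ) refl

    E : ℚ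
    E = m * m * inv (# 2 * m - 1ℚ)

    E-def : (# 2 * m - 1ℚ) * E ≡ m * m
    E-def = trans (e (# 2 * m - 1ℚ) (m * m) (inv (# 2 * m - 1ℚ))) (trans (cong (m * m *_) (inv-* 2m-1>0)) (*-identityʳ (m * m)))
      where e = ring 3 (λ a b c → a :* (b :* c) := b :* (a :* c)) refl

    cancel : ∀ {a b c} → 0ℚ < c → c * a ≡ c * b → a ≡ b
    cancel p h = ≤-antisym (*-cancel p (≤-reflexive h)) (*-cancel p (≤-reflexive (sym h)))

    r²E : r * r * E ≡ E - 1ℚ
    r²E = cancel 2m-1>0 (trans (e₀ (# 2 * m - 1ℚ) r E) (trans (cong (r * r *_) E-def) (trans (e₁ r m) (trans (cong (λ t → t * t) rm) (trans (e₂ m) (trans (cong (_- (# 2 * m - 1ℚ)) (sym E-def)) (e₃ (# 2 * m - 1ℚ) E)))))))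
      where e₀ = ring 3 (λ a r E → a :* (r :* r :* E) := r :* r :* (a :* E)) refl
            e₁ = ring 2 (λ r m → r :* r :* (m :* m) := r :* m :* (r :* m)) refl
            e₂ = ring 1 (λ m → (m :- con 1ℚ) :* (m :- con 1ℚ) := m :* m :- (:# 2 :* m :- con 1ℚ)) refl
            e₃ = ring 2 (λ a E → a :* E :- a := a :* (E :- con 1ℚ)) refl

    E≤ : # 2 * E ≤ m + 1ℚ
    E≤ = *-cancel 2m-1>0 (≤-trans (≤-reflexive (trans (e₀ (# 2 * m - 1ℚ) E) (cong (# 2 *_) E-def))) (≤by (diff (≤-trans (lit≤ 1ℚ (# 250)) m≥250)) (e₁ m)))
      where e₀ = ring 2 (λ a E → a :* (:# 2 :* E) := :# 2 :* (a :* E)) refl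
            e₁ = ring 1 (λ m → :# 2 :* (m :* m) :+ (m :- con 1ℚ) := (:# 2 :* m :- con 1ℚ) :* (m :+ con 1ℚ)) refl

    E≥ : ½ * m ≤ E
    E≥ = *-cancel 2m-1>0 (≤-trans (≤by (lit ½ ⊠ m≥0) (e₁ m)) (≤-reflexive (sym E-def)))
      where e₁ = ring 1 (λ m → (:# 2 :* m :- con 1ℚ) :* (con ½ :* m) :+ con ½ :* m := m :* m) refl

    m≥1 = ≤-trans (lit≤ 1ℚ (# 250)) m≥250

    E≥1 : 1ℚ ≤ E
    E≥1 = ≤-trans (≤by (lit ½ ⊠ diff m≥250 ⊹ lit (# 124)) (e m)) E≥
      where e = ring 1 (λ m → con 1ℚ :+ (con ½ :* (m :- :# 250) :+ :# 124) := con ½ :* m) refl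

    E≤m : E ≤ m
    E≤m = ≤by (lit ½ ⊠ diff E≤ ⊹ lit ½ ⊠ diff m≥1) (e m E)
      where e = ring 2 (λ m E → E :+ (con ½ :* (m :+ con 1ℚ :- :# 2 :* E) :+ con ½ :* (m :- con 1ℚ)) := m) refl

    module S₁ = Power r m r≥0 rm
    module S₂ = Power (r * r) E (r≥0 ⊠ r≥0) r²E

    zz : ∀ k → z k * z k ≡ (r * r) ^ k
    zz k = sym (^-* r r k)

    -- Truncations of the binomial expansion of (1 + s)^k.
    tb : ℕ → ℕ → ℚ
    tb zero k = 1ℚ
    tb (suc j) zero = 1ℚ
    tb (suc j) (suc k) = tb (suc j) k + s * tb j k

    tb≥0 : ∀ j k → 0ℚ ≤ tb j k
    tb≥0 zero k = lit 1ℚ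
    tb≥0 (suc j) zero = lit 1ℚ
    tb≥0 (suc j) (suc k) = tb≥0 (suc j) k ⊹ s≥0 ⊠ tb≥0 j k

    tb-mono : ∀ j k → tb j k ≤ tb (suc j) k
    tb-mono zero zero = ≤-refl
    tb-mono zero (suc k) = ≤-trans (tb-mono zero k) (≤by (s≥0 ⊠ lit 1ℚ) refl)
    tb-mono (suc j) zero = ≤-refl
    tb-mono (suc j) (suc k) = +-mono-≤ (tb-mono (suc j) k) (*-monoˡ s≥0 (tb-mono j k))

    -- The truncated form of (1 - s)^k (1 + s)^k ≤ 1.
    z-tb : ∀ j k → z k * tb j k ≤ 1ℚ
    z-tb zero k = ≤-trans (≤-reflexive (*-identityʳ (z k))) (z≤1 k)
    z-tb (suc j) zero = ≤-reflexive refl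
    z-tb (suc j) (suc k) = ≤-trans (≤by (z≥0 k ⊠ (r≥0 ⊠ s≥0 ⊠ diff (tb-mono j k) ⊹ s≥0 ⊠ s≥0 ⊠ tb≥0 (suc j) k)) (e s (z k) (tb (suc j) k) (tb j k))) (z-tb (suc j) k)
      where e = ring 4 (λ s z T t → (con 1ℚ :- s) :* z :* (T :+ s :* t) :+ z :* ((con 1ℚ :- s) :* s :* (T :- t) :+ s :* s :* T) := z :* T) refl

    tb1 : ∀ k → tb 1 k ≡ 1ℚ + ι k * s
    tb1 zero = e s
      where e = ring 1 (λ s → con 1ℚ := con 1ℚ :+ con 0ℚ :* s) refl
    tb1 (suc k) = trans (cong (_+ s * 1ℚ) (tb1 k)) (e s (ι k))
      where e = ring 2 (λ s k → con 1ℚ :+ k :* s :+ s :* con 1ℚ := con 1ℚ :+ (con 1ℚ :+ k) :* s) refl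

    tb2 : ∀ k → tb 2 k ≡ 1ℚ + ι k * s + ½ * (ι k * ι k - ι k) * (s * s)
    tb2 zero = e s
      where e = ring 1 (λ s → con 1ℚ := con 1ℚ :+ con 0ℚ :* s :+ con ½ :* (con 0ℚ :* con 0ℚ :- con 0ℚ) :* (s :* s)) refl
    tb2 (suc k) = trans (cong₂ (λ p q → p + s * q) (tb2 k) (tb1 k)) (e s (ι k))
      where e = ring 2 (λ s k → con 1ℚ :+ k :* s :+ con ½ :* (k :* k :- k) :* (s :* s) :+ s :* (con 1ℚ :+ k :* s) := con 1ℚ :+ (con 1ℚ :+ k) :* s :+ con ½ :* ((con 1ℚ :+ k) :* (con 1ℚ :+ k) :- (con 1ℚ :+ k)) :* (s :* s)) refl

    tb3 : ∀ k → tb 3 k ≡ 1ℚ + ι k * s + ½ * (ι k * ι k - ι k) * (s * s) + 1 ÷′ 6 * (ι k * ι k * ι k - # 3 * (ι k * ι k) + # 2 * ι k) * (s * s * s)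
    tb3 zero = e s
      where e = ring 1 (λ s → con 1ℚ := con 1ℚ :+ con 0ℚ :* s :+ con ½ :* (con 0ℚ :* con 0ℚ :- con 0ℚ) :* (s :* s) :+ 1 :/ 6 :* (con 0ℚ :* con 0ℚ :* con 0ℚ :- :# 3 :* (con 0ℚ :* con 0ℚ) :+ :# 2 :* con 0ℚ) :* (s :* s :* s)) refl
    tb3 (suc k) = trans (cong₂ (λ p q → p + s * q) (tb3 k) (tb2 k)) (e s (ι k))
      where e = ring 2 (λ s k → con 1ℚ :+ k :* s :+ con ½ :* (k :* k :- k) :* (s :* s) :+ 1 :/ 6 :* (k :* k :* k :- :# 3 :* (k :* k) :+ :# 2 :* k) :* (s :* s :* s) :+ s :* (con 1ℚ :+ k :* s :+ con ½ :* (k :* k :- k) :* (s :* s)) := con 1ℚ :+ (con 1ℚ :+ k) :* s :+ con ½ :* ((con 1ℚ :+ k) :* (con 1ℚ :+ k) :- (con 1ℚ :+ k)) :* (s :* s) :+ 1 :/ 6 :* ((con 1ℚ :+ k) :* (con 1ℚ :+ k) :* (con 1ℚ :+ k) :- :# 3 :* ((con 1ℚ :+ k) :* (con 1ℚ :+ k)) :+ :# 2 :* (con 1ℚ :+ k)) :* (s :* s :* s)) refl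

    -- The cubic term of `tb 3` is a falling factorial and smaller than the left side; the lower
    -- terms make up for this since s ≤ 1/250.
    t³≤tb : ∀ k → 1 ÷′ 6 * (ι k * s * (ι k * s) * (ι k * s)) ≤ tb 3 k
    t³≤tb k = subst (1 ÷′ 6 * (ι k * s * (ι k * s) * (ι k * s)) ≤_) (sym (tb3 k))
       (≤by (lit 1ℚ ⊹ t≥0 ⊠ (lit (249 ÷′ 250) ⊹ ½ₙ ⊠ diff s≤ ⊹ lit (1 ÷′ 500) ⊹ lit (1 ÷′ 3) ⊠ (s≥0 ⊠ s≥0)) ⊹ t≥0 ⊠ t≥0 ⊠ (½ₙ ⊠ diff r≤1′ ) )
         (e s (ι k)))
      where
      t≥0 = ι≥0 k ⊠ s≥0
      ½ₙ = lit ½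
      r≤1′ : s ≤ 1ℚ
      r≤1′ = ≤-trans s≤ (lit≤ (1 ÷′ 250) 1ℚ)
      e = ring 2 (λ s k → 1 :/ 6 :* (k :* s :* (k :* s) :* (k :* s)) :+ (con 1ℚ :+ k :* s :* (249 :/ 250 :+ con ½ :* (1 :/ 250 :- s) :+ 1 :/ 500 :+ 1 :/ 3 :* (s :* s)) :+ k :* s :* (k :* s) :* (con ½ :* (con 1ℚ :- s))) := con 1ℚ :+ k :* s :+ con ½ :* (k :* k :- k) :* (s :* s) :+ 1 :/ 6 :* (k :* k :* k :- :# 3 :* (k :* k) :+ :# 2 :* k) :* (s :* s :* s)) refl

    -- With t = k s fixed and s → 0 the difference is t (t - 3/2)² / 6 + 5t/8 + 1; the terms in s
    -- perturb this slightly.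
    t²≤tb : ∀ k → ι k * s * (ι k * s) ≤ tb 3 k
    t²≤tb k = subst (ι k * s * (ι k * s) ≤_) (sym (tb3 k))
       (≤by (lit 1ℚ ⊹ t≥0 ⊠ (lit (1 ÷′ 6) ⊠ sq≥0 (ι k * s - 3 ÷′ 2 * (1ℚ + s)) ⊹ diff s≤ ⊠ (lit (5 ÷′ 4 + 1 ÷′ 6000) ⊹ lit (1 ÷′ 24) ⊠ s≥0) ⊹ lit (5 ÷′ 8 - 5 ÷′ 1000 - 1 ÷′ 1500000)))
         (e s (ι k)))
      where
      t≥0 = ι≥0 k ⊠ s≥0
      e = ring 2 (λ s k → k :* s :* (k :* s) :+ (con 1ℚ :+ k :* s :* (1 :/ 6 :* ((k :* s :- 3 :/ 2 :* (con 1ℚ :+ s)) :* (k :* s :- 3 :/ 2 :* (con 1ℚ :+ s))) :+ (1 :/ 250 :- s) :* (5 :/ 4 :+ 1 :/ 6000 :+ 1 :/ 24 :* s) :+ (5 :/ 8 :- 5 :/ 1000 :- 1 :/ 1500000))) := con 1ℚ :+ k :* s :+ con ½ :* (k :* k :- k) :* (s :* s) :+ 1 :/ 6 :* (k :* k :* k :- :# 3 :* (k :* k) :+ :# 2 :* k) :* (s :* s :* s)) refl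

    t≤tb : ∀ k → ι k * s ≤ tb 3 k
    t≤tb k = ≤-trans (≤-trans (≤by (lit 1ℚ) (e (ι k * s))) (≤-reflexive (sym (tb1 k)))) (≤-trans (tb-mono 1 k) (tb-mono 2 k))
      where e = ring 1 (λ t → t :+ con 1ℚ := con 1ℚ :+ t) refl

    kz≤ : ∀ k → ι k * z k ≤ m
    kz≤ k = subst₂ _≤_ (trans (e m s (z k) (ι k)) (trans (cong (λ t → t * (ι k * z k)) ms) (*-identityˡ (ι k * z k)))) (*-identityʳ m) (*-monoˡ m≥0 (≤-trans (*-monoˡ (z≥0 k) (t≤tb k)) (z-tb 3 k)))
      where e = ring 4 (λ m s z k → m :* (z :* (k :* s)) := m :* s :* (k :* z)) refl

    k²z≤ : ∀ k → ι k * ι k * z k ≤ m * m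
    k²z≤ k = subst₂ _≤_ (trans (e m s (z k) (ι k)) (trans (cong (λ t → t * t * (ι k * ι k * z k)) ms) (e′ (ι k * ι k * z k)))) (*-identityʳ (m * m)) (*-monoˡ (m≥0 ⊠ m≥0) (≤-trans (*-monoˡ (z≥0 k) (t²≤tb k)) (z-tb 3 k)))
      where e = ring 4 (λ m s z k → m :* m :* (z :* (k :* s :* (k :* s))) := m :* s :* (m :* s) :* (k :* k :* z)) refl
            e′ = ring 1 (λ a → con 1ℚ :* con 1ℚ :* a := a) refl

    k³z≤ : ∀ k → ι k * ι k * ι k * z k ≤ # 6 * (m * m * m)
    k³z≤ k = subst₂ _≤_ (trans (e m s (z k) (ι k)) (trans (cong (λ t → t * t * t * (ι k * ι k * ι k * z k)) ms) (e′ (ι k * ι k * ι k * z k)))) (*-identityʳ (# 6 * (m * m * m))) (*-monoˡ (lit (# 6) ⊠ (m≥0 ⊠ m≥0 ⊠ m≥0)) (≤-trans (*-monoˡ (z≥0 k) (t³≤tb k)) (z-tb 3 k)))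
      where e = ring 4 (λ m s z k → :# 6 :* (m :* m :* m) :* (z :* (1 :/ 6 :* (k :* s :* (k :* s) :* (k :* s)))) := m :* s :* (m :* s) :* (m :* s) :* (k :* k :* k :* z)) refl
            e′ = ring 1 (λ a → con 1ℚ :* con 1ℚ :* con 1ℚ :* a := a) refl

    ∑kz≤ : ∀ K → ∑ (λ k → ι k * z k) K ≤ m * m
    ∑kz≤ K = ≤-trans (≤by (z≥0 K ⊠ (ι≥0 K ⊠ diff m≥1 ⊹ m≥0 ⊠ diff m≥1)) (S₁.sum₁ K)) (≤by m≥0 (e m))
      where e = ring 1 (λ m → m :* (m :- con 1ℚ) :+ m := m :* m) refl

  ∏≡norm² : ∀ N (y : ℕ → ℚ) K → (∀ k → norm² (N (suc k)) ≡ 1ℚ - y (suc k)) → norm² (cprod N K) ≡ ∏ (λ k → 1ℚ - y k) K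
  ∏≡norm² N y zero h = refl
  ∏≡norm² N y (suc K) h = trans (norm²-⊗ (cprod N K) (N (suc K))) (cong₂ _*_ (∏≡norm² N y K h) (h K))

  ∑-lin : ∀ a b f g K → ∑ (λ k → a * f k + b * g k) K ≡ a * ∑ f K + b * ∑ g K
  ∑-lin a b f g K = trans (∑-+ (λ k → a * f k) (λ k → b * g k) K) (cong₂ _+_ (∑-* a f K) (∑-* b g K))

  inv-unique : ∀ {a b} → 0ℚ < a → a * b ≡ 1ℚ → inv a ≡ b
  inv-unique {a} {b} p h = ≤-antisym (*-cancel p (≤-reflexive (trans (inv-* p) (sym h)))) (*-cancel p (≤-reflexive (trans h (sym (inv-* p)))))

  -- (1 - h)^n ≤ 0.38^j for n h ≥ j + j h; the bound approaches e^(-j).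
  module Decay (h : ℚ) (h>0 : 0ℚ < h) (h≤ : h ≤ 1 ÷′ 250) where
    M≥250 : # 250 ≤ inv h
    M≥250 = *-cancel h>0 (≤-trans (≤by (lit (# 250) ⊠ diff h≤) (e h)) (≤-reflexive (sym (inv-* h>0))))
      where e = ring 1 (λ h → h :* :# 250 :+ :# 250 :* (1 :/ 250 :- h) := con 1ℚ) refl

    open Scale (inv h) M≥250

    s≡h : s ≡ h
    s≡h = inv-unique (inv>0 h>0) (trans (*-comm (inv h) h) (inv-* h>0))

    n₀ = proj₁ (ceil (inv h) (inv≥0 h>0))

    n₀≤ : ι n₀ ≤ inv h + 1ℚ
    n₀≤ = proj₂ (proj₂ (ceil (inv h) (inv≥0 h>0)))

    t≥1 : 1ℚ ≤ ι n₀ * s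
    t≥1 = ≤-trans (≤-reflexive (sym ms)) (*-monoʳ s≥0 (proj₁ (proj₂ (ceil (inv h) (inv≥0 h>0)))))

    -- At t ≥ 1 the cubic truncation is about 1 + 1 + 1/2 + 1/6 > 2.66, and 2.66 · 0.38 > 1.
    block : (1ℚ - h) ^ n₀ ≤ 38 ÷′ 100
    block = ≤-trans (≤-reflexive (cong (λ t → (1ℚ - t) ^ n₀) (sym s≡h))) (*-cancel (lit< 0ℚ (266 ÷′ 100))
      (≤-trans (≤-trans (≤-reflexive (*-comm (266 ÷′ 100) (z n₀))) (*-monoˡ (z≥0 n₀) tb≥)) (≤-trans (z-tb 3 n₀) (lit≤ 1ℚ (266 ÷′ 100 * (38 ÷′ 100))))))
      where
      t = ι n₀ * s
      t-1 = diff t≥1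
      1-s = diff r≤1ₛ
        where r≤1ₛ : s ≤ 1ℚ
              r≤1ₛ = ≤-trans s≤ (lit≤ (1 ÷′ 250) 1ℚ)
      1-2s : 0ℚ ≤ 1ℚ - # 2 * s
      1-2s = subst (0ℚ ≤_) (e s) (lit (# 2) ⊠ diff s≤ ⊹ lit (124 ÷′ 125))
        where e = ring 1 (λ s → :# 2 :* (1 :/ 250 :- s) :+ 124 :/ 125 := con 1ℚ :- :# 2 :* s) refl
      t≥0 = ι≥0 n₀ ⊠ s≥0
      p1 : 1ℚ - s ≤ t * (t - s)
      p1 = ≤by (t-1 ⊠ (t≥0 ⊹ 1-s)) (e t s)
        where e = ring 2 (λ t s → con 1ℚ :- s :+ (t :- con 1ℚ) :* (t :+ (con 1ℚ :- s)) := t :* (t :- s)) refl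
      p2 : (1ℚ - s) * (1ℚ - # 2 * s) ≤ t * (t - s) * (t - # 2 * s)
      p2 = *-mono 1-s p1 1-2s (+-monoˡ-≤ (- (# 2 * s)) t≥1)
      tb≥ : 266 ÷′ 100 ≤ tb 3 n₀
      tb≥ = ≤-trans (≤by (t-1 ⊹ lit ½ ⊠ diff p1 ⊹ lit (1 ÷′ 6) ⊠ diff p2 ⊹ diff s≤ ⊹ lit (1 ÷′ 3) ⊠ (s≥0 ⊠ s≥0) ⊹ lit (2 ÷′ 3 - 66 ÷′ 100 - 1 ÷′ 250)) (e t s))
          (≤-reflexive (trans (e′ (ι n₀) s) (sym (tb3 n₀))))
        where e = ring 2 (λ t s → 266 :/ 100 :+ (t :- con 1ℚ :+ con ½ :* (t :* (t :- s) :- (con 1ℚ :- s)) :+ 1 :/ 6 :* (t :* (t :- s) :* (t :- :# 2 :* s) :- (con 1ℚ :- s) :* (con 1ℚ :- :# 2 :* s)) :+ (1 :/ 250 :- s) :+ 1 :/ 3 :* (s :* s) :+ (2 :/ 3 :- 66 :/ 100 :- 1 :/ 250)) := con 1ℚ :+ t :+ con ½ :* (t :* (t :- s)) :+ 1 :/ 6 :* (t :* (t :- s) :* (t :- :# 2 :* s))) refl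
              e′ = ring 2 (λ k s → con 1ℚ :+ k :* s :+ con ½ :* (k :* s :* (k :* s :- s)) :+ 1 :/ 6 :* (k :* s :* (k :* s :- s) :* (k :* s :- :# 2 :* s)) := con 1ℚ :+ k :* s :+ con ½ :* (k :* k :- k) :* (s :* s) :+ 1 :/ 6 :* (k :* k :* k :- :# 3 :* (k :* k) :+ :# 2 :* k) :* (s :* s :* s)) refl

    h≥0 = <⇒≤ h>0
    h≤1 = ≤-trans h≤ (lit≤ (1 ÷′ 250) 1ℚ)

    decay : ∀ j n → ι j + ι j * h ≤ ι n * h → (1ℚ - h) ^ n ≤ (38 ÷′ 100) ^ j
    decay j n p = ≤-trans (^-anti {m = j ℕ.* n₀} (diff h≤1) (≤by h≥0 (e₀ h)) jn₀≤n) (≤-trans (≤-reflexive (^-^ (1ℚ - h) j n₀)) (^-mono j (^≥0 n₀ (diff h≤1)) block))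
      where
      e₀ = ring 1 (λ h → con 1ℚ :- h :+ h := con 1ℚ) refl
      e₁ = ring 3 (λ h j i → h :* (j :* (i :+ con 1ℚ)) := j :* (h :* i) :+ j :* h) refl
      jn₀≤n : j ℕ.* n₀ ℕ.≤ n
      jn₀≤n = ι≤⇒≤ (≤-<-trans (≤-trans (≤-reflexive (ι-* j n₀)) (≤-trans (*-monoˡ (ι≥0 j) n₀≤)
          (*-cancel h>0 (≤-trans (≤-reflexive (trans (e₁ h (ι j) (inv h)) (cong (λ t → ι j * t + ι j * h) (inv-* h>0)))) (≤-trans (≤-reflexive (cong (_+ ι j * h) (*-identityʳ (ι j)))) (≤-trans p (≤-reflexive (*-comm (ι n) h))))))))
          (<by (lit< 0ℚ 1ℚ) (+-comm (ι n) 1ℚ)))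

  max≤ : ∀ a b {c} → ι a ≤ c → ι b ≤ c → ι (a ℕ.⊔ b) ≤ c
  max≤ a b {c} p q with ℕ.≤-total a b
  ... | inj₁ h = subst (λ t → ι t ≤ c) (sym (ℕ.m≤n⇒m⊔n≡n h)) q
  ... | inj₂ h = subst (λ t → ι t ≤ c) (sym (ℕ.m≥n⇒m⊔n≡m h)) p

  -- Comparison of Beta integrals

  module BetaBounds where
    open Beta

    2[1+L]>0 : ∀ L → 0ℚ < # 2 * (1ℚ + ι L)
    2[1+L]>0 L = 0<* (lit< 0ℚ (# 2)) (0<+ (lit< 0ℚ 1ℚ) (ι≥0 L))

    β≥0 : ∀ L → 0ℚ ≤ β L
    β≥0 zero = lit 1ℚ
    β≥0 (suc L) = *-cancel (2[1+L]>0 L) (≤-trans (≤-reflexive (*-zeroʳ (# 2 * (1ℚ + ι L)))) (≤-trans ((lit (# 2) ⊠ ι≥0 L ⊹ lit 1ℚ) ⊠ β≥0 L) (≤-reflexive (sym (β-suc L)))))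

    β≤1 : ∀ L → β L ≤ 1ℚ
    β≤1 zero = ≤-refl
    β≤1 (suc L) = ≤-trans (*-cancel (2[1+L]>0 L) (≤-trans (≤-reflexive (β-suc L)) (≤by (β≥0 L) (e (ι L) (β L))))) (β≤1 L)
      where e = ring 2 (λ L b → (:# 2 :* L :+ con 1ℚ) :* b :+ b := :# 2 :* (con 1ℚ :+ L) :* b) refl

    -- From 4L(L + 1) ≤ (2L + 1)². The increasing sequence L β² tends to 1/π and serves to compare β
    -- at different exponents of the same order.
    Lβ²-step : ∀ L → ι L * (β L * β L) ≤ ι (suc L) * (β (suc L) * β (suc L))
    Lβ²-step L = *-cancel (0<* (lit< 0ℚ (# 4)) (0<+ (lit< 0ℚ 1ℚ) (ι≥0 L))) (≤-trans (≤by (sq≥0 (β L)) (e (ι L) (β L)))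
        (≤-reflexive (trans (sym (cong₂ _*_ (β-suc L) (β-suc L))) (e₁ (ι L) (β (suc L))))))
      where e = ring 2 (λ L b → :# 4 :* (con 1ℚ :+ L) :* (L :* (b :* b)) :+ b :* b := (:# 2 :* L :+ con 1ℚ) :* b :* ((:# 2 :* L :+ con 1ℚ) :* b)) refl
            e₁ = ring 2 (λ L b → :# 2 :* (con 1ℚ :+ L) :* b :* (:# 2 :* (con 1ℚ :+ L) :* b) := :# 4 :* (con 1ℚ :+ L) :* ((con 1ℚ :+ L) :* (b :* b))) refl

    Lβ²-mono : ∀ L d → ι L * (β L * β L) ≤ ι (d ℕ.+ L) * (β (d ℕ.+ L) * β (d ℕ.+ L))
    Lβ²-mono L zero = ≤-refl
    Lβ²-mono L (suc d) = ≤-trans (Lβ²-mono L d) (Lβ²-step (d ℕ.+ L))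

    Lβ²≤ : ∀ {L L′} → L ℕ.≤ L′ → ι L * (β L * β L) ≤ ι L′ * (β L′ * β L′)
    Lβ²≤ {L} {L′} p = subst (λ k → ι L * (β L * β L) ≤ ι k * (β k * β k)) (ℕ.m∸n+n≡m p) (Lβ²-mono L (L′ ℕ.∸ L))

    -- L β² equals 1/4 at L = 1 and increases, and β ≤ 1.
    1≤4Lβ : ∀ {L} → 1 ℕ.≤ L → 1ℚ ≤ # 4 * ι L * β L
    1≤4Lβ {L} p = ≤-trans (*-monoˡ (lit (# 4)) (Lβ²≤ p)) (≤by (lit (# 4) ⊠ ι≥0 L ⊠ (β≥0 L ⊠ diff (β≤1 L))) (e (ι L) (β L)))
      where e = ring 2 (λ L b → :# 4 :* (L :* (b :* b)) :+ :# 4 :* L :* (b :* (con 1ℚ :- b)) := :# 4 :* L :* b) refl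

    D>0 : ∀ L j → 0ℚ < 1ℚ + ι L + ι j
    D>0 L j = 0<+ (0<+ (lit< 0ℚ 1ℚ) (ι≥0 L)) (ι≥0 j)

    mom≥0 : ∀ L j → 0ℚ ≤ mom L j
    mom≥0 L zero = β≥0 L
    mom≥0 L (suc j) = *-cancel (D>0 L j) (≤-trans (≤-reflexive (*-zeroʳ (1ℚ + ι L + ι j))) (≤-trans ((lit (# 4) ⊠ ι≥0 j ⊹ lit (# 2)) ⊠ mom≥0 L j) (≤-reflexive (sym (proj₂ (mom-ratio j L))))))

    mom-step : ∀ L j {a} → 0ℚ ≤ a → 1ℚ ≤ a * (1ℚ + ι L) → mom L (suc j) ≤ a * ((# 4 * ι j + # 2) * mom L j)
    mom-step L j {a} a0 h = ≤-trans (≤by (mom≥0 L (suc j) ⊠ (diff h ⊹ a0 ⊠ ι≥0 j)) (e a (ι L) (ι j) (mom L (suc j)))) (≤-reflexive (cong (a *_) (proj₂ (mom-ratio j L))))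
      where e = ring 4 (λ a L j M → M :+ M :* (a :* (con 1ℚ :+ L) :- con 1ℚ :+ a :* j) := a :* ((con 1ℚ :+ L :+ j) :* M)) refl

  -- x^9 0.38^x decreases for x ≥ 90.
  tiny : ∀ d → (1ℚ + ι (d ℕ.+ 90)) ^ 9 * (38 ÷′ 100) ^ (d ℕ.+ 90) ≤ (# 91) ^ 9 * (38 ÷′ 100) ^ 90
  tiny zero = ≤-reflexive refl
  tiny (suc d) = ≤-trans (≤-trans (*-monoʳ (lit (38 ÷′ 100) ⊠ ^≥0 (d ℕ.+ 90) (lit (38 ÷′ 100))) (≤-trans (^-mono 9 (lit 1ℚ ⊹ (lit 1ℚ ⊹ ι≥0 (d ℕ.+ 90))) up) (≤-reflexive (^-* (92 ÷′ 91) (1ℚ + ι (d ℕ.+ 90)) 9))))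
      (≤by (^≥0 9 (lit 1ℚ ⊹ ι≥0 (d ℕ.+ 90)) ⊠ ^≥0 (d ℕ.+ 90) (lit (38 ÷′ 100)) ⊠ diff (lit≤ ((92 ÷′ 91) ^ 9 * (38 ÷′ 100)) 1ℚ)) (e ((92 ÷′ 91) ^ 9) ((1ℚ + ι (d ℕ.+ 90)) ^ 9) ((38 ÷′ 100) ^ (d ℕ.+ 90)) (38 ÷′ 100)))) (tiny d)
    where
    e = ring 4 (λ u X Z k → u :* X :* (k :* Z) :+ X :* Z :* (con 1ℚ :- u :* k) := X :* Z) refl
    ≥90 : # 90 ≤ ι (d ℕ.+ 90)
    ≥90 = ≤-trans (≤-reflexive (sym (ι-lit 90))) (ι-mono (ℕ.m≤n+m 90 d))
    up : 1ℚ + ι (suc d ℕ.+ 90) ≤ 92 ÷′ 91 * (1ℚ + ι (d ℕ.+ 90))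
    up = ≤by (lit (1 ÷′ 91) ⊠ diff ≥90) (e₁ (ι (d ℕ.+ 90)))
      where e₁ = ring 1 (λ x → con 1ℚ :+ (con 1ℚ :+ x) :+ 1 :/ 91 :* (x :- :# 90) := 92 :/ 91 :* (con 1ℚ :+ x)) refl

  mean-lin₄ : ∀ {f₁ f₂ f₃ f₄ t₁ t₂ t₃ t₄} a b c d → HasMean f₁ t₁ → HasMean f₂ t₂ → HasMean f₃ t₃ → HasMean f₄ t₄ →
              HasMean (λ x → 1ℚ * (a * f₁ x + b * f₂ x) + 1ℚ * (c * f₃ x + d * f₄ x)) (1ℚ * (a * t₁ + b * t₂) + 1ℚ * (c * t₃ + d * t₄))
  mean-lin₄ a b c d p₁ p₂ p₃ p₄ = mean-lin 1ℚ 1ℚ (mean-lin a b p₁ p₂) (mean-lin c d p₃ p₄)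

  -- `K` truncates the parts. `K-large` and `z-small` make the truncated sums nearly complete, while
  -- `K≤` keeps `K` small against m³, so that rounding once per factor is harmless.
  module Window (m : ℚ) (m≥250 : # 250 ≤ m) (K : ℕ) (K-large : # 40 * m ≤ ι K)
    (z-small : Scale.z m m≥250 K * ((ι K * ι K) * (ι K * ι K * (ι K * ι K))) ≤ # 2304 * (m * m * (m * m * (m * m))))
    (K≤ : ι K ≤ 21 ÷′ 10 * (m * m)) where
    open Scale m m≥250


    -- Truncated variances and third moments

    κ : ℚ
    κ = ι K

    κ≥0 = ι≥0 K
    m²≥0 = m≥0 ⊠ m≥0
    R = z K
    R≥0 = z≥0 K

    -- r^K κ² ≤ 2304/40⁴ m², since κ ≥ 40 m.
    40² : # 1600 * (m * m) ≤ κ * κ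
    40² = ≤-trans (≤-reflexive (e m)) (*-mono (lit (# 40) ⊠ m≥0) K-large (lit (# 40) ⊠ m≥0) K-large)
      where e = ring 1 (λ m → :# 1600 :* (m :* m) := :# 40 :* m :* (:# 40 :* m)) refl

    40⁴ : # 2560000 * (m * m * (m * m)) ≤ κ * κ * (κ * κ)
    40⁴ = ≤-trans (≤-reflexive (e m)) (*-mono (lit (# 1600) ⊠ m²≥0) 40² (lit (# 1600) ⊠ m²≥0) 40²)
      where e = ring 1 (λ m → :# 2560000 :* (m :* m :* (m :* m)) := :# 1600 :* (m :* m) :* (:# 1600 :* (m :* m))) refl

    m²>0 = 0<* m>0 m>0

    Rκ² : R * (κ * κ) ≤ 9 ÷′ 10000 * (m * m)
    Rκ² = *-cancel (0<* (lit< 0ℚ (# 2560000)) (0<* m²>0 m²>0))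
       (≤-trans (≤by (R≥0 ⊠ (κ≥0 ⊠ κ≥0) ⊠ diff 40⁴) (e₀ (m * m * (m * m)) R (κ * κ) (κ * κ * (κ * κ)))) (≤-trans z-small (≤-reflexive (e₁ m))))
      where e₀ = ring 4 (λ M R k q → :# 2560000 :* M :* (R :* k) :+ R :* k :* (q :- :# 2560000 :* M) := R :* (k :* q)) refl
            e₁ = ring 1 (λ m → :# 2304 :* (m :* m :* (m :* m :* (m :* m))) := :# 2560000 :* (m :* m :* (m :* m)) :* (9 :/ 10000 :* (m :* m))) refl

    R≤ : R ≤ 1 ÷′ 1000000
    R≤ = *-cancel (0<* (lit< 0ℚ (# 1600)) m²>0) (≤-trans (≤by (R≥0 ⊠ diff 40²) (e₀ (m * m) R (κ * κ))) (≤-trans Rκ² (≤by (lit (7 ÷′ 10000) ⊠ m²≥0) (e₁ (m * m)))))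
      where e₀ = ring 3 (λ M R k → :# 1600 :* M :* R :+ R :* (k :- :# 1600 :* M) := R :* k) refl
            e₁ = ring 1 (λ M → 9 :/ 10000 :* M :+ 7 :/ 10000 :* M := :# 1600 :* M :* (1 :/ 1000000)) refl

    Rκ : R * κ ≤ 1 ÷′ 40000 * m
    Rκ = *-cancel (0<* (lit< 0ℚ (# 40)) m>0) (≤-trans (≤by (R≥0 ⊠ κ≥0 ⊠ diff K-large) (e₀ m R κ)) (≤-trans Rκ² (≤by (lit (1 ÷′ 10000) ⊠ m²≥0) (e₁ m))))
      where e₀ = ring 3 (λ m R k → :# 40 :* m :* (R :* k) :+ R :* k :* (k :- :# 40 :* m) := R :* (k :* k)) refl
            e₁ = ring 1 (λ m → 9 :/ 10000 :* (m :* m) :+ 1 :/ 10000 :* (m :* m) := :# 40 :* m :* (1 :/ 40000 :* m)) refl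

    m³≥0 = m≥0 ⊠ m≥0 ⊠ m≥0

    tail₂ : R * (κ * κ * m + # 2 * κ * (m * m) + m * m + # 2 * (m * m * m)) ≤ 1 ÷′ 1000 * (m * m * m)
    tail₂ = ≤by (lit (21 ÷′ 20) ⊠ m≥0 ⊠ diff Rκ² ⊹ lit (501 ÷′ 250) ⊠ m³≥0 ⊠ diff R≤ ⊹ R≥0 ⊠ (lit (1 ÷′ 20) ⊠ κ≥0 ⊠ m≥0 ⊠ diff K-large)
       ⊹ R≥0 ⊠ (lit (1 ÷′ 250) ⊠ m²≥0 ⊠ diff m≥250) ⊹ lit (1 ÷′ 1000 - 945 ÷′ 1000000 - 501 ÷′ 250000000) ⊠ m³≥0) (e m R κ)
      where e = ring 3 (λ m R k → R :* (k :* k :* m :+ :# 2 :* k :* (m :* m) :+ m :* m :+ :# 2 :* (m :* m :* m)) :+ (21 :/ 20 :* m :* (9 :/ 10000 :* (m :* m) :- R :* (k :* k)) :+ 501 :/ 250 :* (m :* m :* m) :* (1 :/ 1000000 :- R) :+ R :* (1 :/ 20 :* k :* m :* (k :- :# 40 :* m)) :+ R :* (1 :/ 250 :* (m :* m) :* (m :- :# 250)) :+ (1 :/ 1000 :- 945 :/ 1000000 :- 501 :/ 250000000) :* (m :* m :* m)) := 1 :/ 1000 :* (m :* m :* m)) refl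

    m⁴≥0 = m²≥0 ⊠ m²≥0

    tail₃ : R * R * (κ * κ * κ * m + # 3 * (κ * κ) * (m * m) + # 6 * κ * (m * m * m) + # 6 * (m * m * (m * m))) ≤ 1 ÷′ 1000 * (m * m * (m * m))
    tail₃ = ≤-trans (≤-reflexive (e₀ m R κ)) (≤-trans (+-mono-≤ (+-mono-≤ (+-mono-≤
         (*-monoˡ m≥0 (*-mono (R≥0 ⊠ (κ≥0 ⊠ κ≥0)) Rκ² (R≥0 ⊠ κ≥0) Rκ))
         (*-monoˡ (lit (# 3) ⊠ m²≥0) (*-mono R≥0 R≤ (R≥0 ⊠ (κ≥0 ⊠ κ≥0)) Rκ²)))
         (*-monoˡ (lit (# 6) ⊠ m³≥0) (*-mono R≥0 R≤ (R≥0 ⊠ κ≥0) Rκ)))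
         (*-monoˡ (lit (# 6) ⊠ m⁴≥0) (*-mono R≥0 R≤ R≥0 R≤)))
       (≤by (lit d ⊠ m⁴≥0) (e₁ m)))
      where d = 1 ÷′ 1000 - 9 ÷′ 400000000 - 27 ÷′ 10000000000 - 6 ÷′ 40000000000 - 6 ÷′ 1000000000000
            e₀ = ring 3 (λ m R k → R :* R :* (k :* k :* k :* m :+ :# 3 :* (k :* k) :* (m :* m) :+ :# 6 :* k :* (m :* m :* m) :+ :# 6 :* (m :* m :* (m :* m))) := m :* (R :* (k :* k) :* (R :* k)) :+ :# 3 :* (m :* m) :* (R :* (R :* (k :* k))) :+ :# 6 :* (m :* m :* m) :* (R :* (R :* k)) :+ :# 6 :* (m :* m :* (m :* m)) :* (R :* R)) refl
            e₁ = ring 1 (λ m → m :* (9 :/ 10000 :* (m :* m) :* (1 :/ 40000 :* m)) :+ :# 3 :* (m :* m) :* (1 :/ 1000000 :* (9 :/ 10000 :* (m :* m))) :+ :# 6 :* (m :* m :* m) :* (1 :/ 1000000 :* (1 :/ 40000 :* m)) :+ :# 6 :* (m :* m :* (m :* m)) :* (1 :/ 1000000 :* (1 :/ 1000000)) :+ (1 :/ 1000 :- 9 :/ 400000000 :- 27 :/ 10000000000 :- 6 :/ 40000000000 :- 6 :/ 1000000000000) :* (m :* m :* (m :* m)) := 1 :/ 1000 :* (m :* m :* (m :* m))) refl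

    E≥0 = ≤-trans (lit 1ℚ) E≥1
    R₂ = (r * r) ^ K

    R₂≡ : R₂ ≡ R * R
    R₂≡ = sym (zz K)

    E-1≥0 = diff E≥1
    E-1≤m : E - 1ℚ ≤ m
    E-1≤m = ≤-trans (≤by (lit 1ℚ) (e E)) E≤m
      where e = ring 1 (λ E → E :- con 1ℚ :+ con 1ℚ := E) refl
    twoE-1≥0 : 0ℚ ≤ # 2 * E - 1ℚ
    twoE-1≥0 = subst (0ℚ ≤_) (e E) (E≥0 ⊹ E-1≥0)
      where e = ring 1 (λ E → E :+ (E :- con 1ℚ) := :# 2 :* E :- con 1ℚ) refl
    twoE-1≤m : # 2 * E - 1ℚ ≤ m
    twoE-1≤m = ≤by (diff E≤) (e m E)
      where e = ring 2 (λ m E → :# 2 :* E :- con 1ℚ :+ (m :+ con 1ℚ :- :# 2 :* E) := m) refl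
    ½m-1≥0 : 0ℚ ≤ ½ * m - 1ℚ
    ½m-1≥0 = subst (0ℚ ≤_) (e m) (lit ½ ⊠ diff m≥250 ⊹ lit (# 124))
      where e = ring 1 (λ m → con ½ :* (m :- :# 250) :+ :# 124 := con ½ :* m :- con 1ℚ) refl
    m-1≥0 = diff m≥1
    ½m-1≤ : ½ * m - 1ℚ ≤ E - 1ℚ
    ½m-1≤ = +-monoˡ-≤ (- 1ℚ) E≥
    m-1≤ : m - 1ℚ ≤ # 2 * E - 1ℚ
    m-1≤ = ≤by (lit (# 2) ⊠ diff E≥) (e m E)
      where e = ring 2 (λ m E → m :- con 1ℚ :+ :# 2 :* (E :- con ½ :* m) := :# 2 :* E :- con 1ℚ) refl

    B₂≤ : S₂.B ≤ m * m
    B₂≤ = *-mono E≥0 E≤m E-1≥0 E-1≤m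
    C₂≤ : S₂.C ≤ m * m * m
    C₂≤ = *-mono (E≥0 ⊠ E-1≥0) B₂≤ twoE-1≥0 twoE-1≤m
    C₂≥ : ½ * m * (½ * m - 1ℚ) * (m - 1ℚ) ≤ S₂.C
    C₂≥ = *-mono (lit ½ ⊠ m≥0 ⊠ ½m-1≥0) (*-mono (lit ½ ⊠ m≥0) E≥ ½m-1≥0 ½m-1≤) m-1≥0 m-1≤
    D₂≥ : ½ * m * (½ * m - 1ℚ) * (# 6 * (½ * m * (½ * m - 1ℚ)) + 1ℚ) ≤ S₂.D
    D₂≥ = *-mono h0 h (lit (# 6) ⊠ h0 ⊹ lit 1ℚ) (≤-trans (+-monoˡ-≤ 1ℚ (*-monoˡ (lit (# 6)) h)) (≤-reflexive (e E)))
      where h0 = lit ½ ⊠ m≥0 ⊠ ½m-1≥0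
            h = *-mono (lit ½ ⊠ m≥0) E≥ ½m-1≥0 ½m-1≤
            e = ring 1 (λ E → :# 6 :* (E :* (E :- con 1ℚ)) :+ con 1ℚ := :# 6 :* (E :* E) :- :# 6 :* E :+ con 1ℚ) refl
    D₂≤ : S₂.D ≤ # 6 * (m * m * (m * m))
    D₂≤ = ≤-trans (*-mono (E≥0 ⊠ E-1≥0) B₂≤ six≥0 six≤) (≤-reflexive (e m))
      where e = ring 1 (λ m → m :* m :* (:# 6 :* (m :* m)) := :# 6 :* (m :* m :* (m :* m))) refl
            e₁ = ring 1 (λ E → :# 6 :* (E :* (E :- con 1ℚ)) :+ con 1ℚ := :# 6 :* (E :* E) :- :# 6 :* E :+ con 1ℚ) refl
            six≥0 = subst (0ℚ ≤_) (e₁ E) (lit (# 6) ⊠ (E≥0 ⊠ E-1≥0) ⊹ lit 1ℚ)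
            e₂ = ring 2 (λ E m → :# 6 :* (E :* E) :- :# 6 :* E :+ con 1ℚ :+ (:# 6 :* ((m :- E) :* E :+ m :* (m :- E)) :+ :# 6 :* (E :- con 1ℚ) :+ :# 5) := :# 6 :* (m :* m)) refl
            six≤ = ≤by (lit (# 6) ⊠ (diff E≤m ⊠ E≥0 ⊹ m≥0 ⊠ diff E≤m) ⊹ lit (# 6) ⊠ E-1≥0 ⊹ lit (# 5)) (e₂ E m)

    ω-split : ∀ (a : ℕ → ℚ) → (∀ k → 0ℚ ≤ a k) → ∑ (λ k → a k * ω k) K ≤ ∑ (λ k → a k * z k) K - 3 ÷′ 4 * ∑ (λ k → a k * (r * r) ^ k) K
    ω-split a a≥0 = ≤-trans (∑-mono K (λ k → ≤-trans (*-monoˡ (a≥0 k) (ω≤ k)) (≤-reflexive (trans (cong (λ t → a k * (z k - 3 ÷′ 4 * t)) (zz k)) (e₀ (a k) (z k) ((r * r) ^ k))))))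
       (≤-reflexive (trans (∑-lin 1ℚ (- (3 ÷′ 4)) (λ k → a k * z k) (λ k → a k * (r * r) ^ k) K) (e₁ (∑ (λ k → a k * z k) K) (∑ (λ k → a k * (r * r) ^ k) K))))
      where e₀ = ring 3 (λ k z y → k :* (z :- 3 :/ 4 :* y) := con 1ℚ :* (k :* z) :+ (:- (3 :/ 4)) :* (k :* y)) refl
            e₁ = ring 2 (λ P Q → con 1ℚ :* P :+ (:- (3 :/ 4)) :* Q := P :- 3 :/ 4 :* Q) refl

    R≤1 : R ≤ 1ℚ
    R≤1 = z≤1 K

    R₂≤R : R₂ ≤ R
    R₂≤R = ≤-trans (≤-reflexive R₂≡) (≤-trans (*-monoˡ R≥0 R≤1) (≤-reflexive (*-identityʳ R)))

    mix≤ : ∀ {P Q P₀ Q₀ T u X} → P + T ≡ P₀ → 0ℚ ≤ T → Q + u ≡ Q₀ → P₀ - 3 ÷′ 4 * (Q₀ - u) ≤ X → P - 3 ÷′ 4 * Q ≤ X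
    mix≤ {P} {Q} {P₀} {Q₀} {T} {u} p T0 q h = ≤-trans (≤by T0 (trans (e P Q T) (cong₂ (λ a b → a - 3 ÷′ 4 * b) p (trans (e′ Q u) (cong (_- u) q))))) h
      where e = ring 3 (λ P Q T → P :- 3 :/ 4 :* Q :+ T := P :+ T :- 3 :/ 4 :* Q) refl
            e′ = ring 2 (λ Q u → Q := Q :+ u :- u) refl

    S₁B≥0 = m≥0 ⊠ m-1≥0
    2m-1≥0 = <⇒≤ 2m-1>0
    S₁C≥0 = S₁B≥0 ⊠ 2m-1≥0
    S₁D≥0 : 0ℚ ≤ S₁.D
    S₁D≥0 = subst (0ℚ ≤_) (e m) (S₁B≥0 ⊠ (lit (# 6) ⊠ S₁B≥0 ⊹ lit 1ℚ))
      where e = ring 1 (λ m → m :* (m :- con 1ℚ) :* (:# 6 :* (m :* (m :- con 1ℚ)) :+ con 1ℚ) := m :* (m :- con 1ℚ) :* (:# 6 :* (m :* m) :- :# 6 :* m :+ con 1ℚ)) refl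

    S₂A≤ : S₂.A ≤ m
    S₂A≤ = E-1≤m

    -- The two geometric sums give about 2 - (3/4)(1/4) = 1.8125; the true constant is π²/6, about
    -- 1.645.
    ∑k²ω≤ : ∑ (λ k → ι k * ι k * ω k) K ≤ 182 ÷′ 100 * (m * m * m)
    ∑k²ω≤ = ≤-trans (ω-split (λ k → ι k * ι k) (λ k → ι≥0 k ⊠ ι≥0 k))
       (mix≤ {∑ (λ k → ι k * ι k * z k) K} {∑ (λ k → ι k * ι k * (r * r) ^ k) K} (S₁.sum₂ K) (R≥0 ⊠ (κ≥0 ⊠ κ≥0 ⊠ m-1≥0 ⊹ lit (# 2) ⊠ κ≥0 ⊠ S₁B≥0 ⊹ S₁C≥0)) (S₂.sum₂ K)
        (≤by (lit (3 ÷′ 4) ⊠ diff C₂≥ ⊹ lit (3 ÷′ 4) ⊠ diff tl ⊹ lit (27 ÷′ 4000) ⊠ m³≥0 ⊹ lit (29 ÷′ 16) ⊠ m²≥0 ⊹ lit (5 ÷′ 8) ⊠ S₁B≥0)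
          (e m S₂.C (R₂ * (κ * κ * S₂.A + # 2 * κ * S₂.B + S₂.C)))))
      where
      tl : R₂ * (κ * κ * S₂.A + # 2 * κ * S₂.B + S₂.C) ≤ 1 ÷′ 1000 * (m * m * m)
      tl = ≤-trans (*-mono (^≥0 K (r≥0 ⊠ r≥0)) R₂≤R (κ≥0 ⊠ κ≥0 ⊠ E-1≥0 ⊹ lit (# 2) ⊠ κ≥0 ⊠ (E≥0 ⊠ E-1≥0) ⊹ E≥0 ⊠ E-1≥0 ⊠ twoE-1≥0)
         (≤by (κ≥0 ⊠ κ≥0 ⊠ diff S₂A≤ ⊹ lit (# 2) ⊠ κ≥0 ⊠ diff B₂≤ ⊹ diff C₂≤ ⊹ m²≥0 ⊹ m³≥0) (e₁ κ m S₂.A S₂.B S₂.C))) tail₂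
        where e₁ = ring 5 (λ k m A B C → k :* k :* A :+ :# 2 :* k :* B :+ C :+ (k :* k :* (m :- A) :+ :# 2 :* k :* (m :* m :- B) :+ (m :* m :* m :- C) :+ m :* m :+ m :* m :* m) := k :* k :* m :+ :# 2 :* k :* (m :* m) :+ m :* m :+ :# 2 :* (m :* m :* m)) refl
      e = ring 3 (λ m C u → m :* (m :- con 1ℚ) :* (:# 2 :* m :- con 1ℚ) :- 3 :/ 4 :* (C :- u) :+ (3 :/ 4 :* (C :- con ½ :* m :* (con ½ :* m :- con 1ℚ) :* (m :- con 1ℚ)) :+ 3 :/ 4 :* (1 :/ 1000 :* (m :* m :* m) :- u) :+ 27 :/ 4000 :* (m :* m :* m) :+ 29 :/ 16 :* (m :* m) :+ 5 :/ 8 :* (m :* (m :- con 1ℚ))) := 182 :/ 100 :* (m :* m :* m)) refl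

    -- Here the two sums give about 6 - (3/4)(3/8) = 5.71875.
    ∑k³ω≤ : ∑ (λ k → ι k * ι k * ι k * ω k) K ≤ 573 ÷′ 100 * (m * m * (m * m))
    ∑k³ω≤ = ≤-trans (ω-split (λ k → ι k * ι k * ι k) (λ k → ι≥0 k ⊠ ι≥0 k ⊠ ι≥0 k))
       (mix≤ {∑ (λ k → ι k * ι k * ι k * z k) K} {∑ (λ k → ι k * ι k * ι k * (r * r) ^ k) K} (S₁.sum₃ K) (R≥0 ⊠ (κ≥0 ⊠ κ≥0 ⊠ κ≥0 ⊠ m-1≥0 ⊹ lit (# 3) ⊠ (κ≥0 ⊠ κ≥0) ⊠ S₁B≥0 ⊹ lit (# 3) ⊠ κ≥0 ⊠ S₁C≥0 ⊹ S₁D≥0)) (S₂.sum₃ K)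
        (≤by (lit (3 ÷′ 4) ⊠ diff D₂≥ ⊹ lit (3 ÷′ 4) ⊠ diff tl ⊹ lit (21 ÷′ 2000) ⊠ m⁴≥0 ⊹ lit (83 ÷′ 16) ⊠ m³≥0 ⊹ lit (91 ÷′ 16) ⊠ (m²≥0 ⊠ m-1≥0) ⊹ lit (5 ÷′ 8) ⊠ m≥0)
          (e m S₂.D (R₂ * (κ * κ * κ * S₂.A + # 3 * (κ * κ) * S₂.B + # 3 * κ * S₂.C + S₂.D)))))
      where
      tl : R₂ * (κ * κ * κ * S₂.A + # 3 * (κ * κ) * S₂.B + # 3 * κ * S₂.C + S₂.D) ≤ 1 ÷′ 1000 * (m * m * (m * m))
      tl = ≤-trans (≤-trans (*-monoʳ (κ≥0 ⊠ κ≥0 ⊠ κ≥0 ⊠ E-1≥0 ⊹ lit (# 3) ⊠ (κ≥0 ⊠ κ≥0) ⊠ (E≥0 ⊠ E-1≥0) ⊹ lit (# 3) ⊠ κ≥0 ⊠ (E≥0 ⊠ E-1≥0 ⊠ twoE-1≥0) ⊹ D₂≥0) (≤-reflexive R₂≡))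
         (*-monoˡ (R≥0 ⊠ R≥0)
         (≤by (κ≥0 ⊠ κ≥0 ⊠ κ≥0 ⊠ diff S₂A≤ ⊹ lit (# 3) ⊠ (κ≥0 ⊠ κ≥0) ⊠ diff B₂≤ ⊹ lit (# 3) ⊠ κ≥0 ⊠ diff C₂≤ ⊹ diff D₂≤ ⊹ lit (# 3) ⊠ κ≥0 ⊠ m³≥0) (e₁ κ m S₂.A S₂.B S₂.C S₂.D)))) tail₃
        where e₁ = ring 6 (λ k m A B C D → k :* k :* k :* A :+ :# 3 :* (k :* k) :* B :+ :# 3 :* k :* C :+ D :+ (k :* k :* k :* (m :- A) :+ :# 3 :* (k :* k) :* (m :* m :- B) :+ :# 3 :* k :* (m :* m :* m :- C) :+ (:# 6 :* (m :* m :* (m :* m)) :- D) :+ :# 3 :* k :* (m :* m :* m)) := k :* k :* k :* m :+ :# 3 :* (k :* k) :* (m :* m) :+ :# 6 :* k :* (m :* m :* m) :+ :# 6 :* (m :* m :* (m :* m))) refl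
              D₂≥0 = ≤-trans (lit ½ ⊠ m≥0 ⊠ ½m-1≥0 ⊠ (lit (# 6) ⊠ (lit ½ ⊠ m≥0 ⊠ ½m-1≥0) ⊹ lit 1ℚ)) D₂≥
      e = ring 3 (λ m D u → m :* (m :- con 1ℚ) :* (:# 6 :* (m :* m) :- :# 6 :* m :+ con 1ℚ) :- 3 :/ 4 :* (D :- u) :+ (3 :/ 4 :* (D :- con ½ :* m :* (con ½ :* m :- con 1ℚ) :* (:# 6 :* (con ½ :* m :* (con ½ :* m :- con 1ℚ)) :+ con 1ℚ)) :+ 3 :/ 4 :* (1 :/ 1000 :* (m :* m :* (m :* m)) :- u) :+ 21 :/ 2000 :* (m :* m :* (m :* m)) :+ 83 :/ 16 :* (m :* m :* m) :+ 91 :/ 16 :* (m :* m :* (m :- con 1ℚ)) :+ 5 :/ 8 :* m) := 573 :/ 100 :* (m :* m :* (m :* m))) refl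

    -- Decay of the modulus of ψ

    -- Lower bounds for ∑ ω_k W k on the three ranges of w, in terms of Y = m² w.
    module Zones (x : Point) where
      open Point x
      module V₁ = S₁.Wave x
      module V₂ = S₂.Wave x

      w≥0 = W≥0 (ℤ.+ 1)

      Y : ℚ
      Y = m * m * w

      Y≥0 : 0ℚ ≤ Y
      Y≥0 = m²≥0 ⊠ w≥0

      S : ℚ
      S = ∑ (λ k → ω k * W (ℤ.+ k)) K

      WS₁≥0 : 0ℚ ≤ V₁.WS K
      WS₁≥0 = ∑≥0 K (λ k → z≥0 k ⊠ W≥0 (ℤ.+ k))

      S≥ : 8 ÷′ 9 * V₁.WS K - V₂.WS K ≤ S
      S≥ = ≤-trans (≤-reflexive (trans (e (V₁.WS K) (V₂.WS K)) (sym (∑-lin (8 ÷′ 9) (- 1ℚ) (λ k → z k * W (ℤ.+ k)) (λ k → (r * r) ^ k * W (ℤ.+ k)) K))))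
         (∑-mono K (λ k → ≤-trans (≤-reflexive (trans (cong (λ t → 8 ÷′ 9 * (z k * W (ℤ.+ k)) + (- 1ℚ) * (t * W (ℤ.+ k))) (sym (zz k))) (e₁ (z k) (W (ℤ.+ k))))) (*-monoʳ (W≥0 (ℤ.+ k)) (≤ω k))))
        where e = ring 2 (λ a b → 8 :/ 9 :* a :- b := 8 :/ 9 :* a :+ (:- con 1ℚ) :* b) refl
              e₁ = ring 2 (λ z W → 8 :/ 9 :* (z :* W) :+ (:- con 1ℚ) :* (z :* z :* W) := (8 :/ 9 :* z :- z :* z) :* W) refl

      main₁ : V₁.Δ * V₁.WS K + V₁.rest K ≡ r * w * (# 2 * m - 1ℚ)
      main₁ = trans (V₁.WS-rest K) (trans (e r m V₁.c₁) (trans (cong (λ t → # 2 * (# 1 - r) * (m - # 1 - t) + r * (# 2 - # 2 * V₁.c₁) * (# 2 * m - # 1)) rm) (e′ r m (r * (# 2 - # 2 * V₁.c₁) * (# 2 * m - # 1)))))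
        where e = ring 3 (λ r m c → :# 2 :* (m :- con 1ℚ) :* ((con 1ℚ :- r) :* (con 1ℚ :- r) :+ r :* (:# 2 :- :# 2 :* c)) :- :# 2 :* r :* (c :- r) := :# 2 :* (:# 1 :- r) :* (m :- :# 1 :- r :* m) :+ r :* (:# 2 :- :# 2 :* c) :* (:# 2 :* m :- :# 1)) refl
              e′ = ring 3 (λ r m a → :# 2 :* (:# 1 :- r) :* (m :- :# 1 :- (m :- con 1ℚ)) :+ a := a) refl

      main₂ : V₂.Δ * V₂.WS K + V₂.rest K ≡ r * r * w * (# 2 * E - 1ℚ)
      main₂ = trans (V₂.WS-rest K) (trans (e (r * r) E V₂.c₁) (trans (cong (λ t → # 2 * (# 1 - r * r) * (E - # 1 - t) + r * r * (# 2 - # 2 * V₂.c₁) * (# 2 * E - # 1)) r²E) (e′ (r * r) E (r * r * (# 2 - # 2 * V₂.c₁) * (# 2 * E - # 1)))))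
        where e = ring 3 (λ r m c → :# 2 :* (m :- con 1ℚ) :* ((con 1ℚ :- r) :* (con 1ℚ :- r) :+ r :* (:# 2 :- :# 2 :* c)) :- :# 2 :* r :* (c :- r) := :# 2 :* (:# 1 :- r) :* (m :- :# 1 :- r :* m) :+ r :* (:# 2 :- :# 2 :* c) :* (:# 2 :* m :- :# 1)) refl
              e′ = ring 3 (λ r m a → :# 2 :* (:# 1 :- r) :* (m :- :# 1 :- (m :- con 1ℚ)) :+ a := a) refl

      -- (1 + Y) ∑ z W is at least 1.987 m³ w, and 1.988 m Y up to m/1000 for large w; (4 + Y) ∑ z² W ≤ m Y.
      Δ₁ : m * m * V₁.Δ ≡ 1ℚ + r * Y
      Δ₁ = trans (e m s w) (cong (λ t → t * t + r * Y) ms)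
        where e = ring 3 (λ m s w → m :* m :* ((con 1ℚ :- (con 1ℚ :- s)) :* (con 1ℚ :- (con 1ℚ :- s)) :+ (con 1ℚ :- s) :* w) := m :* s :* (m :* s) :+ (con 1ℚ :- s) :* (m :* m :* w)) refl

      rw≥ : m * (# 2 * m - # 3) * w ≤ m * (r * w * (# 2 * m - 1ℚ))
      rw≥ = ≤by w≥0 (trans (e₀ m w) (trans (cong (λ t → t * w * (# 2 * m - 1ℚ)) (sym rm)) (e₁ r m w)))
        where e₀ = ring 2 (λ m w → m :* (:# 2 :* m :- :# 3) :* w :+ w := (m :- con 1ℚ) :* w :* (:# 2 :* m :- con 1ℚ)) refl
              e₁ = ring 3 (λ r m w → r :* m :* w :* (:# 2 :* m :- con 1ℚ) := m :* (r :* w :* (:# 2 :* m :- con 1ℚ))) refl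

      near-rest : m * m * V₁.rest K ≤ 1 ÷′ 1000 * (m * m * m) * w
      near-rest = ≤-trans (*-monoˡ m²≥0 (V₁.rest≤w r≤1 m≥1 K)) (≤-trans (≤-reflexive (trans (e₀ m s R κ w) (trans (cong (λ t → R * (κ * κ * m * t + # 2 * κ * (m * m) + m * m + # 2 * (m * m * m)) * w) ms) (cong (λ t → R * (t + # 2 * κ * (m * m) + m * m + # 2 * (m * m * m)) * w) (*-identityʳ (κ * κ * m)))))) (*-monoʳ w≥0 tail₂))
        where e₀ = ring 5 (λ m s R k w → m :* m :* (R :* (w :* (:# 2 :* m :+ :# 2 :* k :+ con 1ℚ :+ k :* k :* (con 1ℚ :- (con 1ℚ :- s))))) := R :* (k :* k :* m :* (m :* s) :+ :# 2 :* k :* (m :* m) :+ m :* m :+ :# 2 :* (m :* m :* m)) :* w) refl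

      near₁ : 1987 ÷′ 1000 * (m * m * m) * w ≤ (1ℚ + Y) * V₁.WS K
      near₁ = ≤-trans (≤by (m≥0 ⊠ diff rw≥ ⊹ diff near-rest ⊹ s≥0 ⊠ Y≥0 ⊠ WS₁≥0 ⊹ lit (12 ÷′ 1000) ⊠ (m²≥0 ⊠ w≥0) ⊠ diff m≥250)
          (trans (e₀ m w s (r * w * (# 2 * m - 1ℚ)) (V₁.rest K) Y (V₁.WS K)) (cong (λ t → m * m * t - m * m * V₁.rest K + s * Y * V₁.WS K) (sym main₁))))
          (≤-reflexive (trans (e₁ (m * m) V₁.Δ (V₁.WS K) (V₁.rest K) s Y) (trans (cong (λ t → t * V₁.WS K + s * Y * V₁.WS K) Δ₁) (e₂ s Y (V₁.WS K)))))
        where e₀ = ring 7 (λ m w s X T Y S → 1987 :/ 1000 :* (m :* m :* m) :* w :+ (m :* (m :* X :- m :* (:# 2 :* m :- :# 3) :* w) :+ (1 :/ 1000 :* (m :* m :* m) :* w :- m :* m :* T) :+ s :* Y :* S :+ 12 :/ 1000 :* (m :* m :* w) :* (m :- :# 250)) := m :* m :* X :- m :* m :* T :+ s :* Y :* S) refl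
              e₁ = ring 6 (λ M D S T s Y → M :* (D :* S :+ T) :- M :* T :+ s :* Y :* S := M :* D :* S :+ s :* Y :* S) refl
              e₂ = ring 3 (λ s Y S → (con 1ℚ :+ (con 1ℚ :- s) :* Y) :* S :+ s :* Y :* S := (con 1ℚ :+ Y) :* S) refl

      far-rest : V₁.rest K ≤ 1 ÷′ 1000 * m * V₁.Δ
      far-rest = ≤-trans (V₁.rest≤ r≤1 m≥1 K) (≤by (lit (# 4) ⊠ m-1≥0 ⊠ V₁.Δ≥0 ⊠ diff R≤ ⊹ lit (1 ÷′ 250000) ⊠ V₁.Δ≥0 ⊹ lit (996 ÷′ 1000000) ⊠ m≥0 ⊠ V₁.Δ≥0) (e R m V₁.Δ))
        where e = ring 3 (λ R m D → R :* (:# 4 :* (m :- con 1ℚ) :* D) :+ (:# 4 :* (m :- con 1ℚ) :* D :* (1 :/ 1000000 :- R) :+ 1 :/ 250000 :* D :+ 996 :/ 1000000 :* m :* D) := 1 :/ 1000 :* m :* D) refl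

      far₁ : 1988 ÷′ 1000 * m * Y ≤ (1ℚ + Y) * (V₁.WS K + 1 ÷′ 1000 * m)
      far₁ = ≤-trans (≤by (m≥0 ⊠ diff rw≥ ⊹ m²≥0 ⊠ diff far-rest ⊹ s≥0 ⊠ Y≥0 ⊠ (WS₁≥0 ⊹ lit (1 ÷′ 1000) ⊠ m≥0) ⊹ lit (12 ÷′ 1000) ⊠ (m²≥0 ⊠ w≥0) ⊠ diff m≥250)
          (trans (e₀ m w s (r * w * (# 2 * m - 1ℚ)) (V₁.rest K) V₁.Δ Y (V₁.WS K)) (cong (λ t → m * m * t - m * m * V₁.rest K + m * m * (1 ÷′ 1000 * m * V₁.Δ) + s * Y * (V₁.WS K + 1 ÷′ 1000 * m)) (sym main₁))))
          (≤-reflexive (trans (e₁ (m * m) V₁.Δ (V₁.WS K) (V₁.rest K) s Y (1 ÷′ 1000 * m)) (trans (cong (λ t → t * (V₁.WS K + 1 ÷′ 1000 * m) + s * Y * (V₁.WS K + 1 ÷′ 1000 * m)) Δ₁) (e₂ s Y (V₁.WS K + 1 ÷′ 1000 * m)))))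
        where e₀ = ring 8 (λ m w s X T D Y S → 1988 :/ 1000 :* m :* (m :* m :* w) :+ (m :* (m :* X :- m :* (:# 2 :* m :- :# 3) :* w) :+ m :* m :* (1 :/ 1000 :* m :* D :- T) :+ s :* Y :* (S :+ 1 :/ 1000 :* m) :+ 12 :/ 1000 :* (m :* m :* w) :* (m :- :# 250)) := m :* m :* X :- m :* m :* T :+ m :* m :* (1 :/ 1000 :* m :* D) :+ s :* Y :* (S :+ 1 :/ 1000 :* m)) refl
              e₁ = ring 7 (λ M D S T s Y u → M :* (D :* S :+ T) :- M :* T :+ M :* (u :* D) :+ s :* Y :* (S :+ u) := M :* D :* (S :+ u) :+ s :* Y :* (S :+ u)) refl
              e₂ = ring 3 (λ s Y S → (con 1ℚ :+ (con 1ℚ :- s) :* Y) :* S :+ s :* Y :* S := (con 1ℚ :+ Y) :* S) refl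

      Δ₂ : E * E * V₂.Δ ≡ 1ℚ + E * (E - 1ℚ) * w
      Δ₂ = trans (e₀ E (r * r) w) (trans (cong (λ t → (E - t) * (E - t) + E * t * w) r²E) (e₁ E w))
        where e₀ = ring 3 (λ E ρ w → E :* E :* ((con 1ℚ :- ρ) :* (con 1ℚ :- ρ) :+ ρ :* w) := (E :- ρ :* E) :* (E :- ρ :* E) :+ E :* (ρ :* E) :* w) refl
              e₁ = ring 2 (λ E w → (E :- (E :- con 1ℚ)) :* (E :- (E :- con 1ℚ)) :+ E :* (E :- con 1ℚ) :* w := con 1ℚ :+ E :* (E :- con 1ℚ) :* w) refl

      -- The squares z² decay on the scale `E`, about m/2, which turns 1 + Y into 1 + Y/4.
      second : (# 4 + Y) * V₂.WS K ≤ m * Y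
      second = *-cancel U>0 (≤-trans (≤-reflexive (e₀ U (# 4 + Y) (V₂.WS K))) (≤-trans (*-monoˡ (lit (# 4) ⊹ Y≥0) top) 
          (≤by (w≥0 ⊠ diff four ⊹ m²≥0 ⊠ w≥0 ⊠ w≥0 ⊠ (E≥0 ⊠ E-1≥0) ⊠ diff twoE-1≤m) (e₁ m E w))))
        where
        U = 1ℚ + E * (E - 1ℚ) * w
        U>0 : 0ℚ < U
        U>0 = 0<+ (lit< 0ℚ 1ℚ) (E≥0 ⊠ E-1≥0 ⊠ w≥0)
        e₀ = ring 3 (λ U f S → U :* (f :* S) := f :* (U :* S)) refl
        top : U * V₂.WS K ≤ E * (E - 1ℚ) * (# 2 * E - 1ℚ) * w
        top = ≤-trans (≤by (E≥0 ⊠ E≥0 ⊠ V₂.rest≥0 r²≤1 E≥1 K) (trans (cong (λ t → t * V₂.WS K + E * E * V₂.rest K) (sym Δ₂)) (trans (e₂ (E * E) V₂.Δ (V₂.WS K) (V₂.rest K)) (trans (cong (E * E *_) main₂) (e₃ E (r * r) w)))))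
             (≤-reflexive (trans (cong (λ t → E * t * (# 2 * E - 1ℚ) * w) r²E) refl))
          where r²≤1 = ≤-trans (*-mono r≥0 r≤1 r≥0 r≤1) (≤-reflexive (*-identityˡ 1ℚ))
                e₂ = ring 4 (λ M D S T → M :* D :* S :+ M :* T := M :* (D :* S :+ T)) refl
                e₃ = ring 3 (λ E ρ w → E :* E :* (ρ :* w :* (:# 2 :* E :- con 1ℚ)) := E :* (ρ :* E) :* (:# 2 :* E :- con 1ℚ) :* w) refl
        four : # 4 * (E * (E - 1ℚ) * (# 2 * E - 1ℚ)) ≤ m * m * m
        four = ≤-trans (≤-reflexive (e₄ E)) (≤-trans (*-mono (twoE≥0 ⊠ twoE-2≥0) (*-mono twoE≥0 E≤ twoE-2≥0 twoE-2≤) twoE-1≥0 twoE-1≤m) (≤by m≥0 (e₅ m)))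
          where e₄ = ring 1 (λ E → :# 4 :* (E :* (E :- con 1ℚ) :* (:# 2 :* E :- con 1ℚ)) := :# 2 :* E :* (:# 2 :* E :- :# 2) :* (:# 2 :* E :- con 1ℚ)) refl
                e₅ = ring 1 (λ m → (m :+ con 1ℚ) :* (m :- con 1ℚ) :* m :+ m := m :* m :* m) refl
                e₆ = ring 2 (λ m E → :# 2 :* E :- :# 2 :+ (m :+ con 1ℚ :- :# 2 :* E) := m :- con 1ℚ) refl
                e₇ = ring 1 (λ E → :# 2 :* (E :- con 1ℚ) := :# 2 :* E :- :# 2) refl
                twoE≥0 = lit (# 2) ⊠ E≥0
                twoE-2≥0 = subst (0ℚ ≤_) (e₇ E) (lit (# 2) ⊠ E-1≥0)
                twoE-2≤ = ≤by (diff E≤) (e₆ m E)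
        e₁ = ring 3 (λ m E w → (:# 4 :+ m :* m :* w) :* (E :* (E :- con 1ℚ) :* (:# 2 :* E :- con 1ℚ) :* w) :+ (w :* (m :* m :* m :- :# 4 :* (E :* (E :- con 1ℚ) :* (:# 2 :* E :- con 1ℚ))) :+ m :* m :* w :* w :* (E :* (E :- con 1ℚ)) :* (m :- (:# 2 :* E :- con 1ℚ))) := (con 1ℚ :+ E :* (E :- con 1ℚ) :* w) :* (m :* (m :* m :* w))) refl


    κ≤ : κ ≤ 1 ÷′ 50 * (m * m * m)
    κ≤ = ≤-trans K≤ (≤by (lit (1 ÷′ 50) ⊠ m²≥0 ⊠ diff m≥250 ⊹ lit (29 ÷′ 10) ⊠ m²≥0) (e m))
      where e = ring 1 (λ m → 21 :/ 10 :* (m :* m) :+ (1 :/ 50 :* (m :* m) :* (m :- :# 250) :+ 29 :/ 10 :* (m :* m)) := 1 :/ 50 :* (m :* m :* m)) refl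

    m³>0 : 0ℚ < m * m * m
    m³>0 = 0<* m²>0 m>0

    -- ⌊l m³⌋
    module _ (l : ℚ) (l≥0 : 0ℚ ≤ l) where
      ex : ℕ
      ex = proj₁ (floor (l * (m * m * m)) (l≥0 ⊠ m³≥0))
      ex≤ : ι ex ≤ l * (m * m * m)
      ex≤ = proj₁ (proj₂ (floor (l * (m * m * m)) (l≥0 ⊠ m³≥0)))
      ex≥ : l * (m * m * m) ≤ 1ℚ + ι ex
      ex≥ = <⇒≤ (proj₂ (proj₂ (floor (l * (m * m * m)) (l≥0 ⊠ m³≥0))))

    -- Exponents in bounds for |ψ|: `L₁` holds for Y ≤ 6/100; `L₃` remains in the middle ranges
    -- after the factor `ε₂` is split off; `L∞` goes with the base 1 - s²/2 for Y ≥ 2.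
    L₁ L₃ L∞ : ℕ
    L₁ = ex (28 ÷′ 10) (lit _)
    L₃ = ex ½ (lit _)
    L∞ = ex (74 ÷′ 100) (lit _)

    ε₂ ε₃ : ℚ
    ε₂ = (38 ÷′ 100) ^ 8
    ε₃ = (1ℚ - ½ * (s * s)) ^ L∞

    s²≤ : s * s ≤ 1 ÷′ 62500
    s²≤ = *-mono s≥0 s≤ s≥0 s≤

    1-½s²≥0 : 0ℚ ≤ 1ℚ - ½ * (s * s)
    1-½s²≥0 = subst (0ℚ ≤_) (e (s * s)) (lit ½ ⊠ diff s²≤ ⊹ lit (1ℚ - ½ * (1 ÷′ 62500)))
      where e = ring 1 (λ a → con ½ :* (1 :/ 62500 :- a) :+ (con 1ℚ :- con ½ :* (1 :/ 62500)) := con 1ℚ :- con ½ :* a) refl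

    ε₃≥0 : 0ℚ ≤ ε₃
    ε₃≥0 = ^≥0 L∞ 1-½s²≥0

    module Pointwise (x : Point) where
      open Point x
      open Characters x
      open Zones x

      c : ℚ
      c = 1ℚ - 1 ÷′ 4 * w

      ¼w≥0 = lit (1 ÷′ 4) ⊠ w≥0

      ¼w≤1 : 1 ÷′ 4 * w ≤ 1ℚ
      ¼w≤1 = ≤-trans (*-monoˡ (lit (1 ÷′ 4)) (W≤4 (ℤ.+ 1))) (lit≤ _ _)

      c≥0 : 0ℚ ≤ c
      c≥0 = diff ¼w≤1

      c≤1 : c ≤ 1ℚ
      c≤1 = ≤by ¼w≥0 (e w)
        where e = ring 1 (λ w → con 1ℚ :- 1 :/ 4 :* w :+ 1 :/ 4 :* w := con 1ℚ) refl

      Z : ℕ → ℂ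
      Z = cprod (λ k → factor (v k) (ℤ.+ k))

      norm²-factor : ∀ v a → norm² (factor v a) ≡ 1ℚ - v * (1ℚ - v) * W a
      norm²-factor v a = trans (e v (cos a) (sin a)) (trans (cong (λ t → (1ℚ - v) * (1ℚ - v) + # 2 * v * (1ℚ - v) * cos a + v * v * t) (pyth a)) (e′ v (cos a)))
        where e = ring 3 (λ v c s → (con 1ℚ :- v :+ v :* c) :* (con 1ℚ :- v :+ v :* c) :+ v :* s :* (v :* s) := (con 1ℚ :- v) :* (con 1ℚ :- v) :+ :# 2 :* v :* (con 1ℚ :- v) :* c :+ v :* v :* (c :* c :+ s :* s)) refl
              e′ = ring 2 (λ v c → (con 1ℚ :- v) :* (con 1ℚ :- v) :+ :# 2 :* v :* (con 1ℚ :- v) :* c :+ v :* v :* con 1ℚ := con 1ℚ :- v :* (con 1ℚ :- v) :* (:# 2 :- :# 2 :* c)) refl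

      norm²-Z : norm² (Z K) ≡ ∏ (λ k → 1ℚ - ω k * W (ℤ.+ k)) K
      norm²-Z = ∏≡norm² (λ k → factor (v k) (ℤ.+ k)) (λ k → ω k * W (ℤ.+ k)) K (λ k → norm²-factor (v (suc k)) (ℤ.+ suc k))

      y≤1 : ∀ k → ω k * W (ℤ.+ k) ≤ 1ℚ
      y≤1 k = *-mono (ω≥0 k) (v[1-v]≤¼ (v k)) (W≥0 (ℤ.+ k)) (W≤4 (ℤ.+ k))

      square : ∀ δ L → (1ℚ - δ) ^ (L ℕ.+ L) ≡ (1ℚ - δ) ^ L * (1ℚ - δ) ^ L
      square δ L = ^-+ (1ℚ - δ) L L

      -- The exponent is doubled because |Z|² is the product of the 1 - ω W; the summand `κ` pays
      -- for rounding down once per factor.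
      norm²≤pow : ∀ δ L → 0ℚ ≤ δ → δ ≤ 1ℚ → (# 2 * ι L + κ) * δ ≤ S → norm² (Z K) ≤ (1ℚ - δ) ^ L * (1ℚ - δ) ^ L
      norm²≤pow δ L d0 d1 h = subst₂ _≤_ (sym norm²-Z) (square δ L) (∏≤pow (λ k → ω k * W (ℤ.+ k)) δ K (L ℕ.+ L) (λ k → ω≥0 k ⊠ W≥0 (ℤ.+ k)) y≤1 d0 d1
          (subst (λ t → (t + κ) * δ ≤ S) (trans (e (ι L)) (sym (ι-+ L L))) h))
        where e = ring 1 (λ a → :# 2 :* a := a :+ a) refl

      -- The quadratic 1.766(4 + Y) - (1 + Y) - q(1 + Y)(4 + Y) is (B - Y)(b + qY) + rem.
      bound-b bound-rem : ℚ → ℚ → ℚ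
      bound-b q B = q * B - (8 ÷′ 9 * (1987 ÷′ 1000) - 1ℚ - # 5 * q)
      bound-rem q B = # 4 * (8 ÷′ 9 * (1987 ÷′ 1000)) - 1ℚ - # 4 * q - B * bound-b q B

      -- Multiplication by (1 + Y)(4 + Y) leaves a quadratic in `Y`. A smaller range `B` admits a
      -- larger slope `q`.
      zone : ∀ q B → 0ℚ ≤ q → 0ℚ ≤ bound-b q B → 0ℚ ≤ bound-rem q B → Y ≤ B → q * (m * m * m) * w ≤ S
      zone q B q0 b0 rem0 h = *-cancel (0<* (0<+ (lit< 0ℚ 1ℚ) Y≥0) (0<+ (lit< 0ℚ (# 4)) Y≥0))
         (≤by ((lit 1ℚ ⊹ Y≥0) ⊠ (lit (# 4) ⊹ Y≥0) ⊠ diff S≥ ⊹ lit (8 ÷′ 9) ⊠ (lit (# 4) ⊹ Y≥0) ⊠ diff near₁ ⊹ (lit 1ℚ ⊹ Y≥0) ⊠ diff second ⊹ m³≥0 ⊠ w≥0 ⊠ (diff h ⊠ (b0 ⊹ q0 ⊠ Y≥0) ⊹ rem0))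
           (e m w S (V₁.WS K) (V₂.WS K) q B))
        where e = ring 7 (λ m w S P Q q B → (con 1ℚ :+ m :* m :* w) :* (:# 4 :+ m :* m :* w) :* (q :* (m :* m :* m) :* w) :+ ((con 1ℚ :+ m :* m :* w) :* (:# 4 :+ m :* m :* w) :* (S :- (8 :/ 9 :* P :- Q)) :+ 8 :/ 9 :* (:# 4 :+ m :* m :* w) :* ((con 1ℚ :+ m :* m :* w) :* P :- 1987 :/ 1000 :* (m :* m :* m) :* w) :+ (con 1ℚ :+ m :* m :* w) :* (m :* (m :* m :* w) :- (:# 4 :+ m :* m :* w) :* Q) :+ m :* m :* m :* w :* ((B :- m :* m :* w) :* (q :* B :- (8 :/ 9 :* (1987 :/ 1000) :- con 1ℚ :- :# 5 :* q) :+ q :* (m :* m :* w)) :+ (:# 4 :* (8 :/ 9 :* (1987 :/ 1000)) :- con 1ℚ :- :# 4 :* q :- B :* (q :* B :- (8 :/ 9 :* (1987 :/ 1000) :- con 1ℚ :- :# 5 :* q))))) := (con 1ℚ :+ m :* m :* w) :* (:# 4 :+ m :* m :* w) :* S) refl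

      far : # 2 ≤ Y → 76 ÷′ 100 * m ≤ S
      far h = *-cancel (0<* (0<+ (lit< 0ℚ 1ℚ) Y≥0) (0<+ (lit< 0ℚ (# 4)) Y≥0))
         (≤by ((lit 1ℚ ⊹ Y≥0) ⊠ (lit (# 4) ⊹ Y≥0) ⊠ diff S≥ ⊹ lit (8 ÷′ 9) ⊠ (lit (# 4) ⊹ Y≥0) ⊠ diff far₁ ⊹ (lit 1ℚ ⊹ Y≥0) ⊠ diff second ⊹ m≥0 ⊠ (lit (7 ÷′ 1125) ⊠ (Y≥0 ⊠ Y≥0) ⊹ lit (283 ÷′ 125) ⊠ diff h ⊹ lit (334 ÷′ 225)))
           (e m Y S (V₁.WS K) (V₂.WS K)))
        where e = ring 5 (λ m Y S P Q → (con 1ℚ :+ Y) :* (:# 4 :+ Y) :* (76 :/ 100 :* m) :+ ((con 1ℚ :+ Y) :* (:# 4 :+ Y) :* (S :- (8 :/ 9 :* P :- Q)) :+ 8 :/ 9 :* (:# 4 :+ Y) :* ((con 1ℚ :+ Y) :* (P :+ 1 :/ 1000 :* m) :- 1988 :/ 1000 :* m :* Y) :+ (con 1ℚ :+ Y) :* (m :* Y :- (:# 4 :+ Y) :* Q) :+ m :* (7 :/ 1125 :* (Y :* Y) :+ 283 :/ 125 :* (Y :- :# 2) :+ 334 :/ 225)) := (con 1ℚ :+ Y) :* (:# 4 :+ Y) :* S) refl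

      -- With δ = w/4 and K ≤ m³/50, the total exponent is at most (2l + 1/50) m³.
      norm²-zone : ∀ q l (l≥0 : 0ℚ ≤ l) → # 2 * l + 1 ÷′ 50 ≤ # 4 * q → q * (m * m * m) * w ≤ S → norm² (Z K) ≤ c ^ ex l l≥0 * c ^ ex l l≥0
      norm²-zone q l l≥0 h hS = norm²≤pow (1 ÷′ 4 * w) (ex l l≥0) ¼w≥0 ¼w≤1
         (≤-trans (≤by (¼w≥0 ⊠ (lit (# 2) ⊠ diff (ex≤ l l≥0) ⊹ diff κ≤ ⊹ m³≥0 ⊠ diff h)) (e (ι (ex l l≥0)) κ w l q (m * m * m))) hS)
        where e = ring 6 (λ L κ w l q M → (:# 2 :* L :+ κ) :* (1 :/ 4 :* w) :+ 1 :/ 4 :* w :* (:# 2 :* (l :* M :- L) :+ (1 :/ 50 :* M :- κ) :+ M :* (:# 4 :* q :- (:# 2 :* l :+ 1 :/ 50))) := q :* M :* w) refl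

      -- With δ = s²/2 the demand is ½ (2 · 0.74 + 0.02) m = 0.75 m, below the 0.76 m of `far`.
      norm²-far : # 2 ≤ Y → norm² (Z K) ≤ ε₃ * ε₃
      norm²-far h = norm²≤pow (½ * (s * s)) L∞ (lit ½ ⊠ (s≥0 ⊠ s≥0)) (undiff 1-½s²≥0)
         (≤-trans (≤by (lit ½ ⊠ (s≥0 ⊠ s≥0) ⊠ (lit (# 2) ⊠ diff (ex≤ (74 ÷′ 100) (lit _)) ⊹ diff κ≤) ⊹ lit (1 ÷′ 100) ⊠ m≥0) (trans (e (ι L∞) κ s (m * m * m) (1 ÷′ 100 * m)) (trans (e₁ m s) (trans (cong (λ t → 75 ÷′ 100 * (t * t * m) + 1 ÷′ 100 * m) ms) (e₂ m))))) (far h))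
        where e = ring 5 (λ L κ s M u → (:# 2 :* L :+ κ) :* (con ½ :* (s :* s)) :+ (con ½ :* (s :* s) :* (:# 2 :* (74 :/ 100 :* M :- L) :+ (1 :/ 50 :* M :- κ)) :+ u) := 75 :/ 100 :* (M :* (s :* s)) :+ u) refl
              e₁ = ring 2 (λ m s → 75 :/ 100 :* (m :* m :* m :* (s :* s)) :+ 1 :/ 100 :* m := 75 :/ 100 :* (m :* s :* (m :* s) :* m) :+ 1 :/ 100 :* m) refl
              e₂ = ring 1 (λ m → 75 :/ 100 :* (con 1ℚ :* con 1ℚ :* m) :+ 1 :/ 100 :* m := 76 :/ 100 :* m) refl

      -- For Y ≥ B₀ each factor `c` is at most 1 - h with h = B₀ s² / 4. The `n` factors beyond `L₃`
      -- give n h of about (l - ½) B₀ m / 4, more than 8 when m ≥ 250; hence 125/2 = 250/4, and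
      -- 8001/1000 leaves room for rounding.
      norm²-middle : ∀ q l (l≥0 : 0ℚ ≤ l) B₀ B → 0ℚ ≤ q → 0ℚ ≤ bound-b q B → 0ℚ ≤ bound-rem q B → # 2 * l + 1 ÷′ 50 ≤ # 4 * q →
                     0ℚ < B₀ → B₀ ≤ # 2 → ½ ≤ l → 8001 ÷′ 1000 ≤ 125 ÷′ 2 * B₀ * (l - ½) → B₀ ≤ Y → Y ≤ B → norm² (Z K) ≤ ε₂ * c ^ L₃ * (ε₂ * c ^ L₃)
      norm²-middle q l l≥0 B₀ B q0 b0 r0 lq B₀>0 B₀≤2 ½≤l num lo hi =
        ≤-trans (norm²-zone q l l≥0 lq (zone q B q0 b0 r0 hi)) (*-mono (^≥0 L c≥0) small (^≥0 L c≥0) small)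
        where
        L = ex l l≥0
        n = L ℕ.∸ L₃
        h = 1 ÷′ 4 * B₀ * (s * s)
        s>0 = inv>0 m>0
        h>0 : 0ℚ < h
        h>0 = 0<* (0<* (lit< 0ℚ (1 ÷′ 4)) B₀>0) (0<* s>0 s>0)
        h≤′ : h ≤ 1 ÷′ 125000
        h≤′ = ≤-trans (*-mono (lit (1 ÷′ 4) ⊠ <⇒≤ B₀>0) (*-monoˡ (lit (1 ÷′ 4)) B₀≤2) (s≥0 ⊠ s≥0) s²≤) (lit≤ _ _)
        h≤ : h ≤ 1 ÷′ 250
        h≤ = ≤-trans h≤′ (lit≤ _ _)
        L₃≤L : L₃ ℕ.≤ L
        L₃≤L = ι≤⇒≤ (≤-<-trans (ex≤ ½ (lit _)) (≤-<-trans (*-monoʳ m³≥0 ½≤l) (proj₂ (proj₂ (floor (l * (m * m * m)) (l≥0 ⊠ m³≥0))))))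
        ιn : ι n ≡ ι L - ι L₃
        ιn = trans (e (ι n) (ι L₃)) (cong (_- ι L₃) (trans (sym (ι-+ n L₃)) (cong ι (ℕ.m∸n+n≡m L₃≤L))))
          where e = ring 2 (λ a b → a := a :+ b :- b) refl
        c≤ : c ≤ 1ℚ - h
        c≤ = ≤by (lit (1 ÷′ 4) ⊠ diff Bw) (e w h (B₀ * (s * s)) refl)
          where Bw : B₀ * (s * s) ≤ w
                Bw = subst (B₀ * (s * s) ≤_) (trans (e₀ m w s) (trans (cong (λ t → t * t * w) ms) (e₁ w))) (*-monoʳ (s≥0 ⊠ s≥0) lo)
                  where e₀ = ring 3 (λ m w s → m :* m :* w :* (s :* s) := m :* s :* (m :* s) :* w) refl
                        e₁ = ring 1 (λ w → con 1ℚ :* con 1ℚ :* w := w) refl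
                e : ∀ w h b → h ≡ 1 ÷′ 4 * B₀ * (s * s) → 1ℚ - 1 ÷′ 4 * w + 1 ÷′ 4 * (w - B₀ * (s * s)) ≡ 1ℚ - 1 ÷′ 4 * B₀ * (s * s)
                e w h b _ = e₂ w B₀ s
                  where e₂ = ring 3 (λ w B s → con 1ℚ :- 1 :/ 4 :* w :+ 1 :/ 4 :* (w :- B :* (s :* s)) := con 1ℚ :- 1 :/ 4 :* B :* (s :* s)) refl
        module D = Decay h h>0 h≤
        enough : ι 8 + ι 8 * h ≤ ι n * h
        enough = ≤-trans (≤by (lit (# 10) ⊠ diff h≤′ ⊹ lit (1 ÷′ 1000 - # 10 * (1 ÷′ 125000) ) ⊹ D.h≥0 ⊹ diff num ⊹ lit (1 ÷′ 4) ⊠ <⇒≤ B₀>0 ⊠ diff ½≤l ⊠ diff m≥250)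
               (trans (e₀ h B₀ l m) (trans (sym (cong (λ t → 1 ÷′ 4 * B₀ * ((l - ½) * (t * t * m)) - h) ms)) (trans (e₁ h B₀ l m s) refl))))
            (≤by (D.h≥0 ⊠ diff (ex≥ l l≥0) ⊹ D.h≥0 ⊠ diff (ex≤ ½ (lit _))) (trans (e₂ h (l * (m * m * m)) (½ * (m * m * m)) (ι L) (ι L₃) (1 ÷′ 4 * B₀ * (s * s) * ((l - ½) * (m * m * m))) (e₃ h l m)) (cong (_* h) (sym ιn))))
          where
          e₀ = ring 4 (λ h B l m → :# 8 :+ :# 8 :* h :+ (:# 10 :* (1 :/ 125000 :- h) :+ (1 :/ 1000 :- :# 10 :* (1 :/ 125000)) :+ h :+ (125 :/ 2 :* B :* (l :- con ½) :- 8001 :/ 1000) :+ 1 :/ 4 :* B :* (l :- con ½) :* (m :- :# 250)) := 1 :/ 4 :* B :* ((l :- con ½) :* (con 1ℚ :* con 1ℚ :* m)) :- h) refl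
          e₁ = ring 5 (λ h B l m s → 1 :/ 4 :* B :* ((l :- con ½) :* (m :* s :* (m :* s) :* m)) :- h := 1 :/ 4 :* B :* (s :* s) :* ((l :- con ½) :* (m :* m :* m)) :- h) refl
          e₃ = ring 3 (λ h l m → h :* ((l :- con ½) :* (m :* m :* m)) := h :* (l :* (m :* m :* m)) :- h :* (con ½ :* (m :* m :* m))) refl
          e₂ : ∀ h p q L L₃ X → X ≡ h * p - h * q → X - h + (h * (1ℚ + L - p) + h * (q - L₃)) ≡ (L - L₃) * h
          e₂ h p q L L₃ X refl = e₄ h p q L L₃
            where e₄ = ring 5 (λ h p q L L₃ → h :* p :- h :* q :- h :+ (h :* (con 1ℚ :+ L :- p) :+ h :* (q :- L₃)) := (L :- L₃) :* h) refl
        small : c ^ L ≤ ε₂ * c ^ L₃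
        small = subst (_≤ ε₂ * c ^ L₃) (trans (sym (^-+ c n L₃)) (cong (c ^_) (ℕ.m∸n+n≡m L₃≤L)))
           (*-monoʳ (^≥0 L₃ c≥0) (≤-trans (^-mono n c≥0 c≤) (D.decay 8 n enough)))

    -- The pointwise lower bound on the whole circle

    module Lower (g : ℚ) (g≥0 : 0ℚ ≤ g) (g≤ : g ≤ 1 ÷′ 20 * m) (n₀ : ℕ) (centre : Carry.M r r>0 r≤1 g g≥0 K ≡ ι n₀) where
      E₂ = Carry.E₂ r r>0 r≤1 g g≥0
      E₃ = Carry.E₃ r r>0 r≤1 g g≥0
      E₂≥0 = Carry.E₂≥0 r r>0 r≤1 g g≥0
      E₃≥0 = Carry.E₃≥0 r r>0 r≤1 g g≥0

      -- For Y ≤ 0.06 half of w `E₂` is at most 0.03 + w/4, which `η` rounds up; `J` is 1 / (1 - η).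
      η J : ℚ
      η = 301 ÷′ 10000
      J = 10000 ÷′ 9699

      J≥0 : 0ℚ ≤ J
      J≥0 = lit _

      l = Carry.Exponents.l r r>0 r≤1 g g≥0 J J≥0
      total-l = Carry.Exponents.total-l r r>0 r≤1 g g≥0 J J≥0

      -- The maximum secures L₁ ≤ L₂, so that c^L₂ can be dominated by c^L₁.
      L₂ : ℕ
      L₂ = nsum l (suc K) ℕ.⊔ L₁

      g+1≥0 = g≥0 ⊹ lit 1ℚ

      J[g+1]≤ : J * (g + 1ℚ) ≤ 1 ÷′ 16 * m
      J[g+1]≤ = ≤by (J≥0 ⊠ diff g≤ ⊹ lit (1 ÷′ 250) ⊠ diff m≥250 ⊹ lit (1 ÷′ 16 - 1 ÷′ 250 - J * (1 ÷′ 20)) ⊠ diff m≥250 ⊹ lit (1ℚ - J + # 250 * (1 ÷′ 16 - 1 ÷′ 250 - J * (1 ÷′ 20)))) (e g m)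
        where e = ring 2 (λ g m → 10000 :/ 9699 :* (g :+ con 1ℚ) :+ (10000 :/ 9699 :* (1 :/ 20 :* m :- g) :+ 1 :/ 250 :* (m :- :# 250) :+ (1 :/ 16 :- 1 :/ 250 :- 10000 :/ 9699 :* (1 :/ 20)) :* (m :- :# 250) :+ (con 1ℚ :- 10000 :/ 9699 :+ :# 250 :* (1 :/ 16 :- 1 :/ 250 :- 10000 :/ 9699 :* (1 :/ 20)))) := 1 :/ 16 :* m) refl

      g+1≤ : g + 1ℚ ≤ 1 ÷′ 16 * m
      g+1≤ = ≤-trans (≤by (lit (301 ÷′ 9699) ⊠ g+1≥0) (e (g + 1ℚ))) J[g+1]≤
        where e = ring 1 (λ a → a :+ 301 :/ 9699 :* a := 10000 :/ 9699 :* a) refl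

      ∑E₂≤ : ∑ E₂ K ≤ 182 ÷′ 100 * (m * m * m) + ½ * κ
      ∑E₂≤ = ≤-trans (≤-reflexive (trans (∑-+ (λ k → ι k * ι k * ω k) (λ _ → ½) K) (cong (∑ (λ k → ι k * ι k * ω k) K +_) (trans (∑-const ½ K) (*-comm κ ½)))))
          (+-monoˡ-≤ (½ * κ) ∑k²ω≤)

      -- The leading constant 5.73 / (6 · 0.9699) is below 1, and m ≥ 250 absorbs the lower terms.
      ∑E₃≤ : J * (1 ÷′ 6 * ∑ E₃ K) ≤ m * m * (m * m)
      ∑E₃≤ = ≤-trans (*-monoˡ J≥0 (*-monoˡ (lit (1 ÷′ 6)) (≤-trans (≤-reflexive split) (+-mono-≤ (+-mono-≤ (+-mono-≤ ∑k³ω≤ (*-monoˡ (lit (# 6)) ∑k²ω≤)) (*-monoˡ (lit (# 24)) ∑kω≤)) (*-monoˡ (lit (# 8)) K≤)))))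
         (≤by (lit (J * (1 ÷′ 6)) ⊠ (lit (# 6 * (9699 ÷′ 10000) - 573 ÷′ 100) ⊠ m³≥0 ⊠ diff m≥250 ⊹ lit (# 11) ⊠ m²≥0 ⊠ diff m≥250 ⊹ lit (# 250 * (# 6 * (9699 ÷′ 10000) - 573 ÷′ 100) - 1092 ÷′ 100 - # 11) ⊠ m³≥0 ⊹ lit (# 11 * # 250 - 408 ÷′ 10) ⊠ m²≥0))
           (e m))
        where
        ∑kω≤ : ∑ (λ k → ι k * ω k) K ≤ m * m
        ∑kω≤ = ≤-trans (∑-mono K (λ k → *-monoˡ (ι≥0 k) (ω≤z k))) (∑kz≤ K)
        split : ∑ E₃ K ≡ ∑ (λ k → ι k * ι k * ι k * ω k) K + # 6 * ∑ (λ k → ι k * ι k * ω k) K + # 24 * ∑ (λ k → ι k * ω k) K + # 8 * κ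
        split = trans (∑-+ (λ k → ι k * ι k * ι k * ω k + # 6 * (ι k * ι k * ω k) + # 24 * (ι k * ω k)) (λ _ → # 8) K)
          (cong₂ _+_ (trans (∑-+ (λ k → ι k * ι k * ι k * ω k + # 6 * (ι k * ι k * ω k)) (λ k → # 24 * (ι k * ω k)) K)
            (cong₂ _+_ (trans (∑-+ (λ k → ι k * ι k * ι k * ω k) (λ k → # 6 * (ι k * ι k * ω k)) K) (cong (∑ (λ k → ι k * ι k * ι k * ω k) K +_) (∑-* (# 6) (λ k → ι k * ι k * ω k) K)))
               (∑-* (# 24) (λ k → ι k * ω k) K))) (trans (∑-const (# 8) K) (*-comm κ (# 8))))
        e = ring 1 (λ m → 10000 :/ 9699 :* (1 :/ 6 :* (573 :/ 100 :* (m :* m :* (m :* m)) :+ :# 6 :* (182 :/ 100 :* (m :* m :* m)) :+ :# 24 :* (m :* m) :+ :# 8 :* (21 :/ 10 :* (m :* m)))) :+ 10000 :/ 9699 :* (1 :/ 6) :* ((:# 6 :* (9699 :/ 10000) :- 573 :/ 100) :* (m :* m :* m) :* (m :- :# 250) :+ :# 11 :* (m :* m) :* (m :- :# 250) :+ (:# 250 :* (:# 6 :* (9699 :/ 10000) :- 573 :/ 100) :- 1092 :/ 100 :- :# 11) :* (m :* m :* m) :+ (:# 11 :* :# 250 :- 408 :/ 10) :* (m :* m)) := m :* m :* (m :* m)) refl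

      -- The leading term of the sum is 2 J · 1.82 m³, about 3.753 m³.
      L₂≤ : ι L₂ ≤ 38 ÷′ 10 * (m * m * m)
      L₂≤ = max≤ (nsum l (suc K)) L₁ sum-l (≤-trans (ex≤ (28 ÷′ 10) (lit _)) (*-monoʳ m³≥0 (lit≤ (28 ÷′ 10) (38 ÷′ 10))))
        where
        sum-l : ι (nsum l (suc K)) ≤ 38 ÷′ 10 * (m * m * m)
        sum-l = ≤-trans (total-l K) (≤-trans (+-monoˡ-≤ (ι (suc K)) (*-monoˡ {b = # 2 * J} (lit (# 2 * J)) (+-mono-≤ (*-mono g+1≥0 g+1≤ g+1≥0 g+1≤) ∑E₂≤)))
           (≤by (lit (J + 1ℚ) ⊠ diff K≤ ⊹ lit (38 ÷′ 10 - # 2 * J * (182 ÷′ 100)) ⊠ m²≥0 ⊠ diff m≥250 ⊹ lit ((38 ÷′ 10 - # 2 * J * (182 ÷′ 100)) * # 250 - # 2 * J * (1 ÷′ 256) - (J + 1ℚ) * (21 ÷′ 10) - 1 ÷′ 250) ⊠ m²≥0 ⊹ lit (1 ÷′ 250) ⊠ (m≥0 ⊠ diff m≥250 ⊹ lit (# 250) ⊠ diff m≥250) ⊹ lit (# 249)) (e m κ)))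
          where e = ring 2 (λ m κ → :# 2 :* (10000 :/ 9699) :* (1 :/ 16 :* m :* (1 :/ 16 :* m) :+ (182 :/ 100 :* (m :* m :* m) :+ con ½ :* κ)) :+ (con 1ℚ :+ κ) :+ ((10000 :/ 9699 :+ con 1ℚ) :* (21 :/ 10 :* (m :* m) :- κ) :+ (38 :/ 10 :- :# 2 :* (10000 :/ 9699) :* (182 :/ 100)) :* (m :* m) :* (m :- :# 250) :+ ((38 :/ 10 :- :# 2 :* (10000 :/ 9699) :* (182 :/ 100)) :* :# 250 :- :# 2 :* (10000 :/ 9699) :* (1 :/ 256) :- (10000 :/ 9699 :+ con 1ℚ) :* (21 :/ 10) :- 1 :/ 250) :* (m :* m) :+ 1 :/ 250 :* (m :* (m :- :# 250) :+ :# 250 :* (m :- :# 250)) :+ :# 249) := 38 :/ 10 :* (m :* m :* m)) refl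

      module At (x : Point) where
        open Point x
        open Characters x
        open Zones x
        open Pointwise x

        -- Dominates the square of the total phase: m⁴ w comes from the third moments and m/16 from
        -- `init`, both times σ, and σ² ≤ w.
        𝒜 : ℚ
        𝒜 = w * ((m * m * (m * m) * w + 1 ÷′ 16 * m) * (m * m * (m * m) * w + 1 ÷′ 16 * m))

        a : ℚ
        a = re (Z K ⊗ pt (ℤ.- (ℤ.+ n₀)))

        norm²-a : norm² (Z K ⊗ pt (ℤ.- (ℤ.+ n₀))) ≡ norm² (Z K)
        norm²-a = trans (norm²-⊗ (Z K) (pt (ℤ.- (ℤ.+ n₀)))) (trans (cong (norm² (Z K) *_) (pyth (ℤ.- (ℤ.+ n₀)))) (*-identityʳ (norm² (Z K))))

        a≥ : ∀ {X} → 0ℚ ≤ X → norm² (Z K) ≤ X * X → - X ≤ a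
        a≥ {X} X0 h = re≤norm (Z K ⊗ pt (ℤ.- (ℤ.+ n₀))) X0 (subst (_≤ X * X) (sym norm²-a) h)

        lower : ℚ
        lower = c ^ L₂ - 51 ÷′ 100 * 𝒜 * c ^ L₁ - ε₂ * c ^ L₃ - ε₃

        c^L₂≤c^L₁ : c ^ L₂ ≤ c ^ L₁
        c^L₂≤c^L₁ = ^-anti c≥0 c≤1 (ℕ.m≤n⊔m (nsum l (suc K)) L₁)

        ε₂c≥0 = lit ε₂ ⊠ ^≥0 L₃ c≥0

        -- The term m² Y³ of `𝒜` alone gives 0.51 · 62500 · 0.06³ > 6. Hence from Y = 0.06 on the
        -- first two terms of `lower` are together nonpositive and only the size of ψ matters.
        outer : 6 ÷′ 100 ≤ Y → c ^ L₂ ≤ 51 ÷′ 100 * 𝒜 * c ^ L₁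
        outer h = ≤-trans c^L₂≤c^L₁ (≤-trans (≤-reflexive (sym (*-identityˡ (c ^ L₁)))) (*-monoʳ (^≥0 L₁ c≥0) big))
          where
          Y³ : 216 ÷′ 1000000 ≤ Y * Y * Y
          Y³ = *-mono (lit _) (*-mono (lit _) h (lit _) h) (lit _) h
          big : 1ℚ ≤ 51 ÷′ 100 * 𝒜
          big = ≤-trans (lit≤ 1ℚ (51 ÷′ 100 * (# 62500 * (216 ÷′ 1000000)))) (*-monoˡ (lit (51 ÷′ 100)) (≤-trans (*-mono (lit (# 62500)) (*-mono (lit (# 250)) m≥250 (lit (# 250)) m≥250) (lit _) Y³)
             (≤by (w≥0 ⊠ (lit (1 ÷′ 8) ⊠ (m⁴≥0 ⊠ w≥0 ⊠ m≥0) ⊹ lit (1 ÷′ 256) ⊠ m²≥0)) (e m w))))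
            where e = ring 2 (λ m w → m :* m :* (m :* m :* w :* (m :* m :* w) :* (m :* m :* w)) :+ w :* (1 :/ 8 :* (m :* m :* (m :* m) :* w :* m) :+ 1 :/ 256 :* (m :* m)) := w :* ((m :* m :* (m :* m) :* w :+ 1 :/ 16 :* m) :* (m :* m :* (m :* m) :* w :+ 1 :/ 16 :* m))) refl

        from-tail : ∀ {X} → 6 ÷′ 100 ≤ Y → X ≤ ε₂ * c ^ L₃ + ε₃ → - X ≤ a → lower ≤ a
        from-tail {X} h p q = ≤-trans (≤by (diff (outer h) ⊹ diff p) (e (c ^ L₂) (51 ÷′ 100 * 𝒜 * c ^ L₁) (ε₂ * c ^ L₃) ε₃ X)) q
          where e = ring 5 (λ A B C D X → A :- B :- C :- D :+ (B :- A :+ (C :+ D :- X)) := :- X) refl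

        middle : 6 ÷′ 100 ≤ Y → norm² (Z K) ≤ ε₂ * c ^ L₃ * (ε₂ * c ^ L₃) → lower ≤ a
        middle h n = from-tail h (≤by ε₃≥0 refl) (a≥ ε₂c≥0 n)

        beyond : # 2 ≤ Y → lower ≤ a
        beyond h = from-tail (≤-trans (lit≤ _ _) h) (≤by ε₂c≥0 (+-comm ε₃ (ε₂ * c ^ L₃))) (a≥ ε₃≥0 (norm²-far h))

        module Inside (Y≤ : Y ≤ 6 ÷′ 100) where

          w≤ : w ≤ 1 ÷′ 1000000
          w≤ = *-cancel (lit< 0ℚ (# 62500)) (≤-trans (*-monoʳ w≥0 (*-mono (lit (# 250)) m≥250 (lit (# 250)) m≥250)) (≤-trans Y≤ (lit≤ _ _)))

          step-small : ∀ k → ½ * w * E₂ k ≤ η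
          step-small k = ≤by (lit ½ ⊠ w≥0 ⊠ diff (≤-trans (*-monoˡ (ι≥0 k ⊠ ι≥0 k) (ω≤z k)) (k²z≤ k)) ⊹ lit ½ ⊠ diff Y≤ ⊹ lit (1 ÷′ 4) ⊠ diff w≤ ⊹ lit (301 ÷′ 10000 - 3 ÷′ 100 - 1 ÷′ 4000000)) (e w m (ι k * ι k * ω k))
            where e = ring 3 (λ w m E → con ½ :* w :* (E :+ con ½) :+ (con ½ :* w :* (m :* m :- E) :+ con ½ :* (6 :/ 100 :- m :* m :* w) :+ 1 :/ 4 :* (1 :/ 1000000 :- w) :+ (301 :/ 10000 :- 3 :/ 100 :- 1 :/ 4000000)) := 301 :/ 10000) refl

          init-small : ½ * w * ((g + 1ℚ) * (g + 1ℚ)) ≤ η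
          init-small = ≤-trans (*-monoˡ (lit ½ ⊠ w≥0) (*-mono g+1≥0 g+1≤ g+1≥0 g+1≤)) (≤by (lit ½ ⊠ diff Y≤ ⊹ lit (255 ÷′ 512) ⊠ Y≥0 ⊹ lit (1 ÷′ 10000)) (e w m))
            where e = ring 2 (λ w m → con ½ :* w :* (1 :/ 16 :* m :* (1 :/ 16 :* m)) :+ (con ½ :* (6 :/ 100 :- m :* m :* w) :+ 255 :/ 512 :* (m :* m :* w) :+ 1 :/ 10000) := 301 :/ 10000) refl

          η<1 : η < 1ℚ
          η<1 = lit< _ _

          w<4 : w < # 4
          w<4 = ≤-<-trans w≤ (lit< _ _)

          τ = Local.Small.τ r r>0 r≤1 g g≥0 x η η<1 w<4 J refl J≥0 step-small init-small
          A = Local.Small.A r r>0 r≤1 g g≥0 x η η<1 w<4 J refl J≥0 step-small init-small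
          A-sum = Local.Small.A-sum r r>0 r≤1 g g≥0 x η η<1 w<4 J refl J≥0 step-small init-small
          A≥0 = Local.Small.A≥0 r r>0 r≤1 g g≥0 x η η<1 w<4 J refl J≥0 step-small init-small
          near = Local.Small.Centre.near r r>0 r≤1 g g≥0 x η η<1 w<4 J refl J≥0 step-small init-small K n₀ centre

          A²≤𝒜 : A (suc K) * A (suc K) ≤ 𝒜
          A²≤𝒜 = ≤-trans (≤-reflexive (trans (cong₂ _*_ (A-sum K) (A-sum K)) (e σ U))) (*-mono (σ≥0 ⊠ σ≥0) σ²≤w (U≥0 ⊠ U≥0) (*-mono U≥0 U≤ U≥0 U≤))
            where
            U = J * (1 ÷′ 6 * ∑ E₃ K) * w + J * (g + 1ℚ)
            U≥0 = J≥0 ⊠ (lit (1 ÷′ 6) ⊠ ∑≥0 K E₃≥0) ⊠ w≥0 ⊹ J≥0 ⊠ g+1≥0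
            U≤ = +-mono-≤ (*-monoʳ w≥0 ∑E₃≤) J[g+1]≤
            e = ring 2 (λ σ U → σ :* U :* (σ :* U) := σ :* σ :* (U :* U)) refl

          mσ≤ : m * σ ≤ 1 ÷′ 4
          mσ≤ = sqrt≤ (lit _) (≤-trans (≤-reflexive (e m σ)) (≤-trans (*-monoˡ m²≥0 σ²≤w) (≤-trans Y≤ (lit≤ _ _))))
            where e = ring 2 (λ m σ → m :* σ :* (m :* σ) := m :* m :* (σ :* σ)) refl

          E₃≤ : ∀ k → J * (1 ÷′ 6 * E₃ k) ≤ 104 ÷′ 100 * (m * m * m)
          E₃≤ k = ≤-trans (*-monoˡ J≥0 (*-monoˡ (lit (1 ÷′ 6)) (+-monoˡ-≤ (# 8) (+-mono-≤ (+-mono-≤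
                (≤-trans (*-monoˡ (ι≥0 k ⊠ ι≥0 k ⊠ ι≥0 k) (ω≤z k)) (k³z≤ k))
                (*-monoˡ (lit (# 6)) (≤-trans (*-monoˡ (ι≥0 k ⊠ ι≥0 k) (ω≤z k)) (k²z≤ k))))
                (*-monoˡ (lit (# 24)) (≤-trans (*-monoˡ (ι≥0 k) (ω≤z k)) (kz≤ k)))))))
             (≤by (lit (J * (1 ÷′ 6)) ⊠ (lit (4 ÷′ 100) ⊠ m²≥0 ⊠ diff m≥250 ⊹ lit (# 4) ⊠ m≥0 ⊠ diff m≥250 ⊹ lit (# 976) ⊠ diff m≥250 ⊹ lit (# 976 * # 250 - # 8) ⊹ lit (104 ÷′ 100 * (# 6 * (9699 ÷′ 10000)) - # 6 - 4 ÷′ 100) ⊠ m³≥0)) (e m))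
            where e = ring 1 (λ m → 10000 :/ 9699 :* (1 :/ 6 :* (:# 6 :* (m :* m :* m) :+ :# 6 :* (m :* m) :+ :# 24 :* m :+ :# 8)) :+ 10000 :/ 9699 :* (1 :/ 6) :* (4 :/ 100 :* (m :* m) :* (m :- :# 250) :+ :# 4 :* m :* (m :- :# 250) :+ :# 976 :* (m :- :# 250) :+ (:# 976 :* :# 250 :- :# 8) :+ (104 :/ 100 :* (:# 6 :* (9699 :/ 10000)) :- :# 6 :- 4 :/ 100) :* (m :* m :* m)) := 104 :/ 100 :* (m :* m :* m)) refl

          -- 1/52 is half of 1/26, the bound that `near` asks for, as `A ≤ 2` where this is applied.
          τ≤ : ∀ k → τ k ≤ 1 ÷′ 52
          τ≤ zero = lit≤ _ _
          τ≤ (suc zero) = ≤-trans (≤-reflexive (sym (*-assoc J (g + 1ℚ) σ))) (≤-trans (*-monoʳ σ≥0 J[g+1]≤) (≤-trans (≤-reflexive (*-assoc (1 ÷′ 16) m σ)) (≤-trans (*-monoˡ (lit (1 ÷′ 16)) mσ≤) (lit≤ _ _))))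
          τ≤ (suc (suc k)) = ≤-trans (≤-reflexive (e J w σ (E₃ (suc k)))) (≤-trans (*-monoʳ (w≥0 ⊠ σ≥0) (E₃≤ (suc k)))
               (≤-trans (≤-reflexive (e₁ m w σ)) (≤-trans (*-monoˡ (lit (104 ÷′ 100)) (*-mono Y≥0 Y≤ (m≥0 ⊠ σ≥0) mσ≤)) (lit≤ _ _))))
            where e = ring 4 (λ J w σ E → J :* (1 :/ 6 :* (w :* σ :* E)) := J :* (1 :/ 6 :* E) :* (w :* σ)) refl
                  e₁ = ring 3 (λ m w σ → 104 :/ 100 :* (m :* m :* m) :* (w :* σ) := 104 :/ 100 :* (m :* m :* w :* (m :* σ))) refl

          norm²≤ : norm² (Z K) ≤ c ^ L₁ * c ^ L₁
          norm²≤ = norm²-zone (141 ÷′ 100) (28 ÷′ 10) (lit _) (lit≤ _ _) (zone (141 ÷′ 100) (6 ÷′ 100) (lit _) (lit _) (lit _) Y≤)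

          X≥0 = ^≥0 L₁ c≥0

          -- When the phase is too large for `near`, its term exceeds 2 c^L₁; then `lower` is at
          -- most - c^L₁ and the modulus bound suffices.
          inside : lower ≤ a
          inside = cases≤ (51 ÷′ 100 * 𝒜) (# 2) small large
            where
            small : 51 ÷′ 100 * 𝒜 ≤ # 2 → lower ≤ a
            small p = ≤-trans (≤by (diff (^-anti c≥0 c≤1 (ℕ.m≤m⊔n (nsum l (suc K)) L₁)) ⊹ lit (51 ÷′ 100) ⊠ diff A²≤𝒜 ⊠ X≥0 ⊹ ε₂c≥0 ⊹ ε₃≥0)
                  (e (c ^ L₂) 𝒜 (c ^ L₁) (ε₂ * c ^ L₃) ε₃ (c ^ nsum l (suc K)) (A (suc K) * A (suc K))))
                (near τ≤ (≤-trans (*-monoˡ (lit (1 ÷′ 52)) A≤2) (lit≤ _ _)) X≥0 (subst (_≤ c ^ L₁ * c ^ L₁) (sym norm²-a) norm²≤))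
              where
              e = ring 7 (λ P 𝒜 X E F Q B → P :- 51 :/ 100 :* 𝒜 :* X :- E :- F :+ (Q :- P :+ 51 :/ 100 :* (𝒜 :- B) :* X :+ E :+ F) := Q :- 51 :/ 100 :* B :* X) refl
              A≤2 : A (suc K) ≤ # 2
              A≤2 = sqrt≤ (lit _) (≤-trans A²≤𝒜 (*-cancel (lit< 0ℚ (51 ÷′ 100)) (≤-trans p (lit≤ _ _))))
            large : # 2 ≤ 51 ÷′ 100 * 𝒜 → lower ≤ a
            large p = ≤-trans (≤by (diff c^L₂≤c^L₁ ⊹ diff p ⊠ X≥0 ⊹ ε₂c≥0 ⊹ ε₃≥0) (e (c ^ L₂) (51 ÷′ 100 * 𝒜) (c ^ L₁) (ε₂ * c ^ L₃) ε₃)) (a≥ X≥0 norm²≤)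
              where
              e = ring 5 (λ P 𝒜 X E F → P :- 𝒜 :* X :- E :- F :+ (X :- P :+ (𝒜 :- :# 2) :* X :+ E :+ F) := :- X) refl

        -- On each interval between 0.06, 0.1, 0.25, 0.8 and 2 the right end limits the slope `q`,
        -- hence `l`, and the left end must still yield the decay `ε₂`.
        lower≤a : lower ≤ a
        lower≤a = cases≤ Y (6 ÷′ 100) Inside.inside λ h₀ →
          cases≤ Y (1 ÷′ 10) (λ h → middle h₀ (norm²-middle (136 ÷′ 100) (271 ÷′ 100) (lit _) (6 ÷′ 100) (1 ÷′ 10) (lit _) (lit _) (lit _) (lit≤ _ _) (lit< _ _) (lit≤ _ _) (lit≤ _ _) (lit≤ _ _) h₀ h)) λ h₁ →
          cases≤ Y (1 ÷′ 4) (λ h → middle h₀ (norm²-middle (117 ÷′ 100) (233 ÷′ 100) (lit _) (1 ÷′ 10) (1 ÷′ 4) (lit _) (lit _) (lit _) (lit≤ _ _) (lit< _ _) (lit≤ _ _) (lit≤ _ _) (lit≤ _ _) h₁ h)) λ h₂ →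
          cases≤ Y (4 ÷′ 5) (λ h → middle h₀ (norm²-middle (77 ÷′ 100) (153 ÷′ 100) (lit _) (1 ÷′ 4) (4 ÷′ 5) (lit _) (lit _) (lit _) (lit≤ _ _) (lit< _ _) (lit≤ _ _) (lit≤ _ _) (lit≤ _ _) h₂ h)) λ h₃ →
          cases≤ Y (# 2) (λ h → middle h₀ (norm²-middle (42 ÷′ 100) (83 ÷′ 100) (lit _) (4 ÷′ 5) (# 2) (lit _) (lit _) (lit _) (lit≤ _ _) (lit< _ _) (lit≤ _ _) (lit≤ _ _) (lit≤ _ _) h₃ h)) beyond

      -- Moments of the lower bound

      open Beta hiding (c)
      open BetaBounds


      -- q = 1/m³ is the natural unit of w: the moments of w^j are compared with q^j β.
      q M₃ : ℚ
      q = s * s * s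
      M₃ = m * m * m

      q≥0 = s≥0 ⊠ s≥0 ⊠ s≥0

      M₃q : M₃ * q ≡ 1ℚ
      M₃q = trans (e m s) (cong (λ t → t * t * t) ms)
        where e = ring 2 (λ m s → m :* m :* m :* (s :* s :* s) := m :* s :* (m :* s) :* (m :* s)) refl

      M₃≥ : # 15625000 ≤ M₃
      M₃≥ = *-mono (lit (# 62500)) (*-mono (lit (# 250)) m≥250 (lit (# 250)) m≥250) (lit (# 250)) m≥250

      s>0 = inv>0 m>0
      q>0 : 0ℚ < q
      q>0 = 0<* (0<* s>0 s>0) s>0

      q≤1 : q ≤ 1ℚ
      q≤1 = *-cancel m³>0 (≤-trans (≤-reflexive M₃q) (≤-trans (≤-trans (lit≤ 1ℚ (# 15625000)) M₃≥) (≤-reflexive (sym (*-identityʳ M₃)))))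

      h₁ : 1ℚ ≤ 5 ÷′ 14 * q * (1ℚ + ι L₁)
      h₁ = ≤by (lit (5 ÷′ 14) ⊠ q≥0 ⊠ diff (ex≥ (28 ÷′ 10) (lit _))) (trans (cong (λ t → t + 5 ÷′ 14 * q * (1ℚ + ι L₁ - 28 ÷′ 10 * M₃)) (sym M₃q)) (e M₃ q (ι L₁)))
        where e = ring 3 (λ M q L → M :* q :+ 5 :/ 14 :* q :* (con 1ℚ :+ L :- 28 :/ 10 :* M) := 5 :/ 14 :* q :* (con 1ℚ :+ L)) refl

      h₃ : 1ℚ ≤ # 2 * q * (1ℚ + ι L₃)
      h₃ = ≤by (lit (# 2) ⊠ q≥0 ⊠ diff (ex≥ ½ (lit _))) (trans (cong (λ t → t + # 2 * q * (1ℚ + ι L₃ - ½ * M₃)) (sym M₃q)) (e M₃ q (ι L₃)))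
        where e = ring 3 (λ M q L → M :* q :+ :# 2 :* q :* (con 1ℚ :+ L :- con ½ :* M) := :# 2 :* q :* (con 1ℚ :+ L)) refl

      -- `mom-step` with 1 / (1 + L) ≤ k q: the next moment gains at most (4j + 2) k q, and `C′`
      -- rounds up.
      grow : ∀ L k j C C′ → 0ℚ ≤ k → 1ℚ ≤ k * q * (1ℚ + ι L) → C * (# 4 * ι j + # 2) * k ≤ C′ → mom L j ≤ C * (q ^ j * β L) → mom L (suc j) ≤ C′ * (q ^ suc j * β L)
      grow L k j C C′ k0 h hC p = ≤-trans (mom-step L j (k0 ⊠ q≥0) h) (≤by (k0 ⊠ q≥0 ⊠ (lit (# 4) ⊠ ι≥0 j ⊹ lit (# 2)) ⊠ diff p ⊹ diff hC ⊠ (q≥0 ⊠ (^≥0 j q≥0 ⊠ β≥0 L))) (e k q (ι j) C C′ (q ^ j) (β L) (mom L j)))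
        where e = ring 8 (λ k q j C C′ Q b M → k :* q :* ((:# 4 :* j :+ :# 2) :* M) :+ (k :* q :* (:# 4 :* j :+ :# 2) :* (C :* (Q :* b) :- M) :+ (C′ :- C :* (:# 4 :* j :+ :# 2) :* k) :* (q :* (Q :* b))) := C′ :* (q :* Q :* b)) refl

      start : ∀ L → mom L 0 ≤ 1ℚ * (q ^ 0 * β L)
      start L = ≤-reflexive (e (β L))
        where e = ring 1 (λ b → b := con 1ℚ :* (con 1ℚ :* b)) refl

      k₁≥0 = lit (5 ÷′ 14)

      m₁₁ : mom L₁ 1 ≤ 715 ÷′ 1000 * (q ^ 1 * β L₁)
      m₁₁ = grow L₁ (5 ÷′ 14) 0 (1ℚ) (715 ÷′ 1000) k₁≥0 h₁ (lit≤ _ _) (start L₁)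
      m₁₂ : mom L₁ 2 ≤ 1533 ÷′ 1000 * (q ^ 2 * β L₁)
      m₁₂ = grow L₁ (5 ÷′ 14) 1 (715 ÷′ 1000) (1533 ÷′ 1000) k₁≥0 h₁ (lit≤ _ _) m₁₁
      m₁₃ : mom L₁ 3 ≤ 5476 ÷′ 1000 * (q ^ 3 * β L₁)
      m₁₃ = grow L₁ (5 ÷′ 14) 2 (1533 ÷′ 1000) (5476 ÷′ 1000) k₁≥0 h₁ (lit≤ _ _) m₁₂
      m₁₄ : mom L₁ 4 ≤ 2738 ÷′ 100 * (q ^ 4 * β L₁)
      m₁₄ = grow L₁ (5 ÷′ 14) 3 (5476 ÷′ 1000) (2738 ÷′ 100) k₁≥0 h₁ (lit≤ _ _) m₁₃
      m₁₅ : mom L₁ 5 ≤ 1761 ÷′ 10 * (q ^ 5 * β L₁)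
      m₁₅ = grow L₁ (5 ÷′ 14) 4 (2738 ÷′ 100) (1761 ÷′ 10) k₁≥0 h₁ (lit≤ _ _) m₁₄

      m₃₁ : mom L₃ 1 ≤ # 4 * (q ^ 1 * β L₃)
      m₃₁ = grow L₃ (# 2) 0 (1ℚ) (# 4) (lit (# 2)) h₃ (lit≤ _ _) (start L₃)
      m₃₂ : mom L₃ 2 ≤ # 48 * (q ^ 2 * β L₃)
      m₃₂ = grow L₃ (# 2) 1 (# 4) (# 48) (lit (# 2)) h₃ (lit≤ _ _) m₃₁

      β₁ β₂ β₃ : ℚ
      β₁ = β L₁
      β₂ = β L₂
      β₃ = β L₃

      L₁≤L₂ : L₁ ℕ.≤ L₂
      L₁≤L₂ = ℕ.m≤n⊔m _ L₁

      L₃≤L₁ : L₃ ℕ.≤ L₁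
      L₃≤L₁ = ι≤⇒≤ (≤-<-trans (ex≤ ½ (lit _)) (≤-<-trans (*-monoʳ m³≥0 (lit≤ ½ (28 ÷′ 10))) (proj₂ (proj₂ (floor (28 ÷′ 10 * (m * m * m)) (lit (28 ÷′ 10) ⊠ m³≥0))))))

      -- Since L β² increases, a M₃ β² is at most L₂ β₂² ≤ 3.8 M₃ β₂²; hence the condition on a κ².
      compare : ∀ {L} a κ → L ℕ.≤ L₂ → 0ℚ < a → 0ℚ ≤ κ → a * M₃ ≤ ι L → 38 ÷′ 10 ≤ a * (κ * κ) → β L ≤ κ * β₂
      compare {L} a κ′ L≤ a>0 k0 aM h = sqrt≤ (k0 ⊠ β≥0 L₂) (*-cancel (0<* a>0 m³>0)
         (≤-trans (≤-trans (*-monoʳ (sq≥0 (β L)) aM) (Lβ²≤ L≤)) (≤by (diff L₂≤ ⊠ sq≥0 β₂ ⊹ m³≥0 ⊠ diff h ⊠ sq≥0 β₂) (e (ι L₂) M₃ β₂ a κ′))))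
        where e = ring 5 (λ L M b a k → L :* (b :* b) :+ ((38 :/ 10 :* M :- L) :* (b :* b) :+ M :* (a :* (k :* k) :- 38 :/ 10) :* (b :* b)) := a :* M :* (k :* b :* (k :* b))) refl

      β₁≤ : β₁ ≤ 117 ÷′ 100 * β₂
      β₁≤ = compare (279 ÷′ 100) (117 ÷′ 100) L₁≤L₂ (lit< _ _) (lit _) (≤by (diff (ex≥ (28 ÷′ 10) (lit _)) ⊹ lit (1 ÷′ 100) ⊠ diff M₃≥ ⊹ lit (# 156249)) (e M₃ (ι L₁))) (lit≤ _ _)
        where e = ring 2 (λ M L → 279 :/ 100 :* M :+ (con 1ℚ :+ L :- 28 :/ 10 :* M :+ 1 :/ 100 :* (M :- :# 15625000) :+ :# 156249) := L) refl

      β₃≤ : β₃ ≤ 276 ÷′ 100 * β₂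
      β₃≤ = compare (4999 ÷′ 10000) (276 ÷′ 100) (ℕ.≤-trans L₃≤L₁ L₁≤L₂) (lit< _ _) (lit _) (≤by (diff (ex≥ ½ (lit _)) ⊹ lit (1 ÷′ 10000) ⊠ diff M₃≥ ⊹ lit (1562 ÷′ 1 - ½)) (e M₃ (ι L₃))) (lit≤ _ _)
        where e = ring 2 (λ M L → 4999 :/ 10000 :* M :+ (con 1ℚ :+ L :- con ½ :* M :+ 1 :/ 10000 :* (M :- :# 15625000) :+ (1562 :/ 1 :- con ½)) := L) refl

      q≤β₂ : q ≤ 152 ÷′ 10 * β₂
      q≤β₂ = ≤by (q≥0 ⊠ diff (1≤4Lβ 1≤L₂) ⊹ lit (# 4) ⊠ q≥0 ⊠ β≥0 L₂ ⊠ diff L₂≤) (trans (e q (ι L₂) β₂ M₃) (trans (cong (λ t → 152 ÷′ 10 * (t * β₂)) M₃q) (cong (152 ÷′ 10 *_) (*-identityˡ β₂))))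
        where e = ring 4 (λ q L b M → q :+ (q :* (:# 4 :* L :* b :- con 1ℚ) :+ :# 4 :* q :* b :* (38 :/ 10 :* M :- L)) := 152 :/ 10 :* (M :* q :* b)) refl
              1≤L₂ : 1 ℕ.≤ L₂
              1≤L₂ = ℕ.≤-trans (ι≤⇒≤ (≤-<-trans (≤-trans (lit≤ (1ℚ + 0ℚ) (28 ÷′ 10 * # 15625000)) (*-monoˡ (lit (28 ÷′ 10)) M₃≥)) (proj₂ (proj₂ (floor (28 ÷′ 10 * (m * m * m)) (lit (28 ÷′ 10) ⊠ m³≥0)))))) L₁≤L₂

      -- The last error term carries no power of c, so its moments do not shrink with q and `ε₃`
      -- itself must. The power 0.38^(0.36 m) beats m^(-9), and 0.36 m ≥ 90 for m ≥ 250.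
      ε₃≤ : ε₃ ≤ 1 ÷′ 256000 * (q * (q * q))
      ε₃≤ = ≤-trans (D.decay j L∞ enough) (*-cancel (0<* m³>0 (0<* m³>0 m³>0)) (≤-trans main (≤-reflexive (sym (trans (e₀ M₃ q) (trans (cong (λ t → 1 ÷′ 256000 * (t * (t * t))) M₃q) refl))))))
        where
        h = ½ * (s * s)
        h>0 : 0ℚ < h
        h>0 = 0<* (lit< 0ℚ ½) (0<* s>0 s>0)
        h≤ : h ≤ 1 ÷′ 125000
        h≤ = ≤-trans (*-monoˡ (lit ½) s²≤) (lit≤ _ _)
        module D = Decay h h>0 (≤-trans h≤ (lit≤ _ _))
        km≥0 = lit (36 ÷′ 100) ⊠ m≥0
        j = proj₁ (floor (36 ÷′ 100 * m) km≥0)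
        j≤ : ι j ≤ 36 ÷′ 100 * m
        j≤ = proj₁ (proj₂ (floor (36 ÷′ 100 * m) km≥0))
        j> : 36 ÷′ 100 * m < 1ℚ + ι j
        j> = proj₂ (proj₂ (floor (36 ÷′ 100 * m) km≥0))
        90≤j : 90 ℕ.≤ j
        90≤j = ι≤⇒≤ (≤-<-trans (≤-trans (≤-reflexive (ι-lit 90)) (≤-trans (lit≤ (# 90) (36 ÷′ 100 * # 250)) (*-monoˡ (lit (36 ÷′ 100)) m≥250))) j>)
        e₀ = ring 2 (λ M q → M :* (M :* M) :* (1 :/ 256000 :* (q :* (q :* q))) := 1 :/ 256000 :* (M :* q :* (M :* q :* (M :* q)))) refl
        enough : ι j + ι j * h ≤ ι L∞ * h
        enough = ≤-trans (+-mono-≤ j≤ (*-monoʳ D.h≥0 j≤)) (≤by (D.h≥0 ⊠ diff (ex≥ (74 ÷′ 100) (lit _)) ⊹ lit (36 ÷′ 100) ⊠ m≥0 ⊠ diff h≤ ⊹ diff h≤ ⊹ lit (1 ÷′ 100 - 36 ÷′ 100 * (1 ÷′ 125000)) ⊠ diff m≥250 ⊹ lit (# 250 * (1 ÷′ 100 - 36 ÷′ 100 * (1 ÷′ 125000)) - 1 ÷′ 125000))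
           (trans (e₁ m h (ι L∞)) (trans (cong (λ t → t + (ι L∞ * h - 74 ÷′ 100 * (m * m * m) * h)) (trans (cong (λ t → 37 ÷′ 100 * (t * t * m) + (1ℚ - 1ℚ)) (sym ms)) (e₂ m s))) (e₃ (74 ÷′ 100 * (m * m * m) * h) (ι L∞ * h)))))
          where e₁ = ring 3 (λ m h L → 36 :/ 100 :* m :+ 36 :/ 100 :* m :* h :+ (h :* (con 1ℚ :+ L :- 74 :/ 100 :* (m :* m :* m)) :+ 36 :/ 100 :* m :* (1 :/ 125000 :- h) :+ (1 :/ 125000 :- h) :+ (1 :/ 100 :- 36 :/ 100 :* (1 :/ 125000)) :* (m :- :# 250) :+ (:# 250 :* (1 :/ 100 :- 36 :/ 100 :* (1 :/ 125000)) :- 1 :/ 125000)) := 37 :/ 100 :* (con 1ℚ :* con 1ℚ :* m) :+ (con 1ℚ :- con 1ℚ) :+ (L :* h :- 74 :/ 100 :* (m :* m :* m) :* h)) refl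
                e₂ = ring 2 (λ m s → 37 :/ 100 :* (m :* s :* (m :* s) :* m) :+ (con 1ℚ :- con 1ℚ) := 74 :/ 100 :* (m :* m :* m) :* (con ½ :* (s :* s))) refl
                e₃ = ring 2 (λ a b → a :+ (b :- a) := b) refl
        main : M₃ * (M₃ * M₃) * (38 ÷′ 100) ^ j ≤ 1 ÷′ 256000
        main = ≤-trans (≤-reflexive (e₄ m ((38 ÷′ 100) ^ j))) (≤-trans (*-monoʳ (^≥0 j (lit (38 ÷′ 100))) (^-mono 9 m≥0 m≤)) (≤-trans (≤-reflexive (trans (cong (_* (38 ÷′ 100) ^ j) (^-* (100 ÷′ 36) (1ℚ + ι j) 9)) (*-assoc ((100 ÷′ 36) ^ 9) ((1ℚ + ι j) ^ 9) ((38 ÷′ 100) ^ j))))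
           (≤-trans (*-monoˡ (lit ((100 ÷′ 36) ^ 9)) (subst (λ k → (1ℚ + ι k) ^ 9 * (38 ÷′ 100) ^ k ≤ (# 91) ^ 9 * (38 ÷′ 100) ^ 90) (ℕ.m∸n+n≡m 90≤j) (tiny (j ℕ.∸ 90)))) (lit≤ _ _))))
          where e₄ = ring 2 (λ m Z → m :* m :* m :* (m :* m :* m :* (m :* m :* m)) :* Z := m :* (m :* (m :* (m :* (m :* (m :* (m :* (m :* (m :* con 1ℚ)))))))) :* Z) refl
                m≤ : m ≤ 100 ÷′ 36 * (1ℚ + ι j)
                m≤ = *-cancel (lit< 0ℚ (36 ÷′ 100)) (≤-trans (<⇒≤ j>) (≤-reflexive (e₅ (1ℚ + ι j))))
                  where e₅ = ring 1 (λ a → a := 36 :/ 100 :* (100 :/ 36 :* a)) refl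

      -- Moments of the subtracted terms of the lower bound.
      T err N : ℕ → ℚ
      T j = m ^ 8 * mom L₁ (3 ℕ.+ j) + 1 ÷′ 8 * m ^ 5 * mom L₁ (2 ℕ.+ j) + 1 ÷′ 256 * m ^ 2 * mom L₁ (1 ℕ.+ j)
      err j = 51 ÷′ 100 * T j + ε₂ * mom L₃ j + ε₃ * mom 0 j
      N j = mom L₂ j - err j

      -- m^8 q^(3+j), m^5 q^(2+j) and m^2 q^(1+j) all equal s q^j.
      T≤ : ∀ j C₁ C₂ C₃ C → mom L₁ (3 ℕ.+ j) ≤ C₃ * (q ^ (3 ℕ.+ j) * β₁) → mom L₁ (2 ℕ.+ j) ≤ C₂ * (q ^ (2 ℕ.+ j) * β₁) → mom L₁ (1 ℕ.+ j) ≤ C₁ * (q ^ (1 ℕ.+ j) * β₁) →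
           0ℚ ≤ C₃ + 1 ÷′ 8 * C₂ + 1 ÷′ 256 * C₁ → C₃ + 1 ÷′ 8 * C₂ + 1 ÷′ 256 * C₁ ≤ C → T j ≤ C * (117 ÷′ 25000) * (q ^ j * β₂)
      T≤ j C₁ C₂ C₃ C p₃ p₂ p₁ C′0 h = ≤-trans (≤by (^≥0 8 m≥0 ⊠ diff p₃ ⊹ lit (1 ÷′ 8) ⊠ ^≥0 5 m≥0 ⊠ diff p₂ ⊹ lit (1 ÷′ 256) ⊠ ^≥0 2 m≥0 ⊠ diff p₁)
            (trans (e₀ (m ^ 8) (m ^ 5) (m ^ 2) (mom L₁ (3 ℕ.+ j)) (mom L₁ (2 ℕ.+ j)) (mom L₁ (1 ℕ.+ j)) C₃ C₂ C₁ (q ^ (3 ℕ.+ j) * β₁) (q ^ (2 ℕ.+ j) * β₁) (q ^ (1 ℕ.+ j) * β₁))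
              (trans (e₁ m s (q ^ j) β₁ C₁ C₂ C₃) (trans (cong (λ t → (C₃ * (t * t * t * t * (t * t * t * t)) + 1 ÷′ 8 * C₂ * (t * t * t * t * t) + 1 ÷′ 256 * C₁ * (t * t)) * (s * (q ^ j * β₁))) ms) (e₂ C₁ C₂ C₃ (s * (q ^ j * β₁)))))))
           (≤-trans (*-mono C′0 h (s≥0 ⊠ (Q≥0 ⊠ β≥0 L₁)) (*-mono s≥0 s≤ (Q≥0 ⊠ β≥0 L₁) (*-monoˡ Q≥0 β₁≤))) (≤-reflexive (e₃ C (q ^ j) β₂)))
        where
        Q≥0 = ^≥0 j q≥0
        e₀ = ring 12 (λ a b c x y z C₃ C₂ C₁ X Y Z → a :* x :+ 1 :/ 8 :* b :* y :+ 1 :/ 256 :* c :* z :+ (a :* (C₃ :* X :- x) :+ 1 :/ 8 :* b :* (C₂ :* Y :- y) :+ 1 :/ 256 :* c :* (C₁ :* Z :- z)) := a :* (C₃ :* X) :+ 1 :/ 8 :* b :* (C₂ :* Y) :+ 1 :/ 256 :* c :* (C₁ :* Z)) refl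
        e₁ = ring 7 (λ m s Q b C₁ C₂ C₃ → m :* (m :* (m :* (m :* (m :* (m :* (m :* (m :* con 1ℚ))))))) :* (C₃ :* (s :* s :* s :* (s :* s :* s :* (s :* s :* s :* Q)) :* b)) :+ 1 :/ 8 :* (m :* (m :* (m :* (m :* (m :* con 1ℚ))))) :* (C₂ :* (s :* s :* s :* (s :* s :* s :* Q) :* b)) :+ 1 :/ 256 :* (m :* (m :* con 1ℚ)) :* (C₁ :* (s :* s :* s :* Q :* b)) := (C₃ :* (m :* s :* (m :* s) :* (m :* s) :* (m :* s) :* (m :* s :* (m :* s) :* (m :* s) :* (m :* s))) :+ 1 :/ 8 :* C₂ :* (m :* s :* (m :* s) :* (m :* s) :* (m :* s) :* (m :* s)) :+ 1 :/ 256 :* C₁ :* (m :* s :* (m :* s))) :* (s :* (Q :* b))) refl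
        e₂ = ring 4 (λ C₁ C₂ C₃ X → (C₃ :* (con 1ℚ :* con 1ℚ :* con 1ℚ :* con 1ℚ :* (con 1ℚ :* con 1ℚ :* con 1ℚ :* con 1ℚ)) :+ 1 :/ 8 :* C₂ :* (con 1ℚ :* con 1ℚ :* con 1ℚ :* con 1ℚ :* con 1ℚ) :+ 1 :/ 256 :* C₁ :* (con 1ℚ :* con 1ℚ)) :* X := (C₃ :+ 1 :/ 8 :* C₂ :+ 1 :/ 256 :* C₁) :* X) refl
        e₃ = ring 3 (λ C Q b → C :* (1 :/ 250 :* (Q :* (117 :/ 100 :* b))) := C :* (117 :/ 25000) :* (Q :* b)) refl

      err₀ : err 0 ≤ 2 ÷′ 100 * β₂
      err₀ = ≤-trans (+-mono-≤ (+-mono-≤ (*-monoˡ (lit (51 ÷′ 100)) (T≤ 0 (715 ÷′ 1000) (1533 ÷′ 1000) (5476 ÷′ 1000) (568 ÷′ 100) m₁₃ m₁₂ m₁₁ (lit _) (lit≤ _ _))) (*-monoˡ (lit ε₂) β₃≤)) (*-monoʳ (lit (mom 0 0)) ε₃≤))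
         (≤by (lit (1 ÷′ 256000) ⊠ diff qqq ⊹ lit (2 ÷′ 100 - 51 ÷′ 100 * (568 ÷′ 100 * (117 ÷′ 25000)) - ε₂ * (276 ÷′ 100) - 1 ÷′ 256000 * (152 ÷′ 10)) ⊠ β≥0 L₂) (e β₂ ε₂ (q * (q * q))))
        where qqq : q * (q * q) ≤ 152 ÷′ 10 * β₂
              qqq = ≤-trans (≤-trans (*-monoˡ q≥0 (≤-trans (*-mono q≥0 q≤1 q≥0 q≤1) ≤-refl)) (≤-reflexive (*-identityʳ q))) q≤β₂
              e = ring 3 (λ b E Q → 51 :/ 100 :* (568 :/ 100 :* (117 :/ 25000) :* (con 1ℚ :* b)) :+ E :* (276 :/ 100 :* b) :+ 1 :/ 256000 :* Q :* con 1ℚ :+ (1 :/ 256000 :* (152 :/ 10 :* b :- Q) :+ (2 :/ 100 :- 51 :/ 100 :* (568 :/ 100 :* (117 :/ 25000)) :- E :* (276 :/ 100) :- 1 :/ 256000 :* (152 :/ 10)) :* b) := 2 :/ 100 :* b) refl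

      err₁ : err 1 ≤ 73 ÷′ 1000 * (q * β₂)
      err₁ = ≤-trans (+-mono-≤ (+-mono-≤ (*-monoˡ (lit (51 ÷′ 100)) (T≤ 1 (1533 ÷′ 1000) (5476 ÷′ 1000) (2738 ÷′ 100) (2808 ÷′ 100) m₁₄ m₁₃ m₁₂ (lit _) (lit≤ _ _))) (*-monoˡ (lit ε₂) (≤-trans m₃₁ (*-monoˡ (lit (# 4)) (*-monoˡ (^≥0 1 q≥0) β₃≤))))) (*-monoʳ (lit (mom 0 1)) ε₃≤))
         (≤by (lit (1 ÷′ 128000) ⊠ q≥0 ⊠ diff qq ⊹ lit (73 ÷′ 1000 - 51 ÷′ 100 * (2808 ÷′ 100 * (117 ÷′ 25000)) - # 4 * ε₂ * (276 ÷′ 100) - 1 ÷′ 128000 * (152 ÷′ 10)) ⊠ (q≥0 ⊠ β≥0 L₂)) (e β₂ ε₂ q))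
        where qq : q * q ≤ 152 ÷′ 10 * β₂
              qq = ≤-trans (≤-trans (*-monoˡ q≥0 q≤1) (≤-reflexive (*-identityʳ q))) q≤β₂
              e = ring 3 (λ b E q → 51 :/ 100 :* (2808 :/ 100 :* (117 :/ 25000) :* (q :* con 1ℚ :* b)) :+ E :* (:# 4 :* (q :* con 1ℚ :* (276 :/ 100 :* b))) :+ 1 :/ 256000 :* (q :* (q :* q)) :* :# 2 :+ (1 :/ 128000 :* q :* (152 :/ 10 :* b :- q :* q) :+ (73 :/ 1000 :- 51 :/ 100 :* (2808 :/ 100 :* (117 :/ 25000)) :- :# 4 :* E :* (276 :/ 100) :- 1 :/ 128000 :* (152 :/ 10)) :* (q :* b)) := 73 :/ 1000 :* (q :* b)) refl

      err₂ : err 2 ≤ 49 ÷′ 100 * (q * q * β₂)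
      err₂ = ≤-trans (+-mono-≤ (+-mono-≤ (*-monoˡ (lit (51 ÷′ 100)) (T≤ 2 (5476 ÷′ 1000) (2738 ÷′ 100) (1761 ÷′ 10) (1796 ÷′ 10) m₁₅ m₁₄ m₁₃ (lit _) (lit≤ _ _))) (*-monoˡ (lit ε₂) (≤-trans m₃₂ (*-monoˡ (lit (# 48)) (*-monoˡ (^≥0 2 q≥0) β₃≤))))) (*-monoʳ (lit (mom 0 2)) ε₃≤))
         (≤by (lit (6 ÷′ 256000) ⊠ (q≥0 ⊠ q≥0) ⊠ diff q≤β₂ ⊹ lit (49 ÷′ 100 - 51 ÷′ 100 * (1796 ÷′ 10 * (117 ÷′ 25000)) - # 48 * ε₂ * (276 ÷′ 100) - 6 ÷′ 256000 * (152 ÷′ 10)) ⊠ (q≥0 ⊠ q≥0 ⊠ β≥0 L₂)) (e β₂ ε₂ q))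
        where e = ring 3 (λ b E q → 51 :/ 100 :* (1796 :/ 10 :* (117 :/ 25000) :* (q :* (q :* con 1ℚ) :* b)) :+ E :* (:# 48 :* (q :* (q :* con 1ℚ) :* (276 :/ 100 :* b))) :+ 1 :/ 256000 :* (q :* (q :* q)) :* :# 6 :+ (6 :/ 256000 :* (q :* q) :* (152 :/ 10 :* b :- q) :+ (49 :/ 100 :- 51 :/ 100 :* (1796 :/ 10 :* (117 :/ 25000)) :- :# 48 :* E :* (276 :/ 100) :- 6 :/ 256000 :* (152 :/ 10)) :* (q :* q :* b)) := 49 :/ 100 :* (q :* q :* b)) refl

      -- From moments to central differences

      module Curvature (n : ℕ) (n₀≡ : n₀ ≡ 2 ℕ.+ n) where
        module C = Coefficients r r>0 r≤1

        U M₂ M₄ : ℚ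
        U = 1ℚ + ι L₂
        M₂ = mom L₂ 1
        M₄ = mom L₂ 2

        U≥ : # 8 ≤ U
        U≥ = ≤-trans (≤-trans (lit≤ (# 8) (28 ÷′ 10 * # 15625000)) (*-monoˡ (lit (28 ÷′ 10)) M₃≥)) (≤-trans (ex≥ (28 ÷′ 10) (lit _)) (+-monoʳ-≤ 1ℚ (ι-mono L₁≤L₂)))

        U≥0 = ≤-trans (lit (# 8)) U≥
        U>0 = <-≤-trans (lit< 0ℚ (# 8)) U≥

        UM₂ : U * M₂ ≡ # 2 * β₂
        UM₂ = trans (e U M₂) (trans (proj₂ (mom-ratio 0 L₂)) (e₁ β₂))
          where e = ring 2 (λ U M → U :* M := (U :+ con 0ℚ) :* M) refl
                e₁ = ring 1 (λ b → (:# 4 :* con 0ℚ :+ :# 2) :* b := :# 2 :* b) refl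

        UM₄ : (U + 1ℚ) * M₄ ≡ # 6 * M₂
        UM₄ = trans (e U M₄) (trans (proj₂ (mom-ratio 1 L₂)) (e₁ M₂))
          where e = ring 2 (λ U M → (U :+ con 1ℚ) :* M := (U :+ (con 1ℚ :+ con 0ℚ)) :* M) refl
                e₁ = ring 1 (λ b → (:# 4 :* (con 1ℚ :+ con 0ℚ) :+ :# 2) :* b := :# 6 :* b) refl

        β₂>0 : 0ℚ < β₂
        β₂>0 = *-cancel< (<-≤-trans q>0 q≤β₂)
          where *-cancel< : 0ℚ < 152 ÷′ 10 * β₂ → 0ℚ < β₂
                *-cancel< h = subst₂ _<_ (*-zeroʳ (10 ÷′ 152)) (e β₂) (*-monoʳ-<-pos (10 ÷′ 152) h)
                  where e = ring 1 (λ b → 10 :/ 152 :* (152 :/ 10 :* b) := b) refl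

        qU≤ : q * (U + 1ℚ) ≤ 3801 ÷′ 1000
        qU≤ = ≤-trans (≤by (q≥0 ⊠ diff L₂≤ ⊹ q≥0 ⊠ (lit (1 ÷′ 1000) ⊠ diff M₃≥ ⊹ lit (# 15623))) (e q (ι L₂) M₃)) (≤-reflexive (trans (e₁ q M₃) (trans (cong (3801 ÷′ 1000 *_) M₃q) refl)))
          where e = ring 3 (λ q L M → q :* (con 1ℚ :+ L :+ con 1ℚ) :+ (q :* (38 :/ 10 :* M :- L) :+ q :* (1 :/ 1000 :* (M :- :# 15625000) :+ :# 15623)) := q :* (3801 :/ 1000 :* M)) refl
                e₁ = ring 2 (λ q M → q :* (3801 :/ 1000 :* M) := 3801 :/ 1000 :* (M :* q)) refl

        qU≤′ : q * U ≤ 3801 ÷′ 1000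
        qU≤′ = ≤-trans (≤by q≥0 (e q U)) qU≤
          where e = ring 2 (λ q U → q :* U :+ q := q :* (U :+ con 1ℚ)) refl

        -- U M₂ = 2 β₂ and q U ≤ 3.801 turn an error in units of q into a fraction of the main
        -- moment.
        err₁≤ : err 1 ≤ 2 ÷′ 10 * M₂
        err₁≤ = *-cancel U>0 (≤-trans (*-monoˡ U≥0 err₁) (≤-trans (≤by (lit (73 ÷′ 1000) ⊠ β≥0 L₂ ⊠ diff qU≤′ ⊹ lit (4 ÷′ 10 - 73 ÷′ 1000 * (3801 ÷′ 1000)) ⊠ β≥0 L₂) (e U q β₂))
            (≤-reflexive (trans (cong (2 ÷′ 10 *_) (sym UM₂)) (e₁ U M₂)))))
          where e = ring 3 (λ U q b → U :* (73 :/ 1000 :* (q :* b)) :+ (73 :/ 1000 :* b :* (3801 :/ 1000 :- q :* U) :+ (4 :/ 10 :- 73 :/ 1000 :* (3801 :/ 1000)) :* b) := 2 :/ 10 :* (:# 2 :* b)) refl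
                e₁ = ring 2 (λ U M → 2 :/ 10 :* (U :* M) := U :* (2 :/ 10 :* M)) refl

        U+1>0 : 0ℚ < U + 1ℚ
        U+1>0 = 0<+ U>0 (lit 1ℚ)

        err₂≤ : err 2 ≤ 6 ÷′ 10 * M₄
        err₂≤ = *-cancel (0<* U>0 U+1>0) (≤-trans (*-monoˡ (U≥0 ⊠ <⇒≤ U+1>0) err₂) (≤-trans
            (≤by (lit (49 ÷′ 100) ⊠ β≥0 L₂ ⊠ diff (*-mono (q≥0 ⊠ U≥0) qU≤′ (q≥0 ⊠ <⇒≤ U+1>0) qU≤) ⊹ lit (72 ÷′ 10 - 49 ÷′ 100 * (3801 ÷′ 1000 * (3801 ÷′ 1000))) ⊠ β≥0 L₂) (e U q β₂))
            (≤-reflexive (trans (cong (36 ÷′ 10 *_) (sym UM₂)) (trans (e₁ U M₂) (trans (cong (λ t → 6 ÷′ 10 * (U * t)) (sym UM₄)) (e₂ U M₄)))))))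
          where e = ring 3 (λ U q b → U :* (U :+ con 1ℚ) :* (49 :/ 100 :* (q :* q :* b)) :+ (49 :/ 100 :* b :* (3801 :/ 1000 :* (3801 :/ 1000) :- q :* U :* (q :* (U :+ con 1ℚ))) :+ (72 :/ 10 :- 49 :/ 100 :* (3801 :/ 1000 :* (3801 :/ 1000))) :* b) := 36 :/ 10 :* (:# 2 :* b)) refl
                e₁ = ring 2 (λ U M → 36 :/ 10 :* (U :* M) := 6 :/ 10 :* (U :* (:# 6 :* M))) refl
                e₂ = ring 2 (λ U M → 6 :/ 10 :* (U :* ((U :+ con 1ℚ) :* M)) := U :* (U :+ con 1ℚ) :* (6 :/ 10 :* M)) refl

        err≥0 : ∀ j → 0ℚ ≤ err j
        err≥0 j = lit (51 ÷′ 100) ⊠ (^≥0 8 m≥0 ⊠ mom≥0 L₁ (3 ℕ.+ j) ⊹ lit (1 ÷′ 8) ⊠ ^≥0 5 m≥0 ⊠ mom≥0 L₁ (2 ℕ.+ j) ⊹ lit (1 ÷′ 256) ⊠ ^≥0 2 m≥0 ⊠ mom≥0 L₁ (1 ℕ.+ j)) ⊹ lit ε₂ ⊠ mom≥0 L₃ j ⊹ ε₃≥0 ⊠ mom≥0 0 j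

        M₂≥0 = mom≥0 L₂ 1
        M₂>0 : 0ℚ < M₂
        M₂>0 = subst₂ _<_ (*-zeroʳ (inv U)) (trans (sym (*-assoc (inv U) U M₂)) (trans (cong (_* M₂) (trans (*-comm (inv U) U) (inv-* U>0))) (*-identityˡ M₂)))
           (*-monoʳ-<-pos (inv U) {{positive (inv>0 U>0)}} (subst (0ℚ <_) (sym UM₂) (0<* (lit< 0ℚ (# 2)) β₂>0)))
        M₄≥0 = mom≥0 L₂ 2

        N₀>0 : 0ℚ < N 0
        N₀>0 = <-≤-trans (0<* (lit< 0ℚ (98 ÷′ 100)) β₂>0) (≤by (diff err₀) (e β₂ (err 0)))
          where e = ring 2 (λ b E → 98 :/ 100 :* b :+ (2 :/ 100 :* b :- E) := b :- E) refl

        N₂≥ : 8 ÷′ 10 * M₂ ≤ N 1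
        N₂≥ = ≤by (diff err₁≤) (e M₂ (err 1))
          where e = ring 2 (λ b E → 8 :/ 10 :* b :+ (2 :/ 10 :* b :- E) := b :- E) refl

        N≤ : ∀ j → N j ≤ mom L₂ j
        N≤ j = ≤by (err≥0 j) (e (mom L₂ j) (err j))
          where e = ring 2 (λ b E → b :- E :+ E := b) refl

        N₄≥ : 4 ÷′ 10 * M₄ ≤ N 2
        N₄≥ = ≤by (diff err₂≤) (e M₄ (err 2))
          where e = ring 2 (λ b E → 4 :/ 10 :* b :+ (6 :/ 10 :* b :- E) := b :- E) refl

        M₄≤M₂ : M₄ ≤ M₂
        M₄≤M₂ = *-cancel U+1>0 (≤-trans (≤-reflexive UM₄) (≤by (diff U≥ ⊠ M₂≥0 ⊹ lit (# 3) ⊠ M₂≥0) (e U M₂)))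
          where e = ring 2 (λ U M → :# 6 :* M :+ ((U :- :# 8) :* M :+ :# 3 :* M) := (U :+ con 1ℚ) :* M) refl

        -- For the main terms (U + 1) β₂ M₄ = 3 U M₂², the Gaussian ratio up to 1/U. After the
        -- losses 0.98 · 0.4 · 3 = 1.176 remains, still above 1 + 1/U as U ≥ 8.
        N₂²< : N 1 * N 1 < N 0 * N 2
        N₂²< = ≤-<-trans (*-mono (≤-trans (lit (8 ÷′ 10) ⊠ M₂≥0) N₂≥) (N≤ 1) (≤-trans (lit (8 ÷′ 10) ⊠ M₂≥0) N₂≥) (N≤ 1)) (<-≤-trans strict 
            (*-mono (lit (98 ÷′ 100) ⊠ β≥0 L₂) (≤by (diff err₀) (e β₂ (err 0))) (lit (4 ÷′ 10) ⊠ M₄≥0) N₄≥))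
          where e = ring 2 (λ b E → 98 :/ 100 :* b :+ (2 :/ 100 :* b :- E) := b :- E) refl
                strict : M₂ * M₂ < 98 ÷′ 100 * β₂ * (4 ÷′ 10 * M₄)
                strict = *-cancel<₀ U+1>0 (<-≤-trans (<by (0<* (0<* M₂>0 M₂>0) (0<+ (lit< 0ℚ (1 ÷′ 100)) (lit (176 ÷′ 1000) ⊠ diff U≥ ⊹ lit (176 ÷′ 1000 * # 8 - 101 ÷′ 100)))) (e₁ U M₂))
                    (≤-reflexive (trans (e₂ U M₂) (trans (cong (λ t → 98 ÷′ 100 * (½ * t) * (4 ÷′ 10 * (# 6 * M₂))) UM₂) (trans (cong (λ t → 98 ÷′ 100 * (½ * (# 2 * β₂)) * (4 ÷′ 10 * t)) (sym UM₄)) (e₃ U β₂ M₄))))))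
                  where
                  *-cancel<₀ : ∀ {a b c} → 0ℚ < c → c * a < c * b → a < b
                  *-cancel<₀ {c = c} p = *-cancelˡ-<-nonNeg c {{nonNegative (<⇒≤ p)}}
                  e₁ = ring 2 (λ U M → (U :+ con 1ℚ) :* (M :* M) :+ M :* M :* (1 :/ 100 :+ (176 :/ 1000 :* (U :- :# 8) :+ (176 :/ 1000 :* :# 8 :- 101 :/ 100))) := 1176 :/ 1000 :* U :* (M :* M)) refl
                  e₂ = ring 2 (λ U M → 1176 :/ 1000 :* U :* (M :* M) := 98 :/ 100 :* (con ½ :* (U :* M)) :* (4 :/ 10 :* (:# 6 :* M))) refl
                  e₃ = ring 3 (λ U b M → 98 :/ 100 :* (con ½ :* (:# 2 :* b)) :* (4 :/ 10 :* ((U :+ con 1ℚ) :* M)) := (U :+ con 1ℚ) :* (98 :/ 100 :* b :* (4 :/ 10 :* M))) refl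

        N₄<4N₂ : N 2 < # 4 * N 1
        N₄<4N₂ = ≤-<-trans (≤-trans (N≤ 2) M₄≤M₂) (<-≤-trans (<by (0<* (lit< 0ℚ (22 ÷′ 10)) M₂>0) (e M₂)) (*-monoˡ (lit (# 4)) N₂≥))
          where e = ring 1 (λ M → M :+ 22 :/ 10 :* M := :# 4 :* (8 :/ 10 :* M)) refl

        low : Point → ℚ
        low x = At.lower x

        -- Expanding `𝒜` gives m^8 w³ + m^5 w² / 8 + m² w / 256, the three terms of `T`.
        mean-low : ∀ j → HasMean (λ x → low x * Point.w x ^ j) (N j)
        mean-low j = mean-eq (e₀ (mom L₂ j) (mom L₁ (3 ℕ.+ j)) (mom L₁ (2 ℕ.+ j)) (mom L₁ (1 ℕ.+ j)) (mom L₃ j) (mom 0 j) (m ^ 8) (m ^ 5) (m ^ 2) ε₂ ε₃)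
          (mean-ext (λ x → e₁ m (Beta.c x ^ L₂) (Beta.c x ^ L₁) (Beta.c x ^ L₃) (Point.w x) (Point.w x ^ j) ε₂ ε₃)
           (mean-lin 1ℚ 1ℚ (mean-lin₄ 1ℚ (- (51 ÷′ 100) * m ^ 8) (- (51 ÷′ 100) * (1 ÷′ 8 * m ^ 5)) (- (51 ÷′ 100) * (1 ÷′ 256 * m ^ 2)) (mean-mom j L₂) (mean-mom (3 ℕ.+ j) L₁) (mean-mom (2 ℕ.+ j) L₁) (mean-mom (1 ℕ.+ j) L₁))
              (mean-lin (- ε₂) (- ε₃) (mean-mom j L₃) (mean-mom j 0))))
          where
          e₀ = ring 11 (λ a b c d f h m₈ m₅ m₂ E F → con 1ℚ :* (con 1ℚ :* (con 1ℚ :* a :+ :- (51 :/ 100) :* m₈ :* b) :+ con 1ℚ :* (:- (51 :/ 100) :* (1 :/ 8 :* m₅) :* c :+ :- (51 :/ 100) :* (1 :/ 256 :* m₂) :* d)) :+ con 1ℚ :* ((:- E) :* f :+ (:- F) :* h) := a :- (51 :/ 100 :* (m₈ :* b :+ 1 :/ 8 :* m₅ :* c :+ 1 :/ 256 :* m₂ :* d) :+ E :* f :+ F :* h)) refl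
          e₁ = ring 8 (λ m A B C w W E F → con 1ℚ :* (con 1ℚ :* (con 1ℚ :* (A :* W) :+ :- (51 :/ 100) :* (m :* (m :* (m :* (m :* (m :* (m :* (m :* (m :* con 1ℚ)))))))) :* (B :* (w :* (w :* (w :* W))))) :+ con 1ℚ :* (:- (51 :/ 100) :* (1 :/ 8 :* (m :* (m :* (m :* (m :* (m :* con 1ℚ)))))) :* (B :* (w :* (w :* W))) :+ :- (51 :/ 100) :* (1 :/ 256 :* (m :* (m :* con 1ℚ))) :* (B :* (w :* W)))) :+ con 1ℚ :* ((:- E) :* (C :* W) :+ (:- F) :* (con 1ℚ :* W)) := (A :- 51 :/ 100 :* (w :* ((m :* m :* (m :* m) :* w :+ 1 :/ 16 :* m) :* (m :* m :* (m :* m) :* w :+ 1 :/ 16 :* m))) :* B :- E :* C :- F) :* W) refl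

        low≤a : ∀ x → low x ≤ C.a K (ℤ.-[1+ suc n ]) x
        low≤a x = subst (λ k → low x ≤ C.a K (ℤ.- (ℤ.+ k)) x) n₀≡ (At.lower≤a x)

        -- p i is the probability of the total i in the tilted model.
        p : ℕ → ℚ
        p i = C.Π K * (r ^ i * ι (dq i K))

        -- Multiplication by w = 2 - x - 1/x is minus the second difference in the exponent.
        wave : ∀ l x → # 2 * C.a K l x + (- 1ℚ) * (1ℚ * C.a K (ℤ.+ 1 ℤ.+ l) x + 1ℚ * C.a K (ℤ.-[1+ 0 ] ℤ.+ l) x) ≡ C.a K l x * Point.w x
        wave l x = trans (cong₂ (λ u v → # 2 * (Rz * cos l - I * sin l) + (- 1ℚ) * (1ℚ * u + 1ℚ * v)) (cong₂ (λ u v → Rz * u - I * v) (cos-+ (ℤ.+ 1) l) (sin-+ (ℤ.+ 1) l))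
              (cong₂ (λ u v → Rz * u - I * v) (trans (cos-+ ℤ.-[1+ 0 ] l) (cong₂ (λ u v → u * cos l - v * sin l) (cos-neg (ℤ.+ 1)) (sin-neg (ℤ.+ 1))))
                 (trans (sin-+ ℤ.-[1+ 0 ] l) (cong₂ (λ u v → u * cos l + v * sin l) (sin-neg (ℤ.+ 1)) (cos-neg (ℤ.+ 1))))))
            (e Rz I (cos l) (sin l) (cos (ℤ.+ 1)) (sin (ℤ.+ 1)))
          where
          open Point x
          Rz = re (C.Z x K)
          I = im (C.Z x K)
          e = ring 6 (λ R I C S c s → :# 2 :* (R :* C :- I :* S) :+ (:- con 1ℚ) :* (con 1ℚ :* (R :* (c :* C :- s :* S) :- I :* (s :* C :+ c :* S)) :+ con 1ℚ :* (R :* (c :* C :- (:- s) :* S) :- I :* ((:- s) :* C :+ c :* S))) := (R :* C :- I :* S) :* (:# 2 :- :# 2 :* c)) refl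

        -- Centred at `suc i`, so `δ² (suc n)` belongs to the target `2 + n`.
        δ² : ℕ → ℚ
        δ² i = # 2 * p (suc i) + (- 1ℚ) * (1ℚ * p i + 1ℚ * p (2 ℕ.+ i))

        mean-wave : ∀ i → HasMean (λ x → C.a K (ℤ.-[1+ i ]) x * Point.w x) (δ² i)
        mean-wave zero = mean-ext (wave ℤ.-[1+ 0 ]) (mean-lin (# 2) (- 1ℚ) (C.mean-neg K 1) (mean-lin 1ℚ 1ℚ (C.mean-neg K 0) (C.mean-neg K 2)))
        mean-wave (suc i) = mean-ext (wave ℤ.-[1+ suc i ]) (mean-lin (# 2) (- 1ℚ) (C.mean-neg K (2 ℕ.+ i)) (mean-lin 1ℚ 1ℚ (C.mean-neg K (suc i)) (C.mean-neg K (3 ℕ.+ i))))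

        A₀ A₂ A₄ : ℚ
        A₀ = p (2 ℕ.+ n)
        A₂ = δ² (suc n)
        A₄ = # 2 * δ² (suc n) + (- 1ℚ) * (1ℚ * δ² n + 1ℚ * δ² (2 ℕ.+ n))

        mean-A₄ : HasMean (λ x → C.a K (ℤ.-[1+ suc n ]) x * Point.w x * Point.w x) A₄
        mean-A₄ = mean-ext (λ x → trans (e (C.a K ℤ.-[1+ suc n ] x) (C.a K ℤ.-[1+ n ] x) (C.a K ℤ.-[1+ 2 ℕ.+ n ] x) (Point.w x)) (cong (_* Point.w x) (wave ℤ.-[1+ suc n ] x)))
             (mean-lin (# 2) (- 1ℚ) (mean-wave (suc n)) (mean-lin 1ℚ 1ℚ (mean-wave n) (mean-wave (2 ℕ.+ n))))
          where e = ring 4 (λ a b c w → :# 2 :* (a :* w) :+ (:- con 1ℚ) :* (con 1ℚ :* (b :* w) :+ con 1ℚ :* (c :* w)) := (:# 2 :* a :+ (:- con 1ℚ) :* (con 1ℚ :* b :+ con 1ℚ :* c)) :* w) refl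

        -- Testing with the nonnegative weights 1, (w - t)² and w (4 - w).
        A₀≥ : N 0 ≤ A₀
        A₀≥ = mean-mono (mean-ext (λ x → *-identityʳ (low x)) (mean-low 0)) (C.mean-neg K (2 ℕ.+ n)) low≤a

        quadratic : ∀ t → N 2 - # 2 * t * N 1 + t * t * N 0 ≤ A₄ - # 2 * t * A₂ + t * t * A₀
        quadratic t = mean-mono (mean-eq (e₀ t (N 0) (N 1) (N 2)) (mean-lin 1ℚ 1ℚ (mean-lin 1ℚ (- (# 2 * t)) (mean-low 2) (mean-low 1)) (mean-lin (t * t) 0ℚ (mean-low 0) (mean-low 0))))
            (mean-eq (e₀ t A₀ A₂ A₄) (mean-lin 1ℚ 1ℚ (mean-lin 1ℚ (- (# 2 * t)) mean-A₄ (mean-wave (suc n))) (mean-lin (t * t) 0ℚ (C.mean-neg K (2 ℕ.+ n)) (C.mean-neg K (2 ℕ.+ n)))))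
            (λ x → ≤by (sq≥0 (Point.w x - t) ⊠ diff (low≤a x)) (e₁ t (low x) (C.a K ℤ.-[1+ suc n ] x) (Point.w x)))
          where e₀ = ring 4 (λ t a b c → con 1ℚ :* (con 1ℚ :* c :+ (:- (:# 2 :* t)) :* b) :+ con 1ℚ :* (t :* t :* a :+ con 0ℚ :* a) := c :- :# 2 :* t :* b :+ t :* t :* a) refl
                e₁ = ring 4 (λ t l a w → con 1ℚ :* (con 1ℚ :* (l :* (w :* (w :* con 1ℚ))) :+ (:- (:# 2 :* t)) :* (l :* (w :* con 1ℚ))) :+ con 1ℚ :* (t :* t :* (l :* con 1ℚ) :+ con 0ℚ :* (l :* con 1ℚ)) :+ (w :- t) :* (w :- t) :* (a :- l) := con 1ℚ :* (con 1ℚ :* (a :* w :* w) :+ (:- (:# 2 :* t)) :* (a :* w)) :+ con 1ℚ :* (t :* t :* a :+ con 0ℚ :* a)) refl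

        4A₂-A₄≥ : # 4 * N 1 + (- 1ℚ) * N 2 ≤ # 4 * A₂ + (- 1ℚ) * A₄
        4A₂-A₄≥ = mean-mono (mean-lin (# 4) (- 1ℚ) (mean-low 1) (mean-low 2)) (mean-lin (# 4) (- 1ℚ) (mean-wave (suc n)) mean-A₄)
            (λ x → ≤by (Point.W≥0 x (ℤ.+ 1) ⊠ diff (Point.W≤4 x (ℤ.+ 1)) ⊠ diff (low≤a x)) (e₁ (low x) (C.a K ℤ.-[1+ suc n ] x) (Point.w x)))
          where e₁ = ring 3 (λ l a w → :# 4 :* (l :* (w :* con 1ℚ)) :+ (:- con 1ℚ) :* (l :* (w :* (w :* con 1ℚ))) :+ w :* (:# 4 :- w) :* (a :- l) := :# 4 :* (a :* w) :+ (:- con 1ℚ) :* (a :* w :* w)) refl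

        A₀>0 : 0ℚ < A₀
        A₀>0 = <-≤-trans N₀>0 A₀≥

        A₄<4A₂ : 0ℚ < # 4 * A₂ + (- 1ℚ) * A₄
        A₄<4A₂ = <-≤-trans (subst (0ℚ <_) (e (N 1) (N 2)) (diff< N₄<4N₂)) 4A₂-A₄≥
          where e = ring 2 (λ a b → :# 4 :* a :- b := :# 4 :* a :+ (:- con 1ℚ) :* b) refl

        -- t = A₂ / A₀ minimises the right side of `quadratic`, with minimum (A₀A₄ - A₂²) / A₀. By
        -- `N₂²<` the left side has negative discriminant and is positive for every t.
        A₂²<A₀A₄ : 0ℚ < A₀ * A₄ - A₂ * A₂
        A₂²<A₀A₄ = subst (0ℚ <_) (trans (e A₀ A₂ A₄ t) (trans (cong (λ u → A₀ * A₄ - A₂ * A₂ + (u - A₂) * (u - A₂)) tA₀) (e₂ (A₀ * A₄ - A₂ * A₂) A₂))) (0<* A₀>0 (<-≤-trans quad>0 (quadratic t)))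
          where
          t = A₂ * inv A₀
          tA₀ : t * A₀ ≡ A₂
          tA₀ = trans (*-assoc A₂ (inv A₀) A₀) (trans (cong (A₂ *_) (trans (*-comm (inv A₀) A₀) (inv-* A₀>0))) (*-identityʳ A₂))
          e = ring 4 (λ a b c t → a :* (c :- :# 2 :* t :* b :+ t :* t :* a) := a :* c :- b :* b :+ (t :* a :- b) :* (t :* a :- b)) refl
          e₂ = ring 2 (λ X b → X :+ (b :- b) :* (b :- b) := X) refl
          quad>0 : 0ℚ < N 2 - # 2 * t * N 1 + t * t * N 0
          quad>0 = subst₂ _<_ (*-zeroʳ (inv (N 0))) (trans (sym (*-assoc (inv (N 0)) (N 0) _)) (trans (cong (_* (N 2 - # 2 * t * N 1 + t * t * N 0)) (trans (*-comm (inv (N 0)) (N 0)) (inv-* N₀>0))) (*-identityˡ _)))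
             (*-monoʳ-<-pos (inv (N 0)) {{positive (inv>0 N₀>0)}} (subst (0ℚ <_) (sym (e (N 0) (N 1) (N 2) t)) (0<+ (diff< N₂²<) (sq≥0 (t * N 0 - N 1)))))

  -- From central differences to the determinant

  open import Defs using (q)

  dq-stable : ∀ n d → dq n (d ℕ.+ n) ≡ q n
  dq-stable n zero = refl
  dq-stable zero (suc d) = refl
  dq-stable (suc n) (suc d) with n ℕ.<ᵇ d ℕ.+ suc n in eq
  ... | true  = trans (ℕ.+-identityʳ (dq (suc n) (d ℕ.+ suc n))) (dq-stable (suc n) d)
  ... | false = ⊥-elim (subst Data.Bool.T eq (ℕ.<⇒<ᵇ (ℕ.m≤n+m (suc n) d)))
    where import Data.Bool

  dq-large : ∀ {n k} → n ℕ.≤ k → dq n k ≡ q n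
  dq-large {n} {k} p = subst (λ j → dq n j ≡ q n) (ℕ.m∸n+n≡m p) (dq-stable n (k ℕ.∸ n))

  ι-cancel-< : ∀ {a b} → ι a < ι b → a ℕ.< b
  ι-cancel-< {a} {b} h with suc a ℕ.≤? b
  ... | yes p = p
  ... | no ¬p = ⊥-elim (<-irrefl refl (<-≤-trans h (ι-mono (ℕ.≮⇒≥ ¬p))))

  Det : (a₀ a₁ a₂ a₃ a₄ : ℚ) → ℚ
  Det a₀ a₁ a₂ a₃ a₄ = a₂ * a₂ * a₂ + a₀ * (a₃ * a₃) + a₁ * a₁ * a₄ - (a₀ * a₂ * a₄ + # 2 * (a₁ * a₂ * a₃))

  det⇒hankel : ∀ a₀ a₁ a₂ a₃ a₄ → 0ℚ < Det (ι a₀) (ι a₁) (ι a₂) (ι a₃) (ι a₄) → HankelNeg a₀ a₁ a₂ a₃ a₄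
  det⇒hankel a₀ a₁ a₂ a₃ a₄ h = ι-cancel-< (subst₂ _<_ (sym l) (sym rr) (<by h (e (ι a₀ * ι a₂ * ι a₄ + # 2 * (ι a₁ * ι a₂ * ι a₃)) (ι a₂ * ι a₂ * ι a₂ + ι a₀ * (ι a₃ * ι a₃) + ι a₁ * ι a₁ * ι a₄))))
    where
    e = ring 2 (λ a b → a :+ (b :- a) := b) refl
    ι3 : ∀ a b c → ι (a ℕ.* b ℕ.* c) ≡ ι a * ι b * ι c
    ι3 a b c = trans (ι-* (a ℕ.* b) c) (cong (_* ι c) (ι-* a b))
    l : ι (a₀ ℕ.* a₂ ℕ.* a₄ ℕ.+ 2 ℕ.* (a₁ ℕ.* a₂ ℕ.* a₃)) ≡ ι a₀ * ι a₂ * ι a₄ + # 2 * (ι a₁ * ι a₂ * ι a₃)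
    l = trans (ι-+ (a₀ ℕ.* a₂ ℕ.* a₄) (2 ℕ.* (a₁ ℕ.* a₂ ℕ.* a₃))) (cong₂ _+_ (ι3 a₀ a₂ a₄) (trans (ι-* 2 (a₁ ℕ.* a₂ ℕ.* a₃)) (cong (# 2 *_) (ι3 a₁ a₂ a₃))))
    rr : ι (a₂ ℕ.* a₂ ℕ.* a₂ ℕ.+ a₀ ℕ.* (a₃ ℕ.* a₃) ℕ.+ a₁ ℕ.* a₁ ℕ.* a₄) ≡ ι a₂ * ι a₂ * ι a₂ + ι a₀ * (ι a₃ * ι a₃) + ι a₁ * ι a₁ * ι a₄
    rr = trans (ι-+ (a₂ ℕ.* a₂ ℕ.* a₂ ℕ.+ a₀ ℕ.* (a₃ ℕ.* a₃)) (a₁ ℕ.* a₁ ℕ.* a₄)) (cong₂ _+_ (trans (ι-+ (a₂ ℕ.* a₂ ℕ.* a₂) (a₀ ℕ.* (a₃ ℕ.* a₃))) (cong₂ _+_ (ι3 a₂ a₂ a₂) (trans (ι-* a₀ (a₃ ℕ.* a₃)) (cong (ι a₀ *_) (ι-* a₃ a₃))))) (ι3 a₁ a₁ a₄))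

  -- With A₀, A₂, A₄ the central even differences and D₁, D₃ the odd ones, four times the determinant is
  -- (4A₂ - A₄)(A₀A₄ - A₂²) + (A₀D₃² + 2A₂D₁D₃ + A₄D₁²), and the second form is definite.
  det-positive : ∀ p₀ p₁ p₂ p₃ p₄ → let
      A₀ = p₂
      A₂ = # 2 * p₂ + (- 1ℚ) * (1ℚ * p₁ + 1ℚ * p₃)
      A₄ = # 2 * A₂ + (- 1ℚ) * (1ℚ * (# 2 * p₁ + (- 1ℚ) * (1ℚ * p₀ + 1ℚ * p₂)) + 1ℚ * (# 2 * p₃ + (- 1ℚ) * (1ℚ * p₂ + 1ℚ * p₄)))
    in 0ℚ < A₀ → 0ℚ < A₀ * A₄ - A₂ * A₂ → 0ℚ < # 4 * A₂ + (- 1ℚ) * A₄ → 0ℚ < Det p₀ p₁ p₂ p₃ p₄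
  det-positive p₀ p₁ p₂ p₃ p₄ a b c = subst₂ _<_ (*-zeroʳ (inv A₀)) (trans (sym (*-assoc (inv A₀) A₀ D)) (trans (cong (_* D) (trans (*-comm (inv A₀) A₀) (inv-* a))) (*-identityˡ D)))
      (*-monoʳ-<-pos (inv A₀) {{positive (inv>0 a)}} (subst (0ℚ <_) (e p₀ p₁ p₂ p₃ p₄)
        -- Multiplied by A₀, the form in D₁ and D₃ becomes (A₀D₃ + A₂D₁)² + (A₀A₄ - A₂²)D₁².
        (0<+ (0<* (lit< 0ℚ (1 ÷′ 4)) (0<* a (0<* c b))) (lit (1 ÷′ 4) ⊠ (sq≥0 (A₀ * D₃ + A₂ * D₁) ⊹ <⇒≤ b ⊠ sq≥0 D₁)))))
    where
    A₀ = p₂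
    A₂ = # 2 * p₂ + (- 1ℚ) * (1ℚ * p₁ + 1ℚ * p₃)
    A₄ = # 2 * A₂ + (- 1ℚ) * (1ℚ * (# 2 * p₁ + (- 1ℚ) * (1ℚ * p₀ + 1ℚ * p₂)) + 1ℚ * (# 2 * p₃ + (- 1ℚ) * (1ℚ * p₂ + 1ℚ * p₄)))
    D₁ = p₃ - p₁
    D₃ = p₄ - p₀ - # 2 * D₁
    D = Det p₀ p₁ p₂ p₃ p₄
    e₀ = ring 5 (λ A₀ A₂ A₄ D₁ D₃ → 1 :/ 4 :* (A₀ :* ((:# 4 :* A₂ :+ (:- con 1ℚ) :* A₄) :* (A₀ :* A₄ :- A₂ :* A₂))) :+ 1 :/ 4 :* ((A₀ :* D₃ :+ A₂ :* D₁) :* (A₀ :* D₃ :+ A₂ :* D₁) :+ (A₀ :* A₄ :- A₂ :* A₂) :* (D₁ :* D₁)) := A₀ :* (1 :/ 4 :* ((:# 4 :* A₂ :+ (:- con 1ℚ) :* A₄) :* (A₀ :* A₄ :- A₂ :* A₂) :+ (A₀ :* (D₃ :* D₃) :+ :# 2 :* A₂ :* D₁ :* D₃ :+ A₄ :* (D₁ :* D₁))))) refl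
    e₁ = ring 5 (λ p₀ p₁ p₂ p₃ p₄ → 1 :/ 4 :* ((:# 4 :* (:# 2 :* p₂ :+ (:- con 1ℚ) :* (con 1ℚ :* p₁ :+ con 1ℚ :* p₃)) :+ (:- con 1ℚ) :* (:# 2 :* (:# 2 :* p₂ :+ (:- con 1ℚ) :* (con 1ℚ :* p₁ :+ con 1ℚ :* p₃)) :+ (:- con 1ℚ) :* (con 1ℚ :* (:# 2 :* p₁ :+ (:- con 1ℚ) :* (con 1ℚ :* p₀ :+ con 1ℚ :* p₂)) :+ con 1ℚ :* (:# 2 :* p₃ :+ (:- con 1ℚ) :* (con 1ℚ :* p₂ :+ con 1ℚ :* p₄))))) :* (p₂ :* (:# 2 :* (:# 2 :* p₂ :+ (:- con 1ℚ) :* (con 1ℚ :* p₁ :+ con 1ℚ :* p₃)) :+ (:- con 1ℚ) :* (con 1ℚ :* (:# 2 :* p₁ :+ (:- con 1ℚ) :* (con 1ℚ :* p₀ :+ con 1ℚ :* p₂)) :+ con 1ℚ :* (:# 2 :* p₃ :+ (:- con 1ℚ) :* (con 1ℚ :* p₂ :+ con 1ℚ :* p₄)))) :- (:# 2 :* p₂ :+ (:- con 1ℚ) :* (con 1ℚ :* p₁ :+ con 1ℚ :* p₃)) :* (:# 2 :* p₂ :+ (:- con 1ℚ) :* (con 1ℚ :* p₁ :+ con 1ℚ :* p₃))) :+ (p₂ :* ((p₄ :- p₀ :- :# 2 :* (p₃ :- p₁)) :* (p₄ :- p₀ :- :# 2 :* (p₃ :- p₁))) :+ :# 2 :* (:#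 2 :* p₂ :+ (:- con 1ℚ) :* (con 1ℚ :* p₁ :+ con 1ℚ :* p₃)) :* (p₃ :- p₁) :* (p₄ :- p₀ :- :# 2 :* (p₃ :- p₁)) :+ (:# 2 :* (:# 2 :* p₂ :+ (:- con 1ℚ) :* (con 1ℚ :* p₁ :+ con 1ℚ :* p₃)) :+ (:- con 1ℚ) :* (con 1ℚ :* (:# 2 :* p₁ :+ (:- con 1ℚ) :* (con 1ℚ :* p₀ :+ con 1ℚ :* p₂)) :+ con 1ℚ :* (:# 2 :* p₃ :+ (:- con 1ℚ) :* (con 1ℚ :* p₂ :+ con 1ℚ :* p₄)))) :* ((p₃ :- p₁) :* (p₃ :- p₁)))) := p₂ :* p₂ :* p₂ :+ p₀ :* (p₃ :* p₃) :+ p₁ :* p₁ :* p₄ :- (p₀ :* p₂ :* p₄ :+ :# 2 :* (p₁ :* p₂ :* p₃))) refl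
    e : ∀ p₀ p₁ p₂ p₃ p₄ → _ ≡ p₂ * Det p₀ p₁ p₂ p₃ p₄
    e p₀ p₁ p₂ p₃ p₄ = trans (e₀ p₂ (# 2 * p₂ + (- 1ℚ) * (1ℚ * p₁ + 1ℚ * p₃)) (# 2 * (# 2 * p₂ + (- 1ℚ) * (1ℚ * p₁ + 1ℚ * p₃)) + (- 1ℚ) * (1ℚ * (# 2 * p₁ + (- 1ℚ) * (1ℚ * p₀ + 1ℚ * p₂)) + 1ℚ * (# 2 * p₃ + (- 1ℚ) * (1ℚ * p₂ + 1ℚ * p₄)))) (p₃ - p₁) (p₄ - p₀ - # 2 * (p₃ - p₁))) (cong (p₂ *_) (e₁ p₀ p₁ p₂ p₃ p₄))

  -- Every monomial is cubic with indices adding up to 6, which gives the common factor c³ r⁶.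
  det-scale : ∀ c r a₀ a₁ a₂ a₃ a₄ → Det (c * a₀) (c * r * a₁) (c * (r * r) * a₂) (c * (r * r * r) * a₃) (c * (r * r * (r * r)) * a₄) ≡ c * c * c * (r * r * (r * r * (r * r))) * Det a₀ a₁ a₂ a₃ a₄
  det-scale = e
    where e = ring 7 (λ c r a₀ a₁ a₂ a₃ a₄ → c :* (r :* r) :* a₂ :* (c :* (r :* r) :* a₂) :* (c :* (r :* r) :* a₂) :+ c :* a₀ :* (c :* (r :* r :* r) :* a₃ :* (c :* (r :* r :* r) :* a₃)) :+ c :* r :* a₁ :* (c :* r :* a₁) :* (c :* (r :* r :* (r :* r)) :* a₄) :- (c :* a₀ :* (c :* (r :* r) :* a₂) :* (c :* (r :* r :* (r :* r)) :* a₄) :+ :# 2 :* (c :* r :* a₁ :* (c :* (r :* r) :* a₂) :* (c :* (r :* r :* r) :* a₃))) := c :* c :* c :* (r :* r :* (r :* r :* (r :* r))) :* (a₂ :* a₂ :* a₂ :+ a₀ :* (a₃ :* a₃) :+ a₁ :* a₁ :* a₄ :- (a₀ :* a₂ :* a₄ :+ :# 2 :* (a₁ :* a₂ :* a₃)))) refl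

  positive-factor : ∀ {a b} → 0ℚ ≤ a → 0ℚ < a * b → 0ℚ < b
  positive-factor {a} {b} a0 h with 0ℚ <? b
  ... | yes p = p
  ... | no ¬p = ⊥-elim (<-irrefl refl (<-≤-trans h (≤-trans (*-monoˡ a0 (≮⇒≥ ¬p)) (≤-reflexive (*-zeroʳ a)))))

  -- The choice of the scale

  private
    1/40 : ℚ
    1/40 = 1 ÷′ 40

  -- Candidate scales m = 250 + d/40, tilt r = 1 - 1/m.
  scale : ℕ → ℚ
  scale d = # 250 + ι d * 1/40

  scale≥250 : ∀ d → # 250 ≤ scale d
  scale≥250 d = ≤by (ι≥0 d ⊠ lit 1/40) refl

  module At (d : ℕ) = Scale (scale d) (scale≥250 d)

  μ : ℕ → ℕ → ℚ
  μ d = ∑ (λ k → ι k * At.v d k)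

  ∑-prefix : ∀ {f : ℕ → ℚ} {h K} → (∀ k → 0ℚ ≤ f k) → h ℕ.≤ K → ∑ f h ≤ ∑ f K
  ∑-prefix {f} {h} {K} f0 p = subst (λ k → ∑ f h ≤ ∑ f k) (ℕ.m∸n+n≡m p) (go (K ℕ.∸ h))
    where go : ∀ e → ∑ f h ≤ ∑ f (e ℕ.+ h)
          go zero = ≤-refl
          go (suc e) = ≤-trans (go e) (≤by (f0 (suc (e ℕ.+ h))) refl)

  μ≤ : ∀ d K → μ d K ≤ scale d * scale d
  μ≤ d K = ≤-trans (∑-mono K (λ k → *-monoˡ (ι≥0 k) (At.v≤z d k))) (At.∑kz≤ d K)

  ∑-k : ∀ h s → ∑ (λ k → ι k * (½ * (1ℚ - ι k * s))) h ≡ 1 ÷′ 12 * (ι h * (1ℚ + ι h)) * (# 3 - s * (1ℚ + # 2 * ι h))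
  ∑-k zero s = e s
    where e = ring 1 (λ s → con 0ℚ := 1 :/ 12 :* (con 0ℚ :* (con 1ℚ :+ con 0ℚ)) :* (:# 3 :- s :* (con 1ℚ :+ :# 2 :* con 0ℚ))) refl
  ∑-k (suc h) s = trans (cong (_+ ι (suc h) * (½ * (1ℚ - ι (suc h) * s))) (∑-k h s)) (e (ι h) s)
    where e = ring 2 (λ h s → 1 :/ 12 :* (h :* (con 1ℚ :+ h)) :* (:# 3 :- s :* (con 1ℚ :+ :# 2 :* h)) :+ (con 1ℚ :+ h) :* (con ½ :* (con 1ℚ :- (con 1ℚ :+ h) :* s)) := 1 :/ 12 :* ((con 1ℚ :+ h) :* (con 1ℚ :+ (con 1ℚ :+ h))) :* (:# 3 :- s :* (con 1ℚ :+ :# 2 :* (con 1ℚ :+ h)))) refl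

  1-ks≤z : ∀ d k → 1ℚ - ι k * At.s d ≤ At.z d k
  1-ks≤z d zero = ≤-reflexive (e (At.s d))
    where e = ring 1 (λ s → con 1ℚ :- con 0ℚ :* s := con 1ℚ) refl
  1-ks≤z d (suc k) = ≤by (At.r≥0 d ⊠ diff (1-ks≤z d k) ⊹ ι≥0 k ⊠ (At.s≥0 d ⊠ At.s≥0 d)) (e (At.s d) (ι k) (At.z d k))
    where e = ring 3 (λ s k z → con 1ℚ :- (con 1ℚ :+ k) :* s :+ ((con 1ℚ :- s) :* (z :- (con 1ℚ :- k :* s)) :+ k :* (s :* s)) := (con 1ℚ :- s) :* z) refl

  ≤v : ∀ d k → ½ * (1ℚ - ι k * At.s d) ≤ At.v d k
  ≤v d k = ≤-trans (*-monoˡ (lit ½) (≤-trans (1-ks≤z d k) (At.z≤2v d k))) (≤-reflexive (e (At.v d k)))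
    where e = ring 1 (λ v → con ½ :* (:# 2 :* v) := v) refl

  kv≥0 : ∀ d k → 0ℚ ≤ ι k * At.v d k
  kv≥0 d k = ι≥0 k ⊠ At.v≥0 d k

  -- From v ≥ ½ (1 - k s) with h s ≤ 1; the constant is (1 - 1/250) / 12.
  μ≥ : ∀ d {h K} → h ℕ.≤ K → ι h ≤ scale d → 83 ÷′ 1000 * (ι h * (1ℚ + ι h)) ≤ μ d K
  μ≥ d {h} {K} p hm = ≤-trans (≤-trans (≤by (lit (1 ÷′ 12) ⊠ (ι≥0 h ⊠ (lit 1ℚ ⊹ ι≥0 h)) ⊠ (lit (# 2) ⊠ (At.s≥0 d ⊠ diff hm) ⊹ diff (At.s≤ d)))
        (trans (e (ι h) (At.s d) (scale d)) (trans (cong (λ t → 1 ÷′ 12 * (ι h * (1ℚ + ι h)) * (# 3 - At.s d * (1ℚ + # 2 * ι h) - # 2 + # 2 * t)) (At.ms d)) (e₁ (ι h) (At.s d)))))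
      (≤-reflexive (sym (∑-k h (At.s d))))) (≤-trans (∑-mono h (λ k → *-monoˡ (ι≥0 k) (≤v d k))) (∑-prefix (kv≥0 d) p))
    where e = ring 3 (λ h s m → 83 :/ 1000 :* (h :* (con 1ℚ :+ h)) :+ 1 :/ 12 :* (h :* (con 1ℚ :+ h)) :* (:# 2 :* (s :* (m :- h)) :+ (1 :/ 250 :- s)) := 1 :/ 12 :* (h :* (con 1ℚ :+ h)) :* (:# 3 :- s :* (con 1ℚ :+ :# 2 :* h) :- :# 2 :+ :# 2 :* (m :* s))) refl
          e₁ = ring 2 (λ h s → 1 :/ 12 :* (h :* (con 1ℚ :+ h)) :* (:# 3 :- s :* (con 1ℚ :+ :# 2 :* h) :- :# 2 :+ :# 2 :* con 1ℚ) := 1 :/ 12 :* (h :* (con 1ℚ :+ h)) :* (:# 3 :- s :* (con 1ℚ :+ :# 2 :* h))) refl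

  scale-suc : ∀ d → scale (suc d) ≡ scale d + 1/40
  scale-suc d = e (ι d)
    where e = ring 1 (λ d → :# 250 :+ (con 1ℚ :+ d) :* (1 :/ 40) := :# 250 :+ d :* (1 :/ 40) :+ 1 :/ 40) refl

  m≤m′ : ∀ d → scale d ≤ scale (suc d)
  m≤m′ d = ≤by (lit 1/40) (sym (scale-suc d))

  s′≤s : ∀ d → At.s (suc d) ≤ At.s d
  s′≤s d = *-cancel (At.m>0 (suc d)) (≤-trans (≤-reflexive (trans (At.ms (suc d)) (sym (At.ms d)))) (*-monoʳ (At.s≥0 d) (m≤m′ d)))

  z≤z′ : ∀ d k → At.z d k ≤ At.z (suc d) k
  z≤z′ d k = ^-mono k (At.r≥0 d) (+-monoʳ-≤ 1ℚ (neg-antimono-≤ (s′≤s d)))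

  -- The map z / (1 + z) has slope at most 1 for z ≥ 0.
  v-step : ∀ d k → At.v (suc d) k ≤ At.v d k + (At.z (suc d) k - At.z d k)
  v-step d k = *-cancel (0<* (At.1+z>0 d k) (At.1+z>0 (suc d) k)) (≤-trans (≤-reflexive (trans (e (At.z d k) (At.z (suc d) k) (At.i (suc d) k)) (trans (cong ((1ℚ + At.z d k) * At.z (suc d) k *_) (At.i-def (suc d) k)) (*-identityʳ ((1ℚ + At.z d k) * At.z (suc d) k)))))
      (≤-trans (≤by (diff (z≤z′ d k) ⊠ (At.z≥0 d k ⊹ At.z≥0 (suc d) k ⊹ At.z≥0 d k ⊠ At.z≥0 (suc d) k)) (e₁ (At.z d k) (At.z (suc d) k)))
       (≤-reflexive (sym (trans (e₂ (At.z d k) (At.z (suc d) k) (At.i d k)) (trans (cong (λ t → (1ℚ + At.z (suc d) k) * (At.z d k * t) + (1ℚ + At.z d k) * (1ℚ + At.z (suc d) k) * (At.z (suc d) k - At.z d k)) (At.i-def d k)) (e₃ (At.z d k) (At.z (suc d) k))))))))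
    where e = ring 3 (λ z y i → (con 1ℚ :+ z) :* (con 1ℚ :+ y) :* (y :* i) := (con 1ℚ :+ z) :* y :* ((con 1ℚ :+ y) :* i)) refl
          e₁ = ring 2 (λ z y → (con 1ℚ :+ z) :* y :+ (y :- z) :* (z :+ y :+ z :* y) := (con 1ℚ :+ y) :* z :+ (con 1ℚ :+ z) :* (con 1ℚ :+ y) :* (y :- z)) refl
          e₂ = ring 3 (λ z y i → (con 1ℚ :+ z) :* (con 1ℚ :+ y) :* (z :* i :+ (y :- z)) := (con 1ℚ :+ y) :* (z :* ((con 1ℚ :+ z) :* i)) :+ (con 1ℚ :+ z) :* (con 1ℚ :+ y) :* (y :- z)) refl
          e₃ = ring 2 (λ z y → (con 1ℚ :+ y) :* (z :* con 1ℚ) :+ (con 1ℚ :+ z) :* (con 1ℚ :+ y) :* (y :- z) := (con 1ℚ :+ y) :* z :+ (con 1ℚ :+ z) :* (con 1ℚ :+ y) :* (y :- z)) refl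

  ∑-sub : ∀ f g K → ∑ (λ k → f k - g k) K ≡ ∑ f K - ∑ g K
  ∑-sub f g zero = refl
  ∑-sub f g (suc K) = trans (cong (_+ (f (suc K) - g (suc K))) (∑-sub f g K)) (e (∑ f K) (∑ g K) (f (suc K)) (g (suc K)))
    where e = ring 4 (λ a b c d → a :- b :+ (c :- d) := a :+ c :- (b :+ d)) refl

  -- The sum of k z is m (m - 1) minus a remainder that grows with m, so a step of 1/40 in m raises
  -- the mean by at most 2m/40. This fixes the bound m/20 for the leftover `g`.
  μ-step : ∀ d K → μ (suc d) K ≤ μ d K + 1 ÷′ 20 * scale d
  μ-step d K = ≤-trans (∑-mono K (λ k → ≤-trans (*-monoˡ (ι≥0 k) (v-step d k)) (≤-reflexive (e (ι k) (At.v d k) (At.z (suc d) k) (At.z d k)))))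
     (≤-trans (≤-reflexive (trans (∑-+ (λ k → ι k * At.v d k) (λ k → ι k * At.z (suc d) k - ι k * At.z d k) K) (cong (μ d K +_) (∑-sub (λ k → ι k * At.z (suc d) k) (λ k → ι k * At.z d k) K))))
      (+-monoʳ-≤ (μ d K) (≤by (diff tails ⊹ lit (39 ÷′ 1600)) (trans (e₁ P Q (T (suc d)) (T d) (scale d)) (trans (cong₂ (λ u v → u - v + 1/40 * (1ℚ - # 2 * scale d) - 1/40 * 1/40 + 1 ÷′ 20 * scale d) (At.S₁.sum₁ (suc d) K) (At.S₁.sum₁ d K))
         (trans (cong (λ u → u * (u - 1ℚ) - scale d * (scale d - 1ℚ) + 1/40 * (1ℚ - # 2 * scale d) - 1/40 * 1/40 + 1 ÷′ 20 * scale d) (scale-suc d)) (e₂ (scale d))))))))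
    where
    P = ∑ (λ k → ι k * At.z (suc d) k) K
    Q = ∑ (λ k → ι k * At.z d k) K
    T : ℕ → ℚ
    T d = At.z d K * (ι K * (scale d - 1ℚ) + scale d * (scale d - 1ℚ))
    m-1≥0 : ∀ d → 0ℚ ≤ scale d - 1ℚ
    m-1≥0 d = diff (At.m≥1 d)
    tails : T d ≤ T (suc d)
    tails = *-mono (At.z≥0 d K) (z≤z′ d K) (ι≥0 K ⊠ m-1≥0 d ⊹ At.m≥0 d ⊠ m-1≥0 d)
       (+-mono-≤ (*-monoˡ (ι≥0 K) m-1) (*-mono (At.m≥0 d) (m≤m′ d) (m-1≥0 d) m-1))
      where m-1 = +-monoˡ-≤ (- 1ℚ) (m≤m′ d)
    e = ring 4 (λ k v y z → k :* (v :+ (y :- z)) := k :* v :+ (k :* y :- k :* z)) refl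
    e₁ = ring 5 (λ P Q T′ T m → P :- Q :+ (T′ :- T :+ 39 :/ 1600) := P :+ T′ :- (Q :+ T) :+ 1 :/ 40 :* (con 1ℚ :- :# 2 :* m) :- 1 :/ 40 :* (1 :/ 40) :+ 1 :/ 20 :* m) refl
    e₂ = ring 1 (λ m → (m :+ 1 :/ 40) :* (m :+ 1 :/ 40 :- con 1ℚ) :- m :* (m :- con 1ℚ) :+ 1 :/ 40 :* (con 1ℚ :- :# 2 :* m) :- 1 :/ 40 :* (1 :/ 40) :+ 1 :/ 20 :* m := 1 :/ 20 :* m) refl

  crossing : ∀ (f : ℕ → ℚ) t → f 0 ≤ t → ∀ D → t < f D → ∃ λ d → f d ≤ t × t < f (suc d)
  crossing f t f0 zero h = ⊥-elim (<-irrefl refl (<-≤-trans h f0))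
  crossing f t f0 (suc D) h with t <? f D
  ... | yes p = crossing f t f0 D p
  ... | no ¬p = D , ≮⇒≥ ¬p , h

  scale-large : ∀ K → ι K ≤ scale (80 ℕ.* K)
  scale-large K = ≤by (lit (# 250) ⊹ ι≥0 K) (sym (trans (cong (λ t → # 250 + t * 1/40) (trans (ι-* 80 K) (cong (_* ι K) (ι-lit 80)))) (e₁ (ι K))))
    where e₁ = ring 1 (λ k → :# 250 :+ :# 80 :* k :* (1 :/ 40) := k :+ (:# 250 :+ k)) refl

  module Choice (n : ℕ) (n-large : # 62500 ≤ ι (2 ℕ.+ n)) where
    n₀ K : ℕ
    n₀ = 2 ℕ.+ n
    -- Doubling the target makes r^K the square of r^n₀, which `z-small` exploits.
    K = n₀ ℕ.+ n₀

    ν = ι n₀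

    ιK : ι K ≡ # 2 * ν
    ιK = trans (ι-+ n₀ n₀) (e ν)
      where e = ring 1 (λ a → a :+ a := :# 2 :* a) refl

    -- At m = 250 the mean is at most 250² = 62500, so the smallest scale does not overshoot.
    below : μ 0 K ≤ ν
    below = ≤-trans (μ≤ 0 K) (≤-trans (lit≤ (scale 0 * scale 0) (# 62500)) n-large)

    D : ℕ
    D = 80 ℕ.* K

    ν<bound : ν < 83 ÷′ 1000 * (ι K * (1ℚ + ι K))
    ν<bound = <-≤-trans (<by (0<* (lit< 0ℚ (1 ÷′ 1000)) (<-≤-trans (lit< 0ℚ (# 62500)) n-large)) (e₀ ν)) bound
      where
      ν≥0 = ι≥0 n₀
      e₀ = ring 1 (λ n → n :+ 1 :/ 1000 :* n := 1001 :/ 1000 :* n) refl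
      bound : 1001 ÷′ 1000 * ν ≤ 83 ÷′ 1000 * (ι K * (1ℚ + ι K))
      bound = subst (λ t → 1001 ÷′ 1000 * ν ≤ 83 ÷′ 1000 * (t * (1ℚ + t))) (sym ιK) (≤by (ν≥0 ⊠ (lit (332 ÷′ 1000) ⊠ diff n-large) ⊹ lit (332 ÷′ 1000 * # 62500 - 1001 ÷′ 1000 + 166 ÷′ 1000) ⊠ ν≥0) (e₁ ν))
        where e₁ = ring 1 (λ n → 1001 :/ 1000 :* n :+ (n :* (332 :/ 1000 :* (n :- :# 62500)) :+ (332 :/ 1000 :* :# 62500 :- 1001 :/ 1000 :+ 166 :/ 1000) :* n) := 83 :/ 1000 :* (:# 2 :* n :* (con 1ℚ :+ :# 2 :* n))) refl

    above : ν < μ D K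
    above = <-≤-trans ν<bound (μ≥ D {K} {K} ℕ.≤-refl (scale-large K))

    abstract
      found : ∃ λ d → μ d K ≤ ν × ν < μ (suc d) K
      found = crossing (λ d → μ d K) ν below D above

    d : ℕ
    d = proj₁ found
    m g : ℚ
    m = scale d
    g = ν - μ d K

    g≥0 : 0ℚ ≤ g
    g≥0 = diff (proj₁ (proj₂ found))

    g≤ : g ≤ 1 ÷′ 20 * m
    g≤ = ≤by (diff (<⇒≤ (proj₂ (proj₂ found))) ⊹ diff (μ-step d K)) (e ν (μ d K) (μ (suc d) K) (1 ÷′ 20 * m))
      where e = ring 4 (λ n a b c → n :- a :+ (b :- n :+ (a :+ c :- b)) := c) refl

    m≥250 : # 250 ≤ m
    m≥250 = scale≥250 d

    n≤ : ν ≤ 105 ÷′ 100 * (m * m)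
    n≤ = ≤-trans (<⇒≤ (proj₂ (proj₂ found))) (≤-trans (μ≤ (suc d) K) (subst (λ t → t * t ≤ 105 ÷′ 100 * (m * m)) (sym (scale-suc d))
         (≤by (lit (5 ÷′ 100) ⊠ (At.m≥0 d ⊠ diff m≥250) ⊹ lit (1245 ÷′ 100) ⊠ diff m≥250 ⊹ lit (6225 ÷′ 2 - 1 ÷′ 1600)) (e m))))
      where e = ring 1 (λ m → (m :+ 1 :/ 40) :* (m :+ 1 :/ 40) :+ (5 :/ 100 :* (m :* (m :- :# 250)) :+ 1245 :/ 100 :* (m :- :# 250) :+ (6225 :/ 2 :- 1 :/ 1600)) := 105 :/ 100 :* (m :* m)) refl

    K≤ : ι K ≤ 21 ÷′ 10 * (m * m)
    K≤ = ≤-trans (≤-reflexive ιK) (≤-trans (*-monoˡ (lit (# 2)) n≤) (≤-reflexive (e m)))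
      where e = ring 1 (λ m → :# 2 :* (105 :/ 100 :* (m :* m)) := 21 :/ 10 :* (m :* m)) refl

    h : ℕ
    h = proj₁ (floor m (At.m≥0 d))
    h≤ : ι h ≤ m
    h≤ = proj₁ (proj₂ (floor m (At.m≥0 d)))
    h> : m ≤ 1ℚ + ι h
    h> = <⇒≤ (proj₂ (proj₂ (floor m (At.m≥0 d))))

    -- Parts up to ⌊m⌋ already contribute about m²/12 to the mean, more than 20 m when m ≥ 250. If
    -- ⌊m⌋ exceeded `K`, the parts up to `K` would push the mean above ν.
    20m≤ : # 20 * m ≤ ν
    20m≤ = by-size (ℕ.≤-total h K)
      where
      long : h ℕ.≤ K → # 20 * m ≤ ν
      long p = ≤-trans (≤by (lit (83 ÷′ 1000) ⊠ (diff h> ⊠ (ι≥0 h ⊹ At.m≥0 d)) ⊹ At.m≥0 d ⊠ (lit (83 ÷′ 1000) ⊠ diff m≥250 ⊹ lit (667 ÷′ 1000))) (e m (ι h))) (≤-trans (μ≥ d {h} {K} p h≤) (proj₁ (proj₂ found)))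
        where e = ring 2 (λ m h → :# 20 :* m :+ (83 :/ 1000 :* ((con 1ℚ :+ h :- m) :* (h :+ m)) :+ m :* (83 :/ 1000 :* (m :- :# 250) :+ 667 :/ 1000)) := 83 :/ 1000 :* (h :* (con 1ℚ :+ h))) refl
      short : K ℕ.≤ h → # 20 * m ≤ ν
      short p = ⊥-elim (<-irrefl refl (<-≤-trans (<-≤-trans ν<bound (μ≥ d {K} {K} ℕ.≤-refl (≤-trans (ι-mono p) h≤))) (proj₁ (proj₂ found))))
      by-size : (h ℕ.≤ K) ⊎ (K ℕ.≤ h) → # 20 * m ≤ ν
      by-size (inj₁ p) = long p
      by-size (inj₂ p) = short p

    K-large : # 40 * m ≤ ι K
    K-large = ≤-trans (≤-trans (≤-reflexive (e m)) (*-monoˡ (lit (# 2)) 20m≤)) (≤-reflexive (sym ιK))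
      where e = ring 1 (λ m → :# 40 :* m := :# 2 :* (:# 20 :* m)) refl

    -- The square of r^n₀ n₀³ ≤ 6 m³ with K = 2 n₀; 2304 = 2^6 · 6².
    z-small : At.z d K * ((ι K * ι K) * (ι K * ι K * (ι K * ι K))) ≤ # 2304 * (m * m * (m * m * (m * m)))
    z-small = subst₂ (λ y κ → y * ((κ * κ) * (κ * κ * (κ * κ))) ≤ # 2304 * (m * m * (m * m * (m * m)))) (sym (^-+ (At.r d) n₀ n₀)) (sym ιK)
       (≤-trans (≤-reflexive (e (At.z d n₀) ν)) (≤-trans (*-monoˡ (lit (# 64)) (*-mono X≥0 (At.k³z≤ d n₀) X≥0 (At.k³z≤ d n₀))) (≤-reflexive (e₁ m))))
      where X≥0 = ι≥0 n₀ ⊠ ι≥0 n₀ ⊠ ι≥0 n₀ ⊠ At.z≥0 d n₀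
            e = ring 2 (λ z n → z :* z :* ((:# 2 :* n :* (:# 2 :* n)) :* (:# 2 :* n :* (:# 2 :* n) :* (:# 2 :* n :* (:# 2 :* n)))) := :# 64 :* (n :* n :* n :* z :* (n :* n :* n :* z))) refl
            e₁ = ring 1 (λ m → :# 64 :* (:# 6 :* (m :* m :* m) :* (:# 6 :* (m :* m :* m))) := :# 2304 :* (m :* m :* (m :* m :* (m :* m)))) refl

    centre : Carry.M (At.r d) (At.r>0 d) (At.r≤1 d) g g≥0 K ≡ ι n₀
    centre = e ν (μ d K)
      where e = ring 2 (λ n μ → n :- μ :+ μ := n) refl

    large : HankelNeg (q n) (q (1 ℕ.+ n)) (q (2 ℕ.+ n)) (q (3 ℕ.+ n)) (q (4 ℕ.+ n))
    large = det⇒hankel (q n) (q (1 ℕ.+ n)) (q (2 ℕ.+ n)) (q (3 ℕ.+ n)) (q (4 ℕ.+ n)) (positive-factor c0 (subst (0ℚ <_) eq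
         (det-positive (p n) (p (1 ℕ.+ n)) (p (2 ℕ.+ n)) (p (3 ℕ.+ n)) (p (4 ℕ.+ n)) (Window.Lower.Curvature.A₀>0 m m≥250 K K-large z-small K≤ g g≥0 g≤ n₀ centre n refl) (Window.Lower.Curvature.A₂²<A₀A₄ m m≥250 K K-large z-small K≤ g g≥0 g≤ n₀ centre n refl) (Window.Lower.Curvature.A₄<4A₂ m m≥250 K K-large z-small K≤ g g≥0 g≤ n₀ centre n refl))))
      where
      Π = Coefficients.Π (At.r d) (At.r>0 d) (At.r≤1 d) K
      p = Window.Lower.Curvature.p m m≥250 K K-large z-small K≤ g g≥0 g≤ n₀ centre n refl
      r = At.r d
      r0 = At.r≥0 d
      C = Π * r ^ n
      c0 : 0ℚ ≤ C * C * C * (r * r * (r * r * (r * r)))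
      c0 = C0 ⊠ C0 ⊠ C0 ⊠ (r0 ⊠ r0 ⊠ (r0 ⊠ r0 ⊠ (r0 ⊠ r0)))
        where C0 = ∏≥0 K (λ k → diff (At.v≤1 d k)) ⊠ ^≥0 n r0
      n+≤K : ∀ j → j ℕ.≤ 4 → j ℕ.+ n ℕ.≤ K
      n+≤K j p = ℕ.≤-trans (ℕ.+-monoˡ-≤ n p) (ℕ.≤-trans (ℕ.+-monoʳ-≤ 2 (ℕ.m≤m+n (2 ℕ.+ n) 0)) (ℕ.≤-trans (ℕ.≤-reflexive (trans (cong (2 ℕ.+_) (ℕ.+-identityʳ (2 ℕ.+ n))) refl)) (ℕ.≤-trans (ℕ.≤-reflexive (ℕ.+-comm 2 (2 ℕ.+ n))) (ℕ.+-monoʳ-≤ (2 ℕ.+ n) (ℕ.m≤m+n 2 n)))))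
      P : ℚ → ℕ → ℚ
      P x j = x * ι (q (j ℕ.+ n))
      same : ∀ j → j ℕ.≤ 4 → p (j ℕ.+ n) ≡ Π * (r ^ (j ℕ.+ n) * ι (q (j ℕ.+ n)))
      same j j≤4 = cong (λ t → Π * (r ^ (j ℕ.+ n) * ι t)) (dq-large (n+≤K j j≤4))
      s₀ : p n ≡ P C 0
      s₀ = trans (same 0 ℕ.z≤n) (e (Π) (r ^ n) (ι (q n)))
        where e = ring 3 (λ π X a → π :* (X :* a) := π :* X :* a) refl
      s₁ : p (1 ℕ.+ n) ≡ P (C * r) 1
      s₁ = trans (same 1 (ℕ.s≤s ℕ.z≤n)) (e (Π) (r ^ n) r (ι (q (1 ℕ.+ n))))
        where e = ring 4 (λ π X r a → π :* (r :* X :* a) := π :* X :* r :* a) refl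
      s₂ : p (2 ℕ.+ n) ≡ P (C * (r * r)) 2
      s₂ = trans (same 2 (ℕ.s≤s (ℕ.s≤s ℕ.z≤n))) (e (Π) (r ^ n) r (ι (q (2 ℕ.+ n))))
        where e = ring 4 (λ π X r a → π :* (r :* (r :* X) :* a) := π :* X :* (r :* r) :* a) refl
      s₃ : p (3 ℕ.+ n) ≡ P (C * (r * r * r)) 3
      s₃ = trans (same 3 (ℕ.s≤s (ℕ.s≤s (ℕ.s≤s ℕ.z≤n)))) (e (Π) (r ^ n) r (ι (q (3 ℕ.+ n))))
        where e = ring 4 (λ π X r a → π :* (r :* (r :* (r :* X)) :* a) := π :* X :* (r :* r :* r) :* a) refl
      s₄ : p (4 ℕ.+ n) ≡ P (C * (r * r * (r * r))) 4
      s₄ = trans (same 4 ℕ.≤-refl) (e (Π) (r ^ n) r (ι (q (4 ℕ.+ n))))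
        where e = ring 4 (λ π X r a → π :* (r :* (r :* (r :* (r :* X))) :* a) := π :* X :* (r :* r :* (r :* r)) :* a) refl
      eq : Det (p n) (p (1 ℕ.+ n)) (p (2 ℕ.+ n)) (p (3 ℕ.+ n)) (p (4 ℕ.+ n)) ≡ C * C * C * (r * r * (r * r * (r * r))) * Det (ι (q n)) (ι (q (1 ℕ.+ n))) (ι (q (2 ℕ.+ n))) (ι (q (3 ℕ.+ n))) (ι (q (4 ℕ.+ n)))
      eq = trans (cong₂ (λ f g → f g) (cong₂ (λ f g → f g) (cong₂ (λ f g → f g) (cong₂ Det s₀ s₁) s₂) s₃) s₄) (det-scale C r (ι (q n)) (ι (q (1 ℕ.+ n))) (ι (q (2 ℕ.+ n))) (ι (q (3 ℕ.+ n))) (ι (q (4 ℕ.+ n))))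

  hankel-large : ∀ n → 62500 ℕ.≤ 2 ℕ.+ n → HankelNeg (q n) (q (1 ℕ.+ n)) (q (2 ℕ.+ n)) (q (3 ℕ.+ n)) (q (4 ℕ.+ n))
  hankel-large n p = Choice.large n (≤-trans (≤-reflexive (sym (ι-lit 62500))) (ι-mono p))

-- Joining the two ranges and passing to integers

import Data.Nat as ℕ
import Data.Nat.Properties as ℕ
import Data.Integer as ℤ
import Data.Integer.Properties as ℤ
open import Data.Integer.Tactic.RingSolver using (solve-∀)
open import Data.Nat using (suc; s≤s)
open import Data.Sum using (_⊎_; inj₁; inj₂)
open import Relation.Binary.PropositionalEquality
open import Defs
open import Data.Nat using (ℕ; _≤_; _∸_; _+_)
open import Data.Integer using (ℤ; +_; _>_)
open FiniteRange using (HankelNeg; small)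
open CircleMethod using (hankel-large)

hankel : ∀ n → 271 ≤ n → HankelNeg (q n) (q (1 + n)) (q (2 + n)) (q (3 + n)) (q (4 + n))
hankel n p = by-size (ℕ.≤-<-connex 62500 (2 + n))
  where
  by-size : 62500 ≤ 2 + n ⊎ 2 + n ℕ.< 62500 → HankelNeg (q n) (q (1 + n)) (q (2 + n)) (q (3 + n)) (q (4 + n))
  by-size (inj₁ h)             = hankel-large n h
  by-size (inj₂ (s≤s (s≤s h))) = small n p h

B-positive : ∀ a b c d e → HankelNeg a b c d e → B (+ a) (+ b) (+ c) (+ d) (+ e) > + 0
B-positive a b c d e h = subst (+ 0 ℤ.<_) (trans (cong₂ ℤ._-_ plus minus) (regroup (+ a) (+ b) (+ c) (+ d) (+ e))) (subst (ℤ._< + up ℤ.- + down) (ℤ.+-inverseʳ (+ down)) (ℤ.+-monoˡ-< (ℤ.- (+ down)) (ℤ.+<+ h)))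
  where
  up = c ℕ.* c ℕ.* c ℕ.+ a ℕ.* (d ℕ.* d) ℕ.+ b ℕ.* b ℕ.* e
  down = a ℕ.* c ℕ.* e ℕ.+ 2 ℕ.* (b ℕ.* c ℕ.* d)
  pos-*₃ : ∀ x y z → + (x ℕ.* y ℕ.* z) ≡ + x ℤ.* + y ℤ.* + z
  pos-*₃ x y z = trans (ℤ.pos-* (x ℕ.* y) z) (cong (ℤ._* + z) (ℤ.pos-* x y))
  plus : + (c ℕ.* c ℕ.* c ℕ.+ a ℕ.* (d ℕ.* d) ℕ.+ b ℕ.* b ℕ.* e) ≡ + c ℤ.* + c ℤ.* + c ℤ.+ + a ℤ.* (+ d ℤ.* + d) ℤ.+ + b ℤ.* + b ℤ.* + e
  plus = cong₂ ℤ._+_ (cong₂ ℤ._+_ (pos-*₃ c c c) (trans (ℤ.pos-* a (d ℕ.* d)) (cong (+ a ℤ.*_) (ℤ.pos-* d d)))) (pos-*₃ b b e)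
  minus : + (a ℕ.* c ℕ.* e ℕ.+ 2 ℕ.* (b ℕ.* c ℕ.* d)) ≡ + a ℤ.* + c ℤ.* + e ℤ.+ + 2 ℤ.* (+ b ℤ.* + c ℤ.* + d)
  minus = cong₂ ℤ._+_ (pos-*₃ a c e) (trans (ℤ.pos-* 2 (b ℕ.* c ℕ.* d)) (cong (+ 2 ℤ.*_) (pos-*₃ b c d)))
  regroup : ∀ a b c d e → (c ℤ.* c ℤ.* c ℤ.+ a ℤ.* (d ℤ.* d) ℤ.+ b ℤ.* b ℤ.* e) ℤ.- (a ℤ.* c ℤ.* e ℤ.+ + 2 ℤ.* (b ℤ.* c ℤ.* d))
    ≡ ℤ.- (a ℤ.* c ℤ.* e) ℤ.+ c ℤ.* c ℤ.* c ℤ.+ a ℤ.* (d ℤ.* d) ℤ.+ b ℤ.* b ℤ.* e ℤ.- (+ 2) ℤ.* b ℤ.* c ℤ.* d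
  regroup = solve-∀

theorem1p4 : (n : ℕ) → 272 ≤ n →
    B (qℤ (n ∸ 1)) (qℤ n) (qℤ (n + 1)) (qℤ (n + 2)) (qℤ (n + 3)) > + 0
theorem1p4 (suc n) (s≤s p) = at (suc n + 1) (suc n + 2) (suc n + 3) (cong suc (ℕ.+-comm n 1)) (cong suc (ℕ.+-comm n 2)) (cong suc (ℕ.+-comm n 3))
  where
  at : ∀ i j k → i ≡ 2 + n → j ≡ 3 + n → k ≡ 4 + n → B (qℤ n) (qℤ (suc n)) (qℤ i) (qℤ j) (qℤ k) > + 0
  at _ _ _ refl refl refl = B-positive (q n) (q (1 + n)) (q (2 + n)) (q (3 + n)) (q (4 + n)) (hankel n p)
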